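{- Let $T$ be a recursively axiomatized first-order theory extending elementary arithmetic $\mathrm{EA}$, with a standard Gödel numbering and the standard proof predicate $\mathrm{Proof}_T(p,x)$. Then there exists a primitive recursive function $s_T$ such that \[ T\vdash \forall x\,\mathrm{Proof}_T\bigl(s_T(x),\ulcorner\neg\mathrm{Proof}_T(\dot x,\ulcorner 0=1\urcorner)\urcorner\bigr). \] That is, $T$ selector-proves its consistency schema $\{\neg\mathrm{Proof}_T(\overline{n},\ulcorner 0=1\urcorner): n\in\mathbb{N}\}$.
   Context: $\mathrm{EA}$ denotes $I\Delta_0+\mathrm{Exp}$. $\mathrm{Proof}_T(p,x)$ is the standard primitive recursive arithmetized predicate expressing that $p$ codes a $T$-derivation of the formula with Gödel number $x$. $\overline{n}$ is the numeral for $n$ and $\ulcorner\varphi\urcorner$ is the numeral of the Gödel number of $\varphi$. The term $\ulcorner\neg\mathrm{Proof}_T(\dot x,\ulcorner 0=1\urcorner)\urcorner$ denotes (the application to $x$ of) the primitive recursive function mapping $x$ to the Gödel number of the sentence $\neg\mathrm{Proof}_T(\overline{x},\ulcorner 0=1\urcorner)$. A theory $T$ is said to selector-prove a primitive recursive series of formulas $F(x)$ if there is a primitive recursive function $s$ with $T\vdash\forall x\,\mathrm{Proof}_T(s(x),\ulcorner F(\dot x)\urcorner)$. -}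

module Defs where

open import Data.Empty using (⊥)
open import Data.Fin using (Fin; toℕ; _↑ʳ_; #_) renaming (zero to fzero; suc to fsuc; lift to liftFin)
open import Data.List using (List; []; _∷_; foldr)
open import Data.Maybe using (Maybe; just; nothing) renaming (map to mapMaybe)
open import Data.Nat using (ℕ; zero; suc; _+_; _*_; _^_; _≤_)
open import Data.Product using (Σ; ∃; _×_; _,_)
open import Data.Sum using (_⊎_)
open import Data.Vec using (Vec; []; _∷_; lookup; tabulate)
open import Function using (_∘_; _⇔_)
open import Relation.Binary.PropositionalEquality
  using (_≡_; refl; trans; cong; cong₂)
open import Relation.Nullary using (¬_)

data ATerm (n : ℕ) : Set where
  var         : Fin n → ATerm n
  O           : ATerm n
  S exp       : ATerm n → ATerm n
  _⊕_ _⊗_     : ATerm n → ATerm n → ATerm n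

infixl 6 _⊕_
infixl 7 _⊗_

data Δ₀ (n : ℕ) : Set where
  _≈_ _≲_ : ATerm n → ATerm n → Δ₀ n
  ff      : Δ₀ n
  _⊃_     : Δ₀ n → Δ₀ n → Δ₀ n
  all≤    : ATerm n → Δ₀ (suc n) → Δ₀ n

infix  5 _≈_ _≲_
infixr 2 _⊃_

⟦_⟧ : ∀ {n} → ATerm n → Vec ℕ n → ℕ
⟦ var i ⟧ ρ = lookup ρ i
⟦ O ⟧     ρ = 0
⟦ S t ⟧   ρ = suc (⟦ t ⟧ ρ)
⟦ exp t ⟧ ρ = 2 ^ ⟦ t ⟧ ρ
⟦ t ⊕ u ⟧ ρ = ⟦ t ⟧ ρ + ⟦ u ⟧ ρ
⟦ t ⊗ u ⟧ ρ = ⟦ t ⟧ ρ * ⟦ u ⟧ ρ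

infix 1 _⊨_

_⊨_ : ∀ {n} → Vec ℕ n → Δ₀ n → Set
ρ ⊨ t ≈ u    = ⟦ t ⟧ ρ ≡ ⟦ u ⟧ ρ
ρ ⊨ t ≲ u    = ⟦ t ⟧ ρ ≤ ⟦ u ⟧ ρ
ρ ⊨ ff       = ⊥
ρ ⊨ θ ⊃ χ    = (ρ ⊨ θ) → (ρ ⊨ χ)
ρ ⊨ all≤ t θ = ∀ k → k ≤ ⟦ t ⟧ ρ → k ∷ ρ ⊨ θ

neg : ∀ {n} → Δ₀ n → Δ₀ n
neg θ = θ ⊃ ff

infixr 4 _&_
infixr 3 _or_

_&_ _or_ : ∀ {n} → Δ₀ n → Δ₀ n → Δ₀ n
θ & χ  = neg (θ ⊃ neg χ)
θ or χ = neg θ ⊃ χ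

ex≤ : ∀ {n} → ATerm n → Δ₀ (suc n) → Δ₀ n
ex≤ t θ = neg (all≤ t (neg θ))

renT : ∀ {m n} → (Fin m → Fin n) → ATerm m → ATerm n
renT r (var i) = var (r i)
renT r O       = O
renT r (S t)   = S (renT r t)
renT r (exp t) = exp (renT r t)
renT r (t ⊕ u) = renT r t ⊕ renT r u
renT r (t ⊗ u) = renT r t ⊗ renT r u

ren : ∀ {m n} → (Fin m → Fin n) → Δ₀ m → Δ₀ n
ren r (t ≈ u)    = renT r t ≈ renT r u
ren r (t ≲ u)    = renT r t ≲ renT r u
ren r ff         = ff
ren r (θ ⊃ χ)    = ren r θ ⊃ ren r χ
ren r (all≤ t θ) = all≤ (renT r t) (ren (liftFin 1 r) θ)

litA : ∀ {n} → ℕ → ATerm n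
litA zero    = O
litA (suc k) = S (litA k)

-- a ∈̇ w: the a-th binary digit of w is 1, i.e. w = (2q + 1)·2ᵃ + r with
-- r < 2ᵃ.  Numbers thereby code finite sets of numbers.
infix 5 _∈̇_

_∈̇_ : ∀ {n} → ATerm n → ATerm n → Δ₀ n
_∈̇_ {n} a w = ex≤ w (ex≤ (up 1 w)
    ( up 2 w ≈ S (q ⊕ q) ⊗ exp (up 2 a) ⊕ r
    & S r ≲ exp (up 2 a) ))
  where
  up : ∀ k → ATerm n → ATerm (k + n)
  up k = renT (k ↑ʳ_)
  q r : ATerm (2 + n)
  q = var (# 1)
  r = var (# 0)

-- The additional symbols have numbers, and the graph of the arity function
-- on those numbers is given by a Δ₀-formula in (number , arity).
record Language : Set₁ where
  field
    Fun Rel       : Set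
    arityF        : Fun → ℕ
    arityR        : Rel → ℕ
    codeF         : Fun → ℕ
    codeR         : Rel → ℕ
    codeF-inj     : ∀ {f g} → codeF f ≡ codeF g → f ≡ g
    codeR-inj     : ∀ {r s} → codeR r ≡ codeR s → r ≡ s
    isFun isRel   : Δ₀ 2
    isFun-correct : ∀ c k → (c ∷ k ∷ [] ⊨ isFun) ⇔ (∃ λ f → codeF f ≡ c × arityF f ≡ k)
    isRel-correct : ∀ c k → (c ∷ k ∷ [] ⊨ isRel) ⇔ (∃ λ r → codeR r ≡ c × arityR r ≡ k)

data FunSym (L : Language) : Set where
  `0 `S `+ `* `exp : FunSym L
  ext              : Language.Fun L → FunSym L

data RelSym (L : Language) : Set where
  `= `≤ : RelSym L
  ext   : Language.Rel L → RelSym L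

variable
  L : Language

funArity : FunSym L → ℕ
funArity `0              = 0
funArity `S              = 1
funArity `+              = 2
funArity `*              = 2
funArity `exp            = 1
funArity {L = L} (ext f) = Language.arityF L f

relArity : RelSym L → ℕ
relArity `=              = 2
relArity `≤              = 2
relArity {L = L} (ext r) = Language.arityR L r

-- Variables are de Bruijn indices and formulas need not be closed: in a
-- formula under m quantifiers, var (m + i) is the i-th free variable.
data Term (L : Language) : Set where
  var : ℕ → Term L
  fn  : (f : FunSym L) → Vec (Term L) (funArity f) → Term L

infixr 2 _⇒_

data Formula (L : Language) : Set where
  rel : (r : RelSym L) → Vec (Term L) (relArity r) → Formula L
  ⊥′  : Formula L
  _⇒_ : Formula L → Formula L → Formula L
  ∀′  : Formula L → Formula L

infix 5 _≐_ _≤′_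

_≐_ _≤′_ : Term L → Term L → Formula L
t ≐ u  = rel `= (t ∷ u ∷ [])
t ≤′ u = rel `≤ (t ∷ u ∷ [])

infix  4 ¬′_
infixr 3 _∧′_

¬′_ ∃′ : Formula L → Formula L
¬′ φ = φ ⇒ ⊥′
∃′ φ = ¬′ ∀′ (¬′ φ)

_∧′_ : Formula L → Formula L → Formula L
φ ∧′ ψ = ¬′ (φ ⇒ ¬′ ψ)

O′ : Term L
O′ = fn `0 []

S′ exp′ : Term L → Term L
S′ t   = fn `S (t ∷ [])
exp′ t = fn `exp (t ∷ [])

infixl 6 _+′_
infixl 7 _*′_

_+′_ _*′_ : Term L → Term L → Term L
t +′ u = fn `+ (t ∷ u ∷ [])
t *′ u = fn `* (t ∷ u ∷ [])

numeral : ℕ → Term L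
numeral zero    = O′
numeral (suc n) = S′ (numeral n)

mutual
  shift : Term L → Term L
  shift (var i)   = var (suc i)
  shift (fn f ts) = fn f (shifts ts)

  shifts : ∀ {k} → Vec (Term L) k → Vec (Term L) k
  shifts []       = []
  shifts (t ∷ ts) = shift t ∷ shifts ts

-- wk increments all variables; inst t replaces variable 0 by t and
-- decrements the others; lift σ is σ under a quantifier.
data Subst (L : Language) : Set where
  wk   : Subst L
  inst : Term L → Subst L
  lift : Subst L → Subst L

apply : Subst L → ℕ → Term L
apply wk       i       = var (suc i)
apply (inst t) zero    = t
apply (inst t) (suc i) = var i
apply (lift σ) zero    = var zero
apply (lift σ) (suc i) = shift (apply σ i)

mutual
  substT : Subst L → Term L → Term L
  substT σ (var i)   = apply σ i
  substT σ (fn f ts) = fn f (substTs σ ts)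

  substTs : ∀ {k} → Subst L → Vec (Term L) k → Vec (Term L) k
  substTs σ []       = []
  substTs σ (t ∷ ts) = substT σ t ∷ substTs σ ts

infixl 8 _[_]

_[_] : Formula L → Subst L → Formula L
rel r ts [ σ ] = rel r (substTs σ ts)
⊥′       [ σ ] = ⊥′
(φ ⇒ ψ)  [ σ ] = (φ [ σ ]) ⇒ (ψ [ σ ])
∀′ φ     [ σ ] = ∀′ (φ [ lift σ ])

embT : ∀ {n} → ATerm n → Vec (Term L) n → Term L
embT (var i) ρ = lookup ρ i
embT O       ρ = O′
embT (S t)   ρ = S′ (embT t ρ)
embT (exp t) ρ = exp′ (embT t ρ)
embT (t ⊕ u) ρ = embT t ρ +′ embT u ρ
embT (t ⊗ u) ρ = embT t ρ *′ embT u ρ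

-- emb θ ρ is θ as a formula of L, with the terms ρ for its variables.
emb : ∀ {n} → Δ₀ n → Vec (Term L) n → Formula L
emb (t ≈ u)    ρ = embT t ρ ≐ embT u ρ
emb (t ≲ u)    ρ = embT t ρ ≤′ embT u ρ
emb ff         ρ = ⊥′
emb (θ ⊃ χ)    ρ = emb θ ρ ⇒ emb χ ρ
emb (all≤ t θ) ρ = ∀′ (var 0 ≤′ shift (embT t ρ) ⇒ emb θ (var 0 ∷ shifts ρ))

-- The code constructors are used on numbers, on arithmetical terms and on
-- primitive recursive functions.
module Codes {A : Set} (lit : ℕ → A) (pair : A → A → A) where

  c-var : A → A
  c-var i = pair (lit 0) i

  c-fn c-cons c-rel c-imp c-eq : A → A → A
  c-nil c-⊥ : A
  c-all : A → A

  c-fn f ts   = pair (lit 1) (pair f ts)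
  c-nil       = lit 0
  c-cons t ts = pair (lit 2) (pair t ts)
  c-rel r ts  = pair (lit 3) (pair r ts)
  c-⊥         = pair (lit 4) (lit 0)
  c-imp φ ψ   = pair (lit 5) (pair φ ψ)
  c-all φ     = pair (lit 6) φ
  c-eq t u    = c-rel (lit 0) (c-cons t (c-cons u c-nil))

-- An injection ℕ × ℕ → ℕ whose value exceeds both arguments.  It is opaque so
-- that the type checker never computes a Gödel number in unary.
opaque
  pair : ℕ → ℕ → ℕ
  pair a b = suc ((a + b) * (a + b) + a)

pairA : ∀ {n} → ATerm n → ATerm n → ATerm n
pairA a b = S ((a ⊕ b) ⊗ (a ⊕ b) ⊕ a)

module Cℕ = Codes {ℕ} (λ k → k) pair

funCode : FunSym L → ℕ
funCode `0              = 0
funCode `S              = 1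
funCode `+              = 2
funCode `*              = 3
funCode `exp            = 4
funCode {L = L} (ext f) = 5 + Language.codeF L f

relCode : RelSym L → ℕ
relCode `=              = 0
relCode `≤              = 1
relCode {L = L} (ext r) = 2 + Language.codeR L r

mutual
  ⌜_⌝ᵗ : Term L → ℕ
  ⌜ var i ⌝ᵗ   = Cℕ.c-var i
  ⌜ fn f ts ⌝ᵗ = Cℕ.c-fn (funCode f) ⌜ ts ⌝ᵗˢ

  ⌜_⌝ᵗˢ : ∀ {k} → Vec (Term L) k → ℕ
  ⌜ [] ⌝ᵗˢ     = Cℕ.c-nil
  ⌜ t ∷ ts ⌝ᵗˢ = Cℕ.c-cons ⌜ t ⌝ᵗ ⌜ ts ⌝ᵗˢ

⌜_⌝ : Formula L → ℕ
⌜ rel r ts ⌝ = Cℕ.c-rel (relCode r) ⌜ ts ⌝ᵗˢ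
⌜ ⊥′ ⌝       = Cℕ.c-⊥
⌜ φ ⇒ ψ ⌝    = Cℕ.c-imp ⌜ φ ⌝ ⌜ ψ ⌝
⌜ ∀′ φ ⌝     = Cℕ.c-all ⌜ φ ⌝

-- A recursive set of axioms, presented by Δ₀-formulas yes and no in
-- (computation , formula): a number w with yes (w , ⌜ φ ⌝) is an accepting
-- computation on φ, one with no (w , ⌜ φ ⌝) a rejecting computation.
-- Axioms may have free variables, which are read universally (see gen).
record Theory (L : Language) : Set₁ where
  field
    Axiom     : Formula L → Set
    yes no    : Δ₀ 2
    halts     : (φ : Formula L) → (Σ ℕ λ w → w ∷ ⌜ φ ⌝ ∷ [] ⊨ yes)
                    ⊎ (Σ ℕ λ w → w ∷ ⌜ φ ⌝ ∷ [] ⊨ no)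
    yes-sound : ∀ φ w → (w ∷ ⌜ φ ⌝ ∷ [] ⊨ yes) → Axiom φ
    no-sound  : ∀ φ w → (w ∷ ⌜ φ ⌝ ∷ [] ⊨ no) → ¬ Axiom φ

infix 1 _⊢_

data _⊢_ {L : Language} (T : Theory L) : Formula L → Set where
  ax      : ∀ {φ} → Theory.Axiom T φ → T ⊢ φ
  K       : ∀ {φ ψ} → T ⊢ φ ⇒ ψ ⇒ φ
  S       : ∀ {φ ψ χ} → T ⊢ (φ ⇒ ψ ⇒ χ) ⇒ (φ ⇒ ψ) ⇒ φ ⇒ χ
  DNE     : ∀ {φ} → T ⊢ ((φ ⇒ ⊥′) ⇒ ⊥′) ⇒ φ
  ∀-elim  : ∀ {φ} t → T ⊢ ∀′ φ ⇒ φ [ inst t ]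
  ∀-dist  : ∀ {φ ψ} → T ⊢ ∀′ (φ ⇒ ψ) ⇒ ∀′ φ ⇒ ∀′ ψ
  ∀-vac   : ∀ {φ} → T ⊢ φ ⇒ ∀′ (φ [ wk ])
  ≐-refl  : ∀ {t} → T ⊢ t ≐ t
  ≐-subst : ∀ φ {t u} → T ⊢ t ≐ u ⇒ φ [ inst t ] ⇒ φ [ inst u ]
  mp      : ∀ {φ ψ} → T ⊢ φ ⇒ ψ → T ⊢ φ → T ⊢ ψ
  gen     : ∀ {φ} → T ⊢ φ → T ⊢ ∀′ φ

-- IΔ₀ + Exp, with a function symbol for x ↦ 2ˣ.
data EA {L : Language} : Formula L → Set where
  S≠0   : EA (¬′ S′ (var 0) ≐ O′)
  S-inj : EA (S′ (var 0) ≐ S′ (var 1) ⇒ var 0 ≐ var 1)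
  pred  : EA (¬′ var 0 ≐ O′ ⇒ ∃′ (var 1 ≐ S′ (var 0)))
  +0    : EA (var 0 +′ O′ ≐ var 0)
  +S    : EA (var 0 +′ S′ (var 1) ≐ S′ (var 0 +′ var 1))
  *0    : EA (var 0 *′ O′ ≐ O′)
  *S    : EA (var 0 *′ S′ (var 1) ≐ var 0 *′ var 1 +′ var 0)
  exp0  : EA (exp′ O′ ≐ S′ O′)
  expS  : EA (exp′ (S′ (var 0)) ≐ exp′ (var 0) +′ exp′ (var 0))
  ≤⇒    : EA (var 0 ≤′ var 1 ⇒ ∃′ (var 0 +′ var 1 ≐ var 2))
  ⇒≤    : EA (∃′ (var 0 +′ var 1 ≐ var 2) ⇒ var 0 ≤′ var 1)
  -- θ has induction variable 0 and n parameters.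
  ind   : ∀ {n} (θ : Δ₀ (suc n)) →
          let as = tabulate (var ∘ toℕ) in
          EA ( emb θ (O′ ∷ as)
             ⇒ ∀′ (emb θ (var 0 ∷ shifts as) ⇒ emb θ (S′ (var 0) ∷ shifts as))
             ⇒ ∀′ (emb θ (var 0 ∷ shifts as)) )

_ExtendsEA : Theory L → Set
T ExtendsEA = ∀ {φ} → EA φ → T ⊢ φ

-- A derivation is coded as a tree: node φ ρ has conclusion φ, obtained by the
-- rule ρ, which contains the derivations of the premises, the terms and
-- formulas that the conclusion does not determine, and for a non-logical
-- axiom an accepting computation.
--
-- Syntactic notions are arithmetized through numbers coding judgements:
-- a is a term, a list of k terms, a formula, a derivation, or b results from
-- a (a term, list or formula) by the substitution liftᵏ σ, where σ is 0 for
-- wk and 1 + t for inst t.  A judgement holds iff it belongs to a finite set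
-- each member of which follows from other members by a clause below; the
-- recursion in the clauses is well-founded, so a set cannot justify itself
-- circularly.
module Judgements {n : ℕ} where

  open Codes {ATerm n} litA pairA public

  r-ax r-elim r-subst r-gen : ATerm n → ATerm n
  r-K r-S r-DNE r-dist r-vac r-refl : ATerm n
  node r-mp : ATerm n → ATerm n → ATerm n

  node      = pairA
  r-ax w    = pairA (litA 0) w
  r-K       = pairA (litA 1) O
  r-S       = pairA (litA 2) O
  r-DNE     = pairA (litA 3) O
  r-elim t  = pairA (litA 4) t
  r-dist    = pairA (litA 5) O
  r-vac     = pairA (litA 6) O
  r-refl    = pairA (litA 7) O
  r-subst φ = pairA (litA 8) φ
  r-mp d e  = pairA (litA 9) (pairA d e)
  r-gen d   = pairA (litA 10) d

  j-term j-formula j-deriv : ATerm n → ATerm n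
  j-terms : ATerm n → ATerm n → ATerm n
  j-subst : ATerm n → ATerm n → ATerm n → ATerm n → ATerm n

  j-term a        = pairA (litA 0) a
  j-terms k a     = pairA (litA 1) (pairA k a)
  j-formula a     = pairA (litA 2) a
  j-deriv a       = pairA (litA 3) a
  j-subst k σ a b = pairA (litA 4) (pairA (pairA k σ) (pairA a b))

pick : ∀ {n} → Δ₀ 2 → Fin n → Fin n → Δ₀ n
pick θ i j = ren (λ { fzero → i ; (fsuc _) → j }) θ

-- Variables (code , arity).
funAr relAr : Language → Δ₀ 2
funAr L = c ≈ litA 0 & k ≈ litA 0
       or c ≈ litA 1 & k ≈ litA 1
       or c ≈ litA 2 & k ≈ litA 2
       or c ≈ litA 3 & k ≈ litA 2
       or c ≈ litA 4 & k ≈ litA 1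
       or ex≤ c (var (# 1) ≈ litA 5 ⊕ var (# 0)
                 & pick (Language.isFun L) (# 0) (# 2))
  where
  c k : ATerm 2
  c = var (# 0)
  k = var (# 1)

relAr L = c ≈ litA 0 & k ≈ litA 2
       or c ≈ litA 1 & k ≈ litA 2
       or ex≤ c (var (# 1) ≈ litA 2 ⊕ var (# 0)
                 & pick (Language.isRel L) (# 0) (# 2))
  where
  c k : ATerm 2
  c = var (# 0)
  k = var (# 1)

⋁ : ∀ {n} → List (Δ₀ n) → Δ₀ n
⋁ = foldr _or_ ff

-- Variables (j , w): j follows by a clause from members of w.
justified : Theory L → Δ₀ 2
justified {L} T =
  ex≤ (var (# 0)) (ex≤ (var (# 1)) (ex≤ (var (# 2))
    (ex≤ (var (# 3)) (ex≤ (var (# 4)) (ex≤ (var (# 5)) (⋁ clauses))))))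
  where
  open Judgements {8}

  iA iB iC : Fin 8
  iA = # 5
  iB = # 4
  iC = # 3

  a b c d e f j w : ATerm 8
  a = var iA
  b = var iB
  c = var iC
  d = var (# 2)
  e = var (# 1)
  f = var (# 0)
  j = var (# 6)
  w = var (# 7)

  clauses : List (Δ₀ 8)
  clauses =
      (j ≈ j-term (c-var a))
    ∷ (j ≈ j-term (c-fn a b) & pick (funAr L) iA iC & j-terms c b ∈̇ w)
    ∷ (j ≈ j-terms O c-nil)
    ∷ (j ≈ j-terms (S a) (c-cons b c) & j-term b ∈̇ w & j-terms a c ∈̇ w)
    ∷ (j ≈ j-formula (c-rel a b) & pick (relAr L) iA iC & j-terms c b ∈̇ w)
    ∷ (j ≈ j-formula c-⊥)
    ∷ (j ≈ j-formula (c-imp a b) & j-formula a ∈̇ w & j-formula b ∈̇ w)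
    ∷ (j ≈ j-formula (c-all a) & j-formula a ∈̇ w)
    ∷ (j ≈ j-subst O O (c-var a) (c-var (S a)))
    ∷ (j ≈ j-subst O (S a) (c-var O) a)
    ∷ (j ≈ j-subst O (S a) (c-var (S b)) (c-var b))
    ∷ (j ≈ j-subst (S a) b (c-var O) (c-var O))
    ∷ (j ≈ j-subst (S a) b (c-var (S c)) d
        & j-subst a b (c-var c) e ∈̇ w & j-subst O O e d ∈̇ w)
    ∷ (j ≈ j-subst a b (c-fn c d) (c-fn c e) & j-subst a b d e ∈̇ w)
    ∷ (j ≈ j-subst a b c-nil c-nil)
    ∷ (j ≈ j-subst a b (c-cons c d) (c-cons e f)
        & j-subst a b c e ∈̇ w & j-subst a b d f ∈̇ w)
    ∷ (j ≈ j-subst a b (c-rel c d) (c-rel c e) & j-subst a b d e ∈̇ w)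
    ∷ (j ≈ j-subst a b c-⊥ c-⊥)
    ∷ (j ≈ j-subst a b (c-imp c d) (c-imp e f)
        & j-subst a b c e ∈̇ w & j-subst a b d f ∈̇ w)
    ∷ (j ≈ j-subst a b (c-all c) (c-all d) & j-subst (S a) b c d ∈̇ w)
    ∷ (j ≈ j-deriv (node a (r-ax b)) & j-formula a ∈̇ w
        & pick (Theory.yes T) iB iA)
    ∷ (let φ = c-imp a (c-imp b a) in
       j ≈ j-deriv (node φ r-K) & j-formula φ ∈̇ w)
    ∷ (let φ = c-imp (c-imp a (c-imp b c)) (c-imp (c-imp a b) (c-imp a c)) in
       j ≈ j-deriv (node φ r-S) & j-formula φ ∈̇ w)
    ∷ (let φ = c-imp (c-imp (c-imp a c-⊥) c-⊥) a in
       j ≈ j-deriv (node φ r-DNE) & j-formula φ ∈̇ w)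
    ∷ (let φ = c-imp (c-all a) b in
       j ≈ j-deriv (node φ (r-elim c)) & j-formula φ ∈̇ w
        & j-term c ∈̇ w & j-subst O (S c) a b ∈̇ w)
    ∷ (let φ = c-imp (c-all (c-imp a b)) (c-imp (c-all a) (c-all b)) in
       j ≈ j-deriv (node φ r-dist) & j-formula φ ∈̇ w)
    ∷ (let φ = c-imp a (c-all b) in
       j ≈ j-deriv (node φ r-vac) & j-formula φ ∈̇ w & j-subst O O a b ∈̇ w)
    ∷ (j ≈ j-deriv (node (c-eq a a) r-refl) & j-formula (c-eq a a) ∈̇ w)
    ∷ (let φ = c-imp (c-eq a b) (c-imp c d) in
       j ≈ j-deriv (node φ (r-subst e)) & j-formula φ ∈̇ w & j-formula e ∈̇ w
        & j-subst O (S a) e c ∈̇ w & j-subst O (S b) e d ∈̇ w)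
    ∷ (let p = node (c-imp a b) c
           q = node a d in
       j ≈ j-deriv (node b (r-mp p q)) & j-deriv p ∈̇ w & j-deriv q ∈̇ w)
    ∷ (let p = node a b in
       j ≈ j-deriv (node (c-all a) (r-gen p)) & j-deriv p ∈̇ w)
    ∷ []

-- Variables (p , x): p codes a derivation of the formula with code x.  All
-- judgements needed have codes at most j-subst p (1 + p) p p.
opaque
  proof : Theory L → Δ₀ 2
  proof T =
      ex≤ (var (# 0)) (var (# 1) ≈ pairA (var (# 2)) (var (# 0)))
    & ex≤ (exp (S (j-subst p (S p) p p)))
        ( j-deriv (var (# 1)) ∈̇ var (# 0)
        & all≤ (var (# 0)) (var (# 0) ∈̇ var (# 1) ⊃ pick (justified T) (# 0) (# 1)) )
    where
    open Judgements
    p : ATerm 2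
    p = var (# 0)

Proof : Theory L → Term L → Term L → Formula L
Proof T p x = emb (proof T) (p ∷ x ∷ [])

data PR : ℕ → Set where
  zero : PR 0
  succ : PR 1
  proj : ∀ {n} → Fin n → PR n
  comp : ∀ {m n} → PR m → Vec (PR n) m → PR n
  prec : ∀ {n} → PR n → PR (2 + n) → PR (1 + n)

mutual
  eval : ∀ {n} → PR n → Vec ℕ n → ℕ
  eval zero        []           = 0
  eval succ        (x ∷ [])     = suc x
  eval (proj i)    xs           = lookup xs i
  eval (comp f gs) xs           = eval f (evals gs xs)
  eval (prec f g)  (zero ∷ xs)  = eval f xs
  eval (prec f g)  (suc x ∷ xs) = eval g (x ∷ eval (prec f g) (x ∷ xs) ∷ xs)

  evals : ∀ {m n} → Vec (PR n) m → Vec ℕ n → Vec ℕ m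
  evals []       xs = []
  evals (g ∷ gs) xs = eval g xs ∷ evals gs xs

shiftBy : ℕ → Term L → Term L
shiftBy zero    t = t
shiftBy (suc m) t = shift (shiftBy m t)

shiftsBy : ∀ {k} → ℕ → Vec (Term L) k → Vec (Term L) k
shiftsBy zero    ts = ts
shiftsBy (suc m) ts = shifts (shiftsBy m ts)

∃* : ℕ → Formula L → Formula L
∃* zero    φ = φ
∃* (suc m) φ = ∃′ (∃* m φ)

entry : Term L → Term L → Term L → Formula L
entry i v s = emb (pairA (var (# 0)) (var (# 1)) ∈̇ var (# 2)) (i ∷ v ∷ s ∷ [])

-- Graph f xs y is the arithmetical formula f(xs) = y read off from the
-- definition of f.  For a recursion it says that ⟨x , y⟩ belongs to a finite
-- set s of pairs ⟨argument , value⟩ (tested by entry) in which every pair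
-- ⟨0 , v⟩ is correct and every pair ⟨i + 1 , v⟩ comes from some ⟨i , u⟩.
mutual
  Graph : ∀ {n} → PR n → Vec (Term L) n → Term L → Formula L
  Graph zero        []       y = y ≐ O′
  Graph succ        (x ∷ []) y = y ≐ S′ x
  Graph (proj i)    xs       y = y ≐ lookup xs i
  Graph (comp {m} f gs) xs y =
    let zs = tabulate (var ∘ toℕ) in
    ∃* m (Graphs gs (shiftsBy m xs) zs ∧′ Graph f zs (shiftBy m y))
  Graph (prec f g) (x ∷ xs) y =
    ∃′ ( entry (shift x) (shift y) (var 0)
       ∧′ ∀′ (entry O′ (var 0) (var 1) ⇒ Graph f (shiftsBy 2 xs) (var 0))
       ∧′ ∀′ (∀′ (entry (S′ (var 1)) (var 0) (var 2) ⇒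
            ∃′ ( entry (var 2) (var 0) (var 3)
               ∧′ Graph g (var 2 ∷ var 0 ∷ shiftsBy 4 xs) (var 1) ))) )

  Graphs : ∀ {m n} → Vec (PR n) m → Vec (Term L) n → Vec (Term L) m → Formula L
  Graphs []       xs []       = O′ ≐ O′
  Graphs (g ∷ gs) xs (z ∷ zs) = Graph g xs z ∧′ Graphs gs xs zs

litP : ∀ {n} → ℕ → PR n
litP zero    = comp zero []
litP (suc k) = comp succ (litP k ∷ [])

plus times : PR 2
plus  = prec (proj (# 0)) (comp succ (proj (# 1) ∷ []))
times = prec (litP 0) (comp plus (proj (# 2) ∷ proj (# 1) ∷ []))

opaque
  pairP : ∀ {n} → PR n → PR n → PR n
  pairP f g =
    let f+g = comp plus (f ∷ g ∷ []) in
    comp succ (comp plus (comp times (f+g ∷ f+g ∷ []) ∷ f ∷ []) ∷ [])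

module CP {n : ℕ} = Codes {PR n} litP pairP

num : PR 1
num = prec (CP.c-fn (litP 0) CP.c-nil)
           (CP.c-fn (litP 1) (CP.c-cons (proj (# 1)) CP.c-nil))

-- liftᵏ (inst n̄) on variables; nothing stands for n̄.
dotVar : ℕ → ℕ → Maybe ℕ
dotVar zero    zero    = nothing
dotVar zero    (suc i) = just i
dotVar (suc k) zero    = just zero
dotVar (suc k) (suc i) = mapMaybe suc (dotVar k i)

mutual
  dotT : ℕ → Term L → PR 1
  dotT k (var i) with dotVar k i
  ... | nothing = num
  ... | just i′ = CP.c-var (litP i′)
  dotT k (fn f ts) = CP.c-fn (litP (funCode f)) (dotTs k ts)

  dotTs : ∀ {m} → ℕ → Vec (Term L) m → PR 1
  dotTs k []       = CP.c-nil
  dotTs k (t ∷ ts) = CP.c-cons (dotT k t) (dotTs k ts)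

dotAt : ℕ → Formula L → PR 1
dotAt k (rel r ts) = CP.c-rel (litP (relCode r)) (dotTs k ts)
dotAt k ⊥′         = CP.c-⊥
dotAt k (φ ⇒ ψ)    = CP.c-imp (dotAt k φ) (dotAt k ψ)
dotAt k (∀′ φ)     = CP.c-all (dotAt (suc k) φ)

dot : Formula L → PR 1
dot = dotAt 0

⌜0=1⌝ : Language → ℕ
⌜0=1⌝ L = ⌜ numeral {L} 0 ≐ numeral 1 ⌝

-- The variable 0 stands for x.
NotProofOf0=1 : Theory L → Formula L
NotProofOf0=1 {L} T = ¬′ Proof T (var 0) (numeral (⌜0=1⌝ L))

eval-lit : ∀ {n} k (xs : Vec ℕ n) → eval (litP k) xs ≡ k
eval-lit zero    xs = refl
eval-lit (suc k) xs = cong suc (eval-lit k xs)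

eval-plus : ∀ x y → eval plus (x ∷ y ∷ []) ≡ x + y
eval-plus zero    y = refl
eval-plus (suc x) y = cong suc (eval-plus x y)

eval-times : ∀ x y → eval times (x ∷ y ∷ []) ≡ x * y
eval-times zero    y = refl
eval-times (suc x) y =
  trans (eval-plus y _) (cong (y +_) (eval-times x y))

opaque
  unfolding pair pairP

  eval-pair : ∀ {n} (f g : PR n) {xs a b} → eval f xs ≡ a → eval g xs ≡ b →
              eval (pairP f g) xs ≡ pair a b
  eval-pair f g {xs} {a} {b} refl refl =
    cong suc (trans (eval-plus (eval times (s ∷ s ∷ [])) a)
             (cong (_+ a) (trans (eval-times s s)
               (cong₂ _*_ (eval-plus a b) (eval-plus a b)))))
    where
    s : ℕ
    s = eval plus (a ∷ b ∷ [])

eval-num : ∀ n → eval num (n ∷ []) ≡ ⌜ numeral {L} n ⌝ᵗ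
eval-num zero =
  eval-pair (litP 1) (pairP (litP 0) (litP 0)) (eval-lit 1 [])
    (eval-pair (litP 0) (litP 0) (eval-lit 0 []) (eval-lit 0 []))
eval-num {L} (suc n) =
  eval-pair (litP 1) (pairP (litP 1) (CP.c-cons (proj (# 1)) CP.c-nil)) (eval-lit 1 xs)
    (eval-pair (litP 1) (CP.c-cons (proj (# 1)) CP.c-nil) (eval-lit 1 xs)
      (eval-pair (litP 2) (pairP (proj (# 1)) (litP 0)) (eval-lit 2 xs)
        (eval-pair (proj (# 1)) (litP 0) (eval-num {L} n) (eval-lit 0 xs))))
  where xs = n ∷ eval num (n ∷ []) ∷ []

numeral-shift : ∀ n → shift {L} (numeral n) ≡ numeral n
numeral-shift zero    = refl
numeral-shift (suc n) = cong S′ (numeral-shift n)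

numeral-subst : ∀ (σ : Subst L) n → substT σ (numeral n) ≡ numeral n
numeral-subst σ zero    = refl
numeral-subst σ (suc n) = cong S′ (numeral-subst σ n)

lift^ : ℕ → Subst L → Subst L
lift^ zero    σ = σ
lift^ (suc k) σ = lift (lift^ k σ)

stands-for : ℕ → Maybe ℕ → Term L
stands-for n nothing  = numeral n
stands-for n (just i) = var i

dotVar-correct : ∀ n k i → apply {L} (lift^ k (inst (numeral n))) i ≡ stands-for n (dotVar k i)
dotVar-correct n zero    zero    = refl
dotVar-correct n zero    (suc i) = refl
dotVar-correct n (suc k) zero    = refl
dotVar-correct n (suc k) (suc i) =
  trans (cong shift (dotVar-correct n k i)) (shift-stands (dotVar k i))
  where
  shift-stands : ∀ m → shift (stands-for n m) ≡ stands-for {L} n (mapMaybe suc m)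
  shift-stands nothing  = numeral-shift n
  shift-stands (just _) = refl

mutual
  dotT-correct : ∀ n k (t : Term L) →
    eval (dotT k t) (n ∷ []) ≡ ⌜ substT (lift^ k (inst (numeral n))) t ⌝ᵗ
  dotT-correct {L} n k (var i) rewrite dotVar-correct {L} n k i with dotVar k i
  ... | nothing = eval-num {L} n
  ... | just i′ = eval-pair (litP 0) (litP i′) (eval-lit 0 (n ∷ [])) (eval-lit i′ (n ∷ []))
  dotT-correct n k (fn f ts) =
    eval-pair (litP 1) (pairP (litP (funCode f)) (dotTs k ts)) (eval-lit 1 (n ∷ []))
      (eval-pair (litP (funCode f)) (dotTs k ts) (eval-lit (funCode f) (n ∷ []))
        (dotTs-correct n k ts))

  dotTs-correct : ∀ {m} n k (ts : Vec (Term L) m) →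
    eval (dotTs k ts) (n ∷ []) ≡ ⌜ substTs (lift^ k (inst (numeral n))) ts ⌝ᵗˢ
  dotTs-correct n k []       = refl
  dotTs-correct n k (t ∷ ts) =
    eval-pair (litP 2) (pairP (dotT k t) (dotTs k ts)) (eval-lit 2 (n ∷ []))
      (eval-pair (dotT k t) (dotTs k ts) (dotT-correct n k t) (dotTs-correct n k ts))

dotAt-correct : ∀ n k (φ : Formula L) →
  eval (dotAt k φ) (n ∷ []) ≡ ⌜ φ [ lift^ k (inst (numeral n)) ] ⌝
dotAt-correct n k (rel r ts) =
  eval-pair (litP 3) (pairP (litP (relCode r)) (dotTs k ts)) (eval-lit 3 (n ∷ []))
    (eval-pair (litP (relCode r)) (dotTs k ts) (eval-lit (relCode r) (n ∷ []))
      (dotTs-correct n k ts))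
dotAt-correct n k ⊥′ =
  eval-pair (litP 4) (litP 0) (eval-lit 4 (n ∷ [])) (eval-lit 0 (n ∷ []))
dotAt-correct n k (φ ⇒ ψ) =
  eval-pair (litP 5) (pairP (dotAt k φ) (dotAt k ψ)) (eval-lit 5 (n ∷ []))
    (eval-pair (dotAt k φ) (dotAt k ψ) (dotAt-correct n k φ) (dotAt-correct n k ψ))
dotAt-correct n k (∀′ φ) =
  eval-pair (litP 6) (dotAt (suc k) φ) (eval-lit 6 (n ∷ [])) (dotAt-correct n (suc k) φ)

dot-correct : ∀ (φ : Formula L) n → eval (dot φ) (n ∷ []) ≡ ⌜ φ [ inst (numeral n) ] ⌝
dot-correct φ n = dotAt-correct n 0 φ

mutual
  shift-subst : ∀ (σ : Subst L) t → substT (lift σ) (shift t) ≡ shift (substT σ t)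
  shift-subst σ (var i)   = refl
  shift-subst σ (fn f ts) = cong (fn f) (shifts-subst σ ts)

  shifts-subst : ∀ {k} (σ : Subst L) (ts : Vec (Term L) k) →
    substTs (lift σ) (shifts ts) ≡ shifts (substTs σ ts)
  shifts-subst σ []       = refl
  shifts-subst σ (t ∷ ts) = cong₂ _∷_ (shift-subst σ t) (shifts-subst σ ts)

lookup-subst : ∀ {n} (σ : Subst L) (ρ : Vec (Term L) n) i →
  substT σ (lookup ρ i) ≡ lookup (substTs σ ρ) i
lookup-subst σ (t ∷ ρ) fzero    = refl
lookup-subst σ (t ∷ ρ) (fsuc i) = lookup-subst σ ρ i

embT-subst : ∀ {n} (σ : Subst L) (t : ATerm n) ρ →
  substT σ (embT t ρ) ≡ embT t (substTs σ ρ)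
embT-subst σ (var i) ρ = lookup-subst σ ρ i
embT-subst σ O       ρ = refl
embT-subst σ (S t)   ρ = cong S′ (embT-subst σ t ρ)
embT-subst σ (exp t) ρ = cong exp′ (embT-subst σ t ρ)
embT-subst σ (t ⊕ u) ρ = cong₂ _+′_ (embT-subst σ t ρ) (embT-subst σ u ρ)
embT-subst σ (t ⊗ u) ρ = cong₂ _*′_ (embT-subst σ t ρ) (embT-subst σ u ρ)

emb-subst : ∀ {n} (σ : Subst L) (θ : Δ₀ n) ρ →
  emb θ ρ [ σ ] ≡ emb θ (substTs σ ρ)
emb-subst σ (t ≈ u) ρ = cong₂ _≐_ (embT-subst σ t ρ) (embT-subst σ u ρ)
emb-subst σ (t ≲ u) ρ = cong₂ _≤′_ (embT-subst σ t ρ) (embT-subst σ u ρ)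
emb-subst σ ff      ρ = refl
emb-subst σ (θ ⊃ χ) ρ = cong₂ _⇒_ (emb-subst σ θ ρ) (emb-subst σ χ ρ)
emb-subst σ (all≤ t θ) ρ = cong ∀′ (cong₂ _⇒_
  (cong (var 0 ≤′_) (trans (shift-subst σ (embT t ρ)) (cong shift (embT-subst σ t ρ))))
  (trans (emb-subst (lift σ) θ (var 0 ∷ shifts ρ))
         (cong (λ ts → emb θ (var 0 ∷ ts)) (shifts-subst σ ρ))))

Proof-subst : ∀ (T : Theory L) n x →
  (¬′ Proof T (var 0) (numeral x)) [ inst (numeral n) ] ≡ (¬′ Proof T (numeral n) (numeral x))
Proof-subst T n x = cong ¬′_
  (trans (emb-subst σ (proof T) (var 0 ∷ numeral x ∷ []))
         (cong (λ t → emb (proof T) (numeral n ∷ t ∷ [])) (numeral-subst σ x)))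
  where
  σ : Subst _
  σ = inst (numeral n)

dot-NotProofOf0=1 : ∀ (T : Theory L) n →
  eval (dot (NotProofOf0=1 T)) (n ∷ []) ≡ ⌜ ¬′ Proof T (numeral n) (numeral (⌜0=1⌝ L)) ⌝
dot-NotProofOf0=1 {L} T n =
  trans (dot-correct (NotProofOf0=1 T) n) (cong ⌜_⌝ (Proof-subst T n (⌜0=1⌝ L)))

{-# OPTIONS --safe #-}

-- Given x, either x is a proof of 0=1, and then ¬ Proof (x̄ , 0=1) follows by
-- explosion, or the Δ₀-sentence ¬ Proof (x̄ , 0=1) is true, and then it is provable
-- by provable Δ₀-completeness.  In both cases T bounds the size of the proof by an
-- elementary function of x, so that a bounded search finds it; the selector is
-- this search.
--
-- That T proves this is shown in the models of T, by a constructive form of the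
-- completeness theorem (after Krivine): the falsum of a model is an arbitrary set,
-- and → and ∀ are those of the metatheory.  In such a model of IΔ₀ + Exp, proofs
-- are closed sets of judgements, obtained by Δ₀-comprehension.  The recursions on
-- the argument (evaluation of +, * and exp on numerals, bounded quantifiers) make
-- proofs at each step at most polynomially larger, which a double exponential
-- bounds.  The facts to be proved inside T along the way are valid formulas, whose
-- derivations are again supplied by the completeness theorem.
module Submission where

open import Defs
open import Algebra.Bundles using (CommutativeSemiring)
import Algebra.Solver.Ring.NaturalCoefficients.Default
import Algebra.Structures.Biased as Biased
open import Data.Bool using (Bool; true; false; if_then_else_; _∨_)
open import Data.Empty using (⊥; ⊥-elim)
open import Data.Fin using (Fin; toℕ; _↑ʳ_; _↑ˡ_; #_) renaming (zero to fzero; suc to fsuc; lift to liftFin)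
import Data.Fin.Properties as Finₚ
open import Data.List using (List; []; _∷_; foldr; length) renaming (map to mapL; lookup to lookupL)
open import Data.List.Relation.Unary.All using (All; []; _∷_)
open import Data.Maybe using (Maybe; just; nothing) renaming (map to mapMaybe)
open import Data.Nat using (ℕ; zero; suc; _+_; _*_; _^_; _≤_; _<_; _⊔_; z≤n; s≤s)
import Data.Nat.Properties as ℕₚ
open import Data.Product using (Σ-syntax; _×_; _,_; proj₁; proj₂)
open import Data.Sum using (_⊎_; inj₁; inj₂; map₁; map₂)
open import Data.Unit using (⊤; tt)
open import Data.Vec using (Vec; []; _∷_; lookup; tabulate; map; _++_)
open import Data.Vec.Properties using (lookup-map; lookup-++ʳ; lookup-++ˡ; lookup∘tabulate)
open import Function using (_∘_; id; Equivalence)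
open import Relation.Binary.Bundles using (Setoid)
open import Relation.Binary.Definitions using (tri<; tri≈; tri>)
open import Relation.Binary.PropositionalEquality as ≡
  using (_≡_; subst; subst₂; cong; cong₂)
import Relation.Binary.Reasoning.Setoid
open import Relation.Binary.Structures using (IsEquivalence)
open import Relation.Nullary using (¬_; yes; no; does)

-- Injectivity of the Gödel numbering

-- Nothing is assumed about the consistency of `T`, and no test tells whether the falsum holds in a
-- given model; hence `Cl`, double negation with respect to that falsum, carries disjunctions and
-- existence claims. The obstacle inside `T` is that induction is available for Δ₀-formulas only:
-- provability of instances can be proved by induction on a numerical argument only if a term bounds
-- the proofs beforehand. Hence the bounds throughout. The constant behind them is a number `D`
-- attached to a polynomial: it sends 2^e to at most 2^(D e), so `i` applications multiply the
-- exponent by D^i, and D ≤ 2^D replaces this factor by the term 2^(D i). Only recursions on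
-- possibly nonstandard arguments are iterated in this way; recursions on formulas, terms and
-- derivations of the metatheory compose finitely many fixed terms. A search, in place of a function
-- that builds the proofs, means that `T` has to know no more than that some proof lies below the
-- bound.

opaque
  unfolding pair

  private
    -- With s = a + b one has s² + a ≤ s² + s < (s + 1)², so the values of `pair` for different sums
    -- lie in disjoint intervals between squares.
    pair-gap : ∀ a b c d → a + b < c + d → pair a b < pair c d
    pair-gap a b c d lt = s≤s (ℕₚ.<-≤-trans (ℕₚ.≤-<-trans
        (ℕₚ.+-monoʳ-≤ ((a + b) * (a + b)) (ℕₚ.m≤m+n a b))
        (ℕₚ.≤-trans (ℕₚ.≤-reflexive (cong suc (ℕₚ.+-comm ((a + b) * (a + b)) (a + b))))
                    (ℕₚ.+-mono-≤ (ℕₚ.≤-refl {suc (a + b)}) (ℕₚ.*-monoʳ-≤ (a + b) (ℕₚ.n≤1+n (a + b))))))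
      (ℕₚ.≤-trans (ℕₚ.*-mono-≤ lt lt) (ℕₚ.m≤m+n _ c)))

  pair-injective-ℕ : ∀ {a b c d} → pair a b ≡ pair c d → a ≡ c × b ≡ d
  pair-injective-ℕ {a} {b} {c} {d} eq with ℕₚ.<-cmp (a + b) (c + d)
  ... | tri< lt _ _ = ⊥-elim (ℕₚ.<-irrefl eq (pair-gap a b c d lt))
  ... | tri> _ _ gt = ⊥-elim (ℕₚ.<-irrefl (≡.sym eq) (pair-gap c d a b gt))
  ... | tri≈ _ s _ = a≡c , ℕₚ.+-cancelˡ-≡ c b d (≡.trans (cong (_+ b) (≡.sym a≡c)) s)
    where
    a≡c : a ≡ c
    a≡c = ℕₚ.+-cancelˡ-≡ ((a + b) * (a + b)) a c
            (≡.trans (ℕₚ.suc-injective eq) (cong (_+ c) (cong₂ _*_ (≡.sym s) (≡.sym s))))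

  fst<pair : ∀ a b → a < pair a b
  fst<pair a b = s≤s (ℕₚ.m≤n+m a _)

  snd<pair : ∀ a b → b < pair a b
  snd<pair a zero    = s≤s z≤n
  snd<pair a (suc b) = s≤s (ℕₚ.≤-trans (ℕₚ.m≤n+m (suc b) a)
    (ℕₚ.≤-trans (subst (λ n → n ≤ n * n) (≡.sym (ℕₚ.+-suc a b)) (ℕₚ.m≤m*n (suc (a + b)) (suc (a + b))))
                (ℕₚ.m≤m+n _ a)))

pair-fst : ∀ {a b c d} → pair a b ≡ pair c d → a ≡ c
pair-fst = proj₁ ∘ pair-injective-ℕ

pair-snd : ∀ {a b c d} → pair a b ≡ pair c d → b ≡ d
pair-snd = proj₂ ∘ pair-injective-ℕ

pair-tag : ∀ {a b c d} {A : Set} → (a ≡ c → ⊥) → pair a b ≡ pair c d → A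
pair-tag a≢c eq = ⊥-elim (a≢c (pair-fst eq))

funCode-inj : ∀ (f g : FunSym L) → funCode f ≡ funCode g → f ≡ g
funCode-inj `0 `0 _ = ≡.refl
funCode-inj `S `S _ = ≡.refl
funCode-inj `+ `+ _ = ≡.refl
funCode-inj `* `* _ = ≡.refl
funCode-inj `exp `exp _ = ≡.refl
funCode-inj {L} (ext f) (ext g) eq =
  cong ext (Language.codeF-inj L (ℕₚ.+-cancelˡ-≡ 5 _ _ eq))

relCode-inj : ∀ (r s : RelSym L) → relCode r ≡ relCode s → r ≡ s
relCode-inj `= `= _ = ≡.refl
relCode-inj `≤ `≤ _ = ≡.refl
relCode-inj {L} (ext r) (ext s) eq =
  cong ext (Language.codeR-inj L (ℕₚ.+-cancelˡ-≡ 2 _ _ eq))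

mutual
  ⌜⌝ᵗ-inj : ∀ (t u : Term L) → ⌜ t ⌝ᵗ ≡ ⌜ u ⌝ᵗ → t ≡ u
  ⌜⌝ᵗ-inj (var i) (var j) eq = cong var (pair-snd eq)
  ⌜⌝ᵗ-inj (var i) (fn g us) eq = pair-tag (λ ()) eq
  ⌜⌝ᵗ-inj (fn f ts) (var j) eq = pair-tag (λ ()) eq
  ⌜⌝ᵗ-inj (fn f ts) (fn g us) eq
    with ≡.refl ← funCode-inj f g (pair-fst (pair-snd eq))
    = cong (fn f) (⌜⌝ᵗˢ-inj ts us (pair-snd (pair-snd eq)))

  ⌜⌝ᵗˢ-inj : ∀ {k} (ts us : Vec (Term L) k) → ⌜ ts ⌝ᵗˢ ≡ ⌜ us ⌝ᵗˢ → ts ≡ us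
  ⌜⌝ᵗˢ-inj [] [] eq = ≡.refl
  ⌜⌝ᵗˢ-inj (t ∷ ts) (u ∷ us) eq =
    cong₂ _∷_ (⌜⌝ᵗ-inj t u (pair-fst (pair-snd eq))) (⌜⌝ᵗˢ-inj ts us (pair-snd (pair-snd eq)))

-- Stage `n` of the Henkin construction treats whatever formula has number `n`; injectivity makes
-- this at most one formula.
⌜⌝-inj : ∀ (φ ψ : Formula L) → ⌜ φ ⌝ ≡ ⌜ ψ ⌝ → φ ≡ ψ
⌜⌝-inj (rel r ts) (rel s us) eq
  with ≡.refl ← relCode-inj r s (pair-fst (pair-snd eq))
  = cong (rel r) (⌜⌝ᵗˢ-inj ts us (pair-snd (pair-snd eq)))
⌜⌝-inj (rel r ts) ⊥′ eq = pair-tag (λ ()) eq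
⌜⌝-inj (rel r ts) (ψ ⇒ ψ₁) eq = pair-tag (λ ()) eq
⌜⌝-inj (rel r ts) (∀′ ψ) eq = pair-tag (λ ()) eq
⌜⌝-inj ⊥′ (rel r x) eq = pair-tag (λ ()) eq
⌜⌝-inj ⊥′ ⊥′ eq = ≡.refl
⌜⌝-inj ⊥′ (ψ ⇒ ψ₁) eq = pair-tag (λ ()) eq
⌜⌝-inj ⊥′ (∀′ ψ) eq = pair-tag (λ ()) eq
⌜⌝-inj (φ ⇒ φ₁) (rel r x) eq = pair-tag (λ ()) eq
⌜⌝-inj (φ ⇒ φ₁) ⊥′ eq = pair-tag (λ ()) eq
⌜⌝-inj (φ ⇒ φ₁) (ψ ⇒ ψ₁) eq =
  cong₂ _⇒_ (⌜⌝-inj φ ψ (pair-fst (pair-snd eq))) (⌜⌝-inj φ₁ ψ₁ (pair-snd (pair-snd eq)))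
⌜⌝-inj (φ ⇒ φ₁) (∀′ ψ) eq = pair-tag (λ ()) eq
⌜⌝-inj (∀′ φ) (rel r x) eq = pair-tag (λ ()) eq
⌜⌝-inj (∀′ φ) ⊥′ eq = pair-tag (λ ()) eq
⌜⌝-inj (∀′ φ) (ψ ⇒ ψ₁) eq = pair-tag (λ ()) eq
⌜⌝-inj (∀′ φ) (∀′ ψ) eq = cong ∀′ (⌜⌝-inj φ ψ (pair-snd eq))

-- Simultaneous substitution

mutual
  subT : (ℕ → Term L) → Term L → Term L
  subT τ (var i)   = τ i
  subT τ (fn f ts) = fn f (subTs τ ts)

  subTs : ∀ {k} → (ℕ → Term L) → Vec (Term L) k → Vec (Term L) k
  subTs τ []       = []
  subTs τ (t ∷ ts) = subT τ t ∷ subTs τ ts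

liftS : (ℕ → Term L) → ℕ → Term L
liftS τ zero    = var zero
liftS τ (suc i) = shift (τ i)

sub : (ℕ → Term L) → Formula L → Formula L
sub τ (rel r ts) = rel r (subTs τ ts)
sub τ ⊥′         = ⊥′
sub τ (φ ⇒ ψ)    = sub τ φ ⇒ sub τ ψ
sub τ (∀′ φ)     = ∀′ (sub (liftS τ) φ)

mutual
  subT-agree : ∀ {τ τ′ : ℕ → Term L} t → (∀ i → i < ⌜ t ⌝ᵗ → τ i ≡ τ′ i) → subT τ t ≡ subT τ′ t
  subT-agree (var i)   h = h i (snd<pair 0 i)
  subT-agree (fn f ts) h = cong (fn f) (subTs-agree ts
    (λ i lt → h i (ℕₚ.<-trans lt (ℕₚ.<-trans (snd<pair _ _) (snd<pair _ _)))))

  subTs-agree : ∀ {k} {τ τ′ : ℕ → Term L} (ts : Vec (Term L) k) →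
    (∀ i → i < ⌜ ts ⌝ᵗˢ → τ i ≡ τ′ i) → subTs τ ts ≡ subTs τ′ ts
  subTs-agree []       h = ≡.refl
  subTs-agree (t ∷ ts) h = cong₂ _∷_
    (subT-agree t (λ i lt → h i (ℕₚ.<-trans lt (ℕₚ.<-trans (fst<pair _ _) (snd<pair _ _)))))
    (subTs-agree ts (λ i lt → h i (ℕₚ.<-trans lt (ℕₚ.<-trans (snd<pair _ _) (snd<pair _ _)))))

-- Since `pair` exceeds both arguments, a Gödel number exceeds the index of every variable in the
-- formula. It thus serves as a crude bound for the free variables, and none has to be computed.
sub-agree : ∀ {τ τ′ : ℕ → Term L} φ → (∀ i → i < ⌜ φ ⌝ → τ i ≡ τ′ i) → sub τ φ ≡ sub τ′ φ
sub-agree (rel r ts) h = cong (rel r) (subTs-agree ts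
  (λ i lt → h i (ℕₚ.<-trans lt (ℕₚ.<-trans (snd<pair _ _) (snd<pair _ _)))))
sub-agree ⊥′ h = ≡.refl
sub-agree (φ ⇒ ψ) h = cong₂ _⇒_
  (sub-agree φ (λ i lt → h i (ℕₚ.<-trans lt (ℕₚ.<-trans (fst<pair _ _) (snd<pair _ _)))))
  (sub-agree ψ (λ i lt → h i (ℕₚ.<-trans lt (ℕₚ.<-trans (snd<pair _ _) (snd<pair _ _)))))
sub-agree {τ = τ} {τ′} (∀′ φ) h = cong ∀′ (sub-agree φ agree)
  where
  agree : ∀ i → i < ⌜ φ ⌝ → liftS τ i ≡ liftS τ′ i
  agree zero    _  = ≡.refl
  agree (suc i) lt = cong shift (h i (ℕₚ.<-trans (ℕₚ.<-trans (ℕₚ.n<1+n i) lt) (snd<pair _ _)))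

sub-ext : ∀ {τ τ′ : ℕ → Term L} φ → (∀ i → τ i ≡ τ′ i) → sub τ φ ≡ sub τ′ φ
sub-ext φ h = sub-agree φ (λ i _ → h i)

subT-ext : ∀ {τ τ′ : ℕ → Term L} t → (∀ i → τ i ≡ τ′ i) → subT τ t ≡ subT τ′ t
subT-ext t h = subT-agree t (λ i _ → h i)

mutual
  subT-id : ∀ (t : Term L) → subT var t ≡ t
  subT-id (var i)   = ≡.refl
  subT-id (fn f ts) = cong (fn f) (subTs-id ts)

  subTs-id : ∀ {k} (ts : Vec (Term L) k) → subTs var ts ≡ ts
  subTs-id []       = ≡.refl
  subTs-id (t ∷ ts) = cong₂ _∷_ (subT-id t) (subTs-id ts)

sub-id : ∀ (φ : Formula L) → sub var φ ≡ φ
sub-id (rel r ts) = cong (rel r) (subTs-id ts)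
sub-id ⊥′         = ≡.refl
sub-id (φ ⇒ ψ)    = cong₂ _⇒_ (sub-id φ) (sub-id ψ)
sub-id (∀′ φ)     = cong ∀′ (≡.trans (sub-ext φ (λ { zero → ≡.refl ; (suc i) → ≡.refl })) (sub-id φ))

succVar : ℕ → Term L
succVar i = var (suc i)

mutual
  shift≡subT : ∀ (t : Term L) → shift t ≡ subT succVar t
  shift≡subT (var i)   = ≡.refl
  shift≡subT (fn f ts) = cong (fn f) (shifts≡subTs ts)

  shifts≡subTs : ∀ {k} (ts : Vec (Term L) k) → shifts ts ≡ subTs succVar ts
  shifts≡subTs []       = ≡.refl
  shifts≡subTs (t ∷ ts) = cong₂ _∷_ (shift≡subT t) (shifts≡subTs ts)

mutual
  substT≡subT : ∀ (σ : Subst L) t → substT σ t ≡ subT (apply σ) t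
  substT≡subT σ (var i)   = ≡.refl
  substT≡subT σ (fn f ts) = cong (fn f) (substTs≡subTs σ ts)

  substTs≡subTs : ∀ {k} (σ : Subst L) (ts : Vec (Term L) k) → substTs σ ts ≡ subTs (apply σ) ts
  substTs≡subTs σ []       = ≡.refl
  substTs≡subTs σ (t ∷ ts) = cong₂ _∷_ (substT≡subT σ t) (substTs≡subTs σ ts)

[]≡sub : ∀ (σ : Subst L) φ → φ [ σ ] ≡ sub (apply σ) φ
[]≡sub σ (rel r ts) = cong (rel r) (substTs≡subTs σ ts)
[]≡sub σ ⊥′         = ≡.refl
[]≡sub σ (φ ⇒ ψ)    = cong₂ _⇒_ ([]≡sub σ φ) ([]≡sub σ ψ)
[]≡sub σ (∀′ φ)     = cong ∀′ (≡.trans ([]≡sub (lift σ) φ)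
  (sub-ext φ (λ { zero → ≡.refl ; (suc i) → ≡.refl })))

mutual
  subT-comp : ∀ (τ σ : ℕ → Term L) t → subT τ (subT σ t) ≡ subT (subT τ ∘ σ) t
  subT-comp τ σ (var i)   = ≡.refl
  subT-comp τ σ (fn f ts) = cong (fn f) (subTs-comp τ σ ts)

  subTs-comp : ∀ {k} (τ σ : ℕ → Term L) (ts : Vec (Term L) k) →
    subTs τ (subTs σ ts) ≡ subTs (subT τ ∘ σ) ts
  subTs-comp τ σ []       = ≡.refl
  subTs-comp τ σ (t ∷ ts) = cong₂ _∷_ (subT-comp τ σ t) (subTs-comp τ σ ts)

subT-shift : ∀ (τ : ℕ → Term L) t → subT τ (shift t) ≡ subT (τ ∘ suc) t
subT-shift τ t = ≡.trans (cong (subT τ) (shift≡subT t)) (subT-comp τ succVar t)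

shift-subT : ∀ (τ : ℕ → Term L) t → shift (subT τ t) ≡ subT (shift ∘ τ) t
shift-subT τ t = ≡.trans (shift≡subT (subT τ t))
  (≡.trans (subT-comp succVar τ t) (subT-ext t (λ i → ≡.sym (shift≡subT (τ i)))))

sub-comp : ∀ (τ σ : ℕ → Term L) φ → sub τ (sub σ φ) ≡ sub (subT τ ∘ σ) φ
sub-comp τ σ (rel r ts) = cong (rel r) (subTs-comp τ σ ts)
sub-comp τ σ ⊥′         = ≡.refl
sub-comp τ σ (φ ⇒ ψ)    = cong₂ _⇒_ (sub-comp τ σ φ) (sub-comp τ σ ψ)
sub-comp τ σ (∀′ φ)     = cong ∀′ (≡.trans (sub-comp (liftS τ) (liftS σ) φ) (sub-ext φ
  (λ { zero → ≡.refl
     ; (suc i) → ≡.trans (subT-shift (liftS τ) (σ i)) (≡.sym (shift-subT τ (σ i))) })))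

infixr 5 _∷ₑ_

_∷ₑ_ : {A : Set} → A → (ℕ → A) → ℕ → A
(x ∷ₑ ρ) zero    = x
(x ∷ₑ ρ) (suc i) = ρ i

sub-liftS-inst : ∀ (ρ : ℕ → Term L) t φ → sub (liftS ρ) φ [ inst t ] ≡ sub (t ∷ₑ ρ) φ
sub-liftS-inst ρ t φ = ≡.trans ([]≡sub (inst t) (sub (liftS ρ) φ))
  (≡.trans (sub-comp (apply (inst t)) (liftS ρ) φ) (sub-ext φ
    (λ { zero → ≡.refl
       ; (suc i) → ≡.trans (subT-shift (apply (inst t)) (ρ i)) (subT-id (ρ i)) })))

-- Classical structures whose falsum may hold

record Structure (L : Language) : Set₁ where
  field
    Carrier : Set
    fnI     : (f : FunSym L) → Vec Carrier (funArity f) → Carrier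
    relI    : (r : RelSym L) → Vec Carrier (relArity r) → Set
    ⊥I      : Set

  mutual
    evalT : (ℕ → Carrier) → Term L → Carrier
    evalT ρ (var i)   = ρ i
    evalT ρ (fn f ts) = fnI f (evalTs ρ ts)

    evalTs : ∀ {k} → (ℕ → Carrier) → Vec (Term L) k → Vec Carrier k
    evalTs ρ []       = []
    evalTs ρ (t ∷ ts) = evalT ρ t ∷ evalTs ρ ts

  infix 1 _⊩ᶠ_

  _⊩ᶠ_ : (ℕ → Carrier) → Formula L → Set
  ρ ⊩ᶠ rel r ts = relI r (evalTs ρ ts)
  ρ ⊩ᶠ ⊥′       = ⊥I
  ρ ⊩ᶠ φ ⇒ ψ    = (ρ ⊩ᶠ φ) → (ρ ⊩ᶠ ψ)
  ρ ⊩ᶠ ∀′ φ     = ∀ x → x ∷ₑ ρ ⊩ᶠ φ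

  mutual
    evalT-shift : ∀ (ρ : ℕ → Carrier) t → evalT ρ (shift t) ≡ evalT (ρ ∘ suc) t
    evalT-shift ρ (var i)   = ≡.refl
    evalT-shift ρ (fn f ts) = cong (fnI f) (evalTs-shift ρ ts)

    evalTs-shift : ∀ {k} (ρ : ℕ → Carrier) (ts : Vec (Term L) k) →
      evalTs ρ (shifts ts) ≡ evalTs (ρ ∘ suc) ts
    evalTs-shift ρ []       = ≡.refl
    evalTs-shift ρ (t ∷ ts) = cong₂ _∷_ (evalT-shift ρ t) (evalTs-shift ρ ts)

-- Soundness is required of all theorems at once: with an arbitrary `⊥I` and arbitrary atoms a
-- structure need not satisfy `DNE` or the laws of equality, and this field supplies them.
record Model {L : Language} (T : Theory L) : Set₁ where
  field
    structure : Structure L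
  open Structure structure public
  field
    sound : ∀ {φ} → T ⊢ φ → ∀ ρ → ρ ⊩ᶠ φ

-- Completeness by a Henkin construction that makes no decisions

module Completeness {L : Language} (T : Theory L) where

  ⊢-inst : ∀ {ψ} t → T ⊢ ψ → T ⊢ ψ [ inst t ]
  ⊢-inst t d = mp (∀-elim t) (gen d)

  private
    shiftⁿ : ℕ → Term L → Term L
    shiftⁿ = shiftBy

    -- From `k` on the indices drop by `k`, which is the effect of `k` successive instantiations of
    -- variable 0.
    prefix : ℕ → (ℕ → Term L) → ℕ → Term L
    prefix zero    τ i       = var i
    prefix (suc k) τ zero    = τ zero
    prefix (suc k) τ (suc i) = prefix k (τ ∘ suc) i

    prefix-agree : ∀ k τ i → i < k → prefix k τ i ≡ τ i
    prefix-agree (suc k) τ zero    lt       = ≡.refl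
    prefix-agree (suc k) τ (suc i) (s≤s lt) = prefix-agree k (τ ∘ suc) i lt

    prefix-shiftⁿ : ∀ k τ t → subT (prefix k τ) (shiftⁿ k t) ≡ t
    prefix-shiftⁿ zero    τ t = subT-id t
    prefix-shiftⁿ (suc k) τ t =
      ≡.trans (subT-shift (prefix (suc k) τ) (shiftⁿ k t)) (prefix-shiftⁿ k (τ ∘ suc) t)

    ⊢-prefix : ∀ k τ {ψ} → T ⊢ ψ → T ⊢ sub (prefix k τ) ψ
    ⊢-prefix zero    τ {ψ} d = subst (T ⊢_) (≡.sym (sub-id ψ)) d
    ⊢-prefix (suc k) τ {ψ} d = subst (T ⊢_) eq
        (⊢-prefix k (τ ∘ suc) (⊢-inst (shiftⁿ k (τ 0)) d))
      where
      eq : sub (prefix k (τ ∘ suc)) (ψ [ inst (shiftⁿ k (τ 0)) ]) ≡ sub (prefix (suc k) τ) ψ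
      eq = ≡.trans (cong (sub _) ([]≡sub (inst (shiftⁿ k (τ 0))) ψ))
        (≡.trans (sub-comp (prefix k (τ ∘ suc)) (apply (inst (shiftⁿ k (τ 0)))) ψ) (sub-ext ψ
          (λ { zero → prefix-shiftⁿ k (τ ∘ suc) (τ 0) ; (suc i) → ≡.refl })))

  -- Variables are instantiated one at a time, the terms being shifted out of
  -- the way of the variables still to be instantiated.
  ⊢-sub : ∀ τ {ψ} → T ⊢ ψ → T ⊢ sub τ ψ
  ⊢-sub τ {ψ} d = subst (T ⊢_) (sub-agree ψ (prefix-agree ⌜ ψ ⌝ τ)) (⊢-prefix ⌜ ψ ⌝ τ d)

  infix 1 _⊩_
  infixl 3 _,,_

  -- Generalisation is confined to theorems of `T`, so the deduction theorem holds without a side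
  -- condition on variables.
  data _⊩_ (Δ : Formula L → Set) : Formula L → Set where
    thm : ∀ {ψ} → T ⊢ ψ → Δ ⊩ ψ
    hyp : ∀ {ψ} → Δ ψ → Δ ⊩ ψ
    mp  : ∀ {ψ χ} → Δ ⊩ ψ ⇒ χ → Δ ⊩ ψ → Δ ⊩ χ

  _,,_ : (Formula L → Set) → Formula L → Formula L → Set
  (Δ ,, φ) ψ = Δ ψ ⊎ ψ ≡ φ

  ⊩-map : ∀ {Δ Δ′ : Formula L → Set} → (∀ {ψ} → Δ ψ → Δ′ ⊩ ψ) → ∀ {ψ} → Δ ⊩ ψ → Δ′ ⊩ ψ
  ⊩-map h (thm d)  = thm d
  ⊩-map h (hyp p)  = h p
  ⊩-map h (mp d e) = mp (⊩-map h d) (⊩-map h e)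

  ⊩-mono : ∀ {Δ Δ′ : Formula L → Set} → (∀ {ψ} → Δ ψ → Δ′ ψ) → ∀ {ψ} → Δ ⊩ ψ → Δ′ ⊩ ψ
  ⊩-mono h = ⊩-map (hyp ∘ h)

  ⊢-I : ∀ {φ} → T ⊢ φ ⇒ φ
  ⊢-I {φ} = mp (mp S K) (K {φ = φ} {ψ = φ})

  deduction : ∀ {Δ φ ψ} → Δ ,, φ ⊩ ψ → Δ ⊩ φ ⇒ ψ
  deduction (thm d)            = mp (thm K) (thm d)
  deduction (hyp (inj₁ p))     = mp (thm K) (hyp p)
  deduction (hyp (inj₂ ≡.refl))  = thm ⊢-I
  deduction (mp d e)           = mp (mp (thm S) (deduction d)) (deduction e)

  ex-falso : ∀ {Δ φ} → Δ ⊩ ⊥′ → Δ ⊩ φ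
  ex-falso d = mp (thm DNE) (mp (thm K) d)

  ¬⇒-fst : ∀ {Δ φ ψ} → Δ ⊩ (φ ⇒ ψ) ⇒ ⊥′ → Δ ⊩ φ
  ¬⇒-fst d = mp (thm DNE) (deduction
    (mp (⊩-mono inj₁ d) (deduction (ex-falso (mp (hyp (inj₁ (inj₂ ≡.refl))) (hyp (inj₂ ≡.refl)))))))

  ¬⇒-snd : ∀ {Δ φ ψ} → Δ ⊩ (φ ⇒ ψ) ⇒ ⊥′ → Δ ⊩ ψ ⇒ ⊥′
  ¬⇒-snd d = deduction (mp (⊩-mono inj₁ d) (deduction (hyp (inj₁ (inj₂ ≡.refl)))))

  ⊩∅ : ∀ {ψ} → (λ _ → ⊥) ⊩ ψ → T ⊢ ψ
  ⊩∅ (thm d)  = d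
  ⊩∅ (mp d e) = mp (⊩∅ d) (⊩∅ e)

  -- All free variables of `φ` are below `N`, expressed by the effect of substitutions; in this form
  -- it is inherited by subformulas and used in `generalise` directly.
  Fresh : ℕ → Formula L → Set
  Fresh N φ = ∀ {τ τ′ : ℕ → Term L} → (∀ i → i < N → τ i ≡ τ′ i) → sub τ φ ≡ sub τ′ φ

  -- Prepares a formula for a new outer quantifier that binds the parameter `N`; it undoes the
  -- instantiation by `var N`.
  bind : ℕ → ℕ → Term L
  bind N i with i ℕₚ.≟ N
  ... | yes _ = var 0
  ... | no  _ = var (suc i)

  bind-at : ∀ N → bind N N ≡ var 0
  bind-at N with N ℕₚ.≟ N
  ... | yes _ = ≡.refl
  ... | no ne = ⊥-elim (ne ≡.refl)

  bind-below : ∀ N i → i < N → bind N i ≡ var (suc i)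
  bind-below N i lt with i ℕₚ.≟ N
  ... | yes ≡.refl = ⊥-elim (ℕₚ.<-irrefl ≡.refl lt)
  ... | no _     = ≡.refl

  -- A variable that does not occur in Δ is generalised by rewriting the
  -- whole derivation.
  generalise : ∀ {Δ : Formula L → Set} {N} → (∀ {δ} → Δ δ → Fresh N δ) →
    ∀ {ψ} → Δ ⊩ ψ → Δ ⊩ ∀′ (sub (bind N) ψ)
  generalise fr (thm d) = thm (gen (⊢-sub _ d))
  generalise {Δ} {N} fr {δ} (hyp p) =
    mp (thm (subst (λ χ → T ⊢ δ ⇒ ∀′ χ) eq ∀-vac)) (hyp p)
    where
    eq : δ [ wk ] ≡ sub (bind N) δ
    eq = ≡.trans ([]≡sub wk δ) (fr p (λ i lt → ≡.sym (bind-below N i lt)))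
  generalise fr (mp d e) = mp (mp (thm ∀-dist) (generalise fr d)) (generalise fr e)

  bind-inst : ∀ N θ → ⌜ θ ⌝ ≤ N → sub (bind N) (θ [ inst (var N) ]) ≡ θ
  bind-inst N θ le = ≡.trans (cong (sub (bind N)) ([]≡sub (inst (var N)) θ))
    (≡.trans (sub-comp (bind N) (apply (inst (var N))) θ)
      (≡.trans (sub-agree θ agree) (sub-id θ)))
    where
    agree : ∀ i → i < ⌜ θ ⌝ → subT (bind N) (apply (inst (var N)) i) ≡ var i
    agree zero    _  = bind-at N
    agree (suc i) lt = bind-below N i (ℕₚ.<-≤-trans (ℕₚ.<-trans (ℕₚ.n<1+n i) lt) le)

  module Henkin (φ₀ : Formula L) where

    fresh witness : ℕ → ℕ
    fresh zero    = ⌜ ¬′ φ₀ ⌝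
    fresh (suc n) = suc (witness n)
    witness n = fresh n ⊔ n

    henkin : ℕ → Formula L → Formula L
    henkin n θ = θ [ inst (var (witness n)) ] ⇒ ∀′ θ

    -- Stage n treats the formula with Gödel number n, if there is one.
    Δ Δʰ : ℕ → Formula L → Set
    Δ zero    ψ = ψ ≡ (¬′ φ₀)
    Δ (suc n) ψ = Δʰ n ψ ⊎ (⌜ ψ ⌝ ≡ n × (Δʰ n ,, ψ ⊩ ⊥′ → Δʰ n ⊩ ⊥′))
    Δʰ n ψ = Δ n ψ ⊎ (Σ[ θ ∈ Formula L ] ⌜ θ ⌝ ≡ n × ψ ≡ henkin n θ)

    fresh-mono : ∀ {M N} ψ → M ≤ N → Fresh M ψ → Fresh N ψ
    fresh-mono ψ le fr agree = fr (λ i lt → agree i (ℕₚ.<-≤-trans lt le))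

    fresh-code : ∀ {N} ψ → ⌜ ψ ⌝ ≤ N → Fresh N ψ
    fresh-code ψ le agree = sub-agree ψ (λ i lt → agree i (ℕₚ.<-≤-trans lt le))

    fresh-henkin : ∀ n θ → ⌜ θ ⌝ ≡ n → Fresh (suc (witness n)) (henkin n θ)
    fresh-henkin n θ ≡.refl {τ} {τ′} agree =
        cong₂ _⇒_ (≡.trans (unfold τ) (≡.trans (sub-agree θ agree-∷) (≡.sym (unfold τ′))))
                  (cong ∀′ (sub-agree θ agree-lift))
      where
      N = witness n
      unfold : ∀ τ → sub τ (θ [ inst (var N) ]) ≡ sub (τ N ∷ₑ τ) θ
      unfold τ = ≡.trans (cong (sub τ) ([]≡sub (inst (var N)) θ))
        (≡.trans (sub-comp τ (apply (inst (var N))) θ)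
               (sub-ext θ (λ { zero → ≡.refl ; (suc i) → ≡.refl })))
      below : ∀ {i} → suc i < ⌜ θ ⌝ → i < suc N
      below {i} lt = ℕₚ.<-trans (ℕₚ.<-≤-trans (ℕₚ.<-trans (ℕₚ.n<1+n i) lt) (ℕₚ.m≤n⊔m (fresh n) n))
                                (ℕₚ.n<1+n N)
      agree-∷ : ∀ i → i < ⌜ θ ⌝ → (τ N ∷ₑ τ) i ≡ (τ′ N ∷ₑ τ′) i
      agree-∷ zero    _  = agree N (ℕₚ.n<1+n N)
      agree-∷ (suc i) lt = agree i (below lt)
      agree-lift : ∀ i → i < ⌜ θ ⌝ → liftS τ i ≡ liftS τ′ i
      agree-lift zero    _  = ≡.refl
      agree-lift (suc i) lt = cong shift (agree i (below lt))

    Δ-fresh : ∀ n {ψ} → Δ n ψ → Fresh (fresh n) ψ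
    Δ-fresh zero    ≡.refl = fresh-code (¬′ φ₀) ℕₚ.≤-refl
    Δ-fresh (suc n) {ψ} (inj₁ (inj₁ p)) =
      fresh-mono ψ (ℕₚ.≤-trans (ℕₚ.m≤m⊔n (fresh n) n) (ℕₚ.n≤1+n _)) (Δ-fresh n p)
    Δ-fresh (suc n) (inj₁ (inj₂ (θ , eq , ≡.refl))) = fresh-henkin n θ eq
    Δ-fresh (suc n) {ψ} (inj₂ (≡.refl , _)) =
      fresh-code ψ (ℕₚ.≤-trans (ℕₚ.m≤n⊔m (fresh n) n) (ℕₚ.n≤1+n _))

    -- A derivation itself tells whether it uses a Henkin formula, so it need not be asked whether
    -- `n` is the number of a formula; two Henkin formulas of the same stage coincide by
    -- injectivity.
    split-henkin : ∀ n {ψ} → Δʰ n ⊩ ψ →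
      (Δ n ⊩ ψ) ⊎ (Σ[ θ ∈ Formula L ] ⌜ θ ⌝ ≡ n × (Δ n ,, henkin n θ ⊩ ψ))
    split-henkin n (thm d) = inj₁ (thm d)
    split-henkin n (hyp (inj₁ p)) = inj₁ (hyp p)
    split-henkin n (hyp (inj₂ (θ , eq , ≡.refl))) = inj₂ (θ , eq , hyp (inj₂ ≡.refl))
    split-henkin n (mp d e) with split-henkin n d | split-henkin n e
    ... | inj₁ d′ | inj₁ e′ = inj₁ (mp d′ e′)
    ... | inj₁ d′ | inj₂ (θ , eq , e′) = inj₂ (θ , eq , mp (⊩-mono inj₁ d′) e′)
    ... | inj₂ (θ , eq , d′) | inj₁ e′ = inj₂ (θ , eq , mp d′ (⊩-mono inj₁ e′))
    ... | inj₂ (θ , ≡.refl , d′) | inj₂ (θ′ , eq , e′) with ≡.refl ← ⌜⌝-inj θ′ θ eq =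
      inj₂ (θ , ≡.refl , mp d′ e′)

    -- Refuting θ(w) ⇒ ∀θ proves both θ(w) and the negation of ∀θ. As `w` is fresh, the first
    -- generalises to ∀θ, a contradiction without the Henkin formula.
    henkin-conservative : ∀ n → Δʰ n ⊩ ⊥′ → Δ n ⊩ ⊥′
    henkin-conservative n d with split-henkin n d
    ... | inj₁ d′ = d′
    ... | inj₂ (θ , ≡.refl , d′) = mp (¬⇒-snd (deduction d′))
      (subst (λ χ → Δ n ⊩ ∀′ χ)
        (bind-inst (witness n) θ (ℕₚ.m≤n⊔m (fresh n) n))
        (generalise (λ {δ} p → fresh-mono δ (ℕₚ.m≤m⊔n (fresh n) n) (Δ-fresh n p))
                    (¬⇒-fst (deduction d′))))

    split-maximal : ∀ n {ψ} → Δ (suc n) ⊩ ψ →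
      (Δʰ n ⊩ ψ) ⊎ (Σ[ χ ∈ Formula L ] ⌜ χ ⌝ ≡ n ×
        (Δʰ n ,, χ ⊩ ⊥′ → Δʰ n ⊩ ⊥′) × (Δʰ n ,, χ ⊩ ψ))
    split-maximal n (thm d) = inj₁ (thm d)
    split-maximal n (hyp (inj₁ p)) = inj₁ (hyp p)
    split-maximal n {ψ} (hyp (inj₂ (eq , c))) = inj₂ (ψ , eq , c , hyp (inj₂ ≡.refl))
    split-maximal n (mp d e) with split-maximal n d | split-maximal n e
    ... | inj₁ d′ | inj₁ e′ = inj₁ (mp d′ e′)
    ... | inj₁ d′ | inj₂ (χ , eq , c , e′) = inj₂ (χ , eq , c , mp (⊩-mono inj₁ d′) e′)
    ... | inj₂ (χ , eq , c , d′) | inj₁ e′ = inj₂ (χ , eq , c , mp d′ (⊩-mono inj₁ e′))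
    ... | inj₂ (χ , ≡.refl , c , d′) | inj₂ (χ′ , eq , _ , e′) with ≡.refl ← ⌜⌝-inj χ′ χ eq =
      inj₂ (χ , ≡.refl , c , mp d′ e′)

    -- The condition for admitting a formula is precisely that a contradiction obtained with it can
    -- be obtained without it. Being an implication, it takes the place of a decision whether the
    -- formula is consistent with the stage.
    maximal-conservative : ∀ n → Δ (suc n) ⊩ ⊥′ → Δʰ n ⊩ ⊥′
    maximal-conservative n d with split-maximal n d
    ... | inj₁ d′             = d′
    ... | inj₂ (_ , _ , c , d′) = c d′

    Δ-conservative : ∀ n → Δ n ⊩ ⊥′ → Δ 0 ⊩ ⊥′
    Δ-conservative zero    d = d
    Δ-conservative (suc n) d =
      Δ-conservative n (henkin-conservative n (maximal-conservative n d))

    Δ-mono : ∀ {m n} → m ≤ n → ∀ {ψ} → Δ m ψ → Δ n ψ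
    Δ-mono {n = zero}  z≤n p = p
    Δ-mono {m} {suc n} le p with ℕₚ.m≤n⇒m<n∨m≡n le
    ... | inj₁ (s≤s lt) = inj₁ (inj₁ (Δ-mono lt p))
    ... | inj₂ ≡.refl     = p

    Δω : Formula L → Set
    Δω ψ = Σ[ n ∈ ℕ ] Δ n ψ

    compact : ∀ {ψ} → Δω ⊩ ψ → Σ[ n ∈ ℕ ] (Δ n ⊩ ψ)
    compact (thm d)       = 0 , thm d
    compact (hyp (n , p)) = n , hyp p
    compact (mp d e) with compact d | compact e
    ... | m , d′ | n , e′ = m ⊔ n ,
      mp (⊩-mono (Δ-mono (ℕₚ.m≤m⊔n m n)) d′) (⊩-mono (Δ-mono (ℕₚ.m≤n⊔m m n)) e′)

    Δω-conservative : Δω ⊩ ⊥′ → Δ 0 ⊩ ⊥′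
    Δω-conservative d with compact d
    ... | n , d′ = Δ-conservative n d′

    Δʰ⊆Δω : ∀ n {ψ} → Δʰ n ψ → Δω ψ
    Δʰ⊆Δω n p = suc n , inj₁ p

    Δ0⊆Δʰ : ∀ n {ψ} → Δ 0 ⊩ ψ → Δʰ n ⊩ ψ
    Δ0⊆Δʰ n = ⊩-mono (inj₁ ∘ Δ-mono z≤n)

    maximal : ∀ ψ → (Δω ⊩ ψ ⇒ ⊥′ → Δω ⊩ ⊥′) → Δω ψ
    maximal ψ h = suc n , inj₂ (≡.refl , λ d →
        Δ0⊆Δʰ n (Δω-conservative (h (⊩-mono (Δʰ⊆Δω n) (deduction d)))))
      where n = ⌜ ψ ⌝

    closed : ∀ {ψ} → Δω ⊩ ψ → Δω ψ
    closed {ψ} d = maximal ψ (λ e → mp e d)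

    Δω-⇒ : ∀ {φ ψ} → (Δω φ → Δω ψ) → Δω (φ ⇒ ψ)
    Δω-⇒ {φ} {ψ} h = maximal (φ ⇒ ψ) (λ d → mp (¬⇒-snd d) (hyp (h (closed (¬⇒-fst d)))))

    Δω-∀ : ∀ {φ} → (∀ t → Δω (φ [ inst t ])) → Δω (∀′ φ)
    Δω-∀ {φ} h = closed (mp (hyp (Δʰ⊆Δω ⌜ φ ⌝ (inj₂ (φ , ≡.refl , ≡.refl)))) (hyp (h _)))

    termStructure : Structure L
    termStructure = record
      { Carrier = Term L ; fnI = fn ; relI = λ r ts → Δω (rel r ts) ; ⊥I = Δω ⊥′ }

    open Structure termStructure

    mutual
      evalT≡subT : ∀ ρ t → evalT ρ t ≡ subT ρ t
      evalT≡subT ρ (var i)   = ≡.refl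
      evalT≡subT ρ (fn f ts) = cong (fn f) (evalTs≡subTs ρ ts)

      evalTs≡subTs : ∀ {k} ρ (ts : Vec (Term L) k) → evalTs ρ ts ≡ subTs ρ ts
      evalTs≡subTs ρ []       = ≡.refl
      evalTs≡subTs ρ (t ∷ ts) = cong₂ _∷_ (evalT≡subT ρ t) (evalTs≡subTs ρ ts)

    mutual
      truth→ : ∀ φ ρ → ρ ⊩ᶠ φ → Δω (sub ρ φ)
      truth→ (rel r ts) ρ p = subst (λ us → Δω (rel r us)) (evalTs≡subTs ρ ts) p
      truth→ ⊥′         ρ p = p
      truth→ (φ ⇒ ψ)    ρ p = Δω-⇒ (λ q → truth→ ψ ρ (p (truth← φ ρ q)))
      truth→ (∀′ φ)     ρ p =
        Δω-∀ (λ t → subst Δω (≡.sym (sub-liftS-inst ρ t φ)) (truth→ φ (t ∷ₑ ρ) (p t)))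

      truth← : ∀ φ ρ → Δω (sub ρ φ) → ρ ⊩ᶠ φ
      truth← (rel r ts) ρ p = subst (λ us → Δω (rel r us)) (≡.sym (evalTs≡subTs ρ ts)) p
      truth← ⊥′         ρ p = p
      truth← (φ ⇒ ψ)    ρ p = λ q → truth← ψ ρ (closed (mp (hyp p) (hyp (truth→ φ ρ q))))
      truth← (∀′ φ)     ρ p = λ t → truth← φ (t ∷ₑ ρ)
        (subst Δω (sub-liftS-inst ρ t φ) (closed (mp (thm (∀-elim t)) (hyp p))))

    termModel : Model T
    termModel = record
      { structure = termStructure
      ; sound = λ {φ} d ρ → truth← φ ρ (closed (thm (⊢-sub ρ d))) }

  -- The term model over the negation of `φ` exists whether or not that negation is consistent with
  -- `T`. Validity puts `φ` beside its negation into `Δω`, and conservativity turns the clash into a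
  -- derivation of `⊥′` from the negation alone.
  completeness : ∀ φ → (∀ (M : Model T) ρ → Model._⊩ᶠ_ M ρ φ) → T ⊢ φ
  completeness φ valid = mp DNE (⊩∅ (deduction (⊩-mono inj₂ (Δω-conservative
      (mp (hyp (0 , ≡.refl)) (hyp (subst Δω (sub-id φ) (truth→ φ var (valid termModel var)))))))))
    where open Henkin φ

-- Arithmetical structures

record Arithmetic : Set₁ where
  infix  4 _≃_ _≼_
  infixl 6 _∔_
  infixl 7 _·_
  field
    Carrier : Set
    _≃_ _≼_ : Carrier → Carrier → Set
    ⊥ᴵ      : Set
    0#      : Carrier
    sc ex   : Carrier → Carrier
    _∔_ _·_ : Carrier → Carrier → Carrier

  val : ∀ {n} → ATerm n → Vec Carrier n → Carrier
  val (var i) ρ = lookup ρ i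
  val O       ρ = 0#
  val (S t)   ρ = sc (val t ρ)
  val (exp t) ρ = ex (val t ρ)
  val (t ⊕ u) ρ = val t ρ ∔ val u ρ
  val (t ⊗ u) ρ = val t ρ · val u ρ

  infix 1 _⊩_

  _⊩_ : ∀ {n} → Vec Carrier n → Δ₀ n → Set
  ρ ⊩ t ≈ u    = val t ρ ≃ val u ρ
  ρ ⊩ t ≲ u    = val t ρ ≼ val u ρ
  ρ ⊩ ff       = ⊥ᴵ
  ρ ⊩ θ ⊃ χ    = (ρ ⊩ θ) → (ρ ⊩ χ)
  ρ ⊩ all≤ t θ = ∀ x → x ≼ val t ρ → x ∷ ρ ⊩ θ

  -- Double negation relative to the falsum of the model. Classical existence and disjunction live
  -- under it, and the stability of Δ₀-formulas removes it at the end.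
  record Cl (A : Set) : Set where
    constructor cl
    field run : (A → ⊥ᴵ) → ⊥ᴵ
  open Cl public

  return : ∀ {A} → A → Cl A
  return a = cl (λ k → k a)

  infixl 1 _>>=_
  _>>=_ : ∀ {A B} → Cl A → (A → Cl B) → Cl B
  m >>= f = cl (λ k → run m (λ a → run (f a) k))

  ⊥-run : Cl ⊥ᴵ → ⊥ᴵ
  ⊥-run m = run m id

  lem : ∀ A → Cl (A ⊎ (A → ⊥ᴵ))
  lem A = cl (λ k → k (inj₂ (λ a → k (inj₁ a))))

  vals : ∀ {m n} → Vec (ATerm n) m → Vec Carrier n → Vec Carrier m
  vals []       ρ = []
  vals (t ∷ ts) ρ = val t ρ ∷ vals ts ρ

  val-ren : ∀ {m n} (r : Fin m → Fin n) {ρ ρ′} → (∀ i → lookup ρ (r i) ≡ lookup ρ′ i) →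
    ∀ t → val (renT r t) ρ ≡ val t ρ′
  val-ren r h (var i) = h i
  val-ren r h O       = ≡.refl
  val-ren r h (S t)   = cong sc (val-ren r h t)
  val-ren r h (exp t) = cong ex (val-ren r h t)
  val-ren r h (t ⊕ u) = cong₂ _∔_ (val-ren r h t) (val-ren r h u)
  val-ren r h (t ⊗ u) = cong₂ _·_ (val-ren r h t) (val-ren r h u)

  private
    lookup-lift : ∀ {m n} (r : Fin m → Fin n) {ρ ρ′} x → (∀ i → lookup ρ (r i) ≡ lookup ρ′ i) →
      ∀ i → lookup (x ∷ ρ) (liftFin 1 r i) ≡ lookup (x ∷ ρ′) i
    lookup-lift r x h fzero    = ≡.refl
    lookup-lift r x h (fsuc i) = h i

  mutual
    ren→ : ∀ {m n} (r : Fin m → Fin n) {ρ ρ′} → (∀ i → lookup ρ (r i) ≡ lookup ρ′ i) →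
      ∀ θ → ρ ⊩ ren r θ → ρ′ ⊩ θ
    ren→ r h (t ≈ u)    p = subst₂ _≃_ (val-ren r h t) (val-ren r h u) p
    ren→ r h (t ≲ u)    p = subst₂ _≼_ (val-ren r h t) (val-ren r h u) p
    ren→ r h ff         p = p
    ren→ r h (θ ⊃ χ)    p = λ q → ren→ r h χ (p (ren← r h θ q))
    ren→ r h (all≤ t θ) p = λ x le → ren→ (liftFin 1 r) (lookup-lift r x h) θ
      (p x (subst (x ≼_) (≡.sym (val-ren r h t)) le))

    ren← : ∀ {m n} (r : Fin m → Fin n) {ρ ρ′} → (∀ i → lookup ρ (r i) ≡ lookup ρ′ i) →
      ∀ θ → ρ′ ⊩ θ → ρ ⊩ ren r θ
    ren← r h (t ≈ u)    p = subst₂ _≃_ (≡.sym (val-ren r h t)) (≡.sym (val-ren r h u)) p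
    ren← r h (t ≲ u)    p = subst₂ _≼_ (≡.sym (val-ren r h t)) (≡.sym (val-ren r h u)) p
    ren← r h ff         p = p
    ren← r h (θ ⊃ χ)    p = λ q → ren← r h χ (p (ren→ r h θ q))
    ren← r h (all≤ t θ) p = λ x le → ren← (liftFin 1 r) (lookup-lift r x h) θ
      (p x (subst (x ≼_) (val-ren r h t) le))

-- Δ₀-formulas with all connectives primitive

subA : ∀ {m n} → Vec (ATerm n) m → ATerm m → ATerm n
subA ts (var i) = lookup ts i
subA ts O       = O
subA ts (S t)   = S (subA ts t)
subA ts (exp t) = exp (subA ts t)
subA ts (t ⊕ u) = subA ts t ⊕ subA ts u
subA ts (t ⊗ u) = subA ts t ⊗ subA ts u

wkA : ∀ {n} → ATerm n → ATerm (suc n)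
wkA = renT fsuc

subΔ : ∀ {m n} → Vec (ATerm n) m → Δ₀ m → Δ₀ n
subΔ ts (t ≈ u)    = subA ts t ≈ subA ts u
subΔ ts (t ≲ u)    = subA ts t ≲ subA ts u
subΔ ts ff         = ff
subΔ ts (θ ⊃ χ)    = subΔ ts θ ⊃ subΔ ts χ
subΔ ts (all≤ t θ) = all≤ (subA ts t) (subΔ (var fzero ∷ map wkA ts) θ)

infix  5 _≐ᶠ_ _≤ᶠ_ _∈ᶠ_
infixr 4 _∧ᶠ_
infixr 3 _∨ᶠ_
infixr 2 _⇒ᶠ_

-- `Δ₀` codes conjunction, disjunction and bounded existence by implication and `ff`. Here they have
-- their direct meaning, and `toΔ₀` recovers a formula admissible for induction. Substitution is a
-- constructor, so that its meaning is evaluation in another environment.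
data Fm : ℕ → Set where
  ⟪_⟫            : ∀ {n} → Δ₀ n → Fm n
  _≐ᶠ_ _≤ᶠ_ _∈ᶠ_ : ∀ {n} → ATerm n → ATerm n → Fm n
  _∧ᶠ_ _∨ᶠ_ _⇒ᶠ_ : ∀ {n} → Fm n → Fm n → Fm n
  ∀ᶠ ∃ᶠ          : ∀ {n} → ATerm n → Fm (suc n) → Fm n
  _⟨_⟩           : ∀ {m n} → Fm m → Vec (ATerm n) m → Fm n

toΔ₀ : ∀ {n} → Fm n → Δ₀ n
toΔ₀ ⟪ θ ⟫      = θ
toΔ₀ (t ≐ᶠ u)   = t ≈ u
toΔ₀ (t ≤ᶠ u)   = t ≲ u
toΔ₀ (t ∈ᶠ u)   = t ∈̇ u
toΔ₀ (A ∧ᶠ B)   = toΔ₀ A & toΔ₀ B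
toΔ₀ (A ∨ᶠ B)   = toΔ₀ A or toΔ₀ B
toΔ₀ (A ⇒ᶠ B)   = toΔ₀ A ⊃ toΔ₀ B
toΔ₀ (∀ᶠ t A)   = all≤ t (toΔ₀ A)
toΔ₀ (∃ᶠ t A)   = ex≤ t (toΔ₀ A)
toΔ₀ (A ⟨ ts ⟩) = subΔ ts (toΔ₀ A)

-- IΔ₀ + Exp with a falsum that implies every Δ₀-formula but may hold

record IΔ₀Exp : Set₁ where
  field
    arithmetic : Arithmetic
  open Arithmetic arithmetic public
  field
    ≃-refl  : ∀ {x} → x ≃ x
    ≃-subst : ∀ {n} (θ : Δ₀ (suc n)) ρ {x y} → x ≃ y → x ∷ ρ ⊩ θ → y ∷ ρ ⊩ θ
    stable  : ∀ {n} (θ : Δ₀ n) ρ → Cl (ρ ⊩ θ) → ρ ⊩ θ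
    sc≄0    : ∀ {x} → sc x ≃ 0# → ⊥ᴵ
    sc-inj  : ∀ {x y} → sc x ≃ sc y → x ≃ y
    predec  : ∀ x → (x ≃ 0# → ⊥ᴵ) → Cl (Σ[ y ∈ Carrier ] x ≃ sc y)
    +-0     : ∀ x → x ∔ 0# ≃ x
    +-sc    : ∀ x y → x ∔ sc y ≃ sc (x ∔ y)
    *-0     : ∀ x → x · 0# ≃ 0#
    *-sc    : ∀ x y → x · sc y ≃ x · y ∔ x
    ex-0    : ex 0# ≃ sc 0#
    ex-sc   : ∀ x → ex (sc x) ≃ ex x ∔ ex x
    ≼⇒      : ∀ {x y} → x ≼ y → Cl (Σ[ d ∈ Carrier ] d ∔ x ≃ y)
    ⇒≼      : ∀ {x y} d → d ∔ x ≃ y → x ≼ y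
    induct  : ∀ {n} (θ : Δ₀ (suc n)) ρ → 0# ∷ ρ ⊩ θ →
              (∀ x → x ∷ ρ ⊩ θ → sc x ∷ ρ ⊩ θ) → ∀ x → x ∷ ρ ⊩ θ

  opaque
    infix 4 _∈_
    _∈_ : Carrier → Carrier → Set
    a ∈ w = Cl (Σ[ q ∈ Carrier ] Σ[ r ∈ Carrier ]
      (q ≼ w × r ≼ w × w ≃ sc (q ∔ q) · ex a ∔ r × sc r ≼ ex a))

  ⟦_⟧ᶠ : ∀ {n} → Fm n → Vec Carrier n → Set
  ⟦ ⟪ θ ⟫ ⟧ᶠ    ρ = ρ ⊩ θ
  ⟦ t ≐ᶠ u ⟧ᶠ   ρ = val t ρ ≃ val u ρ
  ⟦ t ≤ᶠ u ⟧ᶠ   ρ = val t ρ ≼ val u ρ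
  ⟦ t ∈ᶠ u ⟧ᶠ   ρ = val t ρ ∈ val u ρ
  ⟦ A ∧ᶠ B ⟧ᶠ   ρ = ⟦ A ⟧ᶠ ρ × ⟦ B ⟧ᶠ ρ
  ⟦ A ∨ᶠ B ⟧ᶠ   ρ = Cl (⟦ A ⟧ᶠ ρ ⊎ ⟦ B ⟧ᶠ ρ)
  ⟦ A ⇒ᶠ B ⟧ᶠ   ρ = ⟦ A ⟧ᶠ ρ → ⟦ B ⟧ᶠ ρ
  ⟦ ∀ᶠ t A ⟧ᶠ   ρ = ∀ x → x ≼ val t ρ → ⟦ A ⟧ᶠ (x ∷ ρ)
  ⟦ ∃ᶠ t A ⟧ᶠ   ρ = Cl (Σ[ x ∈ Carrier ] x ≼ val t ρ × ⟦ A ⟧ᶠ (x ∷ ρ))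
  ⟦ A ⟨ ts ⟩ ⟧ᶠ ρ = ⟦ A ⟧ᶠ (vals ts ρ)

  ex-falso : ∀ {n} (θ : Δ₀ n) ρ → ⊥ᴵ → ρ ⊩ θ
  ex-falso θ ρ b = stable θ ρ (cl (λ _ → b))

  val-wkA : ∀ {n} x {ρ : Vec Carrier n} t → val (wkA t) (x ∷ ρ) ≡ val t ρ
  val-wkA x t = val-ren fsuc (λ _ → ≡.refl) t

  vals-wkA : ∀ {m n} x {ρ : Vec Carrier n} (ts : Vec (ATerm n) m) →
    vals (map wkA ts) (x ∷ ρ) ≡ vals ts ρ
  vals-wkA x []       = ≡.refl
  vals-wkA x (t ∷ ts) = cong₂ _∷_ (val-wkA x t) (vals-wkA x ts)

  lookup-vals : ∀ {m n} (ts : Vec (ATerm n) m) (ρ : Vec Carrier n) i →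
    lookup (vals ts ρ) i ≡ val (lookup ts i) ρ
  lookup-vals (t ∷ ts) ρ fzero    = ≡.refl
  lookup-vals (t ∷ ts) ρ (fsuc i) = lookup-vals ts ρ i

  val-subA : ∀ {m n} (ts : Vec (ATerm n) m) {ρ} t → val (subA ts t) ρ ≡ val t (vals ts ρ)
  val-subA ts (var i) = ≡.sym (lookup-vals ts _ i)
  val-subA ts O       = ≡.refl
  val-subA ts (S t)   = cong sc (val-subA ts t)
  val-subA ts (exp t) = cong ex (val-subA ts t)
  val-subA ts (t ⊕ u) = cong₂ _∔_ (val-subA ts t) (val-subA ts u)
  val-subA ts (t ⊗ u) = cong₂ _·_ (val-subA ts t) (val-subA ts u)

  mutual
    subΔ→ : ∀ {m n} (ts : Vec (ATerm n) m) {ρ} θ → ρ ⊩ subΔ ts θ → vals ts ρ ⊩ θ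
    subΔ→ ts (t ≈ u)    p = subst₂ _≃_ (val-subA ts t) (val-subA ts u) p
    subΔ→ ts (t ≲ u)    p = subst₂ _≼_ (val-subA ts t) (val-subA ts u) p
    subΔ→ ts ff         p = p
    subΔ→ ts (θ ⊃ χ)    p = λ q → subΔ→ ts χ (p (subΔ← ts θ q))
    subΔ→ ts (all≤ t θ) p = λ x le → subst (λ τ → x ∷ τ ⊩ θ) (vals-wkA x ts)
      (subΔ→ (var fzero ∷ map wkA ts) θ (p x (subst (x ≼_) (≡.sym (val-subA ts t)) le)))

    subΔ← : ∀ {m n} (ts : Vec (ATerm n) m) {ρ} θ → vals ts ρ ⊩ θ → ρ ⊩ subΔ ts θ
    subΔ← ts (t ≈ u)    p = subst₂ _≃_ (≡.sym (val-subA ts t)) (≡.sym (val-subA ts u)) p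
    subΔ← ts (t ≲ u)    p = subst₂ _≼_ (≡.sym (val-subA ts t)) (≡.sym (val-subA ts u)) p
    subΔ← ts ff         p = p
    subΔ← ts (θ ⊃ χ)    p = λ q → subΔ← ts χ (p (subΔ→ ts θ q))
    subΔ← ts (all≤ t θ) p = λ x le → subΔ← (var fzero ∷ map wkA ts) θ
      (subst (λ τ → x ∷ τ ⊩ θ) (≡.sym (vals-wkA x ts)) (p x (subst (x ≼_) (val-subA ts t) le)))

  opaque
    unfolding _∈_

    ∈̇→ : ∀ {n} {ρ : Vec Carrier n} a w → ρ ⊩ a ∈̇ w → val a ρ ∈ val w ρ
    ∈̇→ {ρ = ρ} a w p = cl λ k → p λ q q≤ → λ p′ → p′ λ r r≤ → λ p″ → p″ λ e l →
      k (q , r , q≤ , subst (r ≼_) (val-ren (1 ↑ʳ_) (λ _ → ≡.refl) w) r≤ ,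
         subst₂ (λ w a → w ≃ sc (q ∔ q) · ex a ∔ r) (ev² q r w) (ev² q r a) e ,
         subst (λ a → sc r ≼ ex a) (ev² q r a) l)
      where
      ev² : ∀ q r t → val (renT (2 ↑ʳ_) t) (r ∷ q ∷ ρ) ≡ val t ρ
      ev² q r = val-ren (2 ↑ʳ_) (λ _ → ≡.refl)

    ∈̇← : ∀ {n} {ρ : Vec Carrier n} a w → val a ρ ∈ val w ρ → ρ ⊩ a ∈̇ w
    ∈̇← {ρ = ρ} a w p all = run p λ { (q , r , q≤ , r≤ , e , l) →
      all q q≤ λ all′ → all′ r (subst (r ≼_) (≡.sym (val-ren (1 ↑ʳ_) (λ _ → ≡.refl) w)) r≤)
        λ imp → imp (subst₂ (λ w a → w ≃ sc (q ∔ q) · ex a ∔ r) (≡.sym (ev² q r w)) (≡.sym (ev² q r a)) e)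
                    (subst (λ a → sc r ≼ ex a) (≡.sym (ev² q r a)) l) }
      where
      ev² : ∀ q r t → val (renT (2 ↑ʳ_) t) (r ∷ q ∷ ρ) ≡ val t ρ
      ev² q r = val-ren (2 ↑ʳ_) (λ _ → ≡.refl)

  mutual
    -- The halves of a coded conjunction come out only doubly negated, and stability restores them.
    -- Both directions are mutual because implication is contravariant.
    fm→ : ∀ {n} (A : Fm n) {ρ} → ρ ⊩ toΔ₀ A → ⟦ A ⟧ᶠ ρ
    fm→ ⟪ θ ⟫      p = p
    fm→ (t ≐ᶠ u)   p = p
    fm→ (t ≤ᶠ u)   p = p
    fm→ (t ∈ᶠ u)   p = ∈̇→ t u p
    fm→ (A ∧ᶠ B)   p = fm→ A (stable (toΔ₀ A) _ (cl (λ k → p (λ a _ → k a))))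
                     , fm→ B (stable (toΔ₀ B) _ (cl (λ k → p (λ _ b → k b))))
    fm→ (A ∨ᶠ B)   p = cl (λ k → k (inj₂ (fm→ B (p (λ a → k (inj₁ (fm→ A a)))))))
    fm→ (A ⇒ᶠ B)   p = λ a → fm→ B (p (fm← A a))
    fm→ (∀ᶠ t A)   p = λ x le → fm→ A (p x le)
    fm→ (∃ᶠ t A)   p = cl (λ k → p (λ x le a → k (x , le , fm→ A a)))
    fm→ (A ⟨ ts ⟩) p = fm→ A (subΔ→ ts (toΔ₀ A) p)

    fm← : ∀ {n} (A : Fm n) {ρ} → ⟦ A ⟧ᶠ ρ → ρ ⊩ toΔ₀ A
    fm← ⟪ θ ⟫      p = p
    fm← (t ≐ᶠ u)   p = p
    fm← (t ≤ᶠ u)   p = p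
    fm← (t ∈ᶠ u)   p = ∈̇← t u p
    fm← (A ∧ᶠ B)   (a , b) = λ k → k (fm← A a) (fm← B b)
    fm← (A ∨ᶠ B) {ρ} p = λ ¬a → stable (toΔ₀ B) ρ (p >>= λ
      { (inj₁ a) → cl (λ _ → ¬a (fm← A a)) ; (inj₂ b) → return (fm← B b) })
    fm← (A ⇒ᶠ B)   p = λ a → fm← B (p (fm→ A a))
    fm← (∀ᶠ t A)   p = λ x le → fm← A (p x le)
    fm← (∃ᶠ t A)   p = λ all → run p (λ { (x , le , a) → all x le (fm← A a) })
    fm← (A ⟨ ts ⟩) p = subΔ← ts (toΔ₀ A) (fm← A p)

  stableᶠ : ∀ {n} (A : Fm n) {ρ} → Cl (⟦ A ⟧ᶠ ρ) → ⟦ A ⟧ᶠ ρ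
  stableᶠ A {ρ} p = fm→ A (stable (toΔ₀ A) ρ (p >>= λ a → return (fm← A a)))

  substᶠ : ∀ {n} (A : Fm (suc n)) {ρ x y} → x ≃ y → ⟦ A ⟧ᶠ (x ∷ ρ) → ⟦ A ⟧ᶠ (y ∷ ρ)
  substᶠ A {ρ} e p = fm→ A (≃-subst (toΔ₀ A) ρ e (fm← A p))

  inductᶠ : ∀ {n} (A : Fm (suc n)) {ρ} → ⟦ A ⟧ᶠ (0# ∷ ρ) →
    (∀ x → ⟦ A ⟧ᶠ (x ∷ ρ) → ⟦ A ⟧ᶠ (sc x ∷ ρ)) → ∀ x → ⟦ A ⟧ᶠ (x ∷ ρ)
  inductᶠ A {ρ} z s x =
    fm→ A (induct (toΔ₀ A) ρ (fm← A z) (λ y p → fm← A (s y (fm→ A p))) x)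

-- Models of `T` as models of IΔ₀ + Exp

vars : ∀ n → Vec (Term L) n
vars n = tabulate (λ i → var (toℕ i))

module ArithmeticOf {L : Language} {T : Theory L} (ext : T ExtendsEA) (M : Model T) where
  open Model M

  arith : Arithmetic
  arith = record
    { Carrier = Carrier
    ; _≃_ = λ x y → relI `= (x ∷ y ∷ [])
    ; _≼_ = λ x y → relI `≤ (x ∷ y ∷ [])
    ; ⊥ᴵ  = ⊥I
    ; 0#  = fnI `0 []
    ; sc  = λ x → fnI `S (x ∷ [])
    ; ex  = λ x → fnI `exp (x ∷ [])
    ; _∔_ = λ x y → fnI `+ (x ∷ y ∷ [])
    ; _·_ = λ x y → fnI `* (x ∷ y ∷ []) }

  open Arithmetic arith hiding (Carrier)

  evalTs-lookup : ∀ {n} ρ (ts : Vec (Term L) n) i → evalT ρ (lookup ts i) ≡ lookup (evalTs ρ ts) i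
  evalTs-lookup ρ (t ∷ ts) fzero    = ≡.refl
  evalTs-lookup ρ (t ∷ ts) (fsuc i) = evalTs-lookup ρ ts i

  evalT-embT : ∀ {n} ρ (t : ATerm n) ts → evalT ρ (embT t ts) ≡ val t (evalTs ρ ts)
  evalT-embT ρ (var i) ts = evalTs-lookup ρ ts i
  evalT-embT ρ O       ts = ≡.refl
  evalT-embT ρ (S t)   ts = cong sc (evalT-embT ρ t ts)
  evalT-embT ρ (exp t) ts = cong ex (evalT-embT ρ t ts)
  evalT-embT ρ (t ⊕ u) ts = cong₂ _∔_ (evalT-embT ρ t ts) (evalT-embT ρ u ts)
  evalT-embT ρ (t ⊗ u) ts = cong₂ _·_ (evalT-embT ρ t ts) (evalT-embT ρ u ts)

  evalT-bound : ∀ {n} x ρ (t : ATerm n) ts →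
    evalT (x ∷ₑ ρ) (shift (embT t ts)) ≡ val t (evalTs ρ ts)
  evalT-bound x ρ t ts = ≡.trans (evalT-shift (x ∷ₑ ρ) (embT t ts)) (evalT-embT ρ t ts)

  mutual
    emb→ : ∀ {n} ρ (θ : Δ₀ n) ts → ρ ⊩ᶠ emb θ ts → evalTs ρ ts ⊩ θ
    emb→ ρ (t ≈ u)    ts p = subst₂ _≃_ (evalT-embT ρ t ts) (evalT-embT ρ u ts) p
    emb→ ρ (t ≲ u)    ts p = subst₂ _≼_ (evalT-embT ρ t ts) (evalT-embT ρ u ts) p
    emb→ ρ ff         ts p = p
    emb→ ρ (θ ⊃ χ)    ts p = λ q → emb→ ρ χ ts (p (emb← ρ θ ts q))
    emb→ ρ (all≤ t θ) ts p = λ x le →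
      subst (λ τ → x ∷ τ ⊩ θ) (evalTs-shift (x ∷ₑ ρ) ts)
        (emb→ (x ∷ₑ ρ) θ (var 0 ∷ shifts ts) (p x (subst (x ≼_) (≡.sym (evalT-bound x ρ t ts)) le)))

    emb← : ∀ {n} ρ (θ : Δ₀ n) ts → evalTs ρ ts ⊩ θ → ρ ⊩ᶠ emb θ ts
    emb← ρ (t ≈ u)    ts p = subst₂ _≃_ (≡.sym (evalT-embT ρ t ts)) (≡.sym (evalT-embT ρ u ts)) p
    emb← ρ (t ≲ u)    ts p = subst₂ _≼_ (≡.sym (evalT-embT ρ t ts)) (≡.sym (evalT-embT ρ u ts)) p
    emb← ρ ff         ts p = p
    emb← ρ (θ ⊃ χ)    ts p = λ q → emb← ρ χ ts (p (emb→ ρ θ ts q))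
    emb← ρ (all≤ t θ) ts p = λ x le →
      emb← (x ∷ₑ ρ) θ (var 0 ∷ shifts ts) (subst (λ τ → x ∷ τ ⊩ θ) (≡.sym (evalTs-shift (x ∷ₑ ρ) ts))
        (p x (subst (x ≼_) (evalT-bound x ρ t ts) le)))

  -- 0# is a junk value, taken beyond the end of the vector.
  valuation : ∀ {n} → Vec Carrier n → ℕ → Carrier
  valuation []      i       = 0#
  valuation (x ∷ ρ) zero    = x
  valuation (x ∷ ρ) (suc i) = valuation ρ i

  lookup-valuation : ∀ {n} (τ : Vec Carrier n) i → valuation τ (toℕ i) ≡ lookup τ i
  lookup-valuation (x ∷ τ) fzero    = ≡.refl
  lookup-valuation (x ∷ τ) (fsuc i) = lookup-valuation τ i

  evalTs-vars : ∀ {n} (r : Fin n → ℕ) (ρ : ℕ → Carrier) (τ : Vec Carrier n) →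
    (∀ i → ρ (r i) ≡ lookup τ i) → evalTs ρ (tabulate (λ i → var (r i))) ≡ τ
  evalTs-vars r ρ []      h = ≡.refl
  evalTs-vars r ρ (x ∷ τ) h =
    cong₂ _∷_ (h fzero) (evalTs-vars (r ∘ fsuc) ρ τ (h ∘ fsuc))

  valuation-vars : ∀ {n} (τ : Vec Carrier n) → evalTs (valuation τ) (vars _) ≡ τ
  valuation-vars τ = evalTs-vars toℕ (valuation τ) τ (lookup-valuation τ)

  vars→ : ∀ {n} (θ : Δ₀ n) τ → valuation τ ⊩ᶠ emb θ (vars n) → τ ⊩ θ
  vars→ θ τ p = subst (_⊩ θ) (valuation-vars τ) (emb→ (valuation τ) θ (vars _) p)

  vars← : ∀ {n} (θ : Δ₀ n) τ → τ ⊩ θ → valuation τ ⊩ᶠ emb θ (vars n)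
  vars← θ τ p = emb← (valuation τ) θ (vars _) (subst (_⊩ θ) (≡.sym (valuation-vars τ)) p)

  bound-vars : ∀ {n} (τ : Vec Carrier n) x →
    evalTs (x ∷ₑ valuation τ) (shifts (vars n)) ≡ τ
  bound-vars τ x = ≡.trans (evalTs-shift (x ∷ₑ valuation τ) (vars _)) (valuation-vars τ)

  private
    evalTs-inst : ∀ {n} t (r : Fin n → ℕ) (ρ : ℕ → Carrier) (τ : Vec Carrier n) →
      (∀ i → ρ (r i) ≡ lookup τ i) →
      evalTs ρ (substTs (inst t) (tabulate (λ i → var (suc (r i))))) ≡ τ
    evalTs-inst t r ρ []      h = ≡.refl
    evalTs-inst t r ρ (x ∷ τ) h = cong₂ _∷_ (h fzero) (evalTs-inst t (r ∘ fsuc) ρ τ (h ∘ fsuc))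

    subst-valid : ∀ {n} (θ : Δ₀ (suc n)) τ {x y} → relI `= (x ∷ y ∷ []) →
      x ∷ τ ⊩ θ → y ∷ τ ⊩ θ
    subst-valid {n} θ τ {x} {y} e p = from (var 1) (sound (≐-subst φ) ρ e (to (var 0) p))
      where
      ρ : ℕ → Carrier
      ρ = valuation (x ∷ y ∷ τ)
      -- Variable 0 is the hole of `≐-subst`. After instantiation all others drop by one, and the
      -- valuation holds `x` and `y` at 0 and 1 and the parameters from 2 on; hence the offset 3.
      ts : Vec (Term L) (suc n)
      ts = var 0 ∷ tabulate (λ i → var (3 + toℕ i))
      φ : Formula L
      φ = emb θ ts
      eq : ∀ t → evalTs ρ (substTs (inst t) ts) ≡ evalT ρ t ∷ τ
      eq t = cong (evalT ρ t ∷_) (evalTs-inst t (λ i → 2 + toℕ i) ρ τ (lookup-valuation τ))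
      from : ∀ t → ρ ⊩ᶠ φ [ inst t ] → evalT ρ t ∷ τ ⊩ θ
      from t q = subst (_⊩ θ) (eq t)
        (emb→ ρ θ _ (subst (ρ ⊩ᶠ_) (emb-subst (inst t) θ ts) q))
      to : ∀ t → evalT ρ t ∷ τ ⊩ θ → ρ ⊩ᶠ φ [ inst t ]
      to t q = subst (ρ ⊩ᶠ_) (≡.sym (emb-subst (inst t) θ ts))
        (emb← ρ θ _ (subst (_⊩ θ) (≡.sym (eq t)) q))

    induct-valid : ∀ {n} (θ : Δ₀ (suc n)) τ → 0# ∷ τ ⊩ θ →
      (∀ x → x ∷ τ ⊩ θ → sc x ∷ τ ⊩ θ) → ∀ x → x ∷ τ ⊩ θ
    induct-valid {n} θ τ z s x = under x (var 0) (sound (ext (ind θ)) ρ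
        (emb← ρ θ (O′ ∷ vars n) (subst (λ τ → 0# ∷ τ ⊩ θ) (≡.sym (valuation-vars τ)) z))
        (λ y p → over y (S′ (var 0)) (s y (under y (var 0) p))) x)
      where
      ρ : ℕ → Carrier
      ρ = valuation τ
      under : ∀ y t → y ∷ₑ ρ ⊩ᶠ emb θ (t ∷ shifts (vars n)) → evalT (y ∷ₑ ρ) t ∷ τ ⊩ θ
      under y t p = subst (λ τ → evalT (y ∷ₑ ρ) t ∷ τ ⊩ θ) (bound-vars τ y) (emb→ (y ∷ₑ ρ) θ _ p)
      over : ∀ y t → evalT (y ∷ₑ ρ) t ∷ τ ⊩ θ → y ∷ₑ ρ ⊩ᶠ emb θ (t ∷ shifts (vars n))
      over y t p = emb← (y ∷ₑ ρ) θ _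
        (subst (λ τ → evalT (y ∷ₑ ρ) t ∷ τ ⊩ θ) (≡.sym (bound-vars τ y)) p)

    at : Vec Carrier 2 → ℕ → Carrier
    at = valuation

  model : IΔ₀Exp
  model = record
    { arithmetic = arith
    ; ≃-refl  = λ {x} → sound (≐-refl {t = var 0}) (at (x ∷ x ∷ []))
    ; ≃-subst = subst-valid
    ; stable  = λ θ τ p → vars→ θ τ (sound (DNE {φ = emb θ (vars _)}) (valuation τ)
                  (λ k → run p (λ q → k (vars← θ τ q))))
    ; sc≄0    = λ {x} → sound (ext S≠0) (at (x ∷ x ∷ []))
    ; sc-inj  = λ {x} {y} → sound (ext S-inj) (at (x ∷ y ∷ []))
    ; predec  = λ x ne → cl (λ k → sound (ext pred) (at (x ∷ x ∷ [])) ne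
                  (λ y e → k (y , e)))
    ; +-0     = λ x → sound (ext +0) (at (x ∷ x ∷ []))
    ; +-sc    = λ x y → sound (ext +S) (at (x ∷ y ∷ []))
    ; *-0     = λ x → sound (ext *0) (at (x ∷ x ∷ []))
    ; *-sc    = λ x y → sound (ext *S) (at (x ∷ y ∷ []))
    ; ex-0    = sound (ext exp0) (at (0# ∷ 0# ∷ []))
    ; ex-sc   = λ x → sound (ext expS) (at (x ∷ x ∷ []))
    ; ≼⇒      = λ {x} {y} le → cl (λ k → sound (ext ≤⇒) (at (x ∷ y ∷ [])) le
                  (λ d e → k (d , e)))
    ; ⇒≼      = λ {x} {y} d e → sound (ext ⇒≤) (at (x ∷ y ∷ [])) (λ all → all d e)
    ; induct  = induct-valid }

-- Arithmetic, binary digits, comprehension and pairing in a model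

module Laws (𝓜 : IΔ₀Exp) where
  open IΔ₀Exp 𝓜

  pattern v0 = var fzero
  pattern v1 = var (fsuc fzero)
  pattern v2 = var (fsuc (fsuc fzero))
  pattern v3 = var (fsuc (fsuc (fsuc fzero)))
  pattern v4 = var (fsuc (fsuc (fsuc (fsuc fzero))))

  sym : ∀ {x y} → x ≃ y → y ≃ x
  sym {x} e = ≃-subst (v0 ≈ v1) (x ∷ []) e ≃-refl

  trans : ∀ {x y z} → x ≃ y → y ≃ z → x ≃ z
  trans {x} e f = ≃-subst (v1 ≈ v0) (x ∷ []) f e

  ≡⇒≃ : ∀ {x y} → x ≡ y → x ≃ y
  ≡⇒≃ ≡.refl = ≃-refl

  sc-cong : ∀ {x y} → x ≃ y → sc x ≃ sc y
  sc-cong {x} e = ≃-subst (S v1 ≈ S v0) (x ∷ []) e ≃-refl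

  ex-cong : ∀ {x y} → x ≃ y → ex x ≃ ex y
  ex-cong {x} e = ≃-subst (exp v1 ≈ exp v0) (x ∷ []) e ≃-refl

  ∔-cong : ∀ {x y u v} → x ≃ y → u ≃ v → x ∔ u ≃ y ∔ v
  ∔-cong {x} {y} {u} {v} e f = ≃-subst (v1 ⊕ v2 ≈ v3 ⊕ v0) (x ∷ u ∷ y ∷ []) f
    (≃-subst (v1 ⊕ v2 ≈ v0 ⊕ v2) (x ∷ u ∷ []) e ≃-refl)

  ·-cong : ∀ {x y u v} → x ≃ y → u ≃ v → x · u ≃ y · v
  ·-cong {x} {y} {u} {v} e f = ≃-subst (v1 ⊗ v2 ≈ v3 ⊗ v0) (x ∷ u ∷ y ∷ []) f
    (≃-subst (v1 ⊗ v2 ≈ v0 ⊗ v2) (x ∷ u ∷ []) e ≃-refl)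

  stable≃ : ∀ {x y} → Cl (x ≃ y) → x ≃ y
  stable≃ {x} {y} = stable (v0 ≈ v1) (x ∷ y ∷ [])

  stable≼ : ∀ {x y} → Cl (x ≼ y) → x ≼ y
  stable≼ {x} {y} = stable (v0 ≲ v1) (x ∷ y ∷ [])

  absurd≃ : ∀ {x y} → ⊥ᴵ → x ≃ y
  absurd≃ b = stable≃ (cl (λ _ → b))

  absurd : ∀ {A} → ⊥ᴵ → Cl A
  absurd b = cl (λ _ → b)

  ≃-isEquivalence : IsEquivalence _≃_
  ≃-isEquivalence = record { refl = ≃-refl ; sym = sym ; trans = trans }

  ≃-setoid : Setoid _ _
  ≃-setoid = record { isEquivalence = ≃-isEquivalence }

  open Relation.Binary.Reasoning.Setoid ≃-setoid public

  -- The semiring laws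

  1# : Carrier
  1# = sc 0#

  +-0ˡ : ∀ x → 0# ∔ x ≃ x
  +-0ˡ = inductᶠ (O ⊕ v0 ≐ᶠ v0) {[]} (+-0 0#) (λ x ih → trans (+-sc 0# x) (sc-cong ih))

  +-scˡ : ∀ x y → sc x ∔ y ≃ sc (x ∔ y)
  +-scˡ x = inductᶠ (S v1 ⊕ v0 ≐ᶠ S (v1 ⊕ v0)) {x ∷ []}
    (trans (+-0 (sc x)) (sc-cong (sym (+-0 x))))
    (λ y ih → trans (+-sc (sc x) y) (sc-cong (trans ih (sym (+-sc x y)))))

  +-comm : ∀ x y → x ∔ y ≃ y ∔ x
  +-comm x y = inductᶠ (v0 ⊕ v1 ≐ᶠ v1 ⊕ v0) {y ∷ []} (trans (+-0ˡ y) (sym (+-0 y)))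
    (λ x ih → trans (+-scˡ x y) (trans (sc-cong ih) (sym (+-sc y x)))) x

  +-assoc : ∀ x y z → (x ∔ y) ∔ z ≃ x ∔ (y ∔ z)
  +-assoc x y = inductᶠ ((v1 ⊕ v2) ⊕ v0 ≐ᶠ v1 ⊕ (v2 ⊕ v0)) {x ∷ y ∷ []}
    (trans (+-0 (x ∔ y)) (∔-cong ≃-refl (sym (+-0 y))))
    (λ z ih → trans (+-sc (x ∔ y) z) (trans (sc-cong ih)
      (trans (sym (+-sc x (y ∔ z))) (∔-cong ≃-refl (sym (+-sc y z))))))

  *-0ˡ : ∀ x → 0# · x ≃ 0#
  *-0ˡ = inductᶠ (O ⊗ v0 ≐ᶠ O) {[]} (*-0 0#)
    (λ x ih → trans (*-sc 0# x) (trans (+-0 (0# · x)) ih))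

  +-swap : ∀ x y z → (x ∔ y) ∔ z ≃ (x ∔ z) ∔ y
  +-swap x y z = trans (+-assoc x y z) (trans (∔-cong ≃-refl (+-comm y z)) (sym (+-assoc x z y)))

  *-scˡ : ∀ x y → sc x · y ≃ x · y ∔ y
  *-scˡ x = inductᶠ (S v1 ⊗ v0 ≐ᶠ v1 ⊗ v0 ⊕ v0) {x ∷ []}
    (trans (*-0 (sc x)) (sym (trans (+-0 (x · 0#)) (*-0 x))))
    (λ y ih → begin
      sc x · sc y            ≈⟨ *-sc (sc x) y ⟩
      sc x · y ∔ sc x        ≈⟨ +-sc (sc x · y) x ⟩
      sc (sc x · y ∔ x)      ≈⟨ sc-cong (∔-cong ih ≃-refl) ⟩
      sc ((x · y ∔ y) ∔ x)   ≈⟨ sc-cong (+-swap (x · y) y x) ⟩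
      sc ((x · y ∔ x) ∔ y)   ≈⟨ sc-cong (∔-cong (*-sc x y) ≃-refl) ⟨
      sc (x · sc y ∔ y)      ≈⟨ +-sc (x · sc y) y ⟨
      x · sc y ∔ sc y        ∎)

  *-comm : ∀ x y → x · y ≃ y · x
  *-comm x y = inductᶠ (v0 ⊗ v1 ≐ᶠ v1 ⊗ v0) {y ∷ []} (trans (*-0ˡ y) (sym (*-0 y)))
    (λ x ih → trans (*-scˡ x y) (trans (∔-cong ih ≃-refl) (sym (*-sc y x)))) x

  *-distribˡ : ∀ x y z → x · (y ∔ z) ≃ x · y ∔ x · z
  *-distribˡ x y = inductᶠ (v1 ⊗ (v2 ⊕ v0) ≐ᶠ v1 ⊗ v2 ⊕ v1 ⊗ v0) {x ∷ y ∷ []}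
    (trans (·-cong ≃-refl (+-0 y)) (sym (trans (∔-cong ≃-refl (*-0 x)) (+-0 (x · y)))))
    (λ z ih → begin
      x · (y ∔ sc z)         ≈⟨ ·-cong ≃-refl (+-sc y z) ⟩
      x · sc (y ∔ z)         ≈⟨ *-sc x (y ∔ z) ⟩
      x · (y ∔ z) ∔ x        ≈⟨ ∔-cong ih ≃-refl ⟩
      (x · y ∔ x · z) ∔ x    ≈⟨ +-assoc (x · y) (x · z) x ⟩
      x · y ∔ (x · z ∔ x)    ≈⟨ ∔-cong ≃-refl (*-sc x z) ⟨
      x · y ∔ x · sc z       ∎)

  *-distribʳ : ∀ x y z → (y ∔ z) · x ≃ y · x ∔ z · x
  *-distribʳ x y z = trans (*-comm (y ∔ z) x)
    (trans (*-distribˡ x y z) (∔-cong (*-comm x y) (*-comm x z)))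

  *-assoc : ∀ x y z → (x · y) · z ≃ x · (y · z)
  *-assoc x y = inductᶠ ((v1 ⊗ v2) ⊗ v0 ≐ᶠ v1 ⊗ (v2 ⊗ v0)) {x ∷ y ∷ []}
    (trans (*-0 (x · y)) (sym (trans (·-cong ≃-refl (*-0 y)) (*-0 x))))
    (λ z ih → trans (*-sc (x · y) z) (trans (∔-cong ih ≃-refl)
      (trans (sym (*-distribˡ x (y · z) y)) (·-cong ≃-refl (sym (*-sc y z))))))

  *-1ˡ : ∀ x → 1# · x ≃ x
  *-1ˡ x = trans (*-scˡ 0# x) (trans (∔-cong (*-0ˡ x) ≃-refl) (+-0ˡ x))

  commutativeSemiring : CommutativeSemiring _ _
  commutativeSemiring = record
    { Carrier = Carrier ; _≈_ = _≃_ ; _+_ = _∔_ ; _*_ = _·_ ; 0# = 0# ; 1# = 1#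
    ; isCommutativeSemiring = Biased.isCommutativeSemiringˡ record
      { +-isCommutativeMonoid = Biased.isCommutativeMonoidˡ record
        { isSemigroup = record
          { isMagma = record { isEquivalence = ≃-isEquivalence ; ∙-cong = ∔-cong }
          ; assoc = +-assoc }
        ; identityˡ = +-0ˡ ; comm = +-comm }
      ; *-isCommutativeMonoid = Biased.isCommutativeMonoidˡ record
        { isSemigroup = record
          { isMagma = record { isEquivalence = ≃-isEquivalence ; ∙-cong = ·-cong }
          ; assoc = *-assoc }
        ; identityˡ = *-1ˡ ; comm = *-comm }
      ; distribʳ = *-distribʳ ; zeroˡ = *-0ˡ } }

  module Solver = Algebra.Solver.Ring.NaturalCoefficients.Default commutativeSemiring
  open Solver using (solve; _:=_; _:+_; _:*_; con)

  sc≃+1 : ∀ x → sc x ≃ x ∔ 1#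
  sc≃+1 x = sym (trans (+-sc x 0#) (sc-cong (+-0 x)))

  +-cancelʳ : ∀ x y z → x ∔ z ≃ y ∔ z → x ≃ y
  +-cancelʳ x y = inductᶠ (v1 ⊕ v0 ≐ᶠ v2 ⊕ v0 ⇒ᶠ v1 ≐ᶠ v2) {x ∷ y ∷ []}
    (λ e → trans (sym (+-0 x)) (trans e (+-0 y)))
    (λ z ih e → ih (sc-inj (trans (sym (+-sc x z)) (trans e (+-sc y z)))))

  zeroOrSuc : ∀ x → Cl (x ≃ 0# ⊎ Σ[ y ∈ Carrier ] x ≃ sc y)
  zeroOrSuc x = lem (x ≃ 0#) >>= λ
    { (inj₁ e) → return (inj₁ e)
    ; (inj₂ n) → predec x n >>= λ p → return (inj₂ p) }

  -- Order

  ≼-reflexive : ∀ {x y} → x ≃ y → x ≼ y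
  ≼-reflexive {x} e = ⇒≼ 0# (trans (+-0ˡ x) e)

  ≼-refl : ∀ {x} → x ≼ x
  ≼-refl = ≼-reflexive ≃-refl

  ≼-trans : ∀ {x y z} → x ≼ y → y ≼ z → x ≼ z
  ≼-trans p q = stable≼ do
    (d , e) ← ≼⇒ p
    (c , f) ← ≼⇒ q
    return (⇒≼ (c ∔ d) (trans (+-assoc c d _) (trans (∔-cong ≃-refl e) f)))

  ≼-respˡ : ∀ {x y z} → x ≃ y → x ≼ z → y ≼ z
  ≼-respˡ e p = ≼-trans (≼-reflexive (sym e)) p

  ≼-respʳ : ∀ {x y z} → x ≃ y → z ≼ x → z ≼ y
  ≼-respʳ e p = ≼-trans p (≼-reflexive e)

  0≼ : ∀ x → 0# ≼ x
  0≼ x = ⇒≼ x (+-0 x)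

  x≼y∔x : ∀ x y → x ≼ y ∔ x
  x≼y∔x x y = ⇒≼ y ≃-refl

  x≼x∔y : ∀ x y → x ≼ x ∔ y
  x≼x∔y x y = ⇒≼ y (+-comm y x)

  x≼scx : ∀ x → x ≼ sc x
  x≼scx x = ≼-respʳ (sym (sc≃+1 x)) (x≼x∔y x 1#)

  sc-mono : ∀ {x y} → x ≼ y → sc x ≼ sc y
  sc-mono p = stable≼ do
    (d , e) ← ≼⇒ p
    return (⇒≼ d (trans (+-sc d _) (sc-cong e)))

  sc-anti : ∀ {x y} → sc x ≼ sc y → x ≼ y
  sc-anti p = stable≼ do
    (d , e) ← ≼⇒ p
    return (⇒≼ d (sc-inj (trans (sym (+-sc d _)) e)))

  ∔-mono : ∀ {x y u v} → x ≼ y → u ≼ v → x ∔ u ≼ y ∔ v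
  ∔-mono {x} {y} {u} {v} p q = stable≼ do
    (d , e) ← ≼⇒ p
    (c , f) ← ≼⇒ q
    return (⇒≼ (d ∔ c) (trans
      (solve 4 (λ d c x u → (d :+ c) :+ (x :+ u) := (d :+ x) :+ (c :+ u)) ≃-refl d c x u)
      (∔-cong e f)))

  ·-mono : ∀ {x y u v} → x ≼ y → u ≼ v → x · u ≼ y · v
  ·-mono {x} {y} {u} {v} p q = stable≼ do
    (d , e) ← ≼⇒ p
    (c , f) ← ≼⇒ q
    return (⇒≼ (d · c ∔ d · u ∔ x · c) (trans
      (solve 4 (λ d c x u → (d :* c :+ d :* u :+ x :* c) :+ x :* u := (d :+ x) :* (c :+ u)) ≃-refl d c x u)
      (·-cong e f)))

  ≼0⇒≃0 : ∀ {x} → x ≼ 0# → x ≃ 0#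
  ≼0⇒≃0 {x} p = stable≃ do
    (d , e) ← ≼⇒ p
    inj₂ (y , f) ← zeroOrSuc x
      where inj₁ f → return f
    absurd (sc≄0 (trans (sym (+-sc d y)) (trans (∔-cong ≃-refl (sym f)) e)))

  ≼sc-split : ∀ {x y} → x ≼ sc y → Cl (x ≼ y ⊎ x ≃ sc y)
  ≼sc-split {x} {y} p = do
    (d , e) ← ≼⇒ p
    inj₂ (c , f) ← zeroOrSuc d
      where inj₁ f → return (inj₂ (trans (sym (+-0ˡ x)) (trans (∔-cong (sym f) ≃-refl) e)))
    return (inj₁ (⇒≼ c (sc-inj (trans (sym (+-scˡ c x)) (trans (∔-cong (sym f) ≃-refl) e)))))

  ≼-split : ∀ {x y} → x ≼ y → Cl (sc x ≼ y ⊎ x ≃ y)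
  ≼-split p = ≼sc-split (sc-mono p) >>= λ
    { (inj₁ q) → return (inj₁ q) ; (inj₂ e) → return (inj₂ (sc-inj e)) }

  ≼-total : ∀ x y → Cl (x ≼ y ⊎ sc y ≼ x)
  ≼-total x y = inductᶠ (v0 ≤ᶠ v1 ∨ᶠ S v1 ≤ᶠ v0) {y ∷ []} (return (inj₁ (0≼ y)))
    (λ x ih → ih >>= λ
      { (inj₁ p) → ≼-split p >>= λ
        { (inj₁ q) → return (inj₁ q)
        ; (inj₂ e) → return (inj₂ (≼-reflexive (sc-cong (sym e)))) }
      ; (inj₂ p) → return (inj₂ (≼-trans p (x≼scx x))) }) x

  ≼-irrefl : ∀ {x} → sc x ≼ x → ⊥ᴵ
  ≼-irrefl {x} p = ⊥-run do
    (d , e) ← ≼⇒ p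
    return (no-fix d x (trans (+-scˡ d x) (trans (sym (+-sc d x)) e)))
    where
    no-fix : ∀ d x → sc d ∔ x ≃ x → ⊥ᴵ
    no-fix d = inductᶠ (S v1 ⊕ v0 ≐ᶠ v0 ⇒ᶠ ⟪ ff ⟫) {d ∷ []}
      (λ e → sc≄0 (trans (sym (+-0 (sc d))) e))
      (λ x ih e → ih (sc-inj (trans (sym (+-sc (sc d) x)) e)))

  ≺⇒≄ : ∀ {x y} → sc x ≼ y → x ≃ y → ⊥ᴵ
  ≺⇒≄ p e = ≼-irrefl (≼-respʳ (sym e) p)

  ≼-antisym : ∀ {x y} → x ≼ y → y ≼ x → x ≃ y
  ≼-antisym p q = stable≃ (≼-split p >>= λ
    { (inj₁ r) → absurd (≼-irrefl (≼-trans r q)) ; (inj₂ e) → return e })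

  -- Exponentiation

  ex-+ : ∀ x y → ex (x ∔ y) ≃ ex x · ex y
  ex-+ x = inductᶠ (exp (v1 ⊕ v0) ≐ᶠ exp v1 ⊗ exp v0) {x ∷ []}
    (trans (ex-cong (+-0 x)) (sym (trans (·-cong ≃-refl ex-0) (trans (*-comm (ex x) 1#) (*-1ˡ (ex x))))))
    (λ y ih → begin
      ex (x ∔ sc y)                 ≈⟨ ex-cong (+-sc x y) ⟩
      ex (sc (x ∔ y))               ≈⟨ ex-sc (x ∔ y) ⟩
      ex (x ∔ y) ∔ ex (x ∔ y)       ≈⟨ ∔-cong ih ih ⟩
      ex x · ex y ∔ ex x · ex y     ≈⟨ *-distribˡ (ex x) (ex y) (ex y) ⟨
      ex x · (ex y ∔ ex y)          ≈⟨ ·-cong ≃-refl (ex-sc y) ⟨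
      ex x · ex (sc y)              ∎)

  x≺exx : ∀ x → sc x ≼ ex x
  x≺exx = inductᶠ (S v0 ≤ᶠ exp v0) {[]} (≼-reflexive (sym ex-0))
    (λ x ih → ≼-respʳ (sym (ex-sc x)) (≼-respˡ (sym (sc≃+1 (sc x)))
      (∔-mono ih (≼-trans (sc-mono (0≼ x)) ih))))

  1≼ex : ∀ x → 1# ≼ ex x
  1≼ex x = ≼-trans (sc-mono (0≼ x)) (x≺exx x)

  x≼exx : ∀ x → x ≼ ex x
  x≼exx x = ≼-trans (x≼scx x) (x≺exx x)

  ex-mono : ∀ {x y} → x ≼ y → ex x ≼ ex y
  ex-mono {x} {y} p = stable≼ do
    (d , e) ← ≼⇒ p
    return (≼-respˡ (*-1ˡ (ex x)) (≼-respʳ (trans (sym (ex-+ d x)) (ex-cong e))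
      (·-mono (1≼ex d) ≼-refl)))

  x≼x·y : ∀ {y} x → 1# ≼ y → x ≼ x · y
  x≼x·y x p = ≼-respˡ (trans (*-comm x 1#) (*-1ˡ x)) (·-mono (≼-refl {x}) p)

  -- Binary digits

  double≄ : ∀ g h → g ∔ g ≃ sc (h ∔ h) → ⊥ᴵ
  double≄ g h e = ⊥-run (≼-total g h >>= λ
    { (inj₁ p) → return (≼-irrefl (≼-respˡ (sym (sc-cong ≃-refl))
        (≼-trans (≼-reflexive (sym e)) (∔-mono p p))))
    ; (inj₂ p) → return (≼-irrefl (≼-respʳ e (≼-respˡ
        (trans (+-scˡ h (sc h)) (sc-cong (+-sc h h))) (∔-mono p p)))) })

  parity : ∀ x → Cl (Σ[ h ∈ Carrier ] (x ≃ h ∔ h ⊎ x ≃ sc (h ∔ h)))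
  parity x = inductᶠ (∃ᶠ v0 (v1 ≐ᶠ v0 ⊕ v0 ∨ᶠ v1 ≐ᶠ S (v0 ⊕ v0))) {[]}
      (return (0# , ≼-refl , return (inj₁ (sym (+-0 0#))))) step x
      >>= λ { (h , _ , c) → c >>= λ c → return (h , c) }
    where
    step : ∀ x → ⟦ ∃ᶠ v0 (v1 ≐ᶠ v0 ⊕ v0 ∨ᶠ v1 ≐ᶠ S (v0 ⊕ v0)) ⟧ᶠ (x ∷ []) →
           ⟦ ∃ᶠ v0 (v1 ≐ᶠ v0 ⊕ v0 ∨ᶠ v1 ≐ᶠ S (v0 ⊕ v0)) ⟧ᶠ (sc x ∷ [])
    step x ih = do
      (h , le , c) ← ih
      inj₂ e ← c
        where inj₁ e → return (h , ≼-trans le (x≼scx x) , return (inj₂ (sc-cong e)))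
      return (sc h , sc-mono le , return (inj₁
        (trans (sc-cong e) (trans (sc-cong (sym (+-sc h h))) (sym (+-scˡ h (sc h)))))))

  div-unique : ∀ {e q r q′ r′} → q · e ∔ r ≃ q′ · e ∔ r′ → sc r ≼ e → sc r′ ≼ e → q ≃ q′
  div-unique {e} {q} {r} {q′} {r′} eq r< r′< = stable≃ do
      inj₁ p ← ≼-total q q′
        where inj₂ p → absurd (below (sym eq) r′< p)
      inj₁ p′ ← ≼-split p
        where inj₂ f → return f
      absurd (below eq r< p′)
    where
    below : ∀ {q r q′ r′} → q · e ∔ r ≃ q′ · e ∔ r′ → sc r ≼ e → sc q ≼ q′ → ⊥ᴵ
    below {q} {r} {q′} {r′} eq r< p = ≼-irrefl (≼-respʳ (sym eq)
      (≼-trans (≼-respˡ (+-sc (q · e) r) (≼-trans (∔-mono ≼-refl r<) (≼-reflexive (sym (*-scˡ q e)))))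
               (≼-trans (·-mono p ≼-refl) (x≼x∔y (q′ · e) r′))))

  divide : ∀ w e → 1# ≼ e →
    Cl (Σ[ q ∈ Carrier ] Σ[ r ∈ Carrier ] (w ≃ q · e ∔ r × sc r ≼ e))
  divide w e 1≼e = inductᶠ A {e ∷ []}
      (return (0# , ≼-refl , return (0# , ≼-refl ,
        sym (trans (+-0 (0# · e)) (*-0ˡ e)) , 1≼e))) step w
      >>= λ { (q , _ , c) → c >>= λ { (r , _ , p) → return (q , r , p) } }
    where
    A : Fm 2
    A = ∃ᶠ v0 (∃ᶠ v1 (v2 ≐ᶠ v1 ⊗ v3 ⊕ v0 ∧ᶠ S v0 ≤ᶠ v3))
    step : ∀ w → ⟦ A ⟧ᶠ (w ∷ e ∷ []) → ⟦ A ⟧ᶠ (sc w ∷ e ∷ [])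
    step w ih = do
      (q , q≤ , c) ← ih
      (r , r≤ , eq , r<) ← c
      inj₂ f ← ≼-split r<
        where inj₁ r<< → return (q , ≼-trans q≤ (x≼scx w) , return (sc r , sc-mono r≤ ,
                           trans (sc-cong eq) (sym (+-sc (q · e) r)) , r<<))
      return (sc q , sc-mono q≤ , return (0# , 0≼ (sc w) ,
        (begin
          sc w               ≈⟨ sc-cong eq ⟩
          sc (q · e ∔ r)     ≈⟨ +-sc (q · e) r ⟨
          q · e ∔ sc r       ≈⟨ ∔-cong ≃-refl f ⟩
          q · e ∔ e          ≈⟨ *-scˡ q e ⟨
          sc q · e           ≈⟨ +-0 (sc q · e) ⟨
          sc q · e ∔ 0#      ∎) , 1≼e))

  opaque
    unfolding _∈_

    ∈-intro : ∀ {a w} q r → w ≃ sc (q ∔ q) · ex a ∔ r → sc r ≼ ex a → a ∈ w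
    ∈-intro {a} {w} q r e l = return (q , r , q≼w , ≼-respʳ (sym e) (x≼y∔x r _) , e , l)
      where
      q≼w : q ≼ w
      q≼w = ≼-respʳ (sym e) (≼-trans (≼-trans (x≼x∔y q q) (x≼scx (q ∔ q)))
        (≼-trans (x≼x·y (sc (q ∔ q)) (1≼ex a)) (x≼x∔y _ r)))

    ∈-elim : ∀ {a w} → a ∈ w → Cl (Σ[ q ∈ Carrier ] Σ[ r ∈ Carrier ]
      (w ≃ sc (q ∔ q) · ex a ∔ r × sc r ≼ ex a))
    ∈-elim p = p >>= λ { (q , r , _ , _ , e , l) → return (q , r , e , l) }

  stable∈ : ∀ {a w} → Cl (a ∈ w) → a ∈ w
  stable∈ {a} {w} = stableᶠ (v0 ∈ᶠ v1) {a ∷ w ∷ []}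

  ∈-respˡ : ∀ {a b w} → a ≃ b → a ∈ w → b ∈ w
  ∈-respˡ {w = w} = substᶠ (v0 ∈ᶠ v1) {w ∷ []}

  ∈⇒ex≼ : ∀ {a w} → a ∈ w → ex a ≼ w
  ∈⇒ex≼ {a} p = stable≼ do
    (q , r , e , _) ← ∈-elim p
    return (≼-respʳ (sym e) (≼-trans (≼-respˡ (*-1ˡ (ex a)) (·-mono (sc-mono (0≼ (q ∔ q))) ≼-refl))
      (x≼x∔y _ r)))

  ∈⇒≺ : ∀ {a w b} → a ∈ w → sc w ≼ ex b → sc a ≼ b
  ∈⇒≺ {a} {w} {b} p l = stable≼ (≼-total b a >>= λ
    { (inj₁ b≼a) → absurd (≼-irrefl (≼-trans l (≼-trans (ex-mono b≼a) (∈⇒ex≼ p))))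
    ; (inj₂ q)   → return q })

  -- For i < b the power 2^b is an even multiple of 2^i. Adding it changes the quotient by 2^i by an
  -- even number, which is why digit `i` is unaffected in `∈-raise` and `∈-lower`.
  ex-above : ∀ {i b} → sc i ≼ b → Cl (Σ[ d ∈ Carrier ] ex b ≃ (d ∔ d) · ex i)
  ex-above {i} {b} l = do
    (d , e) ← ≼⇒ l
    return (ex d , (begin
      ex b                         ≈⟨ ex-cong e ⟨
      ex (d ∔ sc i)                ≈⟨ ex-+ d (sc i) ⟩
      ex d · ex (sc i)             ≈⟨ ·-cong ≃-refl (ex-sc i) ⟩
      ex d · (ex i ∔ ex i)         ≈⟨ solve 2 (λ d i → d :* (i :+ i) := (d :+ d) :* i) ≃-refl (ex d) (ex i) ⟩
      (ex d ∔ ex d) · ex i         ∎))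

  ∈-raise : ∀ {i b w} → sc i ≼ b → i ∈ w → i ∈ ex b ∔ w
  ∈-raise {i} {b} {w} l p = stable∈ do
    (d , f) ← ex-above l
    (q , r , e , r<) ← ∈-elim p
    return (∈-intro (d ∔ q) r (begin
      ex b ∔ w                                     ≈⟨ ∔-cong f e ⟩
      (d ∔ d) · ex i ∔ (sc (q ∔ q) · ex i ∔ r)     ≈⟨ ∔-cong ≃-refl (∔-cong (·-cong (sc≃+1 _) ≃-refl) ≃-refl) ⟩
      (d ∔ d) · ex i ∔ ((q ∔ q ∔ 1#) · ex i ∔ r)
        ≈⟨ solve 4 (λ d q i r → (d :+ d) :* i :+ ((q :+ q :+ con 1) :* i :+ r)
             := ((d :+ q) :+ (d :+ q) :+ con 1) :* i :+ r) ≃-refl d q (ex i) r ⟩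
      ((d ∔ q) ∔ (d ∔ q) ∔ 1#) · ex i ∔ r          ≈⟨ ∔-cong (·-cong (sc≃+1 _) ≃-refl) ≃-refl ⟨
      sc ((d ∔ q) ∔ (d ∔ q)) · ex i ∔ r            ∎) r<)

  -- Digit `i` of `w` is read off by dividing by 2^i. Were that quotient even, the quotient of 2^b +
  -- w would be even as well, against its uniqueness and the assumption that it is odd.
  ∈-lower : ∀ {i b w} → sc i ≼ b → i ∈ ex b ∔ w → i ∈ w
  ∈-lower {i} {b} {w} l p = stable∈ do
    (d , f) ← ex-above l
    (q , r , e , r<) ← ∈-elim p
    (q′ , r′ , e′ , r′<) ← divide w (ex i) (1≼ex i)
    (h , c) ← parity q′
    return (decide d f q r e r< q′ r′ e′ r′< h c)
    where
    decide : ∀ d → ex b ≃ (d ∔ d) · ex i → ∀ q r → ex b ∔ w ≃ sc (q ∔ q) · ex i ∔ r → sc r ≼ ex i →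
      ∀ q′ r′ → w ≃ q′ · ex i ∔ r′ → sc r′ ≼ ex i → ∀ h → q′ ≃ h ∔ h ⊎ q′ ≃ sc (h ∔ h) → i ∈ w
    decide d f q r e r< q′ r′ e′ r′< h (inj₂ odd) =
      ∈-intro h r′ (trans e′ (∔-cong (·-cong odd ≃-refl) ≃-refl)) r′<
    decide d f q r e r< q′ r′ e′ r′< h (inj₁ even) =
      stable∈ (absurd (double≄ (d ∔ h) q (div-unique (begin
        ((d ∔ h) ∔ (d ∔ h)) · ex i ∔ r′
          ≈⟨ solve 4 (λ d h i r → ((d :+ h) :+ (d :+ h)) :* i :+ r
               := (d :+ d) :* i :+ ((h :+ h) :* i :+ r)) ≃-refl d h (ex i) r′ ⟩
        (d ∔ d) · ex i ∔ ((h ∔ h) · ex i ∔ r′)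
          ≈⟨ ∔-cong (sym f) (∔-cong (·-cong (sym even) ≃-refl) ≃-refl) ⟩
        ex b ∔ (q′ · ex i ∔ r′)      ≈⟨ ∔-cong ≃-refl e′ ⟨
        ex b ∔ w                     ≈⟨ e ⟩
        sc (q ∔ q) · ex i ∔ r        ∎) r′< r<)))

  top∈ : ∀ {b w} → sc w ≼ ex b → b ∈ ex b ∔ w
  top∈ {b} {w} l = ∈-intro 0# w (∔-cong
    (sym (trans (·-cong (sc-cong (+-0 0#)) ≃-refl) (*-1ˡ (ex b)))) ≃-refl) l

  -- Comprehension

  params : ∀ k n → Vec (ATerm (k + n)) n
  params k n = tabulate (λ i → var (k ↑ʳ i))

  vals-params : ∀ {n} (ρ : Vec Carrier n) {m} (r : Fin n → Fin m) τ →
    (∀ i → lookup τ (r i) ≡ lookup ρ i) → vals (tabulate (λ i → var (r i))) τ ≡ ρ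
  vals-params []      r τ h = ≡.refl
  vals-params (x ∷ ρ) r τ h = cong₂ _∷_ (h fzero) (vals-params ρ (r ∘ fsuc) τ (h ∘ fsuc))

  private
    -- The code of a set of numbers below `b` is itself below 2^b. The existence of the set is
    -- therefore a bounded statement, open to Δ₀-induction on `b`.
    SetBelow : ∀ {n} → Fm (suc n) → Fm (suc n)
    SetBelow {n} A = ∃ᶠ (exp v0) (S v0 ≤ᶠ exp v1 ∧ᶠ
      ∀ᶠ v1 (S v0 ≤ᶠ v2 ⇒ᶠ ((v0 ∈ᶠ v1 ⇒ᶠ A ⟨ v0 ∷ params 3 n ⟩) ∧ᶠ (A ⟨ v0 ∷ params 3 n ⟩ ⇒ᶠ v0 ∈ᶠ v1))))

  -- The set is built digit by digit: 2^b is added if `A` holds at `b`. The estimate for `w` matters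
  -- as much as its members, since `Proof` and `numF` quantify only over sets of that size.
  comprehension : ∀ {n} (A : Fm (suc n)) ρ b → Cl (Σ[ w ∈ Carrier ] sc w ≼ ex (sc b) ×
    (∀ i → i ∈ w → i ≼ b × ⟦ A ⟧ᶠ (i ∷ ρ)) × (∀ i → i ≼ b → ⟦ A ⟧ᶠ (i ∷ ρ) → i ∈ w))
  comprehension {n} A ρ b =
      -- `SetBelow` speaks of numbers strictly below its argument, so including `b` takes the
      -- instance at `sc b`.
      inductᶠ (SetBelow A) {ρ} base (λ b ih → step b ih) (sc b) >>= λ { (w , _ , w< , p) →
      return (w , w< , (λ i i∈ → let l = ∈⇒≺ i∈ w< in sc-anti l , at w (sc b) i .proj₁ (proj₁ (p i (≼-trans (x≼scx i) l) l) i∈))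
                     , (λ i i≼b a → proj₂ (p i (≼-trans i≼b (x≼scx b)) (sc-mono i≼b)) (at w (sc b) i .proj₂ a))) }
    where
    A′ : Fm (3 + n)
    A′ = A ⟨ v0 ∷ params 3 n ⟩
    at : ∀ w b i → (⟦ A′ ⟧ᶠ (i ∷ w ∷ b ∷ ρ) → ⟦ A ⟧ᶠ (i ∷ ρ)) × (⟦ A ⟧ᶠ (i ∷ ρ) → ⟦ A′ ⟧ᶠ (i ∷ w ∷ b ∷ ρ))
    at w b i = subst (λ τ → ⟦ A ⟧ᶠ (i ∷ τ)) eq , subst (λ τ → ⟦ A ⟧ᶠ (i ∷ τ)) (≡.sym eq)
      where
      eq : vals (params 3 n) (i ∷ w ∷ b ∷ ρ) ≡ ρ
      eq = vals-params ρ (3 ↑ʳ_) (i ∷ w ∷ b ∷ ρ) (λ _ → ≡.refl)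
    base : ⟦ SetBelow A ⟧ᶠ (0# ∷ ρ)
    base = return (0# , 0≼ _ , ≼-reflexive (sym ex-0) ,
      λ i _ l → ⟨⊥⟩ i (≼-irrefl (≼-trans l (0≼ i))))
      where
      ⟨⊥⟩ : ∀ i → ⊥ᴵ → ⟦ (v0 ∈ᶠ v1 ⇒ᶠ A′) ∧ᶠ (A′ ⇒ᶠ v0 ∈ᶠ v1) ⟧ᶠ (i ∷ 0# ∷ 0# ∷ ρ)
      ⟨⊥⟩ i b = (λ _ → stableᶠ A′ (absurd b)) , (λ _ → stable∈ (absurd b))
    step : ∀ b → ⟦ SetBelow A ⟧ᶠ (b ∷ ρ) → ⟦ SetBelow A ⟧ᶠ (sc b ∷ ρ)
    step b ih = do
      (w , _ , w< , p) ← ih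
      let member : ∀ i → sc i ≼ b → (i ∈ w → ⟦ A ⟧ᶠ (i ∷ ρ)) × (⟦ A ⟧ᶠ (i ∷ ρ) → i ∈ w)
          member i l = let q = p i (≼-trans (x≼scx i) l) l in
            (λ m → at w b i .proj₁ (proj₁ q m)) , (λ a → proj₂ q (at w b i .proj₂ a))
      inj₁ a ← lem (⟦ A ⟧ᶠ (b ∷ ρ))
        where inj₂ ¬a → do
                let w<′ = ≼-trans w< (ex-mono (x≼scx b))
                return (w , ≼-trans (x≼scx w) w<′ , w<′ , λ i _ l →
                  (λ m → at w (sc b) i .proj₂ (member i (∈⇒≺ m w<) .proj₁ m)) ,
                  (λ a → stable∈ (≼-split (sc-anti l) >>= λ
                    { (inj₁ l′) → return (member i l′ .proj₂ (at w (sc b) i .proj₁ a))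
                    ; (inj₂ e)  → absurd (¬a (substᶠ A e (at w (sc b) i .proj₁ a))) })))
      let u  = ex b ∔ w
          u< : sc u ≼ ex (sc b)
          u< = ≼-respˡ (+-sc (ex b) w) (≼-respʳ (sym (ex-sc b)) (∔-mono ≼-refl w<))
      return (u , ≼-trans (x≼scx u) u< , u< , λ i _ l →
        (λ m → at u (sc b) i .proj₂ (stableᶠ A (≼-split (sc-anti l) >>= λ
          { (inj₁ l′) → return (member i l′ .proj₁ (∈-lower l′ m))
          ; (inj₂ e)  → return (substᶠ A (sym e) a) }))) ,
        (λ a′ → stable∈ (≼-split (sc-anti l) >>= λ
          { (inj₁ l′) → return (∈-raise l′ (member i l′ .proj₂ (at u (sc b) i .proj₁ a′)))
          ; (inj₂ e)  → return (∈-respˡ (sym e) (top∈ w<)) })))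

  -- Pairing

  pr : Carrier → Carrier → Carrier
  pr a b = sc ((a ∔ b) · (a ∔ b) ∔ a)

  pr-cong : ∀ {a b c d} → a ≃ c → b ≃ d → pr a b ≃ pr c d
  pr-cong e f = sc-cong (∔-cong (·-cong (∔-cong e f) (∔-cong e f)) e)

  pr-mono : ∀ {a b c d} → a ≼ c → b ≼ d → pr a b ≼ pr c d
  pr-mono p q = sc-mono (∔-mono (·-mono (∔-mono p q) (∔-mono p q)) p)

  fst≺pr : ∀ a b → sc a ≼ pr a b
  fst≺pr a b = sc-mono (x≼y∔x a _)

  snd≺pr : ∀ a b → sc b ≼ pr a b
  snd≺pr a b = stable≼ do
    inj₂ (c , e) ← zeroOrSuc b
      where inj₁ e → return (sc-mono (≼-respˡ (sym e) (0≼ _)))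
    return (sc-mono (≼-trans (x≼y∔x b a) (≼-trans (x≼x·y (a ∔ b)
      (≼-trans (sc-mono (0≼ c)) (≼-respˡ e (x≼y∔x b a)))) (x≼x∔y _ a))))

  fst≼pr : ∀ a b → a ≼ pr a b
  fst≼pr a b = ≼-trans (x≼scx a) (fst≺pr a b)

  snd≼pr : ∀ a b → b ≼ pr a b
  snd≼pr a b = ≼-trans (x≼scx b) (snd≺pr a b)

  pr-inj : ∀ {a b c d} → pr a b ≃ pr c d → a ≃ c × b ≃ d
  pr-inj {a} {b} {c} {d} e = a≃c , b≃d
    where
    gap : ∀ {a b c d} → sc (a ∔ b) ≼ c ∔ d → pr a b ≃ pr c d → ⊥ᴵ
    gap {a} {b} {c} {d} l e = ≼-irrefl (≼-respʳ (sym (sc-inj e))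
      (≼-trans bound (≼-trans (·-mono l l) (x≼x∔y _ c))))
      where
      bound : sc ((a ∔ b) · (a ∔ b) ∔ a) ≼ sc (a ∔ b) · sc (a ∔ b)
      bound = ⇒≼ (a ∔ b ∔ b) (begin
        (a ∔ b ∔ b) ∔ sc ((a ∔ b) · (a ∔ b) ∔ a)     ≈⟨ ∔-cong ≃-refl (sc≃+1 _) ⟩
        (a ∔ b ∔ b) ∔ ((a ∔ b) · (a ∔ b) ∔ a ∔ 1#)
          ≈⟨ solve 2 (λ a b → (a :+ b :+ b) :+ ((a :+ b) :* (a :+ b) :+ a :+ con 1)
               := (a :+ b :+ con 1) :* (a :+ b :+ con 1)) ≃-refl a b ⟩
        (a ∔ b ∔ 1#) · (a ∔ b ∔ 1#)                  ≈⟨ ·-cong (sc≃+1 _) (sc≃+1 _) ⟨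
        sc (a ∔ b) · sc (a ∔ b)                      ∎)
    sums : a ∔ b ≃ c ∔ d
    sums = stable≃ (≼-total (a ∔ b) (c ∔ d) >>= λ
      { (inj₂ l) → absurd (gap l (sym e))
      ; (inj₁ l) → ≼-split l >>= λ
        { (inj₁ l′) → absurd (gap l′ e) ; (inj₂ f) → return f } })
    a≃c : a ≃ c
    a≃c = +-cancelʳ a c _ (trans (+-comm a _) (trans (sc-inj e)
      (trans (∔-cong (·-cong (sym sums) (sym sums)) ≃-refl) (+-comm _ c))))
    b≃d : b ≃ d
    b≃d = +-cancelʳ b d a (trans (+-comm b a) (trans sums
      (trans (∔-cong (sym a≃c) ≃-refl) (+-comm a d))))

-- Terms without exp in one variable

data Poly : ATerm 1 → Set where
  var : Poly (var fzero)
  O   : Poly O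
  S   : ∀ {t} → Poly t → Poly (S t)
  _⊕_ : ∀ {t u} → Poly t → Poly u → Poly (t ⊕ u)
  _⊗_ : ∀ {t u} → Poly t → Poly u → Poly (t ⊗ u)

Poly-litA : ∀ k → Poly (litA k)
Poly-litA zero    = O
Poly-litA (suc k) = S (Poly-litA k)

Poly-pairA : ∀ {t u} → Poly t → Poly u → Poly (pairA t u)
Poly-pairA p q = S ((p ⊕ q) ⊗ (p ⊕ q) ⊕ p)

-- An upper count rather than the true degree: for u ≤ 2^e with e ≥ 1 the value is at most 2^(degree
-- · e). A successor or a sum costs one extra factor 2^e, which pays for a doubling.
degree : ATerm 1 → ℕ
degree (var _) = 1
degree O       = 0
degree (S t)   = suc (degree t)
degree (exp t) = 0
degree (t ⊕ u) = suc (degree t + degree u)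
degree (t ⊗ u) = degree t + degree u

-- Dominates the i-th iterate, started below β, of every polynomial of degree
-- at most k.  The variables are (β , i).
iterBound : ℕ → ATerm 2
iterBound k = exp (exp (litA k ⊗ var (# 1)) ⊗ S (var (# 0)))

-- Standard numbers in a model, and growth of iterated polynomials

module Numerals (𝓜 : IΔ₀Exp) where
  open IΔ₀Exp 𝓜
  open Laws 𝓜

  _≃*_ _≼*_ : ∀ {n} → Vec Carrier n → Vec Carrier n → Set
  ρ ≃* τ = ∀ i → lookup ρ i ≃ lookup τ i
  ρ ≼* τ = ∀ i → lookup ρ i ≼ lookup τ i

  ≃*-∷ : ∀ {n x y} {ρ τ : Vec Carrier n} → x ≃ y → ρ ≃* τ → (x ∷ ρ) ≃* (y ∷ τ)
  ≃*-∷ e h fzero    = e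
  ≃*-∷ e h (fsuc i) = h i

  ≼*-∷ : ∀ {n x y} {ρ τ : Vec Carrier n} → x ≼ y → ρ ≼* τ → (x ∷ ρ) ≼* (y ∷ τ)
  ≼*-∷ e h fzero    = e
  ≼*-∷ e h (fsuc i) = h i

  ≃*-refl : ∀ {n} {ρ : Vec Carrier n} → ρ ≃* ρ
  ≃*-refl i = ≃-refl

  val-cong : ∀ {n} (t : ATerm n) {ρ τ} → ρ ≃* τ → val t ρ ≃ val t τ
  val-cong (var i) h = h i
  val-cong O       h = ≃-refl
  val-cong (S t)   h = sc-cong (val-cong t h)
  val-cong (exp t) h = ex-cong (val-cong t h)
  val-cong (t ⊕ u) h = ∔-cong (val-cong t h) (val-cong u h)
  val-cong (t ⊗ u) h = ·-cong (val-cong t h) (val-cong u h)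

  val-mono : ∀ {n} (t : ATerm n) {ρ τ} → ρ ≼* τ → val t ρ ≼ val t τ
  val-mono (var i) h = h i
  val-mono O       h = ≼-refl
  val-mono (S t)   h = sc-mono (val-mono t h)
  val-mono (exp t) h = ex-mono (val-mono t h)
  val-mono (t ⊕ u) h = ∔-mono (val-mono t h) (val-mono u h)
  val-mono (t ⊗ u) h = ·-mono (val-mono t h) (val-mono u h)

  ⊩-resp : ∀ {n} (θ : Δ₀ n) {ρ τ} → ρ ≃* τ → ρ ⊩ θ → τ ⊩ θ
  ⊩-resp (t ≈ u)    h p = trans (sym (val-cong t h)) (trans p (val-cong u h))
  ⊩-resp (t ≲ u)    h p = ≼-respˡ (val-cong t h) (≼-respʳ (val-cong u h) p)
  ⊩-resp ff         h p = p
  ⊩-resp (θ ⊃ χ)    h p = λ q → ⊩-resp χ h (p (⊩-resp θ (sym ∘ h) q))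
  ⊩-resp (all≤ t θ) h p = λ x le →
    ⊩-resp θ (≃*-∷ ≃-refl h) (p x (≼-respʳ (sym (val-cong t h)) le))

  fm-resp : ∀ {n} (A : Fm n) {ρ τ} → ρ ≃* τ → ⟦ A ⟧ᶠ ρ → ⟦ A ⟧ᶠ τ
  fm-resp A h p = fm→ A (⊩-resp (toΔ₀ A) h (fm← A p))

  -- Standard numbers

  lit : ℕ → Carrier
  lit zero    = 0#
  lit (suc k) = sc (lit k)

  val-litA : ∀ {n} k {ρ : Vec Carrier n} → val (litA k) ρ ≡ lit k
  val-litA zero    = ≡.refl
  val-litA (suc k) = cong sc (val-litA k)

  lit-+ : ∀ m n → lit (m + n) ≃ lit m ∔ lit n
  lit-+ zero    n = sym (+-0ˡ (lit n))
  lit-+ (suc m) n = trans (sc-cong (lit-+ m n)) (sym (+-scˡ (lit m) (lit n)))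

  lit-* : ∀ m n → lit (m * n) ≃ lit m · lit n
  lit-* zero    n = sym (*-0ˡ (lit n))
  lit-* (suc m) n = trans (lit-+ n (m * n)) (trans (+-comm (lit n) _)
    (trans (∔-cong (lit-* m n) ≃-refl) (sym (*-scˡ (lit m) (lit n)))))

  lit-^ : ∀ n → lit (2 ^ n) ≃ ex (lit n)
  lit-^ zero    = sym ex-0
  lit-^ (suc n) = trans (lit-+ (2 ^ n) (2 ^ n + 0))
    (trans (∔-cong (lit-^ n) (trans (lit-+ (2 ^ n) 0) (trans (+-0 _) (lit-^ n)))) (sym (ex-sc (lit n))))

  opaque
    unfolding pair

    lit-pair : ∀ a b → lit (pair a b) ≃ pr (lit a) (lit b)
    lit-pair a b = sc-cong (trans (lit-+ ((a + b) * (a + b)) a)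
      (∔-cong (trans (lit-* (a + b) (a + b)) (·-cong (lit-+ a b) (lit-+ a b))) ≃-refl))

  lit-mono : ∀ {m n} → m ≤ n → lit m ≼ lit n
  lit-mono z≤n     = 0≼ _
  lit-mono (s≤s p) = sc-mono (lit-mono p)

  ≼lit : ∀ {x} n → x ≼ lit n → Cl (Σ[ k ∈ ℕ ] k ≤ n × x ≃ lit k)
  ≼lit zero    p = return (0 , z≤n , ≼0⇒≃0 p)
  ≼lit (suc n) p = ≼sc-split p >>= λ
    { (inj₁ q) → ≼lit n q >>= λ { (k , le , e) → return (k , ℕₚ.m≤n⇒m≤1+n le , e) }
    ; (inj₂ e) → return (suc n , ℕₚ.≤-refl , e) }

  lit-apart : ∀ {m n} → ¬ m ≡ n → lit m ≃ lit n → ⊥ᴵ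
  lit-apart {m} {n} ne e with ℕₚ.<-cmp m n
  ... | tri< lt _ _ = ≺⇒≄ (lit-mono lt) e
  ... | tri≈ _ eq _ = ⊥-elim (ne eq)
  ... | tri> _ _ gt = ≺⇒≄ (lit-mono gt) (sym e)

  val-lits : ∀ {n} (t : ATerm n) ns → val t (map lit ns) ≃ lit (⟦ t ⟧ ns)
  val-lits (var i) ns = ≡⇒≃ (lookup-map i lit ns)
  val-lits O       ns = ≃-refl
  val-lits (S t)   ns = sc-cong (val-lits t ns)
  val-lits (exp t) ns = trans (ex-cong (val-lits t ns)) (sym (lit-^ (⟦ t ⟧ ns)))
  val-lits (t ⊕ u) ns = trans (∔-cong (val-lits t ns) (val-lits u ns)) (sym (lit-+ (⟦ t ⟧ ns) (⟦ u ⟧ ns)))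
  val-lits (t ⊗ u) ns = trans (·-cong (val-lits t ns) (val-lits u ns)) (sym (lit-* (⟦ t ⟧ ns) (⟦ u ⟧ ns)))

  Decided : ∀ {n} → Δ₀ n → Vec ℕ n → Set
  Decided θ ns = ((ns ⊨ θ) × (map lit ns ⊩ θ)) ⊎ (¬ (ns ⊨ θ) × (map lit ns ⊩ θ → ⊥ᴵ))

  private
    decideBelow : ∀ {n} (θ : Δ₀ (suc n)) ns → (∀ k → Decided θ (k ∷ ns)) → ∀ N →
      (∀ k → k ≤ N → (k ∷ ns ⊨ θ) × (map lit (k ∷ ns) ⊩ θ)) ⊎
      (Σ[ k ∈ ℕ ] k ≤ N × ¬ (k ∷ ns ⊨ θ) × (map lit (k ∷ ns) ⊩ θ → ⊥ᴵ))
    decideBelow θ ns dec zero with dec 0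
    ... | inj₁ p       = inj₁ (λ { zero z≤n → p })
    ... | inj₂ (p , q) = inj₂ (0 , z≤n , p , q)
    decideBelow θ ns dec (suc N) with decideBelow θ ns dec N | dec (suc N)
    ... | inj₂ (k , le , p) | _ = inj₂ (k , ℕₚ.m≤n⇒m≤1+n le , p)
    ... | inj₁ h | inj₂ (p , q) = inj₂ (suc N , ℕₚ.≤-refl , p , q)
    ... | inj₁ h | inj₁ p       = inj₁ all
      where
      all : ∀ k → k ≤ suc N → _
      all k le with ℕₚ.m≤n⇒m<n∨m≡n le
      ... | inj₁ (s≤s lt) = h k lt
      ... | inj₂ ≡.refl   = p

  -- Truth in ℕ and truth in the model are settled together, because the implication clause needs
  -- the negative case as well. At bounded quantifiers every element below a standard number is,
  -- under `Cl`, standard.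
  decide : ∀ {n} (θ : Δ₀ n) ns → Decided θ ns
  decide (t ≈ u) ns with ⟦ t ⟧ ns ℕₚ.≟ ⟦ u ⟧ ns
  ... | yes e = inj₁ (e , trans (val-lits t ns) (trans (≡⇒≃ (cong lit e)) (sym (val-lits u ns))))
  ... | no ne = inj₂ (ne , λ e → lit-apart ne (trans (sym (val-lits t ns)) (trans e (val-lits u ns))))
  decide (t ≲ u) ns with ⟦ t ⟧ ns ℕₚ.≤? ⟦ u ⟧ ns
  ... | yes p = inj₁ (p , ≼-respˡ (sym (val-lits t ns)) (≼-respʳ (sym (val-lits u ns)) (lit-mono p)))
  ... | no ¬p = inj₂ (¬p , λ p → ≼-irrefl (≼-trans (lit-mono (ℕₚ.≰⇒> ¬p))
                    (≼-respˡ (val-lits t ns) (≼-respʳ (val-lits u ns) p))))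
  decide ff ns = inj₂ (id , id)
  decide (θ ⊃ χ) ns with decide θ ns | decide χ ns
  ... | _              | inj₁ (q , q′)  = inj₁ ((λ _ → q) , (λ _ → q′))
  ... | inj₁ (p , p′)  | inj₂ (¬q , q′) = inj₂ ((λ f → ¬q (f p)) , (λ f → q′ (f p′)))
  ... | inj₂ (¬p , p′) | inj₂ _         =
    inj₁ ((λ p → ⊥-elim (¬p p)) , (λ p → ex-falso χ (map lit ns) (p′ p)))
  decide (all≤ t θ) ns with decideBelow θ ns (λ k → decide θ (k ∷ ns)) (⟦ t ⟧ ns)
  ... | inj₁ h = inj₁ ((λ k le → proj₁ (h k le)) , λ x le →
      stable θ (x ∷ map lit ns) (≼lit (⟦ t ⟧ ns) (≼-respʳ (val-lits t ns) le) >>= λ { (k , le′ , e) →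
        return (⊩-resp θ (≃*-∷ (sym e) (≃*-refl {ρ = map lit ns})) (proj₂ (h k le′))) }))
  ... | inj₂ (k , le , ¬p , p′) = inj₂ ((λ f → ¬p (f k le)) ,
      λ f → p′ (f (lit k) (≼-respʳ (sym (val-lits t ns)) (lit-mono le))))

  -- This carries the accepting computations of axioms and the arities of the additional symbols
  -- into every model.
  absolute : ∀ {n} (θ : Δ₀ n) ns → (ns ⊨ θ) → map lit ns ⊩ θ
  absolute θ ns p with decide θ ns
  ... | inj₁ (_ , q) = q
  ... | inj₂ (¬p , _) = ⊥-elim (¬p p)

  -- Growth

  private
    1≼lit·e : ∀ {e} k → 1# ≼ e → lit k · e ∔ 1# ≼ lit (suc k) · e
    1≼lit·e {e} k p = ≼-respʳ (sym (*-scˡ (lit k) e)) (∔-mono ≼-refl p)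

    ex-sum : ∀ {a b e} → 1# ≼ e → ex a ∔ ex b ≼ ex ((a ∔ b) ∔ e)
    ex-sum {a} {b} {e} p = ≼-trans
      (∔-mono (ex-mono (x≼x∔y a b)) (ex-mono (x≼y∔x b a)))
      (≼-trans (≼-reflexive (sym (ex-sc (a ∔ b))))
        (ex-mono (≼-respˡ (sym (sc≃+1 (a ∔ b))) (∔-mono ≼-refl p))))

  poly-bound : ∀ {G} → Poly G → ∀ {u e} → 1# ≼ e → u ≼ ex e →
    val G (u ∷ []) ≼ ex (lit (degree G) · e)
  poly-bound var p q = ≼-respʳ (ex-cong (sym (*-1ˡ _))) q
  poly-bound O p q = 0≼ _
  poly-bound (S {t} P) {u} {e} p q = ≼-respˡ (sym (sc≃+1 _)) (≼-trans
    (∔-mono (poly-bound P p q) (1≼ex (lit (degree t) · e)))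
    (≼-trans (≼-reflexive (sym (ex-sc _))) (ex-mono (≼-respˡ (sym (sc≃+1 _)) (1≼lit·e (degree t) p)))))
  poly-bound (_⊕_ {t} {u} P Q) {e = e} p q = ≼-trans (∔-mono (poly-bound P p q) (poly-bound Q p q))
    (≼-trans (ex-sum p) (ex-mono (≼-reflexive (trans
      (∔-cong (sym (*-distribʳ e (lit (degree t)) (lit (degree u)))) ≃-refl)
      (trans (sym (*-scˡ _ e)) (·-cong (sc-cong (sym (lit-+ (degree t) (degree u)))) ≃-refl))))))
  poly-bound (_⊗_ {t} {u} P Q) {e = e} p q = ≼-trans (·-mono (poly-bound P p q) (poly-bound Q p q))
    (≼-reflexive (trans (sym (ex-+ _ _)) (ex-cong (trans
      (sym (*-distribʳ e (lit (degree t)) (lit (degree u))))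
      (·-cong (sym (lit-+ (degree t) (degree u))) ≃-refl)))))

  iter : ℕ → Carrier → Carrier → Carrier
  iter k β i = val (iterBound k) (β ∷ i ∷ [])

  iter-mono : ∀ k {β γ i j} → β ≼ γ → i ≼ j → iter k β i ≼ iter k γ j
  iter-mono k p q = val-mono (iterBound k) (≼*-∷ p (≼*-∷ q (λ ())))

  iter-start : ∀ k β i → β ≼ iter k β i
  iter-start k β i = ≼-trans (x≼scx β) (≼-trans (≼-respʳ (*-comm (sc β) _)
    (x≼x·y (sc β) (1≼ex _))) (x≼exx _))

  -- With the `i`-th bound written 2^e, the polynomial gives at most 2^(D e). As D ≤ 2^D, the factor
  -- `D` is absorbed when D · i grows to D · (i + 1) in the upper exponent.
  iter-step : ∀ {G} → Poly G → ∀ β i →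
    val G (iter (degree G) β i ∷ []) ≼ iter (degree G) β (sc i)
  iter-step {G} P β i rewrite val-litA {2} (degree G) {β ∷ i ∷ []} | val-litA {2} (degree G) {β ∷ sc i ∷ []} =
    ≼-trans (poly-bound P {e = e} 1≼e ≼-refl) (ex-mono le)
    where
    D e : Carrier
    D = lit (degree G)
    e = ex (D · i) · sc β
    1≼e : 1# ≼ e
    1≼e = ≼-trans (1≼ex (D · i)) (x≼x·y _ (sc-mono (0≼ β)))
    le : D · e ≼ ex (D · sc i) · sc β
    le = ≼-trans (·-mono (x≼exx D) ≼-refl) (≼-reflexive (begin
      ex D · (ex (D · i) · sc β)    ≈⟨ *-assoc _ _ _ ⟨
      ex D · ex (D · i) · sc β      ≈⟨ ·-cong (*-comm _ _) ≃-refl ⟩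
      ex (D · i) · ex D · sc β      ≈⟨ ·-cong (ex-+ _ _) ≃-refl ⟨
      ex (D · i ∔ D) · sc β         ≈⟨ ·-cong (ex-cong (*-sc D i)) ≃-refl ⟨
      ex (D · sc i) · sc β          ∎))

-- Primitive recursive functions and their graphs in a model

projs : ∀ {m n} → (Fin m → Fin n) → Vec (PR n) m
projs r = tabulate (proj ∘ r)

expP predP : PR 1
expP  = prec (litP 1) (comp plus (proj (# 1) ∷ proj (# 1) ∷ []))
predP = prec (litP 0) (proj (# 0))

-- monusP (y , x) is x ∸ y.
monusP : PR 2
monusP = prec (proj (# 0)) (comp predP (proj (# 1) ∷ []))

-- condP (c , a , b) is a if c = 0 and b otherwise.
condP : PR 3
condP = prec (proj (# 0)) (proj (# 3))

termP : ∀ {n} → ATerm n → PR n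
termP (var i) = proj i
termP O       = litP 0
termP (S t)   = comp succ (termP t ∷ [])
termP (exp t) = comp expP (termP t ∷ [])
termP (t ⊕ u) = comp plus (termP t ∷ termP u ∷ [])
termP (t ⊗ u) = comp times (termP t ∷ termP u ∷ [])

leP : ∀ {n} → ATerm n → ATerm n → PR n
leP t u = comp condP (comp monusP (termP u ∷ termP t ∷ []) ∷ litP 0 ∷ litP 1 ∷ [])

-- The value of charP θ is 0 if θ holds and 1 otherwise; allP θ (b , xs) decides
-- the conjunction of the θ (k , xs) with k ≤ b.
allP : ∀ {n} → PR (suc n) → PR (suc n)
allP χ = prec (comp χ (litP 0 ∷ projs id))
  (comp condP (proj (# 1) ∷ comp χ (comp succ (proj (# 0) ∷ []) ∷ projs (2 ↑ʳ_)) ∷ litP 1 ∷ []))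

charP : ∀ {n} → Δ₀ n → PR n
charP (t ≈ u)    = comp condP (leP t u ∷ leP u t ∷ litP 1 ∷ [])
charP (t ≲ u)    = leP t u
charP ff         = litP 1
charP (θ ⊃ χ)    = comp condP (charP θ ∷ charP χ ∷ litP 0 ∷ [])
charP (all≤ t θ) = comp (allP (charP θ)) (termP t ∷ projs id)

-- searchP θ (b , d) is the least k ≤ b with θ (k , d), if there is one.
searchP : Δ₀ 2 → PR 2
searchP θ = prec (litP 0) (comp condP
  (comp (charP θ) (proj (# 1) ∷ proj (# 2) ∷ []) ∷ proj (# 1) ∷ comp succ (proj (# 0) ∷ []) ∷ []))

module Recursive (𝓜 : IΔ₀Exp) where
  open IΔ₀Exp 𝓜
  open Laws 𝓜
  open Numerals 𝓜

  mutual
    GraphR : ∀ {n} → PR n → Vec Carrier n → Carrier → Set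
    GraphR zero        []       y = y ≃ 0#
    GraphR succ        (x ∷ []) y = y ≃ sc x
    GraphR (proj i)    xs       y = y ≃ lookup xs i
    GraphR (comp f gs) xs       y = Cl (Σ[ zs ∈ Vec Carrier _ ] GraphsR gs xs zs × GraphR f zs y)
    GraphR (prec f g)  (x ∷ xs) y = Cl (Σ[ s ∈ Carrier ] pr x y ∈ s
      × (∀ v → pr 0# v ∈ s → GraphR f xs v)
      × (∀ i v → pr (sc i) v ∈ s → Cl (Σ[ u ∈ Carrier ] pr i u ∈ s × GraphR g (i ∷ u ∷ xs) v)))

    GraphsR : ∀ {m n} → Vec (PR n) m → Vec Carrier n → Vec Carrier m → Set
    GraphsR []       xs []       = 0# ≃ 0#
    GraphsR (g ∷ gs) xs (z ∷ zs) = GraphR g xs z × GraphsR gs xs zs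

  -- The wrapper lets the function and its arguments be inferred.
  record GraphM {n} (f : PR n) (xs : Vec Carrier n) (y : Carrier) : Set where
    constructor gr
    field raw : GraphR f xs y
  open GraphM public

  infixr 5 _∷ᵍ_
  data GraphsM {n} (xs : Vec Carrier n) : ∀ {m} → Vec (PR n) m → Vec Carrier m → Set where
    []ᵍ  : GraphsM xs [] []
    _∷ᵍ_ : ∀ {m g z} {gs : Vec (PR n) m} {zs} →
      GraphM g xs z → GraphsM xs gs zs → GraphsM xs (g ∷ gs) (z ∷ zs)

  graphs-raw : ∀ {m n xs} {gs : Vec (PR n) m} {zs} → GraphsM xs gs zs → GraphsR gs xs zs
  graphs-raw []ᵍ      = ≃-refl
  graphs-raw (p ∷ᵍ q) = raw p , graphs-raw q

  graph-proj : ∀ {n} {xs : Vec Carrier n} {i} → GraphM (proj i) xs (lookup xs i)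
  graph-proj = gr ≃-refl

  graph-comp : ∀ {m n} {f : PR m} {gs : Vec (PR n) m} {xs zs y} →
    GraphsM xs gs zs → GraphM f zs y → GraphM (comp f gs) xs y
  graph-comp p q = gr (return (_ , graphs-raw p , raw q))

  graph-succ : ∀ {n} {g : PR n} {xs x y} → GraphM g xs x → y ≃ sc x → GraphM (comp succ (g ∷ [])) xs y
  graph-succ p e = graph-comp (p ∷ᵍ []ᵍ) (gr e)

  private
    raw-stable : ∀ {n} (f : PR n) xs {y} → Cl (GraphR f xs y) → GraphR f xs y
    raw-stable zero        []       p = stable≃ p
    raw-stable succ        (x ∷ []) p = stable≃ p
    raw-stable (proj i)    xs       p = stable≃ p
    raw-stable (comp f gs) xs       p = p >>= id
    raw-stable (prec f g)  (x ∷ xs) p = p >>= id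

    raw-respʳ : ∀ {n} (f : PR n) xs {y y′} → y ≃ y′ → GraphR f xs y → GraphR f xs y′
    raw-respʳ zero        []       e p = trans (sym e) p
    raw-respʳ succ        (x ∷ []) e p = trans (sym e) p
    raw-respʳ (proj i)    xs       e p = trans (sym e) p
    raw-respʳ (comp f gs) xs       e p = p >>= λ { (zs , q , r) → return (zs , q , raw-respʳ f zs e r) }
    raw-respʳ (prec f g)  (x ∷ xs) e p = p >>= λ { (s , q , r) → return (s , ∈-respˡ (pr-cong ≃-refl e) q , r) }

  graph-stable : ∀ {n} {f : PR n} {xs y} → Cl (GraphM f xs y) → GraphM f xs y
  graph-stable {f = f} {xs} p = gr (raw-stable f xs (p >>= λ q → return (raw q)))

  graph-respʳ : ∀ {n} {f : PR n} {xs y y′} → y ≃ y′ → GraphM f xs y → GraphM f xs y′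
  graph-respʳ {f = f} {xs} e p = gr (raw-respʳ f xs e (raw p))

  graph-projs : ∀ {m n} (r : Fin m → Fin n) xs τ → (∀ i → lookup xs (r i) ≡ lookup τ i) →
    GraphsM xs (projs r) τ
  graph-projs r xs []      h = []ᵍ
  graph-projs r xs (x ∷ τ) h = gr (≡⇒≃ (≡.sym (h fzero))) ∷ᵍ graph-projs (r ∘ fsuc) xs τ (h ∘ fsuc)

  graph-lit : ∀ {n} k (xs : Vec Carrier n) → GraphM (litP k) xs (lit k)
  graph-lit zero    xs = graph-comp []ᵍ (gr ≃-refl)
  graph-lit (suc k) xs = graph-succ (graph-lit k xs) ≃-refl

  -- A recursion is verified by a Δ₀-relation γ (i , v ; ρ) between arguments
  -- and values that is preserved downwards.
  graph-prec : ∀ {n k} {f : PR n} {g : PR (2 + n)} {xs} (γ : Fm (2 + k)) (ρ : Vec Carrier k) x y b →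
    (∀ v → ⟦ γ ⟧ᶠ (0# ∷ v ∷ ρ) → GraphM f xs v) →
    (∀ i v → sc i ≼ x → v ≼ b → ⟦ γ ⟧ᶠ (sc i ∷ v ∷ ρ) →
      Cl (Σ[ u ∈ Carrier ] u ≼ b × ⟦ γ ⟧ᶠ (i ∷ u ∷ ρ) × GraphM g (i ∷ u ∷ xs) v)) →
    y ≼ b → ⟦ γ ⟧ᶠ (x ∷ y ∷ ρ) → GraphM (prec f g) (x ∷ xs) y
  graph-prec {k = k} {f} {g} {xs} γ ρ x y b start step y≼b p = graph-stable do
      -- The course of values is obtained all at once, as the set of all pairs with argument up to
      -- `x` and value up to `b` that satisfy `γ`. The bound `b` is what makes this set available by
      -- comprehension.
      (s , _ , out , into) ← comprehension A (x ∷ b ∷ ρ) (pr x b)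
      let entry-in : ∀ i v → i ≼ x → v ≼ b → ⟦ γ ⟧ᶠ (i ∷ v ∷ ρ) → pr i v ∈ s
          entry-in i v i≼ v≼ q = into (pr i v) (pr-mono i≼ v≼)
            (return (i , i≼ , return (v , v≼ , ≃-refl , at i v (pr i v) .proj₂ q)))
          entry-out : ∀ i v → pr i v ∈ s → Cl (i ≼ x × v ≼ b × ⟦ γ ⟧ᶠ (i ∷ v ∷ ρ))
          entry-out i v m = do
            (i′ , i′≼ , c) ← proj₂ (out _ m)
            (v′ , v′≼ , e , q) ← c
            let (e₁ , e₂) = pr-inj e
            return (≼-respˡ (sym e₁) i′≼ , ≼-respˡ (sym e₂) v′≼ ,
              fm-resp γ (≃*-∷ (sym e₁) (≃*-∷ (sym e₂) (≃*-refl {ρ = ρ}))) (at i′ v′ (pr i v) .proj₁ q))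
      return (gr (return (s , entry-in x y ≼-refl y≼b p
        , (λ v m → raw (graph-stable (entry-out 0# v m >>= λ { (_ , _ , q) → return (start v q) })))
        , (λ i v m → entry-out (sc i) v m >>= λ { (i≼ , v≼ , q) → step i v i≼ v≼ q >>= λ { (u , u≼ , q′ , r) →
             return (u , entry-in i u (≼-trans (x≼scx i) i≼) u≼ q′ , raw r) } }))))
    where
    γ′ : Fm (5 + k)
    γ′ = γ ⟨ v1 ∷ v0 ∷ params 5 k ⟩
    A : Fm (3 + k)
    A = ∃ᶠ v1 (∃ᶠ v3 (v2 ≐ᶠ pairA v1 v0 ∧ᶠ γ′))
    at : ∀ i v j → (⟦ γ′ ⟧ᶠ (v ∷ i ∷ j ∷ x ∷ b ∷ ρ) → ⟦ γ ⟧ᶠ (i ∷ v ∷ ρ)) ×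
                   (⟦ γ ⟧ᶠ (i ∷ v ∷ ρ) → ⟦ γ′ ⟧ᶠ (v ∷ i ∷ j ∷ x ∷ b ∷ ρ))
    at i v j = subst (λ τ → ⟦ γ ⟧ᶠ (i ∷ v ∷ τ)) eq , subst (λ τ → ⟦ γ ⟧ᶠ (i ∷ v ∷ τ)) (≡.sym eq)
      where
      eq : vals (params 5 k) (v ∷ i ∷ j ∷ x ∷ b ∷ ρ) ≡ ρ
      eq = vals-params ρ (5 ↑ʳ_) (v ∷ i ∷ j ∷ x ∷ b ∷ ρ) (λ _ → ≡.refl)

  graph-plus : ∀ x y → GraphM plus (x ∷ y ∷ []) (x ∔ y)
  graph-plus x y = graph-prec (v1 ≐ᶠ v0 ⊕ v2) (y ∷ []) x _ (x ∔ y)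
    (λ v e → gr (trans e (+-0ˡ y)))
    (λ i v i≼ _ e → return (i ∔ y , ∔-mono (≼-trans (x≼scx i) i≼) ≼-refl , ≃-refl ,
      graph-succ graph-proj (trans e (+-scˡ i y))))
    ≼-refl ≃-refl

  graph-times : ∀ x y → GraphM times (x ∷ y ∷ []) (x · y)
  graph-times x y = graph-prec (v1 ≐ᶠ v0 ⊗ v2) (y ∷ []) x _ (x · y)
    (λ v e → graph-respʳ (sym (trans e (*-0ˡ y))) (graph-lit 0 _))
    (λ i v i≼ _ e → return (i · y , ·-mono (≼-trans (x≼scx i) i≼) ≼-refl , ≃-refl ,
      graph-comp (graph-proj ∷ᵍ graph-proj ∷ᵍ []ᵍ)
        (graph-respʳ (sym (trans e (trans (*-scˡ i y) (+-comm _ y)))) (graph-plus y (i · y)))))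
    ≼-refl ≃-refl

  graph-exp : ∀ x → GraphM expP (x ∷ []) (ex x)
  graph-exp x = graph-prec (v1 ≐ᶠ exp v0) [] x _ (ex x)
    (λ v e → graph-respʳ (sym (trans e ex-0)) (graph-lit 1 _))
    (λ i v i≼ _ e → return (ex i , ex-mono (≼-trans (x≼scx i) i≼) , ≃-refl ,
      graph-comp (graph-proj ∷ᵍ graph-proj ∷ᵍ []ᵍ)
        (graph-respʳ (sym (trans e (ex-sc i))) (graph-plus (ex i) (ex i)))))
    ≼-refl ≃-refl

  graph-pred : ∀ x y → Cl ((x ≃ 0# × y ≃ 0#) ⊎ x ≃ sc y) → GraphM predP (x ∷ []) y
  graph-pred x y p = graph-prec (v0 ≐ᶠ O ∧ᶠ v1 ≐ᶠ O ∨ᶠ v0 ≐ᶠ S v1) [] x y x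
    (λ v c → graph-stable (c >>= λ
      { (inj₁ (_ , e)) → return (graph-respʳ (sym e) (graph-lit 0 []))
      ; (inj₂ e) → absurd (sc≄0 (sym e)) }))
    (λ i v i≼ _ c → do
      inj₂ e ← c
        where inj₁ (e , _) → absurd (sc≄0 e)
      inj₂ (j , f) ← zeroOrSuc i
        where inj₁ f → return (0# , 0≼ x , return (inj₁ (f , ≃-refl)) , gr (sym (sc-inj e)))
      return (j , ≼-trans (≼-respʳ (sym f) (x≼scx j)) (≼-trans (x≼scx i) i≼)
             , return (inj₂ f) , gr (sym (sc-inj e))))
    (stable≼ (p >>= λ
      { (inj₁ (e , f)) → return (≼-respˡ (sym f) (0≼ x))
      ; (inj₂ e) → return (≼-respʳ (sym e) (x≼scx y)) }))
    p

  -- The relation describes truncated subtraction without naming it and can be followed downwards: a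
  -- value that still complements its argument to `x` comes from its successor, and a value 0 comes
  -- from 0 or, exactly where `x` is reached, from 1.
  graph-monus : ∀ y x z → Cl (z ∔ y ≃ x ⊎ (x ≼ y × z ≃ 0#)) → GraphM monusP (y ∷ x ∷ []) z
  graph-monus y x z p = graph-prec (v1 ⊕ v0 ≐ᶠ v2 ∨ᶠ v2 ≤ᶠ v0 ∧ᶠ v1 ≐ᶠ O) (x ∷ []) y z x
    (λ v c → gr (stable≃ (c >>= λ
      { (inj₁ e) → return (trans (sym (+-0 v)) e)
      ; (inj₂ (l , e)) → return (trans e (sym (≼0⇒≃0 l))) })))
    (λ i v i≼ _ c → do
      inj₂ (l , e) ← c
        where inj₁ e → do
                let e′ : sc v ∔ i ≃ x
                    e′ = trans (+-scˡ v i) (trans (sym (+-sc v i)) e)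
                return (sc v , ≼-respʳ e′ (x≼x∔y (sc v) i) , return (inj₁ e′) ,
                  graph-comp (graph-proj ∷ᵍ []ᵍ) (graph-pred (sc v) v (return (inj₂ ≃-refl))))
      inj₂ f ← ≼sc-split l
        where inj₁ l′ → return (0# , 0≼ x , return (inj₂ (l′ , ≃-refl)) ,
                graph-comp (graph-proj ∷ᵍ []ᵍ) (graph-pred 0# v (return (inj₁ (≃-refl , e)))))
      return (1# , ≼-respʳ (sym f) (sc-mono (0≼ i)) ,
        return (inj₁ (trans (+-scˡ 0# i) (trans (sc-cong (+-0ˡ i)) (sym f)))) ,
        graph-comp (graph-proj ∷ᵍ []ᵍ) (graph-pred 1# v (return (inj₂ (sc-cong (sym e)))))))
    (stable≼ (p >>= λ
      { (inj₁ e) → return (≼-respʳ e (x≼x∔y z y))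
      ; (inj₂ (_ , e)) → return (≼-respˡ (sym e) (0≼ x)) }))
    p

  private
    graph-cond : ∀ c a b y → Cl ((c ≃ 0# × y ≃ a) ⊎ (1# ≼ c × y ≃ b)) → GraphM condP (c ∷ a ∷ b ∷ []) y
    graph-cond c a b y p = graph-prec (v0 ≐ᶠ O ∧ᶠ v1 ≐ᶠ v2 ∨ᶠ S O ≤ᶠ v0 ∧ᶠ v1 ≐ᶠ v3)
      (a ∷ b ∷ []) c y (a ∔ b)
      (λ v q → gr (stable≃ (q >>= λ
        { (inj₁ (_ , e)) → return e
        ; (inj₂ (l , _)) → absurd (≼-irrefl l) })))
      (λ i v _ _ q → do
        inj₂ (_ , e) ← q
          where inj₁ (e , _) → absurd (sc≄0 e)
        inj₂ (j , f) ← zeroOrSuc i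
          where inj₁ f → return (a , x≼x∔y a b , return (inj₁ (f , ≃-refl)) , gr e)
        return (b , x≼y∔x b a , return (inj₂ (≼-respʳ (sym f) (sc-mono (0≼ j)) , ≃-refl)) , gr e))
      (stable≼ (p >>= λ
        { (inj₁ (_ , e)) → return (≼-respˡ (sym e) (x≼x∔y a b))
        ; (inj₂ (_ , e)) → return (≼-respˡ (sym e) (x≼y∔x b a)) }))
      p

  graph-then : ∀ {c a b y} → c ≃ 0# → y ≃ a → GraphM condP (c ∷ a ∷ b ∷ []) y
  graph-then e f = graph-cond _ _ _ _ (return (inj₁ (e , f)))

  graph-else : ∀ {c a b y} → 1# ≼ c → y ≃ b → GraphM condP (c ∷ a ∷ b ∷ []) y
  graph-else e f = graph-cond _ _ _ _ (return (inj₂ (e , f)))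

  graph-term : ∀ {n} (t : ATerm n) xs → GraphM (termP t) xs (val t xs)
  graph-term (var i) xs = graph-proj
  graph-term O       xs = graph-lit 0 xs
  graph-term (S t)   xs = graph-succ (graph-term t xs) ≃-refl
  graph-term (exp t) xs = graph-comp (graph-term t xs ∷ᵍ []ᵍ) (graph-exp _)
  graph-term (t ⊕ u) xs = graph-comp
    (graph-term t xs ∷ᵍ graph-term u xs ∷ᵍ []ᵍ) (graph-plus _ _)
  graph-term (t ⊗ u) xs = graph-comp
    (graph-term t xs ∷ᵍ graph-term u xs ∷ᵍ []ᵍ) (graph-times _ _)

  Decides : ∀ {n} → PR n → Vec Carrier n → Set → Set
  Decides χ xs A = Cl ((A × GraphM χ xs 0#) ⊎ ((A → ⊥ᴵ) × GraphM χ xs 1#))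

  graph-le : ∀ {n} (t u : ATerm n) xs → Decides (leP t u) xs (val t xs ≼ val u xs)
  graph-le t u xs = ≼-total (val t xs) (val u xs) >>= λ
    { (inj₁ l) → return (inj₁ (l , graph-comp
        (graph-comp terms (graph-monus _ _ 0# (return (inj₂ (l , ≃-refl))))
          ∷ᵍ graph-lit 0 xs ∷ᵍ graph-lit 1 xs ∷ᵍ []ᵍ)
        (graph-then ≃-refl ≃-refl)))
    ; (inj₂ l) → ≼⇒ l >>= λ { (d , e) → return (inj₂ ((λ l′ → ≼-irrefl (≼-trans l l′)) , graph-comp
        (graph-comp terms (graph-monus _ _ (sc d)
            (return (inj₁ (trans (+-scˡ d _) (trans (sym (+-sc d _)) e)))))
          ∷ᵍ graph-lit 0 xs ∷ᵍ graph-lit 1 xs ∷ᵍ []ᵍ)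
        (graph-else (sc-mono (0≼ d)) ≃-refl))) } }
    where
    ms : Vec (PR _) 2
    ms = termP u ∷ termP t ∷ []
    terms : GraphsM xs ms (val u xs ∷ val t xs ∷ [])
    terms = graph-term u xs ∷ᵍ graph-term t xs ∷ᵍ []ᵍ

  private
    AllBelow : ∀ {n} → Δ₀ (suc n) → ∀ k → Fm (suc k + n)
    AllBelow {n} θ k = ∀ᶠ v0 (⟪ θ ⟫ ⟨ v0 ∷ params (2 + k) n ⟩)

    valueᶠ : ∀ {n} → Δ₀ (suc n) → Fm (2 + n)
    valueᶠ θ = v1 ≐ᶠ O ∧ᶠ AllBelow θ 1 ∨ᶠ v1 ≐ᶠ S O ∧ᶠ (AllBelow θ 1 ⇒ᶠ ⟪ ff ⟫)

  -- `valueᶠ` ties the values 0 and 1 to the truth of the conjunction up to the argument. Such a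
  -- value and the decision of `χ` at the next point are given independently; combinations that
  -- disagree produce the falsum, from which the required equation or graph follows.
  graph-all : ∀ {n} (θ : Δ₀ (suc n)) χ xs → (∀ x → Decides χ (x ∷ xs) (x ∷ xs ⊩ θ)) →
    ∀ b → Decides (allP χ) (b ∷ xs) (∀ x → x ≼ b → x ∷ xs ⊩ θ)
  graph-all {n} θ χ xs dec b = lem (∀ x → x ≼ b → x ∷ xs ⊩ θ) >>= λ
      { (inj₁ p) → return (inj₁ (p , graph 0# (0≼ 1#) (return (inj₁ (≃-refl , into b 0# p)))))
      ; (inj₂ p) → return (inj₂ (p , graph 1# ≼-refl (return (inj₂ (≃-refl , p ∘ out b 1#))))) }
    where
    eq : ∀ x i v → vals (params 3 n) (x ∷ i ∷ v ∷ xs) ≡ xs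
    eq x i v = vals-params xs (3 ↑ʳ_) (x ∷ i ∷ v ∷ xs) (λ _ → ≡.refl)
    out : ∀ i v → ⟦ AllBelow θ 1 ⟧ᶠ (i ∷ v ∷ xs) → ∀ x → x ≼ i → x ∷ xs ⊩ θ
    out i v p x l = subst (λ τ → x ∷ τ ⊩ θ) (eq x i v) (p x l)
    into : ∀ i v → (∀ x → x ≼ i → x ∷ xs ⊩ θ) → ⟦ AllBelow θ 1 ⟧ᶠ (i ∷ v ∷ xs)
    into i v p x l = subst (λ τ → x ∷ τ ⊩ θ) (≡.sym (eq x i v)) (p x l)
    now : PR (2 + n)
    now = comp χ (comp succ (proj (# 0) ∷ []) ∷ projs (2 ↑ʳ_))
    later : ∀ i u {w} → GraphM χ (sc i ∷ xs) w → GraphM now (i ∷ u ∷ xs) w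
    later i u = graph-comp (graph-succ graph-proj ≃-refl
      ∷ᵍ graph-projs (2 ↑ʳ_) (i ∷ u ∷ xs) xs (λ _ → ≡.refl))
    first : ∀ {w} → GraphM χ (0# ∷ xs) w → GraphM (comp χ (litP 0 ∷ projs id)) xs w
    first = graph-comp (graph-lit 0 xs ∷ᵍ graph-projs id xs xs (λ _ → ≡.refl))
    zer : ∀ v → ⟦ valueᶠ θ ⟧ᶠ (0# ∷ v ∷ xs) → GraphM (comp χ (litP 0 ∷ projs id)) xs v
    zer v c = graph-stable (dec 0# >>= λ d → c >>= λ c → both d c)
      where
      both : _ → _ → Cl _
      both (inj₁ (_ , g)) (inj₁ (e , _)) = return (graph-respʳ (sym e) (first g))
      both (inj₂ (_ , g)) (inj₂ (e , _)) = return (graph-respʳ (sym e) (first g))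
      both (inj₁ (p , _)) (inj₂ (_ , q)) = absurd (q (into 0# v (λ x l →
        ≃-subst θ xs (sym (≼0⇒≃0 l)) p)))
      both (inj₂ (p , _)) (inj₁ (_ , q)) = absurd (p (out 0# v q 0# ≼-refl))
    step : ∀ i v → sc i ≼ b → v ≼ 1# → ⟦ valueᶠ θ ⟧ᶠ (sc i ∷ v ∷ xs) →
      Cl (Σ[ u ∈ Carrier ] u ≼ 1# × ⟦ valueᶠ θ ⟧ᶠ (i ∷ u ∷ xs) ×
        GraphM (comp condP (proj (# 1) ∷ now ∷ litP 1 ∷ [])) (i ∷ u ∷ xs) v)
    step i v _ _ c = do
      c ← c
      inj₁ p ← lem (∀ x → x ≼ i → x ∷ xs ⊩ θ)
        where inj₂ ¬p → return (1# , ≼-refl , return (inj₂ (≃-refl , ¬p ∘ out i 1#)) ,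
                graph-stable (dec (sc i) >>= λ d → return (failed c ¬p d)))
      d ← dec (sc i)
      return (0# , 0≼ 1# , return (inj₁ (≃-refl , into i 0# p)) , passed c p d)
      where
      go : ∀ {u w} → GraphM χ (sc i ∷ xs) w → GraphM condP (u ∷ w ∷ 1# ∷ []) v →
        GraphM (comp condP (proj (# 1) ∷ now ∷ litP 1 ∷ [])) (i ∷ u ∷ xs) v
      go {u} g = graph-comp (graph-proj ∷ᵍ later i u g ∷ᵍ graph-lit 1 _ ∷ᵍ []ᵍ)
      -- Composition evaluates all arguments of `condP`: even where an earlier failure already
      -- determines the result, a value of `χ` has to be exhibited.
      any-value : ∀ {A} → (A × GraphM χ (sc i ∷ xs) 0#) ⊎ ((A → ⊥ᴵ) × GraphM χ (sc i ∷ xs) 1#) →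
        Σ[ w ∈ Carrier ] GraphM χ (sc i ∷ xs) w
      any-value (inj₁ (_ , g)) = 0# , g
      any-value (inj₂ (_ , g)) = 1# , g
      failed : _ → ((∀ x → x ≼ i → x ∷ xs ⊩ θ) → ⊥ᴵ) → _ → GraphM (comp condP _) (i ∷ 1# ∷ xs) v
      failed (inj₁ (_ , q)) ¬p d = go (proj₂ (any-value d)) (graph-else ≼-refl
        (absurd≃ (¬p (λ x l → out (sc i) v q x (≼-trans l (x≼scx i))))))
      failed (inj₂ (e , _)) ¬p d = go (proj₂ (any-value d)) (graph-else ≼-refl e)
      passed : _ → (∀ x → x ≼ i → x ∷ xs ⊩ θ) → _ → GraphM (comp condP _) (i ∷ 0# ∷ xs) v
      passed (inj₁ (e , _)) p (inj₁ (_ , g)) = go g (graph-then ≃-refl e)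
      passed (inj₂ (e , _)) p (inj₂ (_ , g)) = go g (graph-then ≃-refl e)
      passed (inj₁ (_ , q)) p (inj₂ (¬a , g)) = go g (graph-then ≃-refl
        (absurd≃ (¬a (out (sc i) v q (sc i) ≼-refl))))
      passed (inj₂ (_ , ¬q)) p (inj₁ (a , g)) = go g (graph-then ≃-refl
        (absurd≃ (¬q (into (sc i) v (λ x l → stable θ (x ∷ xs) (≼sc-split l >>= λ
          { (inj₁ l′) → return (p x l′)
          ; (inj₂ e) → return (≃-subst θ xs (sym e) a) }))))))
    graph : ∀ y → y ≼ 1# → ⟦ valueᶠ θ ⟧ᶠ (b ∷ y ∷ xs) → GraphM (allP χ) (b ∷ xs) y
    graph y l p = graph-prec (valueᶠ θ) xs b y 1# zer step l p

  graph-char : ∀ {n} (θ : Δ₀ n) xs → Decides (charP θ) xs (xs ⊩ θ)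
  graph-char (t ≈ u) xs = graph-le t u xs >>= λ d → graph-le u t xs >>= λ d′ → return (both d d′)
    where
    both : _ → _ → _
    both (inj₁ (p , g)) (inj₁ (q , h)) = inj₁ (≼-antisym p q ,
      graph-comp (g ∷ᵍ h ∷ᵍ graph-lit 1 xs ∷ᵍ []ᵍ) (graph-then ≃-refl ≃-refl))
    both (inj₁ (p , g)) (inj₂ (q , h)) = inj₂ ((λ e → q (≼-reflexive (sym e))) ,
      graph-comp (g ∷ᵍ h ∷ᵍ graph-lit 1 xs ∷ᵍ []ᵍ) (graph-then ≃-refl ≃-refl))
    both (inj₂ (p , g)) (inj₁ (q , h)) = inj₂ ((λ e → p (≼-reflexive e)) ,
      graph-comp (g ∷ᵍ h ∷ᵍ graph-lit 1 xs ∷ᵍ []ᵍ) (graph-else ≼-refl ≃-refl))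
    both (inj₂ (p , g)) (inj₂ (q , h)) = inj₂ ((λ e → p (≼-reflexive e)) ,
      graph-comp (g ∷ᵍ h ∷ᵍ graph-lit 1 xs ∷ᵍ []ᵍ) (graph-else ≼-refl ≃-refl))
  graph-char (t ≲ u) xs = graph-le t u xs
  graph-char ff xs = return (inj₂ (id , graph-lit 1 xs))
  graph-char (θ ⊃ χ) xs = graph-char θ xs >>= λ d → graph-char χ xs >>= λ d′ → return (both d d′)
    where
    both : _ → _ → _
    both (inj₁ (p , g)) (inj₁ (q , h)) = inj₁ ((λ _ → q) ,
      graph-comp (g ∷ᵍ h ∷ᵍ graph-lit 0 xs ∷ᵍ []ᵍ) (graph-then ≃-refl ≃-refl))
    both (inj₁ (p , g)) (inj₂ (q , h)) = inj₂ ((λ f → q (f p)) ,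
      graph-comp (g ∷ᵍ h ∷ᵍ graph-lit 0 xs ∷ᵍ []ᵍ) (graph-then ≃-refl ≃-refl))
    both (inj₂ (p , g)) (inj₁ (q , h)) = inj₁ ((λ _ → q) ,
      graph-comp (g ∷ᵍ h ∷ᵍ graph-lit 0 xs ∷ᵍ []ᵍ) (graph-else ≼-refl ≃-refl))
    both (inj₂ (p , g)) (inj₂ (q , h)) = inj₁ ((λ a → ex-falso χ xs (p a)) ,
      graph-comp (g ∷ᵍ h ∷ᵍ graph-lit 0 xs ∷ᵍ []ᵍ) (graph-else ≼-refl ≃-refl))
  graph-char (all≤ t θ) xs = graph-all θ (charP θ) xs (λ x → graph-char θ (x ∷ xs)) (val t xs) >>= λ
    { (inj₁ (p , g)) → return (inj₁ (p , graph-comp bound g))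
    ; (inj₂ (p , g)) → return (inj₂ (p , graph-comp bound g)) }
    where
    bound : GraphsM xs (termP t ∷ projs id) (val t xs ∷ xs)
    bound = graph-term t xs ∷ᵍ graph-projs id xs xs (λ _ → ≡.refl)

  least : (θ : Δ₀ 2) → ∀ d b → b ∷ d ∷ [] ⊩ θ →
    Cl (Σ[ k ∈ Carrier ] k ≼ b × (k ∷ d ∷ [] ⊩ θ) × (∀ i → sc i ≼ k → i ∷ d ∷ [] ⊩ θ → ⊥ᴵ))
  least θ d b p = inductᶠ A {d ∷ []} base step b >>= λ
      { (inj₁ q) → q >>= λ { (k , k≼ , a , h) → return (k , k≼ , a , λ i l → h i (≼-trans (x≼scx i) l) l) }
      ; (inj₂ q) → absurd (q b ≼-refl p) }
    where
    A : Fm 2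
    A = ∃ᶠ v0 (⟪ θ ⟫ ⟨ v0 ∷ v2 ∷ [] ⟩ ∧ᶠ ∀ᶠ v0 (S v0 ≤ᶠ v1 ⇒ᶠ ⟪ θ ⟫ ⟨ v0 ∷ v3 ∷ [] ⟩ ⇒ᶠ ⟪ ff ⟫))
        ∨ᶠ ∀ᶠ v0 (⟪ θ ⟫ ⟨ v0 ∷ v2 ∷ [] ⟩ ⇒ᶠ ⟪ ff ⟫)
    base : ⟦ A ⟧ᶠ (0# ∷ d ∷ [])
    base = lem (0# ∷ d ∷ [] ⊩ θ) >>= λ
      { (inj₁ p) → return (inj₁ (return (0# , ≼-refl , p , λ i _ l _ → ≼-irrefl (≼-trans l (0≼ i)))))
      ; (inj₂ p) → return (inj₂ (λ i l q → p (≃-subst θ (d ∷ []) (≼0⇒≃0 l) q))) }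
    step : ∀ x → ⟦ A ⟧ᶠ (x ∷ d ∷ []) → ⟦ A ⟧ᶠ (sc x ∷ d ∷ [])
    step x ih = do
      inj₂ none ← ih
        where inj₁ q → return (inj₁ (q >>= λ { (k , k≼ , r) → return (k , ≼-trans k≼ (x≼scx x) , r) }))
      inj₂ p ← lem (sc x ∷ d ∷ [] ⊩ θ)
        where inj₁ p → return (inj₁ (return (sc x , ≼-refl , p , λ i _ l → none i (sc-anti l))))
      return (inj₂ (λ i l q → ⊥-run (≼sc-split l >>= λ
        { (inj₁ l′) → return (none i l′ q)
        ; (inj₂ e) → return (p (≃-subst θ (d ∷ []) e q)) })))

  -- The relation at stage `i` says that no solution lies below the value `v` and that `v` is a
  -- solution or equals `i`. It can be traced back: the value before `v` is `v` itself if v ≤ i, and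
  -- `i` if v = i + 1, since then `i` lies below `v` and is no solution.
  graph-search : (θ : Δ₀ 2) → ∀ b d {k} → k ≼ b → k ∷ d ∷ [] ⊩ θ →
    Cl (Σ[ y ∈ Carrier ] GraphM (searchP θ) (b ∷ d ∷ []) y × (y ∷ d ∷ [] ⊩ θ))
  graph-search θ b d {k} k≼b p = do
      (y , y≼k , q , min) ← least θ d k p
      let y≼b = ≼-trans y≼k k≼b
      return (y , graph-prec γ (d ∷ []) b y b
        (λ v (l , _) → graph-respʳ (sym (≼0⇒≃0 l)) (graph-lit 0 _))
        step y≼b (y≼b , (λ i _ l → min i l) , return (inj₁ q)) , q)
    where
    γ : Fm 3
    γ = v1 ≤ᶠ v0 ∧ᶠ ∀ᶠ v1 (S v0 ≤ᶠ v2 ⇒ᶠ ⟪ θ ⟫ ⟨ v0 ∷ v3 ∷ [] ⟩ ⇒ᶠ ⟪ ff ⟫)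
        ∧ᶠ (⟪ θ ⟫ ⟨ v1 ∷ v2 ∷ [] ⟩ ∨ᶠ v1 ≐ᶠ v0)
    test = comp (charP θ) (proj (# 1) ∷ proj (# 2) ∷ [])
    gs = test ∷ proj (# 1) ∷ comp succ (proj (# 0) ∷ []) ∷ []
    go : ∀ i u {c v} → GraphM (charP θ) (u ∷ d ∷ []) c → GraphM condP (c ∷ u ∷ sc i ∷ []) v →
      GraphM (comp condP gs) (i ∷ u ∷ d ∷ []) v
    go i u g = graph-comp
      (graph-comp (graph-proj ∷ᵍ graph-proj ∷ᵍ []ᵍ) g
        ∷ᵍ graph-proj ∷ᵍ graph-succ graph-proj ≃-refl ∷ᵍ []ᵍ)
    step : ∀ i v → sc i ≼ b → v ≼ b → ⟦ γ ⟧ᶠ (sc i ∷ v ∷ d ∷ []) →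
      Cl (Σ[ u ∈ Carrier ] u ≼ b × ⟦ γ ⟧ᶠ (i ∷ u ∷ d ∷ []) × GraphM (comp condP gs) (i ∷ u ∷ d ∷ []) v)
    step i v i≼ v≼ (l , min , c) = do
      c ← c
      inj₁ l′ ← ≼sc-split l
        where inj₂ e → do
                let ¬p : i ∷ d ∷ [] ⊩ θ → ⊥ᴵ
                    ¬p = min i (≼-respʳ (sym e) (x≼scx i)) (≼-reflexive (sym e))
                inj₂ (_ , g) ← graph-char θ (i ∷ d ∷ [])
                  where inj₁ (q , _) → absurd (¬p q)
                return (i , ≼-trans (x≼scx i) i≼ ,
                  (≼-refl , (λ j _ l → min j (≼-trans (x≼scx j) (below j l e)) (below j l e)) , return (inj₂ ≃-refl)) ,
                  go i i g (graph-else ≼-refl e))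
      inj₁ q ← return c
        where inj₂ e → absurd (≼-irrefl (≼-respˡ e l′))
      inj₁ (_ , g) ← graph-char θ (v ∷ d ∷ [])
        where inj₂ (¬q , _) → absurd (¬q q)
      return (v , v≼ , (l′ , min , return (inj₁ q)) , go i v g (graph-then ≃-refl ≃-refl))
      where
      below : ∀ j → sc j ≼ i → v ≃ sc i → sc j ≼ v
      below j l e = ≼-respʳ (sym e) (≼-trans l (x≼scx i))

  opaque
    unfolding pairP

    graph-pair : ∀ {n} (f g : PR n) xs {a b} → GraphM f xs a → GraphM g xs b →
      GraphM (pairP f g) xs (pr a b)
    graph-pair f g xs {a} {b} p q = graph-succ
      (graph-comp (graph-comp (sum ∷ᵍ sum ∷ᵍ []ᵍ) (graph-times _ _) ∷ᵍ p ∷ᵍ []ᵍ) (graph-plus _ _)) ≃-refl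
      where
      sum : GraphM (comp plus (f ∷ g ∷ [])) xs (a ∔ b)
      sum = graph-comp (p ∷ᵍ q ∷ᵍ []ᵍ) (graph-plus _ _)

-- The clauses of Judgements as data

module JudgementCodes {A : Set} (lit : ℕ → A) (pair : A → A → A) where

  open Codes lit pair public

  node : A → A → A
  node = pair

  ruleAx ruleElim ruleSubst ruleGen : A → A
  ruleAx w    = pair (lit 0) w
  ruleElim t  = pair (lit 4) t
  ruleSubst φ = pair (lit 8) φ
  ruleGen d   = pair (lit 10) d

  ruleK ruleS ruleDNE ruleDist ruleVac ruleRefl : A
  ruleK    = pair (lit 1) (lit 0)
  ruleS    = pair (lit 2) (lit 0)
  ruleDNE  = pair (lit 3) (lit 0)
  ruleDist = pair (lit 5) (lit 0)
  ruleVac  = pair (lit 6) (lit 0)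
  ruleRefl = pair (lit 7) (lit 0)

  ruleMp : A → A → A
  ruleMp d e = pair (lit 9) (pair d e)

  jTerm jFormula jDeriv : A → A
  jTerm a    = pair (lit 0) a
  jFormula a = pair (lit 2) a
  jDeriv a   = pair (lit 3) a

  jTerms : A → A → A
  jTerms k a = pair (lit 1) (pair k a)

  jSubst : A → A → A → A → A
  jSubst k σ a b = pair (lit 4) (pair (pair k σ) (pair a b))

-- As data, the clauses admit one argument for all of them about bounds, monotonicity in the set and
-- closure under rules. That the data spell out `justified` is checked by computation in
-- `justified-clauses`.
data Pattern : Set where
  pvar  : Fin 6 → Pattern
  plit  : ℕ → Pattern
  psuc  : Pattern → Pattern
  ppair : Pattern → Pattern → Pattern

toA : Pattern → ATerm 6
toA (pvar i)    = var i
toA (plit k)    = litA k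
toA (psuc p)    = S (toA p)
toA (ppair p q) = pairA (toA p) (toA q)

occurs : Fin 6 → Pattern → Bool
occurs i (pvar j)    = does (i Finₚ.≟ j)
occurs i (plit k)    = false
occurs i (psuc p)    = occurs i p
occurs i (ppair p q) = occurs i p ∨ occurs i q

data Condition : Set where
  member : Pattern → Condition
  side   : Δ₀ 2 → Fin 6 → Fin 6 → Condition

record Clause : Set where
  constructor _⟸_
  field
    conclusion : Pattern
    conditions : List Condition
open Clause

infix 3 _⟸_

conditionF : Condition → Fm 8
conditionF (member p)   = renT (_↑ˡ 2) (toA p) ∈ᶠ var (# 7)
conditionF (side θ i j) = ⟪ pick θ (i ↑ˡ 2) (j ↑ˡ 2) ⟫

clauseFrom : Fm 8 → List Condition → Fm 8
clauseFrom A []       = A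
clauseFrom A (c ∷ cs) = A ∧ᶠ clauseFrom (conditionF c) cs

clauseF : Clause → Fm 8
clauseF (p ⟸ cs) = clauseFrom (var (# 6) ≐ᶠ renT (_↑ˡ 2) (toA p)) cs

clauses : Theory L → List Clause
clauses {L} T =
    (jTerm (c-var a) ⟸ [])
  ∷ (jTerm (c-fn a b) ⟸ side (funAr L) iA iC ∷ member (jTerms c b) ∷ [])
  ∷ (jTerms (plit 0) c-nil ⟸ [])
  ∷ (jTerms (psuc a) (c-cons b c) ⟸ member (jTerm b) ∷ member (jTerms a c) ∷ [])
  ∷ (jFormula (c-rel a b) ⟸ side (relAr L) iA iC ∷ member (jTerms c b) ∷ [])
  ∷ (jFormula c-⊥ ⟸ [])
  ∷ (jFormula (c-imp a b) ⟸ member (jFormula a) ∷ member (jFormula b) ∷ [])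
  ∷ (jFormula (c-all a) ⟸ member (jFormula a) ∷ [])
  ∷ (jSubst (plit 0) (plit 0) (c-var a) (c-var (psuc a)) ⟸ [])
  ∷ (jSubst (plit 0) (psuc a) (c-var (plit 0)) a ⟸ [])
  ∷ (jSubst (plit 0) (psuc a) (c-var (psuc b)) (c-var b) ⟸ [])
  ∷ (jSubst (psuc a) b (c-var (plit 0)) (c-var (plit 0)) ⟸ [])
  ∷ (jSubst (psuc a) b (c-var (psuc c)) d ⟸
      member (jSubst a b (c-var c) e) ∷ member (jSubst (plit 0) (plit 0) e d) ∷ [])
  ∷ (jSubst a b (c-fn c d) (c-fn c e) ⟸ member (jSubst a b d e) ∷ [])
  ∷ (jSubst a b c-nil c-nil ⟸ [])
  ∷ (jSubst a b (c-cons c d) (c-cons e f) ⟸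
      member (jSubst a b c e) ∷ member (jSubst a b d f) ∷ [])
  ∷ (jSubst a b (c-rel c d) (c-rel c e) ⟸ member (jSubst a b d e) ∷ [])
  ∷ (jSubst a b c-⊥ c-⊥ ⟸ [])
  ∷ (jSubst a b (c-imp c d) (c-imp e f) ⟸
      member (jSubst a b c e) ∷ member (jSubst a b d f) ∷ [])
  ∷ (jSubst a b (c-all c) (c-all d) ⟸ member (jSubst (psuc a) b c d) ∷ [])
  ∷ (jDeriv (node a (ruleAx b)) ⟸ member (jFormula a) ∷ side (Theory.yes T) iB iA ∷ [])
  ∷ logical (c-imp a (c-imp b a)) ruleK []
  ∷ logical (c-imp (c-imp a (c-imp b c)) (c-imp (c-imp a b) (c-imp a c))) ruleS []
  ∷ logical (c-imp (c-imp (c-imp a c-⊥) c-⊥) a) ruleDNE []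
  ∷ logical (c-imp (c-all a) b) (ruleElim c)
      (member (jTerm c) ∷ member (jSubst (plit 0) (psuc c) a b) ∷ [])
  ∷ logical (c-imp (c-all (c-imp a b)) (c-imp (c-all a) (c-all b))) ruleDist []
  ∷ logical (c-imp a (c-all b)) ruleVac (member (jSubst (plit 0) (plit 0) a b) ∷ [])
  ∷ logical (c-eq a a) ruleRefl []
  ∷ logical (c-imp (c-eq a b) (c-imp c d)) (ruleSubst e)
      (member (jFormula e) ∷ member (jSubst (plit 0) (psuc a) e c)
        ∷ member (jSubst (plit 0) (psuc b) e d) ∷ [])
  ∷ (jDeriv (node b (ruleMp (node (c-imp a b) c) (node a d))) ⟸
      member (jDeriv (node (c-imp a b) c)) ∷ member (jDeriv (node a d)) ∷ [])
  ∷ (jDeriv (node (c-all a) (ruleGen (node a b))) ⟸ member (jDeriv (node a b)) ∷ [])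
  ∷ []
  where
  open JudgementCodes plit ppair
  iA iB iC : Fin 6
  iA = # 5
  iB = # 4
  iC = # 3
  a b c d e f : Pattern
  a = pvar iA
  b = pvar iB
  c = pvar iC
  d = pvar (# 2)
  e = pvar (# 1)
  f = pvar (# 0)
  logical : Pattern → Pattern → List Condition → Clause
  logical φ r cs = jDeriv (node φ r) ⟸ member (jFormula φ) ∷ cs

⋁ᶠ : ∀ {n} → List (Fm n) → Fm n
⋁ᶠ = foldr _∨ᶠ_ ⟪ ff ⟫

clausesF : List Clause → Fm 2
clausesF cls =
  ∃ᶠ (var (# 0)) (∃ᶠ (var (# 1)) (∃ᶠ (var (# 2))
    (∃ᶠ (var (# 3)) (∃ᶠ (var (# 4)) (∃ᶠ (var (# 5)) (⋁ᶠ (mapL clauseF cls)))))))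

justified-clauses : ∀ (T : Theory L) → toΔ₀ (clausesF (clauses T)) ≡ justified T
justified-clauses T = ≡.refl

-- Opaque, so that the type checker does not unfold the semantics of all
-- clauses when it compares types.
opaque
  justifiedΔ : Theory L → Δ₀ 2
  justifiedΔ = justified

  justifiedΔ-def : ∀ (T : Theory L) → justifiedΔ T ≡ justified T
  justifiedΔ-def T = ≡.refl

-- Self-justifying sets of judgements

module Derivability {L : Language} (T : Theory L) (𝓜 : IΔ₀Exp) where
  open IΔ₀Exp 𝓜
  open Laws 𝓜
  open Numerals 𝓜
  open JudgementCodes lit pr public

  valP : Pattern → Vec Carrier 6 → Carrier
  valP (pvar i)    ρ = lookup ρ i
  valP (plit k)    ρ = lit k
  valP (psuc p)    ρ = sc (valP p ρ)
  valP (ppair p q) ρ = pr (valP p ρ) (valP q ρ)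

  val-toA : ∀ p ρ → val (toA p) ρ ≡ valP p ρ
  val-toA (pvar i)    ρ = ≡.refl
  val-toA (plit k)    ρ = val-litA k
  val-toA (psuc p)    ρ = cong sc (val-toA p ρ)
  val-toA (ppair p q) ρ = cong₂ pr (val-toA p ρ) (val-toA q ρ)

  occurs-≼ : ∀ i p ρ → occurs i p ≡ true → lookup ρ i ≼ valP p ρ
  occurs-≼ i (pvar j) ρ o with i Finₚ.≟ j
  ... | yes ≡.refl = ≼-refl
  occurs-≼ i (psuc p) ρ o = ≼-trans (occurs-≼ i p ρ o) (x≼scx _)
  occurs-≼ i (ppair p q) ρ o with occurs i p in eq
  ... | true  = ≼-trans (occurs-≼ i p ρ eq) (fst≼pr _ _)
  ... | false = ≼-trans (occurs-≼ i q ρ o) (snd≼pr _ _)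

  Holds : (Pattern → Set) → Vec Carrier 6 → List Condition → Set
  Holds P ρ []                  = ⊤
  Holds P ρ (member p ∷ cs)     = P p × Holds P ρ cs
  Holds P ρ (side θ i j ∷ cs)   = (lookup ρ i ∷ lookup ρ j ∷ [] ⊩ θ) × Holds P ρ cs

  Holds-map : ∀ {P Q : Pattern → Set} → (∀ p → P p → Q p) → ∀ {ρ} cs → Holds P ρ cs → Holds Q ρ cs
  Holds-map h []                h′      = tt
  Holds-map h (member p ∷ cs)   (x , y) = h p x , Holds-map h cs y
  Holds-map h (side _ _ _ ∷ cs) (x , y) = x , Holds-map h cs y

  pick→ : ∀ {n} (θ : Δ₀ 2) i j {ρ : Vec Carrier n} →
    ρ ⊩ pick θ i j → lookup ρ i ∷ lookup ρ j ∷ [] ⊩ θ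
  pick→ θ i j {ρ} = ren→ _ (λ { fzero → ≡.refl ; (fsuc fzero) → ≡.refl }) θ

  pick← : ∀ {n} (θ : Δ₀ 2) i j {ρ : Vec Carrier n} →
    lookup ρ i ∷ lookup ρ j ∷ [] ⊩ θ → ρ ⊩ pick θ i j
  pick← θ i j {ρ} = ren← _ (λ { fzero → ≡.refl ; (fsuc fzero) → ≡.refl }) θ

  private
    infixr 5 _++₂_
    _++₂_ : Vec Carrier 6 → Vec Carrier 2 → Vec Carrier 8
    (f ∷ e ∷ d ∷ c ∷ b ∷ a ∷ []) ++₂ τ = f ∷ e ∷ d ∷ c ∷ b ∷ a ∷ τ

    lookup-++₂ : ∀ ρ τ i → lookup (ρ ++₂ τ) (i ↑ˡ 2) ≡ lookup ρ i
    lookup-++₂ (f ∷ e ∷ d ∷ c ∷ b ∷ a ∷ []) τ fzero = ≡.refl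
    lookup-++₂ (f ∷ e ∷ d ∷ c ∷ b ∷ a ∷ []) τ (fsuc fzero) = ≡.refl
    lookup-++₂ (f ∷ e ∷ d ∷ c ∷ b ∷ a ∷ []) τ (fsuc (fsuc fzero)) = ≡.refl
    lookup-++₂ (f ∷ e ∷ d ∷ c ∷ b ∷ a ∷ []) τ (fsuc (fsuc (fsuc fzero))) = ≡.refl
    lookup-++₂ (f ∷ e ∷ d ∷ c ∷ b ∷ a ∷ []) τ (fsuc (fsuc (fsuc (fsuc fzero)))) = ≡.refl
    lookup-++₂ (f ∷ e ∷ d ∷ c ∷ b ∷ a ∷ []) τ (fsuc (fsuc (fsuc (fsuc (fsuc fzero))))) = ≡.refl

    val-++₂ : ∀ ρ τ p → val (renT (_↑ˡ 2) (toA p)) (ρ ++₂ τ) ≡ valP p ρ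
    val-++₂ ρ τ p = ≡.trans (val-ren (_↑ˡ 2) (lookup-++₂ ρ τ) (toA p)) (val-toA p ρ)

    lookup-7 : ∀ ρ j w → lookup (ρ ++₂ (j ∷ w ∷ [])) (# 7) ≡ w
    lookup-7 (f ∷ e ∷ d ∷ c ∷ b ∷ a ∷ []) j w = ≡.refl

    InSet : Vec Carrier 6 → Carrier → Pattern → Set
    InSet ρ w p = valP p ρ ∈ w

    clauseFrom→ : ∀ A ρ j w cs → ⟦ clauseFrom A cs ⟧ᶠ (ρ ++₂ (j ∷ w ∷ [])) →
      ⟦ A ⟧ᶠ (ρ ++₂ (j ∷ w ∷ [])) × Holds (InSet ρ w) ρ cs
    clauseFrom→ A ρ j w [] p = p , tt
    clauseFrom→ A ρ j w (c ∷ cs) (p , q) with clauseFrom→ (conditionF c) ρ j w cs q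
    clauseFrom→ A ρ j w (member t ∷ cs) (p , _) | m , r =
      p , subst₂ _∈_ (val-++₂ ρ _ t) (lookup-7 ρ j w) m , r
    clauseFrom→ A ρ j w (side θ i k ∷ cs) (p , _) | m , r =
      p , subst₂ (λ x y → x ∷ y ∷ [] ⊩ θ) (lookup-++₂ ρ _ i) (lookup-++₂ ρ _ k) (pick→ θ _ _ m) , r

    clauseFrom← : ∀ A ρ j w cs → ⟦ A ⟧ᶠ (ρ ++₂ (j ∷ w ∷ [])) → Holds (InSet ρ w) ρ cs →
      ⟦ clauseFrom A cs ⟧ᶠ (ρ ++₂ (j ∷ w ∷ []))
    clauseFrom← A ρ j w [] p q = p
    clauseFrom← A ρ j w (member t ∷ cs) p (m , q) = p , clauseFrom← _ ρ j w cs
      (subst₂ _∈_ (≡.sym (val-++₂ ρ _ t)) (≡.sym (lookup-7 ρ j w)) m) q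
    clauseFrom← A ρ j w (side θ i k ∷ cs) p (m , q) = p , clauseFrom← _ ρ j w cs
      (pick← θ _ _ (subst₂ (λ x y → x ∷ y ∷ [] ⊩ θ)
        (≡.sym (lookup-++₂ ρ _ i)) (≡.sym (lookup-++₂ ρ _ k)) m)) q

    ⋁→ : ∀ {n} {τ : Vec Carrier n} (f : Clause → Fm n) cls → ⟦ ⋁ᶠ (mapL f cls) ⟧ᶠ τ →
      Cl (Σ[ k ∈ Fin (length cls) ] ⟦ f (lookupL cls k) ⟧ᶠ τ)
    ⋁→ f [] p = absurd p
    ⋁→ f (x ∷ cls) p = p >>= λ
      { (inj₁ q) → return (fzero , q)
      ; (inj₂ q) → ⋁→ f cls q >>= λ { (k , r) → return (fsuc k , r) } }

    ⋁← : ∀ {n} {τ : Vec Carrier n} (f : Clause → Fm n) cls k →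
      ⟦ f (lookupL cls k) ⟧ᶠ τ → ⟦ ⋁ᶠ (mapL f cls) ⟧ᶠ τ
    ⋁← f (x ∷ cls) fzero    p = return (inj₁ p)
    ⋁← f (x ∷ cls) (fsuc k) p = return (inj₂ (⋁← f cls k p))

    JustifiedBy : List Clause → Carrier → Carrier → Set
    JustifiedBy cls j w = ⟦ clausesF cls ⟧ᶠ (j ∷ w ∷ [])

    justifyBy : ∀ cls k ρ {j w} → (∀ i → lookup ρ i ≼ j) → j ≃ valP (conclusion (lookupL cls k)) ρ →
      Holds (InSet ρ w) ρ (conditions (lookupL cls k)) → JustifiedBy cls j w
    justifyBy cls k ρ@(f ∷ e ∷ d ∷ c ∷ b ∷ a ∷ []) {j} {w} bnd eq h =
      return (a , bnd (# 5) , return (b , bnd (# 4) , return (c , bnd (# 3) , return (d , bnd (# 2) ,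
        return (e , bnd (# 1) , return (f , bnd (# 0) , ⋁← clauseF cls k
          (clauseFrom← _ ρ j w (conditions (lookupL cls k))
            (≡.subst (j ≃_) (≡.sym (val-++₂ ρ _ (conclusion (lookupL cls k)))) eq) h)))))))

    justifiedBy-mono : ∀ cls {j w w′} → (∀ {i} → i ∈ w → i ∈ w′) →
      JustifiedBy cls j w → JustifiedBy cls j w′
    justifiedBy-mono cls {j} {w} {w′} sub p = do
      (a , a≼ , p) ← p
      (b , b≼ , p) ← p
      (c , c≼ , p) ← p
      (d , d≼ , p) ← p
      (e , e≼ , p) ← p
      (f , f≼ , p) ← p
      (k , q) ← ⋁→ clauseF cls p
      let ρ = f ∷ e ∷ d ∷ c ∷ b ∷ a ∷ []
          (eq , h) = clauseFrom→ (var (# 6) ≐ᶠ renT (_↑ˡ 2) (toA (conclusion (lookupL cls k))))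
                       ρ j w (conditions (lookupL cls k)) q
      justifyBy cls k ρ (λ { fzero → f≼ ; (fsuc fzero) → e≼ ; (fsuc (fsuc fzero)) → d≼
          ; (fsuc (fsuc (fsuc fzero))) → c≼ ; (fsuc (fsuc (fsuc (fsuc fzero)))) → b≼
          ; (fsuc (fsuc (fsuc (fsuc (fsuc fzero))))) → a≼ })
        (≡.subst (j ≃_) (val-++₂ ρ _ (conclusion (lookupL cls k))) eq)
        (Holds-map (λ _ → sub) (conditions (lookupL cls k)) h)

    module _ (cls : List Clause) (θ : Δ₀ 2) (eqn : toΔ₀ (clausesF cls) ≡ θ) where

      justifyΔ : ∀ k ρ {j w} → (∀ i → lookup ρ i ≼ j) → j ≃ valP (conclusion (lookupL cls k)) ρ →
        Holds (InSet ρ w) ρ (conditions (lookupL cls k)) → j ∷ w ∷ [] ⊩ θ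
      justifyΔ k ρ {j} {w} bnd eq h = subst (j ∷ w ∷ [] ⊩_) eqn
        (fm← (clausesF cls) (justifyBy cls k ρ {j} {w} bnd eq h))

      monoΔ : ∀ {j w w′} → (∀ {i} → i ∈ w → i ∈ w′) → j ∷ w ∷ [] ⊩ θ → j ∷ w′ ∷ [] ⊩ θ
      monoΔ {j} {w} {w′} sub p = subst (j ∷ w′ ∷ [] ⊩_) eqn
        (fm← (clausesF cls) (justifiedBy-mono cls {j} {w} {w′} sub
          (fm→ (clausesF cls) (subst (j ∷ w ∷ [] ⊩_) (≡.sym eqn) p))))

  ClauseIndex : Set
  ClauseIndex = Fin (length (clauses T))

  clause : ClauseIndex → Clause
  clause = lookupL (clauses T)

  Justified : Carrier → Carrier → Set
  Justified j w = j ∷ w ∷ [] ⊩ justifiedΔ T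

  stableJ : ∀ {j w} → Cl (Justified j w) → Justified j w
  stableJ = stable (justifiedΔ T) _

  private
    eqn : toΔ₀ (clausesF (clauses T)) ≡ justifiedΔ T
    eqn = ≡.trans (justified-clauses T) (≡.sym (justifiedΔ-def T))

  justify : ∀ k ρ {j w} → (∀ i → lookup ρ i ≼ j) → j ≃ valP (conclusion (clause k)) ρ →
    Holds (InSet ρ w) ρ (conditions (clause k)) → Justified j w
  justify = justifyΔ (clauses T) (justifiedΔ T) eqn

  justified-mono : ∀ {j w w′} → (∀ {i} → i ∈ w → i ∈ w′) → Justified j w → Justified j w′
  justified-mono = monoΔ (clauses T) (justifiedΔ T) eqn

  justified-resp : ∀ {i j w} → i ≃ j → Justified i w → Justified j w
  justified-resp {w = w} = ≃-subst (justifiedΔ T) (w ∷ [])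

  -- Der q j: the judgement j has a justification of the size allowed by Proof
  -- for a derivation q.

  bound : Carrier → Carrier
  bound q = jSubst q (sc q) q q

  boundA : ∀ {n} → ATerm n → ATerm n
  boundA q = Judgements.j-subst q (S q) q q

  Justifies : Carrier → Carrier → Set
  Justifies q w = ∀ i → i ∈ w → i ≼ bound q × Justified i w

  Der : Carrier → Carrier → Set
  Der q j = Cl (Σ[ w ∈ Carrier ] w ≼ ex (sc (bound q)) × Justifies q w × j ∈ w)

  derF : Fm 2
  derF = ∃ᶠ (exp (S (boundA v0))) (∀ᶠ v0 (v0 ∈ᶠ v1 ⇒ᶠ
    (v0 ≤ᶠ boundA v2 ∧ᶠ ⟪ justifiedΔ T ⟫ ⟨ v0 ∷ v1 ∷ [] ⟩)) ∧ᶠ v2 ∈ᶠ v0)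

  ∈⇒≼ : ∀ {i w} → i ∈ w → i ≼ w
  ∈⇒≼ {i} m = ≼-trans (x≼exx i) (∈⇒ex≼ m)

  der→ : ∀ {q j} → ⟦ derF ⟧ᶠ (q ∷ j ∷ []) → Der q j
  der→ p = p >>= λ { (w , l , h , m) →
    return (w , l , (λ i m → h i (∈⇒≼ m) m) , m) }

  der← : ∀ {q j} → Der q j → ⟦ derF ⟧ᶠ (q ∷ j ∷ [])
  der← p = p >>= λ { (w , l , h , m) →
    return (w , l , (λ i _ m → h i m) , m) }

  der-resp : ∀ {q i j} → i ≃ j → Der q i → Der q j
  der-resp e p = p >>= λ { (w , l , h , m) → return (w , l , h , ∈-respˡ e m) }

  jTerm-mono : ∀ {a q} → a ≼ q → jTerm a ≼ bound q
  jTerm-mono p = pr-mono (0≼ _) (≼-trans p (≼-trans (fst≼pr _ _) (snd≼pr _ _)))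

  jTerms-mono : ∀ {k a q} → k ≼ q → a ≼ q → jTerms k a ≼ bound q
  jTerms-mono p r = pr-mono (lit-mono {1} {4} (s≤s z≤n))
    (pr-mono (≼-trans p (fst≼pr _ _)) (≼-trans r (fst≼pr _ _)))

  jFormula-mono : ∀ {a q} → a ≼ q → jFormula a ≼ bound q
  jFormula-mono p = pr-mono (lit-mono {2} {4} (s≤s (s≤s z≤n))) (≼-trans p (≼-trans (fst≼pr _ _) (snd≼pr _ _)))

  jDeriv-mono : ∀ {a q} → a ≼ q → jDeriv a ≼ bound q
  jDeriv-mono p = pr-mono (lit-mono {3} {4} (s≤s (s≤s (s≤s z≤n)))) (≼-trans p (≼-trans (fst≼pr _ _) (snd≼pr _ _)))

  jSubst-mono : ∀ {k σ a b q} → k ≼ q → σ ≼ sc q → a ≼ q → b ≼ q → jSubst k σ a b ≼ bound q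
  jSubst-mono p s r t = pr-mono ≼-refl (pr-mono (pr-mono p s) (pr-mono r t))

  bound-mono : ∀ {q q′} → q ≼ q′ → bound q ≼ bound q′
  bound-mono p = jSubst-mono p (sc-mono p) p p

  private
    -- A justification survives the enlargement of the set, so self-justifying sets can be united.
    -- Both obey the bound of the same `q`, which keeps the union within the size allowed for `q`.
    union : ∀ q {w w′} → Justifies q w → Justifies q w′ →
      Cl (Σ[ u ∈ Carrier ] Justifies q u × (∀ {i} → i ∈ w → i ∈ u) × (∀ {i} → i ∈ w′ → i ∈ u))
    union q {w} {w′} h h′ = do
      (u , _ , out , into) ← comprehension (v0 ∈ᶠ v1 ∨ᶠ v0 ∈ᶠ v2) (w ∷ w′ ∷ []) (bound q)
      let inˡ : ∀ {i} → i ∈ w → i ∈ u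
          inˡ {i} m = into i (proj₁ (h i m)) (return (inj₁ m))
          inʳ : ∀ {i} → i ∈ w′ → i ∈ u
          inʳ {i} m = into i (proj₁ (h′ i m)) (return (inj₂ m))
      return (u , (λ i m → proj₁ (out i m) , stableJ (proj₂ (out i m) >>= λ
        { (inj₁ m₁) → return (justified-mono inˡ (proj₂ (h i m₁)))
        ; (inj₂ m₂) → return (justified-mono inʳ (proj₂ (h′ i m₂))) })) , inˡ , inʳ)

    empty : ∀ q → Cl (Σ[ u ∈ Carrier ] Justifies q u)
    empty q = do
      (u , _ , out , _) ← comprehension {0} ⟪ ff ⟫ [] (bound q)
      return (u , λ i m → proj₁ (out i m) , stableJ (absurd (proj₂ (out i m))))

    gather : ∀ q ρ cs → Holds (λ p → Der q (valP p ρ)) ρ cs →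
      Cl (Σ[ w ∈ Carrier ] Justifies q w × Holds (InSet ρ w) ρ cs)
    gather q ρ [] h = empty q >>= λ { (u , j) → return (u , j , tt) }
    gather q ρ (side θ i k ∷ cs) (p , h) = gather q ρ cs h >>= λ { (w , j , h′) → return (w , j , p , h′) }
    gather q ρ (member t ∷ cs) (d , h) = do
      (w , _ , j , m) ← d
      (w′ , j′ , h′) ← gather q ρ cs h
      (u , j″ , inˡ , inʳ) ← union q j j′
      return (u , j″ , inˡ m , Holds-map (λ _ → inʳ) cs h′)

    adjoin : ∀ q j {w} → Justifies q w → j ≼ bound q → Justified j w → Der q j
    adjoin q j {w} h l p = do
      (u , u< , out , into) ← comprehension (v0 ∈ᶠ v1 ∨ᶠ v0 ≐ᶠ v2) (w ∷ j ∷ []) (bound q)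
      let w⊆u : ∀ {i} → i ∈ w → i ∈ u
          w⊆u {i} m = into i (proj₁ (h i m)) (return (inj₁ m))
      return (u , ≼-trans (x≼scx u) u< , (λ i m → proj₁ (out i m) , stableJ
        (proj₂ (out i m) >>= λ
          { (inj₁ m₁) → return (justified-mono w⊆u (proj₂ (h i m₁)))
          ; (inj₂ e) → return (justified-resp (sym e) (justified-mono w⊆u p)) }))
        , into j l (return (inj₂ ≃-refl)))

  -- The variables that do not occur in the conclusion need bounds.
  Unseen : Pattern → Vec Carrier 6 → Set
  Unseen p ρ = at (# 0) × at (# 1) × at (# 2) × at (# 3) × at (# 4) × at (# 5)
    where
    at : Fin 6 → Set
    at i = if occurs i p then ⊤ else lookup ρ i ≼ valP p ρ

  -- The sets for the premises are united and the conclusion is adjoined. The bound `q` stays the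
  -- same from premises to conclusion: it refers to the whole derivation, not to the judgement at
  -- hand, so nothing has to be enlarged on the way.
  rule : ∀ k q ρ → Unseen (conclusion (clause k)) ρ → valP (conclusion (clause k)) ρ ≼ bound q →
    Holds (λ p → Der q (valP p ρ)) ρ (conditions (clause k)) → Der q (valP (conclusion (clause k)) ρ)
  rule k q ρ (u₀ , u₁ , u₂ , u₃ , u₄ , u₅) l h = gather q ρ (conditions (clause k)) h >>= λ { (w , j , h′) →
      adjoin q (valP p ρ) j l (justify k ρ bounds ≃-refl h′) }
    where
    p : Pattern
    p = conclusion (clause k)
    seen : ∀ i → (if occurs i p then ⊤ else lookup ρ i ≼ valP p ρ) → lookup ρ i ≼ valP p ρ
    seen i u with occurs i p in eq
    ... | true  = occurs-≼ i p ρ eq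
    ... | false = u
    bounds : ∀ i → lookup ρ i ≼ valP p ρ
    bounds fzero                                     = seen (# 0) u₀
    bounds (fsuc fzero)                              = seen (# 1) u₁
    bounds (fsuc (fsuc fzero))                       = seen (# 2) u₂
    bounds (fsuc (fsuc (fsuc fzero)))                = seen (# 3) u₃
    bounds (fsuc (fsuc (fsuc (fsuc fzero))))         = seen (# 4) u₄
    bounds (fsuc (fsuc (fsuc (fsuc (fsuc fzero)))))  = seen (# 5) u₅

-- Arithmetized syntax and the codes of actual derivations

funArF relArF : Language → Fm 2
funArF L = c ≐ᶠ litA 0 ∧ᶠ k ≐ᶠ litA 0
        ∨ᶠ c ≐ᶠ litA 1 ∧ᶠ k ≐ᶠ litA 1
        ∨ᶠ c ≐ᶠ litA 2 ∧ᶠ k ≐ᶠ litA 2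
        ∨ᶠ c ≐ᶠ litA 3 ∧ᶠ k ≐ᶠ litA 2
        ∨ᶠ c ≐ᶠ litA 4 ∧ᶠ k ≐ᶠ litA 1
        ∨ᶠ ∃ᶠ c (var (# 1) ≐ᶠ litA 5 ⊕ var (# 0) ∧ᶠ ⟪ pick (Language.isFun L) (# 0) (# 2) ⟫)
  where
  c k : ATerm 2
  c = var (# 0)
  k = var (# 1)
relArF L = c ≐ᶠ litA 0 ∧ᶠ k ≐ᶠ litA 2
        ∨ᶠ c ≐ᶠ litA 1 ∧ᶠ k ≐ᶠ litA 2
        ∨ᶠ ∃ᶠ c (var (# 1) ≐ᶠ litA 2 ⊕ var (# 0) ∧ᶠ ⟪ pick (Language.isRel L) (# 0) (# 2) ⟫)
  where
  c k : ATerm 2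
  c = var (# 0)
  k = var (# 1)

-- Being an axiom comes without a computation. `halts` provides one, and a rejecting one would
-- contradict `no-sound`.
acceptance : ∀ (T : Theory L) {φ} → Theory.Axiom T φ → Σ[ w ∈ ℕ ] (w ∷ ⌜ φ ⌝ ∷ [] ⊨ Theory.yes T)
acceptance T {φ} a with Theory.halts T φ
... | inj₁ p       = p
... | inj₂ (w , p) = ⊥-elim (Theory.no-sound T φ w p a)

mutual
  proofRule : ∀ {T : Theory L} {φ} → T ⊢ φ → ℕ
  proofRule {T = T} (ax a) = pair 0 (proj₁ (acceptance T a))
  proofRule K              = pair 1 0
  proofRule S              = pair 2 0
  proofRule DNE            = pair 3 0
  proofRule (∀-elim t)     = pair 4 ⌜ t ⌝ᵗ
  proofRule ∀-dist         = pair 5 0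
  proofRule ∀-vac          = pair 6 0
  proofRule ≐-refl         = pair 7 0
  proofRule (≐-subst φ)    = pair 8 ⌜ φ ⌝
  proofRule (mp d e)       = pair 9 (pair (proofCode d) (proofCode e))
  proofRule (gen d)        = pair 10 (proofCode d)

  proofCode : ∀ {T : Theory L} {φ} → T ⊢ φ → ℕ
  proofCode {φ = φ} d = pair ⌜ φ ⌝ (proofRule d)

module Syntax {L : Language} (T : Theory L) (𝓜 : IΔ₀Exp) where
  open IΔ₀Exp 𝓜
  open Laws 𝓜
  open Numerals 𝓜
  open Derivability T 𝓜

  arg₂ : ∀ {k} a b → b ≼ pr k (pr a b)
  arg₂ a b = ≼-trans (snd≼pr a b) (snd≼pr _ _)

  arg₁ : ∀ {k} a b → a ≼ pr k (pr a b)
  arg₁ a b = ≼-trans (fst≼pr a b) (snd≼pr _ _)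

  funAr-holds : ∀ (f : FunSym L) → lit (funCode f) ∷ lit (funArity f) ∷ [] ⊩ funAr L
  funAr-holds f = fm← (funArF L) (holds f)
    where
    holds : ∀ f → ⟦ funArF L ⟧ᶠ (lit (funCode f) ∷ lit (funArity f) ∷ [])
    holds `0   = return (inj₁ (≃-refl , ≃-refl))
    holds `S   = return (inj₂ (return (inj₁ (≃-refl , ≃-refl))))
    holds `+   = return (inj₂ (return (inj₂ (return (inj₁ (≃-refl , ≃-refl))))))
    holds `*   = return (inj₂ (return (inj₂ (return (inj₂ (return (inj₁ (≃-refl , ≃-refl))))))))
    holds `exp = return (inj₂ (return (inj₂ (return (inj₂ (return (inj₂ (return (inj₁ (≃-refl , ≃-refl))))))))))
    holds (ext g) = return (inj₂ (return (inj₂ (return (inj₂ (return (inj₂ (return (inj₂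
      (return (lit (Language.codeF L g) , lit-mono {Language.codeF L g} (ℕₚ.m≤n+m _ 5) , lit-+ 5 (Language.codeF L g) ,
        pick← (Language.isFun L) (# 0) (# 2) (absolute (Language.isFun L)
          (Language.codeF L g ∷ Language.arityF L g ∷ [])
          (Equivalence.from (Language.isFun-correct L _ _) (g , ≡.refl , ≡.refl))))))))))))))

  relAr-holds : ∀ (r : RelSym L) → lit (relCode r) ∷ lit (relArity r) ∷ [] ⊩ relAr L
  relAr-holds r = fm← (relArF L) (holds r)
    where
    holds : ∀ r → ⟦ relArF L ⟧ᶠ (lit (relCode r) ∷ lit (relArity r) ∷ [])
    holds `= = return (inj₁ (≃-refl , ≃-refl))
    holds `≤ = return (inj₂ (return (inj₁ (≃-refl , ≃-refl))))
    holds (ext g) = return (inj₂ (return (inj₂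
      (return (lit (Language.codeR L g) , lit-mono {Language.codeR L g} (ℕₚ.m≤n+m _ 2) , lit-+ 2 (Language.codeR L g) ,
        pick← (Language.isRel L) (# 0) (# 2) (absolute (Language.isRel L)
          (Language.codeR L g ∷ Language.arityR L g ∷ [])
          (Equivalence.from (Language.isRel-correct L _ _) (g , ≡.refl , ≡.refl))))))))

  -- The clauses as rules

  private
    -- A clause variable that is absent from the conclusion must be bounded by its value; 0 is
    -- bounded by anything.
    z : Carrier
    z = 0#

  der-var : ∀ q i → c-var i ≼ q → Der q (jTerm (c-var i))
  der-var q i l = rule (# 0) q (z ∷ z ∷ z ∷ z ∷ z ∷ i ∷ [])
    (0≼ _ , 0≼ _ , 0≼ _ , 0≼ _ , 0≼ _ , tt) (jTerm-mono l) tt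

  der-fn : ∀ q f ts k → c-fn f ts ≼ q → k ≼ ts → f ∷ k ∷ [] ⊩ funAr L →
    Der q (jTerms k ts) → Der q (jTerm (c-fn f ts))
  der-fn q f ts k l k≼ ar d = rule (# 1) q (z ∷ z ∷ z ∷ k ∷ ts ∷ f ∷ [])
    (0≼ _ , 0≼ _ , 0≼ _ , ≼-trans k≼ (≼-trans (arg₂ f ts) (snd≼pr _ _)) , tt , tt)
    (jTerm-mono l) (ar , d , tt)

  der-nil : ∀ q → Der q (jTerms 0# c-nil)
  der-nil q = rule (# 2) q (z ∷ z ∷ z ∷ z ∷ z ∷ z ∷ [])
    (0≼ _ , 0≼ _ , 0≼ _ , 0≼ _ , 0≼ _ , 0≼ _) (jTerms-mono (0≼ q) (0≼ q)) tt

  der-cons : ∀ q k t ts → sc k ≼ q → c-cons t ts ≼ q →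
    Der q (jTerm t) → Der q (jTerms k ts) → Der q (jTerms (sc k) (c-cons t ts))
  der-cons q k t ts k< l d e = rule (# 3) q (z ∷ z ∷ z ∷ ts ∷ t ∷ k ∷ [])
    (0≼ _ , 0≼ _ , 0≼ _ , tt , tt , tt) (jTerms-mono k< l) (d , e , tt)

  der-rel : ∀ q r ts k → c-rel r ts ≼ q → k ≼ ts → r ∷ k ∷ [] ⊩ relAr L →
    Der q (jTerms k ts) → Der q (jFormula (c-rel r ts))
  der-rel q r ts k l k≼ ar d = rule (# 4) q (z ∷ z ∷ z ∷ k ∷ ts ∷ r ∷ [])
    (0≼ _ , 0≼ _ , 0≼ _ , ≼-trans k≼ (≼-trans (arg₂ r ts) (snd≼pr _ _)) , tt , tt)
    (jFormula-mono l) (ar , d , tt)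

  der-⊥ : ∀ q → c-⊥ ≼ q → Der q (jFormula c-⊥)
  der-⊥ q l = rule (# 5) q (z ∷ z ∷ z ∷ z ∷ z ∷ z ∷ [])
    (0≼ _ , 0≼ _ , 0≼ _ , 0≼ _ , 0≼ _ , 0≼ _) (jFormula-mono l) tt

  der-imp : ∀ q a b → c-imp a b ≼ q → Der q (jFormula a) → Der q (jFormula b) → Der q (jFormula (c-imp a b))
  der-imp q a b l d e = rule (# 6) q (z ∷ z ∷ z ∷ z ∷ b ∷ a ∷ [])
    (0≼ _ , 0≼ _ , 0≼ _ , 0≼ _ , tt , tt) (jFormula-mono l) (d , e , tt)

  der-all : ∀ q a → c-all a ≼ q → Der q (jFormula a) → Der q (jFormula (c-all a))
  der-all q a l d = rule (# 7) q (z ∷ z ∷ z ∷ z ∷ z ∷ a ∷ [])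
    (0≼ _ , 0≼ _ , 0≼ _ , 0≼ _ , 0≼ _ , tt) (jFormula-mono l) (d , tt)

  der-wk-var : ∀ q i → c-var (sc i) ≼ q → Der q (jSubst 0# 0# (c-var i) (c-var (sc i)))
  der-wk-var q i l = rule (# 8) q (z ∷ z ∷ z ∷ z ∷ z ∷ i ∷ [])
    (0≼ _ , 0≼ _ , 0≼ _ , 0≼ _ , 0≼ _ , tt)
    (jSubst-mono (0≼ q) (0≼ _) (≼-trans (pr-mono ≼-refl (x≼scx i)) l) l) tt

  der-inst-zero : ∀ q t → c-var 0# ≼ q → t ≼ q → Der q (jSubst 0# (sc t) (c-var 0#) t)
  der-inst-zero q t l m = rule (# 9) q (z ∷ z ∷ z ∷ z ∷ z ∷ t ∷ [])
    (0≼ _ , 0≼ _ , 0≼ _ , 0≼ _ , 0≼ _ , tt) (jSubst-mono (0≼ q) (sc-mono m) l m) tt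

  der-inst-suc : ∀ q t i → t ≼ q → c-var (sc i) ≼ q → Der q (jSubst 0# (sc t) (c-var (sc i)) (c-var i))
  der-inst-suc q t i m l = rule (# 10) q (z ∷ z ∷ z ∷ z ∷ i ∷ t ∷ [])
    (0≼ _ , 0≼ _ , 0≼ _ , 0≼ _ , tt , tt)
    (jSubst-mono (0≼ q) (sc-mono m) l (≼-trans (pr-mono ≼-refl (x≼scx i)) l)) tt

  der-lift-zero : ∀ q k σ → sc k ≼ q → σ ≼ sc q → c-var 0# ≼ q → Der q (jSubst (sc k) σ (c-var 0#) (c-var 0#))
  der-lift-zero q k σ k< σ≼ l = rule (# 11) q (z ∷ z ∷ z ∷ z ∷ σ ∷ k ∷ [])
    (0≼ _ , 0≼ _ , 0≼ _ , 0≼ _ , tt , tt) (jSubst-mono k< σ≼ l l) tt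

  -- `u` is the intermediate result, before the shift past the binder. It is invisible in the
  -- conclusion and is bounded there by its shift `v`.
  der-lift-suc : ∀ q k σ i u v → sc k ≼ q → σ ≼ sc q → c-var (sc i) ≼ q → v ≼ q → u ≼ v →
    Der q (jSubst k σ (c-var i) u) → Der q (jSubst 0# 0# u v) → Der q (jSubst (sc k) σ (c-var (sc i)) v)
  der-lift-suc q k σ i u v k< σ≼ l m u≼ d e = rule (# 12) q (z ∷ u ∷ v ∷ i ∷ σ ∷ k ∷ [])
    (0≼ _ , ≼-trans u≼ (≼-trans (arg₂ _ v) (snd≼pr _ _)) , tt , tt , tt , tt)
    (jSubst-mono k< σ≼ l m) (d , e , tt)

  der-subst-fn : ∀ q k σ f ts us → k ≼ q → σ ≼ sc q → c-fn f ts ≼ q → c-fn f us ≼ q →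
    Der q (jSubst k σ ts us) → Der q (jSubst k σ (c-fn f ts) (c-fn f us))
  der-subst-fn q k σ f ts us k≼ σ≼ l m d = rule (# 13) q (z ∷ us ∷ ts ∷ f ∷ σ ∷ k ∷ [])
    (0≼ _ , tt , tt , tt , tt , tt) (jSubst-mono k≼ σ≼ l m) (d , tt)

  der-subst-nil : ∀ q k σ → k ≼ q → σ ≼ sc q → Der q (jSubst k σ c-nil c-nil)
  der-subst-nil q k σ k≼ σ≼ = rule (# 14) q (z ∷ z ∷ z ∷ z ∷ σ ∷ k ∷ [])
    (0≼ _ , 0≼ _ , 0≼ _ , 0≼ _ , tt , tt) (jSubst-mono k≼ σ≼ (0≼ q) (0≼ q)) tt

  der-subst-cons : ∀ q k σ t ts u us → k ≼ q → σ ≼ sc q → c-cons t ts ≼ q → c-cons u us ≼ q →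
    Der q (jSubst k σ t u) → Der q (jSubst k σ ts us) → Der q (jSubst k σ (c-cons t ts) (c-cons u us))
  der-subst-cons q k σ t ts u us k≼ σ≼ l m d e = rule (# 15) q (us ∷ u ∷ ts ∷ t ∷ σ ∷ k ∷ [])
    (tt , tt , tt , tt , tt , tt) (jSubst-mono k≼ σ≼ l m) (d , e , tt)

  der-subst-rel : ∀ q k σ r ts us → k ≼ q → σ ≼ sc q → c-rel r ts ≼ q → c-rel r us ≼ q →
    Der q (jSubst k σ ts us) → Der q (jSubst k σ (c-rel r ts) (c-rel r us))
  der-subst-rel q k σ r ts us k≼ σ≼ l m d = rule (# 16) q (z ∷ us ∷ ts ∷ r ∷ σ ∷ k ∷ [])
    (0≼ _ , tt , tt , tt , tt , tt) (jSubst-mono k≼ σ≼ l m) (d , tt)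

  der-subst-⊥ : ∀ q k σ → k ≼ q → σ ≼ sc q → c-⊥ ≼ q → Der q (jSubst k σ c-⊥ c-⊥)
  der-subst-⊥ q k σ k≼ σ≼ l = rule (# 17) q (z ∷ z ∷ z ∷ z ∷ σ ∷ k ∷ [])
    (0≼ _ , 0≼ _ , 0≼ _ , 0≼ _ , tt , tt) (jSubst-mono k≼ σ≼ l l) tt

  der-subst-imp : ∀ q k σ a b c d → k ≼ q → σ ≼ sc q → c-imp a b ≼ q → c-imp c d ≼ q →
    Der q (jSubst k σ a c) → Der q (jSubst k σ b d) → Der q (jSubst k σ (c-imp a b) (c-imp c d))
  der-subst-imp q k σ a b c d k≼ σ≼ l m p r = rule (# 18) q (d ∷ c ∷ b ∷ a ∷ σ ∷ k ∷ [])
    (tt , tt , tt , tt , tt , tt) (jSubst-mono k≼ σ≼ l m) (p , r , tt)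

  der-subst-all : ∀ q k σ a b → k ≼ q → σ ≼ sc q → c-all a ≼ q → c-all b ≼ q →
    Der q (jSubst (sc k) σ a b) → Der q (jSubst k σ (c-all a) (c-all b))
  der-subst-all q k σ a b k≼ σ≼ l m d = rule (# 19) q (z ∷ z ∷ b ∷ a ∷ σ ∷ k ∷ [])
    (0≼ _ , 0≼ _ , tt , tt , tt , tt) (jSubst-mono k≼ σ≼ l m) (d , tt)

  -- Codes of terms and formulas in which E k i stands for the variable i under
  -- k quantifiers.

  mutual
    codeT : (ℕ → Carrier) → Term L → Carrier
    codeT E (var i)   = E i
    codeT E (fn f ts) = c-fn (lit (funCode f)) (codeTs E ts)

    codeTs : ∀ {k} → (ℕ → Carrier) → Vec (Term L) k → Carrier
    codeTs E []       = c-nil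
    codeTs E (t ∷ ts) = c-cons (codeT E t) (codeTs E ts)

  codeF : (ℕ → ℕ → Carrier) → ℕ → Formula L → Carrier
  codeF E k (rel r ts) = c-rel (lit (relCode r)) (codeTs (E k) ts)
  codeF E k ⊥′         = c-⊥
  codeF E k (φ ⇒ ψ)    = c-imp (codeF E k φ) (codeF E k ψ)
  codeF E k (∀′ φ)     = c-all (codeF E (suc k) φ)

  -- Bounds the arity, which the conclusions of `der-fn` and `der-rel` do not display, by the code
  -- of the argument list.
  length≼ : ∀ E {k} (ts : Vec (Term L) k) → lit k ≼ codeTs E ts
  length≼ E []       = 0≼ _
  length≼ E (t ∷ ts) = ≼-trans (sc-mono (≼-trans (length≼ E ts) (snd≼pr _ _))) (snd≺pr _ _)

  module _ (q : Carrier) where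

    mutual
      term-der : ∀ E → (∀ i → E i ≼ q → Der q (jTerm (E i))) →
        ∀ t → codeT E t ≼ q → Der q (jTerm (codeT E t))
      term-der E h (var i)   l = h i l
      term-der E h (fn f ts) l = der-fn q _ _ _ l (length≼ E ts) (funAr-holds f)
        (terms-der E h ts (≼-trans (arg₂ _ _) l))

      terms-der : ∀ E → (∀ i → E i ≼ q → Der q (jTerm (E i))) →
        ∀ {k} (ts : Vec (Term L) k) → codeTs E ts ≼ q → Der q (jTerms (lit k) (codeTs E ts))
      terms-der E h []       l = der-nil q
      terms-der E h (t ∷ ts) l = der-cons q _ _ _ (≼-trans (length≼ E (t ∷ ts)) l) l
        (term-der E h t (≼-trans (arg₁ _ _) l)) (terms-der E h ts (≼-trans (arg₂ _ _) l))

    formula-der : ∀ E → (∀ k i → E k i ≼ q → Der q (jTerm (E k i))) →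
      ∀ k φ → codeF E k φ ≼ q → Der q (jFormula (codeF E k φ))
    formula-der E h k (rel r ts) l = der-rel q _ _ _ l (length≼ (E k) ts) (relAr-holds r)
      (terms-der (E k) (h k) ts (≼-trans (arg₂ _ _) l))
    formula-der E h k ⊥′ l = der-⊥ q l
    formula-der E h k (φ ⇒ ψ) l = der-imp q _ _ l
      (formula-der E h k φ (≼-trans (arg₁ _ _) l)) (formula-der E h k ψ (≼-trans (arg₂ _ _) l))
    formula-der E h k (∀′ φ) l = der-all q _ l (formula-der E h (suc k) φ (≼-trans (snd≼pr _ _) l))

    module _ (σ : Carrier) (σ≼ : σ ≼ sc q) where

      mutual
        subst-term : ∀ k → k ≼ q → ∀ E F → (∀ i → E i ≼ q → F i ≼ q → Der q (jSubst k σ (E i) (F i))) →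
          ∀ t → codeT E t ≼ q → codeT F t ≼ q → Der q (jSubst k σ (codeT E t) (codeT F t))
        subst-term k k≼ E F h (var i)   l m = h i l m
        subst-term k k≼ E F h (fn f ts) l m = der-subst-fn q _ _ _ _ _ k≼ σ≼ l m
          (subst-terms k k≼ E F h ts (≼-trans (arg₂ _ _) l) (≼-trans (arg₂ _ _) m))

        subst-terms : ∀ k → k ≼ q → ∀ E F → (∀ i → E i ≼ q → F i ≼ q → Der q (jSubst k σ (E i) (F i))) →
          ∀ {n} (ts : Vec (Term L) n) → codeTs E ts ≼ q → codeTs F ts ≼ q →
          Der q (jSubst k σ (codeTs E ts) (codeTs F ts))
        subst-terms k k≼ E F h []       l m = der-subst-nil q _ _ k≼ σ≼
        subst-terms k k≼ E F h (t ∷ ts) l m = der-subst-cons q _ _ _ _ _ _ k≼ σ≼ l m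
          (subst-term k k≼ E F h t (≼-trans (arg₁ _ _) l) (≼-trans (arg₁ _ _) m))
          (subst-terms k k≼ E F h ts (≼-trans (arg₂ _ _) l) (≼-trans (arg₂ _ _) m))

      -- The number of lifts also has to stay below `q`. The sum of that number and the code does
      -- so: passing a quantifier raises the first by one and lowers the second by at least one.
      subst-formula : ∀ E F →
        (∀ k i → lit k ≼ q → E k i ≼ q → F k i ≼ q → Der q (jSubst (lit k) σ (E k i) (F k i))) →
        ∀ k φ → lit k ∔ codeF E k φ ≼ q → codeF F k φ ≼ q →
        Der q (jSubst (lit k) σ (codeF E k φ) (codeF F k φ))
      subst-formula E F h k (rel r ts) l m = der-subst-rel q _ _ _ _ _ k≼ σ≼ (≼-trans (x≼y∔x _ _) l) m
          (subst-terms (lit k) k≼ (E k) (F k) (λ i → h k i k≼) ts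
            (≼-trans (arg₂ _ _) (≼-trans (x≼y∔x _ _) l)) (≼-trans (arg₂ _ _) m))
        where
        k≼ : lit k ≼ q
        k≼ = ≼-trans (x≼x∔y _ _) l
      subst-formula E F h k ⊥′ l m = der-subst-⊥ q _ _ (≼-trans (x≼x∔y _ _) l) σ≼ m
      subst-formula E F h k (φ ⇒ ψ) l m =
        der-subst-imp q _ _ _ _ _ _ (≼-trans (x≼x∔y _ _) l) σ≼ (≼-trans (x≼y∔x _ _) l) m
          (subst-formula E F h k φ (≼-trans (∔-mono ≼-refl (arg₁ _ _)) l) (≼-trans (arg₁ _ _) m))
          (subst-formula E F h k ψ (≼-trans (∔-mono ≼-refl (arg₂ _ _)) l) (≼-trans (arg₂ _ _) m))
      subst-formula E F h k (∀′ φ) l m =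
        der-subst-all q _ _ _ _ (≼-trans (x≼x∔y _ _) l) σ≼ (≼-trans (x≼y∔x _ _) l) m
          (subst-formula E F h (suc k) φ
            (≼-trans (≼-respˡ (trans (+-sc _ _) (sym (+-scˡ _ _))) (∔-mono ≼-refl (snd≺pr _ _))) l)
            (≼-trans (snd≼pr _ _) m))

  plain : ℕ → Carrier
  plain i = c-var (lit i)

  cT : Term L → Carrier
  cT = codeT plain

  cTs : ∀ {k} → Vec (Term L) k → Carrier
  cTs = codeTs plain

  cF : Formula L → Carrier
  cF (rel r ts) = c-rel (lit (relCode r)) (cTs ts)
  cF ⊥′         = c-⊥
  cF (φ ⇒ ψ)    = c-imp (cF φ) (cF ψ)
  cF (∀′ φ)     = c-all (cF φ)

  codeF-plain : ∀ k φ → codeF (λ _ → plain) k φ ≡ cF φ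
  codeF-plain k (rel r ts) = ≡.refl
  codeF-plain k ⊥′         = ≡.refl
  codeF-plain k (φ ⇒ ψ)    = cong₂ c-imp (codeF-plain k φ) (codeF-plain k ψ)
  codeF-plain k (∀′ φ)     = cong c-all (codeF-plain (suc k) φ)

  mutual
    lit-cT : ∀ t → lit ⌜ t ⌝ᵗ ≃ cT t
    lit-cT (var i)   = lit-pair 0 i
    lit-cT (fn f ts) = trans (lit-pair 1 _) (pr-cong ≃-refl (trans (lit-pair _ _) (pr-cong ≃-refl (lit-cTs ts))))

    lit-cTs : ∀ {k} (ts : Vec (Term L) k) → lit ⌜ ts ⌝ᵗˢ ≃ cTs ts
    lit-cTs []       = ≃-refl
    lit-cTs (t ∷ ts) = trans (lit-pair 2 _) (pr-cong ≃-refl (trans (lit-pair _ _) (pr-cong (lit-cT t) (lit-cTs ts))))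

  lit-cF : ∀ φ → lit ⌜ φ ⌝ ≃ cF φ
  lit-cF (rel r ts) = trans (lit-pair 3 _) (pr-cong ≃-refl (trans (lit-pair _ _) (pr-cong ≃-refl (lit-cTs ts))))
  lit-cF ⊥′         = lit-pair 4 0
  lit-cF (φ ⇒ ψ)    = trans (lit-pair 5 _) (pr-cong ≃-refl (trans (lit-pair _ _) (pr-cong (lit-cF φ) (lit-cF ψ))))
  lit-cF (∀′ φ)     = trans (lit-pair 6 _) (pr-cong ≃-refl (lit-cF φ))

  cF-der : ∀ q φ → cF φ ≼ q → Der q (jFormula (cF φ))
  cF-der q φ l = subst (Der q ∘ jFormula) (codeF-plain 0 φ)
    (formula-der q (λ _ → plain) (λ _ i → der-var q (lit i)) 0 φ (≼-respˡ (≡⇒≃ (≡.sym (codeF-plain 0 φ))) l))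

  cT-der : ∀ q t → cT t ≼ q → Der q (jTerm (cT t))
  cT-der q = term-der q plain (λ i → der-var q (lit i))

  codeσ : Subst L → Carrier
  codeσ wk       = 0#
  codeσ (inst t) = sc (cT t)
  codeσ (lift σ) = codeσ σ

  mutual
    codeT-shift : ∀ u → codeT (plain ∘ suc) u ≡ cT (shift u)
    codeT-shift (var i)   = ≡.refl
    codeT-shift (fn f ts) = cong (c-fn _) (codeTs-shift ts)

    codeTs-shift : ∀ {k} (us : Vec (Term L) k) → codeTs (plain ∘ suc) us ≡ cTs (shifts us)
    codeTs-shift []       = ≡.refl
    codeTs-shift (u ∷ us) = cong₂ c-cons (codeT-shift u) (codeTs-shift us)

  mutual
    cT≼shift : ∀ u → cT u ≼ cT (shift u)
    cT≼shift (var i)   = pr-mono ≼-refl (x≼scx _)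
    cT≼shift (fn f ts) = pr-mono ≼-refl (pr-mono ≼-refl (cTs≼shifts ts))

    cTs≼shifts : ∀ {k} (us : Vec (Term L) k) → cTs us ≼ cTs (shifts us)
    cTs≼shifts []       = ≼-refl
    cTs≼shifts (u ∷ us) = pr-mono ≼-refl (pr-mono (cT≼shift u) (cTs≼shifts us))

  shift-der : ∀ q u → cT (shift u) ≼ q → Der q (jSubst 0# 0# (cT u) (cT (shift u)))
  shift-der q u l = subst (λ c → Der q (jSubst 0# 0# (cT u) c)) (codeT-shift u)
    (subst-term q 0# (0≼ _) 0# (0≼ _) plain (plain ∘ suc) (λ i _ m → der-wk-var q (lit i) m) u
      (≼-trans (cT≼shift u) l) (≼-respˡ (≡⇒≃ (≡.sym (codeT-shift u))) l))

  data Base : Subst L → Set where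
    wk   : Base wk
    inst : ∀ t → Base (inst t)

  -- The recursion follows the clauses for lifted substitutions. Beyond the binder the result from
  -- one level lower is shifted, and as it may be an arbitrary term, this takes a whole substitution
  -- derivation, `shift-der`.
  apply-der : ∀ q {σ} → Base σ → codeσ σ ≼ sc q → ∀ k i → lit k ≼ q → plain i ≼ q →
    cT (apply (lift^ k σ) i) ≼ q → Der q (jSubst (lit k) (codeσ σ) (plain i) (cT (apply (lift^ k σ) i)))
  apply-der q wk       σ≼ zero i       k≼ l m = der-wk-var q (lit i) m
  apply-der q (inst t) σ≼ zero zero    k≼ l m = der-inst-zero q (cT t) l m
  apply-der q (inst t) σ≼ zero (suc i) k≼ l m = der-inst-suc q (cT t) (lit i) (sc-anti σ≼) l
  apply-der q b        σ≼ (suc k) zero k≼ l m = der-lift-zero q (lit k) _ k≼ σ≼ l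
  apply-der q {σ} b    σ≼ (suc k) (suc i) k≼ l m =
      der-lift-suc q (lit k) (codeσ σ) (lit i) (cT u) (cT (shift u)) k≼ σ≼ l m (cT≼shift u)
        (apply-der q b σ≼ k i (≼-trans (x≼scx _) k≼) (≼-trans (pr-mono ≼-refl (x≼scx _)) l)
          (≼-trans (cT≼shift u) m))
        (shift-der q u m)
    where
    u : Term L
    u = apply (lift^ k σ) i

  mutual
    codeT-subst : ∀ σ t → codeT (cT ∘ apply σ) t ≡ cT (substT σ t)
    codeT-subst σ (var i)   = ≡.refl
    codeT-subst σ (fn f ts) = cong (c-fn _) (codeTs-subst σ ts)

    codeTs-subst : ∀ {k} σ (ts : Vec (Term L) k) → codeTs (cT ∘ apply σ) ts ≡ cTs (substTs σ ts)
    codeTs-subst σ []       = ≡.refl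
    codeTs-subst σ (t ∷ ts) = cong₂ c-cons (codeT-subst σ t) (codeTs-subst σ ts)

  codeF-subst : ∀ σ k φ → codeF (λ k i → cT (apply (lift^ k σ) i)) k φ ≡ cF (φ [ lift^ k σ ])
  codeF-subst σ k (rel r ts) = cong (c-rel _) (codeTs-subst (lift^ k σ) ts)
  codeF-subst σ k ⊥′         = ≡.refl
  codeF-subst σ k (φ ⇒ ψ)    = cong₂ c-imp (codeF-subst σ k φ) (codeF-subst σ k ψ)
  codeF-subst σ k (∀′ φ)     = cong c-all (codeF-subst σ (suc k) φ)

  subst-der : ∀ q {σ} → Base σ → codeσ σ ≼ sc q → ∀ φ → cF φ ≼ q → cF (φ [ σ ]) ≼ q →
    Der q (jSubst 0# (codeσ σ) (cF φ) (cF (φ [ σ ])))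
  subst-der q {σ} b σ≼ φ l m = subst₂ (λ x y → Der q (jSubst 0# (codeσ σ) x y))
    (codeF-plain 0 φ) (codeF-subst σ 0 φ)
    (subst-formula q (codeσ σ) σ≼ (λ _ → plain) (λ k i → cT (apply (lift^ k σ) i))
      (λ k i → apply-der q b σ≼ k i) 0 φ
      (≼-respˡ (sym (trans (+-0ˡ _) (≡⇒≃ (codeF-plain 0 φ)))) l)
      (≼-respˡ (≡⇒≃ (≡.sym (codeF-subst σ 0 φ))) m))

  cD : ∀ {φ} → T ⊢ φ → Carrier
  cD {φ} d = node (cF φ) (lit (proofRule d))

  lit-cD : ∀ {φ} (d : T ⊢ φ) → lit (proofCode d) ≃ cD d
  lit-cD {φ} d = trans (lit-pair _ _) (pr-cong (lit-cF φ) ≃-refl)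

  private
    -- Rule codes of actual derivations are standard numbers, whereas the clauses are stated with
    -- the pairing of the model. The two are equal in the model only, so the code is exchanged
    -- before and after a clause is applied.
    encode : ∀ r {q c ρ} → lit r ≃ ρ → (node c ρ ≼ q → Der q (jDeriv (node c ρ))) →
      node c (lit r) ≼ q → Der q (jDeriv (node c (lit r)))
    encode r e f l = der-resp (pr-cong ≃-refl (pr-cong ≃-refl (sym e)))
      (f (≼-respˡ (pr-cong ≃-refl e) l))

  -- The bound is any `q` above the code rather than the code itself, so that subderivations can be
  -- verified at the size of the whole tree.
  derivation-der : ∀ {φ} (d : T ⊢ φ) q → cD d ≼ q → Der q (jDeriv (cD d))
  derivation-der {φ} (ax a) q = encode (pair 0 (proj₁ (acceptance T a))) (lit-pair 0 _) λ l →
    rule (# 20) q (z ∷ z ∷ z ∷ z ∷ lit w ∷ cF φ ∷ []) (0≼ _ , 0≼ _ , 0≼ _ , 0≼ _ , tt , tt) (jDeriv-mono l)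
      (cF-der q φ (≼-trans (fst≼pr _ _) l) ,
       ⊩-resp (Theory.yes T) (≃*-∷ ≃-refl (≃*-∷ (lit-cF φ) (λ ())))
         (absolute (Theory.yes T) (w ∷ ⌜ φ ⌝ ∷ []) (proj₂ (acceptance T a))) , tt)
    where
    w : ℕ
    w = proj₁ (acceptance T a)
  derivation-der {φ} (K {α} {β}) q = encode (pair 1 0) (lit-pair 1 0) λ l →
    rule (# 21) q (z ∷ z ∷ z ∷ z ∷ cF β ∷ cF α ∷ []) (0≼ _ , 0≼ _ , 0≼ _ , 0≼ _ , tt , tt)
      (jDeriv-mono l) (cF-der q φ (≼-trans (fst≼pr _ _) l) , tt)
  derivation-der {φ} (S {α} {β} {γ}) q = encode (pair 2 0) (lit-pair 2 0) λ l →
    rule (# 22) q (z ∷ z ∷ z ∷ cF γ ∷ cF β ∷ cF α ∷ []) (0≼ _ , 0≼ _ , 0≼ _ , tt , tt , tt)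
      (jDeriv-mono l) (cF-der q φ (≼-trans (fst≼pr _ _) l) , tt)
  derivation-der {φ} (DNE {α}) q = encode (pair 3 0) (lit-pair 3 0) λ l →
    rule (# 23) q (z ∷ z ∷ z ∷ z ∷ z ∷ cF α ∷ []) (0≼ _ , 0≼ _ , 0≼ _ , 0≼ _ , 0≼ _ , tt)
      (jDeriv-mono l) (cF-der q φ (≼-trans (fst≼pr _ _) l) , tt)
  derivation-der {φ} (∀-elim {α} t) q =
    encode (pair 4 ⌜ t ⌝ᵗ) (trans (lit-pair 4 _) (pr-cong ≃-refl (lit-cT t))) λ l →
    let l₁ = ≼-trans (fst≼pr _ _) l
        t≼ = ≼-trans (snd≼pr _ _) (≼-trans (snd≼pr _ _) l)
    in rule (# 24) q (z ∷ z ∷ z ∷ cT t ∷ cF (α [ inst t ]) ∷ cF α ∷ []) (0≼ _ , 0≼ _ , 0≼ _ , tt , tt , tt)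
      (jDeriv-mono l) (cF-der q φ l₁ , cT-der q t t≼ ,
        subst-der q (inst t) (sc-mono t≼) α (≼-trans (snd≼pr _ _) (≼-trans (arg₁ _ _) l₁))
          (≼-trans (arg₂ _ _) l₁) , tt)
  derivation-der {φ} (∀-dist {α} {β}) q = encode (pair 5 0) (lit-pair 5 0) λ l →
    rule (# 25) q (z ∷ z ∷ z ∷ z ∷ cF β ∷ cF α ∷ []) (0≼ _ , 0≼ _ , 0≼ _ , 0≼ _ , tt , tt)
      (jDeriv-mono l) (cF-der q φ (≼-trans (fst≼pr _ _) l) , tt)
  derivation-der {φ} (∀-vac {α}) q = encode (pair 6 0) (lit-pair 6 0) λ l →
    let l₁ = ≼-trans (fst≼pr _ _) l in
    rule (# 26) q (z ∷ z ∷ z ∷ z ∷ cF (α [ wk ]) ∷ cF α ∷ []) (0≼ _ , 0≼ _ , 0≼ _ , 0≼ _ , tt , tt)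
      (jDeriv-mono l) (cF-der q φ l₁ ,
        subst-der q wk (0≼ _) α (≼-trans (arg₁ _ _) l₁) (≼-trans (snd≼pr _ _) (≼-trans (arg₂ _ _) l₁)) , tt)
  derivation-der {φ} (≐-refl {t}) q = encode (pair 7 0) (lit-pair 7 0) λ l →
    rule (# 27) q (z ∷ z ∷ z ∷ z ∷ z ∷ cT t ∷ []) (0≼ _ , 0≼ _ , 0≼ _ , 0≼ _ , 0≼ _ , tt)
      (jDeriv-mono l) (cF-der q φ (≼-trans (fst≼pr _ _) l) , tt)
  derivation-der {φ} (≐-subst α {t} {u}) q =
    encode (pair 8 ⌜ α ⌝) (trans (lit-pair 8 _) (pr-cong ≃-refl (lit-cF α))) λ l →
    let l₁ = ≼-trans (fst≼pr _ _) l
        eq≼ = ≼-trans (arg₁ _ _) l₁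
        us≼ = ≼-trans (arg₂ _ _) (≼-trans (arg₂ _ _) eq≼)
        t≼ = ≼-trans (arg₁ _ _) (≼-trans (arg₂ _ _) eq≼)
        u≼ = ≼-trans (arg₁ _ _) us≼
        α≼ = ≼-trans (snd≼pr _ _) (≼-trans (snd≼pr _ _) l)
        c≼ = ≼-trans (arg₂ _ _) l₁
    in rule (# 28) q (z ∷ cF α ∷ cF (α [ inst u ]) ∷ cF (α [ inst t ]) ∷ cT u ∷ cT t ∷ [])
      (0≼ _ , tt , tt , tt , tt , tt) (jDeriv-mono l)
      (cF-der q φ l₁ , cF-der q α α≼ ,
       subst-der q (inst t) (sc-mono t≼) α α≼ (≼-trans (arg₁ _ _) c≼) ,
       subst-der q (inst u) (sc-mono u≼) α α≼ (≼-trans (arg₂ _ _) c≼) , tt)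
  derivation-der (mp {α} {β} d e) q =
    encode (pair 9 (pair (proofCode d) (proofCode e)))
      (trans (lit-pair 9 _) (pr-cong ≃-refl (trans (lit-pair _ _) (pr-cong (lit-cD d) (lit-cD e))))) λ l →
    rule (# 29) q (z ∷ z ∷ lit (proofRule e) ∷ lit (proofRule d) ∷ cF β ∷ cF α ∷ [])
      (0≼ _ , 0≼ _ , tt , tt , tt , tt) (jDeriv-mono l)
      (derivation-der d q (≼-trans (arg₁ _ _) (≼-trans (snd≼pr _ _) l)) ,
       derivation-der e q (≼-trans (arg₂ _ _) (≼-trans (snd≼pr _ _) l)) , tt)
  derivation-der (gen {α} d) q =
    encode (pair 10 (proofCode d)) (trans (lit-pair 10 _) (pr-cong ≃-refl (lit-cD d))) λ l →
    rule (# 30) q (z ∷ z ∷ z ∷ z ∷ lit (proofRule d) ∷ cF α ∷ []) (0≼ _ , 0≼ _ , 0≼ _ , 0≼ _ , tt , tt)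
      (jDeriv-mono l) (derivation-der d q (≼-trans (snd≼pr _ _) (≼-trans (snd≼pr _ _) l)) , tt)

-- Codes of instances of formulas: under k quantifiers, the first n free
-- variables are replaced by closed terms with given codes.

slot₀ : ∀ n → ℕ → Fin n ⊎ ℕ
slot₀ zero    i       = inj₂ i
slot₀ (suc n) zero    = inj₁ fzero
slot₀ (suc n) (suc i) = map₁ fsuc (slot₀ n i)

slot : ∀ n → ℕ → ℕ → Fin n ⊎ ℕ
slot n zero    i       = slot₀ n i
slot n (suc k) zero    = inj₂ zero
slot n (suc k) (suc i) = map₂ suc (slot n k i)

entryA : ∀ {n} → Fin n ⊎ ℕ → ATerm n
entryA (inj₁ j) = var j
entryA (inj₂ i) = pairA (litA 0) (litA i)

module _ {n : ℕ} where
  open Codes {ATerm n} litA pairA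

  mutual
    codeTA : ℕ → Term L → ATerm n
    codeTA k (var i)           = entryA (slot n k i)
    codeTA k (fn f ts) = c-fn (litA (funCode f)) (codeTsA k ts)

    codeTsA : ∀ {m} → ℕ → Vec (Term L) m → ATerm n
    codeTsA k []       = c-nil
    codeTsA k (t ∷ ts) = c-cons (codeTA k t) (codeTsA k ts)

  codeFA : ℕ → Formula L → ATerm n
  codeFA k (rel r ts) = c-rel (litA (relCode r)) (codeTsA k ts)
  codeFA k ⊥′         = c-⊥
  codeFA k (φ ⇒ ψ)    = c-imp (codeFA k φ) (codeFA k ψ)
  codeFA k (∀′ φ)     = c-all (codeFA (suc k) φ)

-- All parameters are replaced by one common upper bound. Terms are monotone, so the value does not
-- decrease (`val-collapse`), and growth becomes a question about one variable.
collapse : ∀ {n} → ATerm n → ATerm 1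
collapse = renT (λ _ → fzero)

collapse-litA : ∀ {n} k → collapse {n} (litA k) ≡ litA k
collapse-litA zero    = ≡.refl
collapse-litA (suc k) = cong S (collapse-litA k)

private
  Poly-lit : ∀ {n} k → Poly (collapse {n} (litA k))
  Poly-lit k = subst Poly (≡.sym (collapse-litA k)) (Poly-litA k)

mutual
  Poly-codeTA : ∀ n k (t : Term L) → Poly (collapse (codeTA {n} k t))
  Poly-codeTA n k (var i) with slot n k i
  ... | inj₁ j = var
  ... | inj₂ i = Poly-pairA O (Poly-lit {n} i)
  Poly-codeTA n k (fn f ts) = Poly-pairA (Poly-litA 1) (Poly-pairA (Poly-lit {n} (funCode f)) (Poly-codeTsA n k ts))

  Poly-codeTsA : ∀ n {m} k (ts : Vec (Term L) m) → Poly (collapse (codeTsA {n} k ts))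
  Poly-codeTsA n k []       = O
  Poly-codeTsA n k (t ∷ ts) = Poly-pairA (Poly-litA 2) (Poly-pairA (Poly-codeTA n k t) (Poly-codeTsA n k ts))

Poly-codeFA : ∀ n k (φ : Formula L) → Poly (collapse (codeFA {n} k φ))
Poly-codeFA n k (rel r ts) = Poly-pairA (Poly-litA 3) (Poly-pairA (Poly-lit {n} (relCode r)) (Poly-codeTsA n k ts))
Poly-codeFA n k ⊥′         = Poly-pairA (Poly-litA 4) O
Poly-codeFA n k (φ ⇒ ψ)    = Poly-pairA (Poly-litA 5) (Poly-pairA (Poly-codeFA n k φ) (Poly-codeFA n k ψ))
Poly-codeFA n k (∀′ φ)     = Poly-pairA (Poly-litA 6) (Poly-codeFA n (suc k) φ)

-- Bounds for derivations obtained by modus ponens and instantiation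

-- The conclusion is a part of the implication, whose code is below that of its proof. Hence the one
-- bound `t` serves for both subproofs and for the conclusion.
mpBound : ATerm 1 → ATerm 1
mpBound t = pairA t (pairA (litA 9) (pairA t t))

mpsBound : ℕ → ATerm 1 → ATerm 1
mpsBound zero    t = t
mpsBound (suc k) t = mpsBound k (mpBound t)

Poly-mpsBound : ∀ k {t} → Poly t → Poly (mpsBound k t)
Poly-mpsBound zero    p = p
Poly-mpsBound (suc k) p =
  Poly-mpsBound k (Poly-pairA p (Poly-pairA (Poly-litA 9) (Poly-pairA p p)))

-- The tree with conclusion b that instantiates ∀ a, proved by t.
instAxiom : (a b : ATerm 1) → ATerm 1
instAxiom a b = pairA (c-imp (c-all a) b) (pairA (litA 4) (var fzero))
  where open Codes {ATerm 1} litA pairA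

instBound : (a b t : ATerm 1) → ATerm 1
instBound a b t = pairA b (pairA (litA 9) (pairA (instAxiom a b) t))

Poly-instBound : ∀ {a b t} → Poly a → Poly b → Poly t → Poly (instBound a b t)
Poly-instBound a b p = Poly-pairA b (Poly-pairA (Poly-litA 9) (Poly-pairA (Poly-pairA
    (Poly-pairA (Poly-litA 5) (Poly-pairA (Poly-pairA (Poly-litA 6) a) b))
    (Poly-pairA (Poly-litA 4) var)) p))

codeBound : ℕ → ℕ → Formula L → ATerm 1
codeBound n k φ = collapse (codeFA {n} k φ)

-- The bounds are opaque because pairing terms double in size with each level
-- when they are unfolded.
opaque
  necessityBound : ∀ {T : Theory L} (n : ℕ) {φ} → T ⊢ φ → ATerm 1
  necessityBound zero    d     = litA (proofCode d)
  necessityBound (suc n) {φ} d =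
    instBound (codeBound n 1 φ) (codeBound (suc n) 0 φ) (necessityBound n (gen d))

  Poly-necessityBound : ∀ {T : Theory L} (n : ℕ) {φ} (d : T ⊢ φ) → Poly (necessityBound n d)
  Poly-necessityBound zero    d = Poly-litA (proofCode d)
  Poly-necessityBound (suc n) {φ} d =
    Poly-instBound (Poly-codeFA n 1 φ) (Poly-codeFA (suc n) 0 φ) (Poly-necessityBound n (gen d))

imps : List (Formula L) → Formula L → Formula L
imps φs ψ = foldr _⇒_ ψ φs

opaque
  inferBound : ∀ {T : Theory L} (n : ℕ) {φ} → T ⊢ φ → ℕ → ATerm 1
  inferBound n d k = mpsBound k (necessityBound n d ⊕ var fzero)

  Poly-inferBound : ∀ {T : Theory L} (n : ℕ) {φ} (d : T ⊢ φ) k → Poly (inferBound n d k)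
  Poly-inferBound n d k = Poly-mpsBound k (Poly-necessityBound n d ⊕ var)

-- Numerals and their size

module _ {n : ℕ} where
  open Codes {ATerm n} litA pairA

  num0A : ATerm n
  num0A = c-fn (litA 0) c-nil

  numSucA : ATerm n → ATerm n
  numSucA v = c-fn (litA 1) (c-cons v c-nil)

Poly-numSucA : Poly (numSucA (var fzero))
Poly-numSucA = Poly-pairA (Poly-litA 1) (Poly-pairA (Poly-litA 1) (Poly-pairA (Poly-litA 2) (Poly-pairA var O)))

numDegree : ℕ
numDegree = degree (numSucA (var fzero))

opaque
  -- The code of the numeral for `x` is the `x`-th iterate of a polynomial, `numSucA`, started at
  -- `num0A`.
  numBound : ATerm 1
  numBound = subA (num0A ∷ var fzero ∷ []) (iterBound numDegree)

-- w contains ⟨x , z⟩, and the members of w are ⟨0 , ⌜0⌝⟩ or come from other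
-- members by ⟨i , ⌜t⌝⟩ ↦ ⟨i + 1 , ⌜S t⌝⟩.
numF : Fm 2
numF = ∃ᶠ (exp (S (pairA x z))) (pairA x′ z′ ∈ᶠ w ∧ᶠ
  ∀ᶠ w (var (# 0) ∈ᶠ var (# 1) ⇒ᶠ (var (# 0) ≤ᶠ pairA (var (# 2)) (var (# 3)) ∧ᶠ
    (var (# 0) ≐ᶠ pairA O num0A
     ∨ᶠ ∃ᶠ (var (# 0)) (∃ᶠ (var (# 1)) (var (# 2) ≐ᶠ pairA (S (var (# 1))) (numSucA (var (# 0)))
          ∧ᶠ pairA (var (# 1)) (var (# 0)) ∈ᶠ var (# 3)))))))
  where
  x z : ATerm 2
  x = var (# 0)
  z = var (# 1)
  w x′ z′ : ATerm 3
  w = var (# 0)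
  x′ = var (# 1)
  z′ = var (# 2)

-- proof T, with J in place of justified T
proofF : Δ₀ 2 → Fm 2
proofF J = ∃ᶠ (var (# 0)) (var (# 1) ≐ᶠ pairA (var (# 2)) (var (# 0)))
  ∧ᶠ ∃ᶠ (exp (S (j-subst p (S p) p p))) (j-deriv (var (# 1)) ∈ᶠ var (# 0)
    ∧ᶠ ∀ᶠ (var (# 0)) (var (# 0) ∈ᶠ var (# 1) ⇒ᶠ ⟪ pick J (# 0) (# 1) ⟫))
  where
  open Judgements
  p : ATerm 2
  p = var (# 0)

opaque
  unfolding proof

  proofF-correct : ∀ (T : Theory L) → toΔ₀ (proofF (justifiedΔ T)) ≡ proof T
  proofF-correct T =
    cong (λ J → toΔ₀ (proofF J)) {x = justifiedΔ T} {y = justified T} (justifiedΔ-def T)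

-- Numerals and provability in a model, with bounds

module Provability {L : Language} (T : Theory L) (𝓜 : IΔ₀Exp) where
  open IΔ₀Exp 𝓜
  open Laws 𝓜
  open Numerals 𝓜
  open Derivability T 𝓜
  open Syntax T 𝓜

  ≼*-[] : ∀ {x y} → x ≼ y → (x ∷ []) ≼* (y ∷ [])
  ≼*-[] l = ≼*-∷ {ρ = []} {τ = []} l (λ ())

  ≃*-pair : ∀ {x y u v} → x ≃ y → u ≃ v → (x ∷ u ∷ []) ≃* (y ∷ v ∷ [])
  ≃*-pair e f = ≃*-∷ {ρ = _ ∷ []} {τ = _ ∷ []} e (≃*-∷ {ρ = []} {τ = []} f (λ ()))

  entryM : ∀ {n} → Vec Carrier n → Fin n ⊎ ℕ → Carrier
  entryM zs (inj₁ j) = lookup zs j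
  entryM zs (inj₂ i) = c-var (lit i)

  ent : ∀ {n} → Vec Carrier n → ℕ → ℕ → Carrier
  ent {n} zs k i = entryM zs (slot n k i)

  code : ∀ {n} → Formula L → Vec Carrier n → Carrier
  code φ zs = codeF (ent zs) 0 φ

  val-entryA : ∀ {n} (zs : Vec Carrier n) s → val (entryA s) zs ≡ entryM zs s
  val-entryA zs (inj₁ j) = ≡.refl
  val-entryA zs (inj₂ i) = cong c-var (val-litA i)

  mutual
    val-codeTA : ∀ {n} (zs : Vec Carrier n) k (t : Term L) → val (codeTA k t) zs ≡ codeT (ent zs k) t
    val-codeTA {n} zs k (var i)   = val-entryA zs (slot n k i)
    val-codeTA zs k (fn f ts) = cong₂ c-fn (val-litA (funCode f)) (val-codeTsA zs k ts)

    val-codeTsA : ∀ {n m} (zs : Vec Carrier n) k (ts : Vec (Term L) m) →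
      val (codeTsA k ts) zs ≡ codeTs (ent zs k) ts
    val-codeTsA zs k []       = ≡.refl
    val-codeTsA zs k (t ∷ ts) = cong₂ c-cons (val-codeTA zs k t) (val-codeTsA zs k ts)

  val-codeFA : ∀ {n} (zs : Vec Carrier n) k (φ : Formula L) → val (codeFA k φ) zs ≡ codeF (ent zs) k φ
  val-codeFA zs k (rel r ts) = cong₂ c-rel (val-litA (relCode r)) (val-codeTsA zs k ts)
  val-codeFA zs k ⊥′         = ≡.refl
  val-codeFA zs k (φ ⇒ ψ)    = cong₂ c-imp (val-codeFA zs k φ) (val-codeFA zs k ψ)
  val-codeFA zs k (∀′ φ)     = cong c-all (val-codeFA zs (suc k) φ)

  Below : ∀ {n} → Carrier → Vec Carrier n → Set
  Below β zs = ∀ i → lookup zs i ≼ β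

  val-collapse : ∀ {n} (t : ATerm n) {zs β} → Below β zs → val t zs ≼ val (collapse t) (β ∷ [])
  val-collapse t {zs} {β} h = ≼-trans (val-mono t {zs} {tabulate (λ _ → β)} (λ i →
      ≼-respʳ (≡⇒≃ (≡.sym (lookup-const i))) (h i)))
      (≼-reflexive (≡⇒≃ (≡.sym (val-ren (λ _ → fzero) (λ i → ≡.sym (lookup-const i)) t))))
    where
    lookup-const : ∀ {n} (i : Fin n) → lookup (tabulate (λ _ → β)) i ≡ β
    lookup-const fzero    = ≡.refl
    lookup-const (fsuc i) = lookup-const i

  codeF-bound : ∀ {n} k φ {zs : Vec Carrier n} {β} → Below β zs →
    codeF (ent zs) k φ ≼ val (collapse (codeFA {n} k φ)) (β ∷ [])
  codeF-bound k φ {zs} h = ≼-respˡ (≡⇒≃ (val-codeFA zs k φ)) (val-collapse (codeFA k φ) h)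

  codeT-ext : ∀ {E F : ℕ → Carrier} → (∀ i → E i ≡ F i) → ∀ t → codeT E t ≡ codeT F t
  codeTs-ext : ∀ {E F : ℕ → Carrier} → (∀ i → E i ≡ F i) → ∀ {m} (ts : Vec (Term L) m) → codeTs E ts ≡ codeTs F ts
  codeT-ext h (var i)   = h i
  codeT-ext h (fn f ts) = cong (c-fn _) (codeTs-ext h ts)
  codeTs-ext h []       = ≡.refl
  codeTs-ext h (t ∷ ts) = cong₂ c-cons (codeT-ext h t) (codeTs-ext h ts)

  codeF-ext : ∀ {E F : ℕ → ℕ → Carrier} m → (∀ k i → E k i ≡ F (m + k) i) →
    ∀ k φ → codeF E k φ ≡ codeF F (m + k) φ
  codeF-ext m h k (rel r ts) = cong (c-rel _) (codeTs-ext (h k) ts)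
  codeF-ext m h k ⊥′         = ≡.refl
  codeF-ext m h k (φ ⇒ ψ)    = cong₂ c-imp (codeF-ext m h k φ) (codeF-ext m h k ψ)
  codeF-ext {E} {F} m h k (∀′ φ) = cong c-all (≡.trans (codeF-ext m h (suc k) φ)
    (cong (λ n → codeF F n φ) (ℕ-suc m k)))
    where
    ℕ-suc : ∀ m k → m + suc k ≡ suc (m + k)
    ℕ-suc zero    k = ≡.refl
    ℕ-suc (suc m) k = cong suc (ℕ-suc m k)

  slot-empty : ∀ k i → slot 0 k i ≡ inj₂ i
  slot-empty zero    i       = ≡.refl
  slot-empty (suc k) zero    = ≡.refl
  slot-empty (suc k) (suc i) = cong (map₂ suc) (slot-empty k i)

  code-empty : ∀ φ → code φ [] ≡ cF φ
  code-empty φ = ≡.trans (codeF-ext 0 (λ k i → cong (entryM []) (slot-empty k i)) 0 φ) (codeF-plain 0 φ)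

  -- Numerals

  num0 : Carrier
  num0 = c-fn (lit 0) c-nil

  numSuc : Carrier → Carrier
  numSuc z = c-fn (lit 1) (c-cons z c-nil)

  z≼numSuc : ∀ z → z ≼ numSuc z
  z≼numSuc z = ≼-trans (≼-trans (fst≼pr _ _) (snd≼pr _ _)) (≼-trans (snd≼pr _ _) (snd≼pr _ _))

  NumStep : Carrier → Carrier → Set
  NumStep w j = Cl (j ≃ pr 0# num0 ⊎ Cl (Σ[ i ∈ Carrier ] i ≼ j × Cl (Σ[ v ∈ Carrier ] v ≼ j ×
    (j ≃ pr (sc i) (numSuc v) × pr i v ∈ w))))

  Num : Carrier → Carrier → Set
  Num x z = ⟦ numF ⟧ᶠ (x ∷ z ∷ [])

  private
    num-intro : ∀ {x z w} → sc w ≼ ex (sc (pr x z)) → pr x z ∈ w →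
      (∀ j → j ∈ w → j ≼ pr x z × NumStep w j) → Num x z
    num-intro {w = w} l m h = return (w , ≼-trans (x≼scx w) l , m , λ j _ → h j)

    numStep-mono : ∀ {w w′ j} → (∀ {i} → i ≼ j → i ∈ w → i ∈ w′) → NumStep w j → NumStep w′ j
    numStep-mono sub p = p >>= λ
      { (inj₁ e) → return (inj₁ e)
      ; (inj₂ q) → return (inj₂ (q >>= λ { (i , i≼ , q) → return (i , i≼ , (q >>= λ { (v , v≼ , e , m) →
          return (v , v≼ , e , sub (≼-respʳ (sym e) (pr-mono (x≼scx i) (z≼numSuc v))) m) })) })) }

  num-zero : Num 0# num0
  num-zero = do
    (w , w< , out , into) ← comprehension (v0 ≐ᶠ v1) (pr 0# num0 ∷ []) (pr 0# num0)
    num-intro w< (into _ ≼-refl ≃-refl) (λ j m → proj₁ (out j m) , return (inj₁ (proj₂ (out j m))))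

  num-suc : ∀ {x z} → Num x z → Num (sc x) (numSuc z)
  num-suc {x} {z} p = do
    (w , _ , m , h) ← p
    (u , u< , out , into) ← comprehension (v0 ∈ᶠ v1 ∨ᶠ v0 ≐ᶠ v2) (w ∷ pr (sc x) (numSuc z) ∷ []) (pr (sc x) (numSuc z))
    let up = pr-mono (x≼scx x) (z≼numSuc z)
        w⊆u : ∀ {i} → i ∈ w → i ∈ u
        w⊆u {i} m = into i (≼-trans (proj₁ (h i (∈⇒≼ m) m)) up) (return (inj₁ m))
    num-intro u< (into _ ≼-refl (return (inj₂ ≃-refl))) (λ j m′ → proj₁ (out j m′) ,
      (proj₂ (out j m′) >>= λ
        { (inj₁ m₁) → numStep-mono (λ _ → w⊆u) (proj₂ (h j (∈⇒≼ m₁) m₁))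
        ; (inj₂ e) → return (inj₂ (return (x , ≼-trans (x≼scx x) (≼-respʳ (sym e) (fst≼pr _ _)) ,
            return (z , ≼-trans (z≼numSuc z) (≼-respʳ (sym e) (snd≼pr _ _)) , e , w⊆u m)))) }))

  num-zero⁻¹ : ∀ {z} → Num 0# z → z ≃ num0
  num-zero⁻¹ {z} p = stable≃ do
    (w , _ , m , h) ← p
    inj₂ q ← proj₂ (h _ (∈⇒≼ m) m)
      where inj₁ e → return (proj₂ (pr-inj e))
    (i , _ , q) ← q
    (v , _ , e , _) ← q
    absurd (sc≄0 (sym (proj₁ (pr-inj e))))

  num-suc⁻¹ : ∀ {x z} → Num (sc x) z → Cl (Σ[ v ∈ Carrier ] Num x v × z ≃ numSuc v)
  num-suc⁻¹ {x} {z} p = do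
    (w , _ , m , h) ← p
    inj₂ q ← proj₂ (h _ (∈⇒≼ m) m)
      where inj₁ e → absurd (sc≄0 (proj₁ (pr-inj e)))
    (i , _ , q) ← q
    (v , _ , e , m′) ← q
    -- The set for `sc x` may be too large for ⟨x , v⟩. It is cut down to the members below that
    -- pair, and these remain justified because a member refers to smaller members only.
    (u , u< , out , into) ← comprehension (v0 ∈ᶠ v1) (w ∷ []) (pr x v)
    let x≃i = sc-inj (proj₁ (pr-inj e))
        inw : ∀ {j} → j ∈ u → j ∈ w
        inw {j} m = proj₂ (out j m)
    return (v , num-intro u< (into _ ≼-refl (∈-respˡ (pr-cong (sym x≃i) ≃-refl) m′))
      (λ j m → proj₁ (out j m) , numStep-mono (λ {i} i≼ → into i (≼-trans i≼ (proj₁ (out j m))))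
        (proj₂ (h j (∈⇒≼ (inw m)) (inw m)))) , proj₂ (pr-inj e))

  num-resp : ∀ {x y z v} → x ≃ y → z ≃ v → Num x z → Num y v
  num-resp {x} {y} {z} {v} e f = fm-resp numF {x ∷ z ∷ []} {y ∷ v ∷ []} (≃*-pair e f)

  -- Uniqueness for arbitrary codes is not a Δ₀-statement. With z + z′ as a parameter both codes are
  -- bounded, and the bound suffices for their predecessors too.
  num-unique : ∀ {x z z′} → Num x z → Num x z′ → z ≃ z′
  num-unique {x} {z} {z′} p q = inductᶠ A {z ∔ z′ ∷ []}
      (λ u _ v _ n m → trans (num-zero⁻¹ n) (sym (num-zero⁻¹ m))) step x
      z (x≼x∔y z z′) z′ (x≼y∔x z′ z) p q
    where
    A : Fm 2
    A = ∀ᶠ v1 (∀ᶠ v2 (numF ⟨ v2 ∷ v1 ∷ [] ⟩ ⇒ᶠ numF ⟨ v2 ∷ v0 ∷ [] ⟩ ⇒ᶠ v1 ≐ᶠ v0))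
    step : ∀ x → ⟦ A ⟧ᶠ (x ∷ z ∔ z′ ∷ []) → ⟦ A ⟧ᶠ (sc x ∷ z ∔ z′ ∷ [])
    step x ih u u≼ v v≼ n m = stable≃ do
      (a , n′ , e) ← num-suc⁻¹ n
      (b , m′ , f) ← num-suc⁻¹ m
      let a≃b = ih a (≼-trans (z≼numSuc a) (≼-respˡ e u≼)) b (≼-trans (z≼numSuc b) (≼-respˡ f v≼)) n′ m′
      return (trans e (trans (pr-cong ≃-refl (pr-cong ≃-refl (pr-cong ≃-refl (pr-cong a≃b ≃-refl)))) (sym f)))

  numB : Carrier → Carrier
  numB x = val numBound (x ∷ [])

  opaque
    unfolding numBound

    numB-iter : ∀ x → numB x ≡ iter numDegree num0 x
    numB-iter x = val-subA (num0A ∷ var fzero ∷ []) {x ∷ []} (iterBound numDegree)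

  numB-mono : ∀ {x y} → x ≼ y → numB x ≼ numB y
  numB-mono {x} {y} l = val-mono numBound {x ∷ []} {y ∷ []} (≼*-[] l)

  num-total : ∀ x → Cl (Σ[ z ∈ Carrier ] z ≼ numB x × Num x z)
  num-total x = inductᶠ A {[]}
      (return (num0 , ≼-respʳ (≡⇒≃ (≡.sym (numB-iter 0#))) (iter-start numDegree num0 0#) , num-zero)) step x
    where
    A : Fm 1
    A = ∃ᶠ numBound (numF ⟨ v1 ∷ v0 ∷ [] ⟩)
    step : ∀ x → ⟦ A ⟧ᶠ (x ∷ []) → ⟦ A ⟧ᶠ (sc x ∷ [])
    step x ih = do
      (z , l , p) ← ih
      return (numSuc z , ≼-trans (val-mono (numSucA v0) {z ∷ []} {iter numDegree num0 x ∷ []} (≼*-[] (≼-respʳ (≡⇒≃ (numB-iter x)) l)))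
        (≼-respʳ (≡⇒≃ (≡.sym (numB-iter (sc x)))) (iter-step Poly-numSucA num0 x)) , num-suc p)

  num-≼ : ∀ {x z} → Num x z → z ≼ numB x
  num-≼ {x} p = stable≼ (num-total x >>= λ { (v , l , q) → return (≼-respˡ (num-unique q p) l) })

  private
    numSuc-term : ∀ q v → numSuc v ≼ q → Der q (jTerm v) → Der q (jTerm (numSuc v))
    numSuc-term q v l d = der-fn q _ _ (lit 1) l (sc-mono (0≼ _)) (funAr-holds `S)
      (der-cons q 0# v c-nil (≼-trans (sc-mono (0≼ _)) (≼-trans (arg₂ _ _) l)) (≼-trans (arg₂ _ _) l) d (der-nil q))

    numSuc-subst : ∀ q k σ v → k ≼ q → σ ≼ sc q → numSuc v ≼ q → Der q (jSubst k σ v v) →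
      Der q (jSubst k σ (numSuc v) (numSuc v))
    numSuc-subst q k σ v k≼ σ≼ l d = der-subst-fn q k σ _ _ _ k≼ σ≼ l l
      (der-subst-cons q k σ v c-nil v c-nil k≼ σ≼ (≼-trans (arg₂ _ _) l) (≼-trans (arg₂ _ _) l) d
        (der-subst-nil q k σ k≼ σ≼))

  -- `x` may be nonstandard, so this is an induction in the model. It is admissible because `derF`
  -- expresses derivability within the fixed size `q` by a Δ₀-formula.
  num-term : ∀ q {x z} → Num x z → z ≼ q → Der q (jTerm z)
  num-term q {x} {z} p l = der→ (inductᶠ A {q ∷ []} base step x z l p)
    where
    A : Fm 2
    A = ∀ᶠ v1 (numF ⟨ v1 ∷ v0 ∷ [] ⟩ ⇒ᶠ derF ⟨ v2 ∷ Judgements.j-term v0 ∷ [] ⟩)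
    base : ⟦ A ⟧ᶠ (0# ∷ q ∷ [])
    base z l p = let e = num-zero⁻¹ p in der← (der-resp (pr-cong ≃-refl (sym e))
      (der-fn q _ _ 0# (≼-respˡ e l) (0≼ _) (funAr-holds `0) (der-nil q)))
    step : ∀ x → ⟦ A ⟧ᶠ (x ∷ q ∷ []) → ⟦ A ⟧ᶠ (sc x ∷ q ∷ [])
    step x ih z l p = do
      (v , n , e) ← num-suc⁻¹ p
      let l′ = ≼-respˡ e l
      der← (der-resp (pr-cong ≃-refl (sym e))
        (numSuc-term q v l′ (der→ (ih v (≼-trans (z≼numSuc v) l′) n))))

  -- Numerals already inserted meet the instantiations of further variables, and a freshly inserted
  -- one is shifted past binders; they have to be inert under both. Again this takes an induction in
  -- the model.
  num-closed : ∀ q k σ {x z} → k ≼ q → σ ≼ sc q → Num x z → z ≼ q → Der q (jSubst k σ z z)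
  num-closed q k σ {x} {z} k≼ σ≼ p l = der→ (inductᶠ A {q ∷ k ∷ σ ∷ []} base step x z l p)
    where
    A : Fm 4
    A = ∀ᶠ v1 (numF ⟨ v1 ∷ v0 ∷ [] ⟩ ⇒ᶠ derF ⟨ v2 ∷ Judgements.j-subst v3 v4 v0 v0 ∷ [] ⟩)
    base : ⟦ A ⟧ᶠ (0# ∷ q ∷ k ∷ σ ∷ [])
    base z l p = let e = num-zero⁻¹ p in der← (der-resp (pr-cong ≃-refl (pr-cong ≃-refl (pr-cong (sym e) (sym e))))
      (der-subst-fn q k σ _ _ _ k≼ σ≼ (≼-respˡ e l) (≼-respˡ e l) (der-subst-nil q k σ k≼ σ≼)))
    step : ∀ x → ⟦ A ⟧ᶠ (x ∷ q ∷ k ∷ σ ∷ []) → ⟦ A ⟧ᶠ (sc x ∷ q ∷ k ∷ σ ∷ [])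
    step x ih z l p = do
      (v , n , e) ← num-suc⁻¹ p
      let l′ = ≼-respˡ e l
      der← (der-resp (pr-cong ≃-refl (pr-cong ≃-refl (pr-cong (sym e) (sym e))))
        (numSuc-subst q k σ v k≼ σ≼ l′ (der→ (ih v (≼-trans (z≼numSuc v) l′) n))))

  Nums : ∀ {n} → Vec Carrier n → Vec Carrier n → Set
  Nums xs zs = ∀ i → Num (lookup xs i) (lookup zs i)

  -- Provability

  Proves : Carrier → Carrier → Set
  Proves p c = p ∷ c ∷ [] ⊩ proof T

  Prf : Carrier → Carrier → Set
  Prf β c = Cl (Σ[ p ∈ Carrier ] p ≼ β × Proves p c)

  prfF : Fm 2
  prfF = ∃ᶠ v0 (⟪ proof T ⟫ ⟨ v0 ∷ v2 ∷ [] ⟩)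

  proves→ : ∀ {p c} → Proves p c → ⟦ proofF (justifiedΔ T) ⟧ᶠ (p ∷ c ∷ [])
  proves→ {p} {c} h = fm→ (proofF (justifiedΔ T))
    (subst (p ∷ c ∷ [] ⊩_) (≡.sym (proofF-correct T)) h)

  proves← : ∀ {p c} → ⟦ proofF (justifiedΔ T) ⟧ᶠ (p ∷ c ∷ []) → Proves p c
  proves← {p} {c} h = subst (p ∷ c ∷ [] ⊩_) (proofF-correct T) (fm← (proofF (justifiedΔ T)) h)

  proves-intro : ∀ {c r} → Der (node c r) (jDeriv (node c r)) → Proves (node c r) c
  proves-intro {c} {r} d = proves← (return (r , snd≼pr _ _ , ≃-refl) , (d >>= λ { (w , l , h , m) →
    return (w , l , m , λ j _ m′ → pick← (justifiedΔ T) (# 0) (# 1) (proj₂ (h j m′))) }))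

  ex-anti : ∀ {a b} → ex a ≼ ex b → a ≼ b
  ex-anti {a} {b} l = stable≼ (≼-total a b >>= λ
    { (inj₁ p) → return p
    ; (inj₂ p) → absurd (≼-irrefl (≼-trans (≼-respˡ (sym (sc≃+1 _)) (≼-respʳ (sym (ex-sc b)) (∔-mono ≼-refl (1≼ex b))))
        (≼-trans (ex-mono p) l))) })

  pr-strict₁ : ∀ {a a′ b b′} → sc a ≼ a′ → b ≼ b′ → sc (pr a b) ≼ pr a′ b′
  pr-strict₁ {a} p q = sc-mono (≼-respˡ (+-sc _ a) (∔-mono (·-mono s s) p))
    where s = ∔-mono (≼-trans (x≼scx a) p) q

  pr-strict₂ : ∀ {a b b′} → sc b ≼ b′ → sc (pr a b) ≼ pr a b′
  pr-strict₂ {a} {b} p = sc-mono (≼-respˡ (+-scˡ _ a) (∔-mono (≼-trans square (·-mono s s)) ≼-refl))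
    where
    s = ≼-respˡ (+-sc a b) (∔-mono (≼-refl {a}) p)
    square : sc ((a ∔ b) · (a ∔ b)) ≼ sc (a ∔ b) · sc (a ∔ b)
    square = ≼-respʳ (sym (*-scˡ _ _)) (≼-respʳ (sym (+-sc _ _))
      (sc-mono (≼-trans (·-mono ≼-refl (x≼scx _)) (x≼x∔y _ _))))

  bound-strict : ∀ {p q} → sc p ≼ q → sc (bound p) ≼ bound q
  bound-strict {p} l = pr-strict₂ (pr-strict₁ (pr-strict₁ l (≼-trans l (x≼scx _)))
    (pr-mono (≼-trans (x≼scx p) l) (≼-trans (x≼scx p) l)))

  -- `Proof` bounds the set by 2^(bound p + 1), which lets members reach one beyond `bound p`. The
  -- strict inequality between `p` and `q` absorbs this, since `bound` is strictly increasing.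
  proves-elim : ∀ {p c q} → Proves p c → sc p ≼ q →
    Cl (Σ[ r ∈ Carrier ] p ≃ node c r × Der q (jDeriv (node c r)))
  proves-elim {p} {c} {q} h l = do
    let (node-shape , set) = proves→ h
    (r , _ , e) ← node-shape
    (w , w≼ , m , h) ← set
    return (r , e , return (w , ≼-trans w≼ (ex-mono (sc-mono (bound-mono (≼-trans (x≼scx p) l)))) ,
      (λ i m′ → ≼-trans (ex-anti (≼-trans (∈⇒ex≼ m′) w≼)) (bound-strict l) ,
        pick→ (justifiedΔ T) (# 0) (# 1) (h i (∈⇒≼ m′) m′)) ,
      ∈-respˡ (pr-cong ≃-refl e) m))

  proves-resp : ∀ {p q c d} → p ≃ q → c ≃ d → Proves p c → Proves q d
  proves-resp {p} {q} {c} {d} e f = ⊩-resp (proof T) {p ∷ c ∷ []} {q ∷ d ∷ []} (≃*-pair e f)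

  prf-mono : ∀ {β γ c} → β ≼ γ → Prf β c → Prf γ c
  prf-mono l h = h >>= λ { (p , p≼ , d) → return (p , ≼-trans p≼ l , d) }

  prf-resp : ∀ {β c d} → c ≃ d → Prf β c → Prf β d
  prf-resp e h = h >>= λ { (p , p≼ , d) → return (p , p≼ , proves-resp ≃-refl e d) }

  prf-derivation : ∀ {φ} (d : T ⊢ φ) → Prf (lit (proofCode d)) (cF φ)
  prf-derivation d = return (cD d , ≼-reflexive (sym (lit-cD d)) , proves-intro (derivation-der d (cD d) ≼-refl))

  proves-≼ : ∀ {p c} → Proves p c → c ≼ p
  proves-≼ d = stable≼ (proj₁ (proves→ d) >>= λ { (r , _ , e) → return (≼-respʳ (sym e) (fst≼pr _ r)) })

  prf-≼ : ∀ {β c} → Prf β c → c ≼ β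
  prf-≼ h = stable≼ (h >>= λ { (p , l , d) → return (≼-trans (proves-≼ d) l) })

  prf-mp : ∀ {β γ δ a b} → Prf β (c-imp a b) → Prf γ a → b ≼ δ → Prf (pr δ (pr (lit 9) (pr β γ))) b
  prf-mp {β} {γ} {δ} {a} {b} h k b≼δ = do
    (p , p≼ , d) ← h
    (q , q≼ , e) ← k
    (r , p≃ , _) ← proves-elim d ≼-refl
    (s , q≃ , _) ← proves-elim e ≼-refl
    let P = node (c-imp a b) r
        Q = node a s
        R = node b (ruleMp P Q)
        P≺R : sc P ≼ R
        P≺R = ≼-trans (fst≺pr P Q) (≼-trans (snd≼pr _ _) (snd≼pr _ _))
        Q≺R : sc Q ≼ R
        Q≺R = ≼-trans (snd≺pr P Q) (≼-trans (snd≼pr _ _) (snd≼pr _ _))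
    -- The first eliminations only reveal the shapes of the two trees, from which `R` is formed.
    -- They are repeated here to obtain the judgements within the size of `R`.
    (r′ , e₁ , d₁) ← proves-elim {q = R} (proves-resp p≃ ≃-refl d) P≺R
    (s′ , e₂ , d₂) ← proves-elim {q = R} (proves-resp q≃ ≃-refl e) Q≺R
    return (R , pr-mono b≼δ (pr-mono ≼-refl (pr-mono (≼-respˡ p≃ p≼) (≼-respˡ q≃ q≼))) ,
      proves-intro (rule (# 29) R (0# ∷ 0# ∷ s ∷ r ∷ b ∷ a ∷ [])
        (0≼ _ , 0≼ _ , tt , tt , tt , tt) (jDeriv-mono ≼-refl)
        (der-resp (pr-cong ≃-refl (sym e₁)) d₁ , der-resp (pr-cong ≃-refl (sym e₂)) d₂ , tt)))

  Numeral : Carrier → Set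
  Numeral z = Cl (Σ[ x ∈ Carrier ] Num x z)

  Numerals : ∀ {n} → Vec Carrier n → Set
  Numerals zs = ∀ i → Numeral (lookup zs i)

  numeral-isTerm : ∀ q {z} → Numeral z → z ≼ q → Der q (jTerm z)
  numeral-isTerm q n l = n >>= λ { (x , p) → num-term q p l }

  numeral-closed : ∀ q k σ {z} → k ≼ q → σ ≼ sc q → Numeral z → z ≼ q → Der q (jSubst k σ z z)
  numeral-closed q k σ k≼ σ≼ n l = n >>= λ { (x , p) → num-closed q k σ k≼ σ≼ p l }

  ent-term : ∀ {n} {zs : Vec Carrier n} → Numerals zs → ∀ q k i → ent zs k i ≼ q → Der q (jTerm (ent zs k i))
  ent-term {n} {zs} ns q k i l = go (slot n k i) l
    where
    go : ∀ s → entryM zs s ≼ q → Der q (jTerm (entryM zs s))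
    go (inj₁ j) l = numeral-isTerm q (ns j) l
    go (inj₂ i) l = der-var q (lit i) l

  private
    -- A slot before and after an instantiation: an inserted numeral that stays, a variable that
    -- stays a variable, or the variable being instantiated. Recording which of these holds keeps
    -- both slots in step when a further quantifier is passed.
    data Match {n} : Fin n ⊎ ℕ → Fin (suc n) ⊎ ℕ → Set where
      closed′  : ∀ j → Match (inj₁ j) (inj₁ (fsuc j))
      variable′ : ∀ a b → Match (inj₂ a) (inj₂ b)
      hit      : ∀ a → Match (inj₂ a) (inj₁ fzero)

    Inst : ∀ {n} → Carrier → Carrier → Vec Carrier n → ℕ → Fin n ⊎ ℕ → Fin (suc n) ⊎ ℕ → Set
    Inst q z zs k s t = Match s t × (lit k ≼ q → z ≼ q → entryM zs s ≼ q → entryM (z ∷ zs) t ≼ q →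
      Der q (jSubst (lit k) (sc z) (entryM zs s) (entryM (z ∷ zs) t)))

    inst-entry : ∀ {n} q {z} {zs : Vec Carrier n} → Numeral z → Numerals zs →
      ∀ k i → Inst q z zs k (slot n (suc k) i) (slot (suc n) k i)
    inst-entry q nz ns zero zero = hit 0 , λ _ z≼ l _ → der-inst-zero q _ l z≼
    inst-entry {n} q {z} {zs} nz ns zero (suc i) = go (slot₀ n i)
      where
      go : ∀ s → Inst q z zs zero (map₂ suc s) (map₁ fsuc s)
      go (inj₁ j) = closed′ j , λ k≼ z≼ l _ → numeral-closed q _ _ k≼ (sc-mono z≼) (ns j) l
      go (inj₂ a) = variable′ (suc a) a , λ _ z≼ l _ → der-inst-suc q z (lit a) z≼ l
    inst-entry q nz ns (suc k) zero = variable′ 0 0 , λ k≼ z≼ l _ → der-lift-zero q (lit k) _ k≼ (sc-mono z≼) l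
    inst-entry {n} q {z} {zs} nz ns (suc k) (suc i) =
        go (slot n (suc k) i) (slot (suc n) k i) (inst-entry q nz ns k i)
      where
      go : ∀ s t → Inst q z zs k s t → Inst q z zs (suc k) (map₂ suc s) (map₂ suc t)
      go _ _ (closed′ j , _) = closed′ j , λ k≼ z≼ l _ → numeral-closed q _ _ k≼ (sc-mono z≼) (ns j) l
      go _ _ (variable′ a b , d) = variable′ (suc a) (suc b) , λ k≼ z≼ l m →
        let b≼ = ≼-trans (pr-mono ≼-refl (x≼scx (lit b))) m in
        der-lift-suc q (lit k) (sc z) (lit a) (c-var (lit b)) (c-var (sc (lit b))) k≼ (sc-mono z≼) l m
          (pr-mono ≼-refl (x≼scx _))
          (d (≼-trans (x≼scx _) k≼) z≼ (≼-trans (pr-mono ≼-refl (x≼scx _)) l) b≼) (der-wk-var q (lit b) m)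
      go _ _ (hit a , d) = hit (suc a) , λ k≼ z≼ l m →
        der-lift-suc q (lit k) (sc z) (lit a) z z k≼ (sc-mono z≼) l m ≼-refl
          (d (≼-trans (x≼scx _) k≼) z≼ (≼-trans (pr-mono ≼-refl (x≼scx _)) l) m)
          (numeral-closed q 0# 0# (0≼ _) (0≼ _) nz m)

  prf-inst : ∀ {n β z} {zs : Vec Carrier n} φ → Numeral z → Numerals zs → Below β (z ∷ zs) →
    ∀ G → Prf (val G (β ∷ [])) (c-all (codeF (ent zs) 1 φ)) →
    Prf (val (instBound (codeBound n 1 φ) (codeBound (suc n) 0 φ) G) (β ∷ [])) (code φ (z ∷ zs))
  prf-inst {n} {β} {z} {zs} φ nz ns below G h =
      prf-mp (return (A , A≼ , proves-intro axiom)) h b≼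
    where
    a b A : Carrier
    a = codeF (ent zs) 1 φ
    b = code φ (z ∷ zs)
    A = node (c-imp (c-all a) b) (ruleElim z)
    a≼ = codeF-bound 1 φ {zs} {β} (below ∘ fsuc)
    b≼ = codeF-bound 0 φ {z ∷ zs} {β} below
    A≼ : A ≼ val (instAxiom (codeBound n 1 φ) (codeBound (suc n) 0 φ)) (β ∷ [])
    A≼ = pr-mono (pr-mono ≼-refl (pr-mono (pr-mono ≼-refl a≼) b≼)) (pr-mono ≼-refl (below fzero))
    imp≼ : c-imp (c-all a) b ≼ A
    imp≼ = fst≼pr _ _
    all≼ : c-all a ≼ A
    all≼ = ≼-trans (arg₁ _ _) imp≼
    a≼A : a ≼ A
    a≼A = ≼-trans (snd≼pr _ _) all≼
    b≼A : b ≼ A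
    b≼A = ≼-trans (arg₂ _ _) imp≼
    z≼A : z ≼ A
    z≼A = ≼-trans (snd≼pr _ _) (snd≼pr _ _)
    nzs : Numerals (z ∷ zs)
    nzs fzero    = nz
    nzs (fsuc i) = ns i
    shifted : codeF (λ k → ent zs (suc k)) 0 φ ≡ a
    shifted = codeF-ext 1 (λ k i → ≡.refl) 0 φ
    axiom : Der A (jDeriv A)
    axiom = rule (# 24) A (0# ∷ 0# ∷ 0# ∷ z ∷ b ∷ a ∷ []) (0≼ _ , 0≼ _ , 0≼ _ , tt , tt , tt)
      (jDeriv-mono ≼-refl)
      (der-imp A _ _ imp≼ (der-all A _ all≼ (formula-der A (ent zs) (ent-term ns A) 1 φ a≼A))
                          (formula-der A (ent (z ∷ zs)) (ent-term nzs A) 0 φ b≼A) ,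
       numeral-isTerm A nz z≼A ,
       subst (λ c → Der A (jSubst 0# (sc z) c b)) shifted
         (subst-formula A (sc z) (sc-mono z≼A) (λ k → ent zs (suc k)) (ent (z ∷ zs))
           (λ k i k≼ l m → proj₂ (inst-entry A nz ns k i) k≼ z≼A l m) 0 φ
           (≼-respˡ (sym (trans (+-0ˡ _) (≡⇒≃ shifted))) a≼A) b≼A) , tt)

  opaque
    unfolding necessityBound

    necessity-closed : ∀ {φ} (d : T ⊢ φ) {β} → Prf (val (necessityBound 0 d) (β ∷ [])) (code φ [])
    necessity-closed {φ} d {β} =
      subst (λ b → Prf b (code φ [])) (≡.sym (val-litA (proofCode d) {β ∷ []}))
        (prf-resp (≡⇒≃ (≡.sym (code-empty φ))) (prf-derivation d))

    -- The last variable is instantiated first: `gen` hides variable 0, the recursion inserts the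
    -- other numerals, and `prf-inst` inserts the head. As `n` is a number of the metatheory, the
    -- resulting bound is a fixed polynomial.
    necessity : ∀ n {φ} (d : T ⊢ φ) {β} {zs : Vec Carrier n} → Numerals zs → Below β zs →
      Prf (val (necessityBound n d) (β ∷ [])) (code φ zs)
    necessity zero {φ} d {β} {[]} ns below =
      necessity-closed d
    necessity (suc n) {φ} d {zs = z ∷ zs} ns below =
      prf-inst φ (ns fzero) (ns ∘ fsuc) below (necessityBound n (gen d))
        (necessity n (gen d) (ns ∘ fsuc) (below ∘ fsuc))

  private
    prf-mps : ∀ {n β} {zs : Vec Carrier n} {ψ} φs t → β ≼ val t (β ∷ []) →
      Prf (val t (β ∷ [])) (code (imps φs ψ) zs) → All (λ φ → Prf β (code φ zs)) φs →
      Prf (val (mpsBound (length φs) t) (β ∷ [])) (code ψ zs)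
    prf-mps []       t l h []       = h
    prf-mps (φ ∷ φs) t l h (p ∷ ps) = prf-mps φs (mpBound t) (≼-trans l (fst≼pr _ _))
      (prf-mp h (prf-mono l p) (≼-trans (arg₂ _ _) (prf-≼ h))) ps

  opaque
    unfolding inferBound

    infer : ∀ n {ψ} φs (d : T ⊢ imps φs ψ) {β} {zs : Vec Carrier n} → Numerals zs → Below β zs →
      All (λ φ → Prf β (code φ zs)) φs → Prf (val (inferBound n d (length φs)) (β ∷ [])) (code ψ zs)
    infer n φs d ns below ps = prf-mps φs (necessityBound n d ⊕ v0) (x≼y∔x _ _)
      (prf-mono (x≼x∔y _ _) (necessity n d ns below)) ps

-- Instances of Δ₀-formulas and their reindexing

slot₀-toℕ : ∀ n (i : Fin n) → slot₀ n (toℕ i) ≡ inj₁ i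
slot₀-toℕ (suc n) fzero    = ≡.refl
slot₀-toℕ (suc n) (fsuc i) = cong (map₁ fsuc) (slot₀-toℕ n i)

slot-free : ∀ n j (i : Fin n) → slot n j (j + toℕ i) ≡ inj₁ i
slot-free n zero    i = slot₀-toℕ n i
slot-free n (suc j) i = cong (map₂ suc) (slot-free n j i)

slot-bound : ∀ n j k → slot n (j + suc k) j ≡ inj₂ j
slot-bound n zero    k = ≡.refl
slot-bound n (suc j) k = cong (map₂ suc) (slot-bound n j k)

shiftBy-var : ∀ j i → shiftBy {L} j (var i) ≡ var (j + i)
shiftBy-var zero    i = ≡.refl
shiftBy-var (suc j) i = cong shift (shiftBy-var j i)

shiftBy-shift : ∀ j (t : Term L) → shiftBy j (shift t) ≡ shift (shiftBy j t)
shiftBy-shift zero    t = ≡.refl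
shiftBy-shift (suc j) t = cong shift (shiftBy-shift j t)

lookup-shifts : ∀ {n} (ts : Vec (Term L) n) i → lookup (shifts ts) i ≡ shift (lookup ts i)
lookup-shifts (t ∷ ts) fzero    = ≡.refl
lookup-shifts (t ∷ ts) (fsuc i) = lookup-shifts ts i

shift-embT : ∀ {n} (t : ATerm n) (ts : Vec (Term L) n) → shift (embT t ts) ≡ embT t (shifts ts)
shift-embT (var i) ts = ≡.sym (lookup-shifts ts i)
shift-embT O       ts = ≡.refl
shift-embT (S t)   ts = cong S′ (shift-embT t ts)
shift-embT (exp t) ts = cong exp′ (shift-embT t ts)
shift-embT (t ⊕ u) ts = cong₂ _+′_ (shift-embT t ts) (shift-embT u ts)
shift-embT (t ⊗ u) ts = cong₂ _*′_ (shift-embT t ts) (shift-embT u ts)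

impsΔ : ∀ {n} → List (Δ₀ n) → Δ₀ n → Δ₀ n
impsΔ χs ψ = foldr _⊃_ ψ χs

emb-imps : ∀ {n} χs (ψ : Δ₀ n) (ts : Vec (Term L) n) →
  emb (impsΔ χs ψ) ts ≡ imps (mapL (λ χ → emb χ ts) χs) (emb ψ ts)
emb-imps []       ψ ts = ≡.refl
emb-imps (χ ∷ χs) ψ ts = cong (emb χ ts ⇒_) (emb-imps χs ψ ts)

infixl 9 _∘A_
_∘A_ : ATerm 1 → ATerm 1 → ATerm 1
t ∘A u = subA (u ∷ []) t

module Instances {L : Language} (T : Theory L) (𝓜 : IΔ₀Exp) where
  open IΔ₀Exp 𝓜
  open Laws 𝓜
  open Numerals 𝓜
  open Derivability T 𝓜
  open Syntax T 𝓜
  open Provability T 𝓜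

  PrfΔ : ∀ {n} → Carrier → Vec Carrier n → Δ₀ n → Set
  PrfΔ {n} β zs χ = Prf β (code (emb χ (vars n)) zs)

  private
    module _ {n N} (zs : Vec Carrier n) (zs′ : Vec Carrier N) where

      -- Equality of codes is demanded after any number `j` of shifts, because a term placed under
      -- further quantifiers is shifted along; this makes the property pass through bounded
      -- quantifiers.
      Same : ℕ → Term L → Term L → Set
      Same k u t = ∀ j → codeT (ent zs′ (j + k)) (shiftBy j u) ≡ codeT (ent zs (j + k)) (shiftBy j t)

    same-shift : ∀ {n N} (zs : Vec Carrier n) (zs′ : Vec Carrier N) k u t →
      Same zs zs′ k u t → Same zs zs′ (suc k) (shift u) (shift t)
    same-shift zs zs′ k u t h j rewrite shiftBy-shift j u | shiftBy-shift j t | ℕₚ.+-suc j k = h (suc j)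

    same-bound : ∀ {n N} (zs : Vec Carrier n) (zs′ : Vec Carrier N) k → Same zs zs′ (suc k) (var 0) (var 0)
    same-bound {n} {N} zs zs′ k j
      rewrite shiftBy-var {L} j 0 | ℕₚ.+-identityʳ j | slot-bound n j k | slot-bound N j k = ≡.refl

    code-renT : ∀ {p m n N} (zs : Vec Carrier n) (zs′ : Vec Carrier N) (r : Fin p → Fin m) k us ts →
      (∀ i → codeT (ent zs′ k) (lookup us (r i)) ≡ codeT (ent zs k) (lookup ts i)) →
      ∀ t → codeT (ent zs′ k) (embT (renT r t) us) ≡ codeT (ent zs k) (embT t ts)
    code-renT zs zs′ r k us ts h (var i) = h i
    code-renT zs zs′ r k us ts h O       = ≡.refl
    code-renT zs zs′ r k us ts h (S t)   = cong (λ c → c-fn _ (c-cons c c-nil)) (code-renT zs zs′ r k us ts h t)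
    code-renT zs zs′ r k us ts h (exp t) = cong (λ c → c-fn _ (c-cons c c-nil)) (code-renT zs zs′ r k us ts h t)
    code-renT zs zs′ r k us ts h (t ⊕ u) = cong₂ (λ c d → c-fn _ (c-cons c (c-cons d c-nil)))
      (code-renT zs zs′ r k us ts h t) (code-renT zs zs′ r k us ts h u)
    code-renT zs zs′ r k us ts h (t ⊗ u) = cong₂ (λ c d → c-fn _ (c-cons c (c-cons d c-nil)))
      (code-renT zs zs′ r k us ts h t) (code-renT zs zs′ r k us ts h u)

    module _ {n N} (zs : Vec Carrier n) (zs′ : Vec Carrier N) where

      code-ren : ∀ {p m} (r : Fin p → Fin m) k us ts →
        (∀ i → Same zs zs′ k (lookup us (r i)) (lookup ts i)) →
        ∀ χ → codeF (ent zs′) k (emb (ren r χ) us) ≡ codeF (ent zs) k (emb χ ts)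
      code-ren r k us ts h (t ≈ u) = cong₂ (λ c d → c-rel _ (c-cons c (c-cons d c-nil)))
        (code-renT zs zs′ r k us ts (λ i → h i 0) t) (code-renT zs zs′ r k us ts (λ i → h i 0) u)
      code-ren r k us ts h (t ≲ u) = cong₂ (λ c d → c-rel _ (c-cons c (c-cons d c-nil)))
        (code-renT zs zs′ r k us ts (λ i → h i 0) t) (code-renT zs zs′ r k us ts (λ i → h i 0) u)
      code-ren r k us ts h ff = ≡.refl
      code-ren r k us ts h (χ ⊃ ψ) = cong₂ c-imp (code-ren r k us ts h χ) (code-ren r k us ts h ψ)
      code-ren r k us ts h (all≤ t χ) = cong c-all (cong₂ c-imp
          (cong₂ (λ c d → c-rel (lit 1) (c-cons c (c-cons d c-nil))) (same-bound zs zs′ k 0) bound-term)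
          (code-ren (liftFin 1 r) (suc k) (var 0 ∷ shifts us) (var 0 ∷ shifts ts) lifted χ))
        where
        shifted : ∀ i → Same zs zs′ (suc k) (lookup (shifts us) (r i)) (lookup (shifts ts) i)
        shifted i = subst₂ (Same zs zs′ (suc k)) (≡.sym (lookup-shifts us (r i))) (≡.sym (lookup-shifts ts i))
          (same-shift zs zs′ k _ _ (h i))
        lifted : ∀ i → Same zs zs′ (suc k) (lookup (var 0 ∷ shifts us) (liftFin 1 r i)) (lookup (var 0 ∷ shifts ts) i)
        lifted fzero    = same-bound zs zs′ k
        lifted (fsuc i) = shifted i
        bound-term : codeT (ent zs′ (suc k)) (shift (embT (renT r t) us)) ≡ codeT (ent zs (suc k)) (shift (embT t ts))
        bound-term = ≡.trans (cong (codeT (ent zs′ (suc k))) (shift-embT (renT r t) us))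
          (≡.trans (code-renT zs zs′ r (suc k) (shifts us) (shifts ts) (λ i → shifted i 0) t)
            (cong (codeT (ent zs (suc k))) (≡.sym (shift-embT t ts))))

  -- Renaming variables and rearranging numerals give the same code, not merely a provably
  -- equivalent sentence. Proofs of instances can therefore be reused in a longer list of arguments
  -- at no cost in size.
  code-reindex : ∀ {n N} (r : Fin n → Fin N) {zs : Vec Carrier n} {zs′ : Vec Carrier N} →
    (∀ i → lookup zs′ (r i) ≡ lookup zs i) → ∀ χ →
    code (emb (ren r χ) (vars N)) zs′ ≡ code (emb χ (vars n)) zs
  code-reindex {n} {N} r {zs} {zs′} h = code-ren zs zs′ r 0 (vars N) (vars n) same
    where
    same : ∀ i → Same zs zs′ 0 (lookup (vars N) (r i)) (lookup (vars n) i)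
    same i j
      rewrite lookup∘tabulate {A = Term L} (λ i → var (toℕ i)) (r i)
            | lookup∘tabulate {A = Term L} (λ i → var (toℕ i)) i
            | shiftBy-var {L} j (toℕ (r i)) | shiftBy-var {L} j (toℕ i)
            | ℕₚ.+-identityʳ j | slot-free N j (r i) | slot-free n j i = h i

  Establishes : ∀ {n} → Fm n → Δ₀ n → ATerm 1 → Set
  Establishes {n} P χ B = ∀ X (xs zs : Vec Carrier n) → Below X xs → Nums xs zs → ⟦ P ⟧ᶠ xs →
    PrfΔ (val B (X ∷ [])) zs χ

  numerals : ∀ {n} (xs : Vec Carrier n) → Cl (Σ[ zs ∈ Vec Carrier n ] Nums xs zs)
  numerals []       = return ([] , λ ())
  numerals (x ∷ xs) = do
    (z , _ , p) ← num-total x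
    (zs , ps) ← numerals xs
    return (z ∷ zs , λ { fzero → p ; (fsuc i) → ps i })

  nums-++ : ∀ {m n} {ws vs : Vec Carrier m} {xs zs : Vec Carrier n} → Nums ws vs → Nums xs zs →
    Nums (ws ++ xs) (vs ++ zs)
  nums-++ {ws = []}     {[]}     h k i        = k i
  nums-++ {ws = w ∷ ws} {v ∷ vs} h k fzero    = h fzero
  nums-++ {ws = w ∷ ws} {v ∷ vs} h k (fsuc i) = nums-++ {ws = ws} {vs} (h ∘ fsuc) k i

  below-++ : ∀ {m n β} {ws : Vec Carrier m} {xs : Vec Carrier n} → Below β ws → Below β xs → Below β (ws ++ xs)
  below-++ {ws = []}     h k i        = k i
  below-++ {ws = w ∷ ws} h k fzero    = h fzero
  below-++ {ws = w ∷ ws} h k (fsuc i) = below-++ {ws = ws} (h ∘ fsuc) k i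

  nums-numerals : ∀ {n} {xs zs : Vec Carrier n} → Nums xs zs → Numerals zs
  nums-numerals h i = return (_ , h i)

  nums-below : ∀ {n X} {xs zs : Vec Carrier n} → Nums xs zs → Below X xs → Below (numB X) zs
  nums-below h b i = ≼-trans (num-≼ (h i)) (numB-mono (b i))

  val-∘A : ∀ t u X → val (t ∘A u) (X ∷ []) ≡ val t (val u (X ∷ []) ∷ [])
  val-∘A t u X = val-subA (u ∷ []) t

  inferΔ : ∀ {n} χs (ψ : Δ₀ n) (d : T ⊢ imps (mapL (λ χ → emb χ (vars n)) χs) (emb ψ (vars n))) {β} {zs : Vec Carrier n} →
    Numerals zs → Below β zs → All (PrfΔ β zs) χs →
    PrfΔ (val (inferBound n d (length (mapL (λ χ → emb χ (vars n)) χs))) (β ∷ [])) zs ψ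
  inferΔ {n} χs ψ d {β} {zs} ns below ps = infer n (mapL (λ χ → emb χ (vars n)) χs) d ns below (all χs ps)
    where
    all : ∀ χs → All (PrfΔ β zs) χs → All (λ φ → Prf β (code φ zs)) (mapL (λ χ → emb χ (vars n)) χs)
    all []       []       = []
    all (χ ∷ χs) (p ∷ ps) = p ∷ all χs ps

-- Uniform provability of instances: cut and iteration

module Reflection {L : Language} (T : Theory L) (ext : T ExtendsEA) where

  -- Instances of χ by numerals are provable in T when the guard P holds, and
  -- the size of the proof is bounded in terms of a bound for the arguments.
  record Derives {n} (P : Fm n) (χ : Δ₀ n) : Set₁ where
    field
      bd          : ATerm 1
      establishes : ∀ 𝓜 → Instances.Establishes T 𝓜 P χ bd
  open Derives public

  Valid : ∀ {n} → Δ₀ n → Set₁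
  Valid {n} χ = ∀ 𝓜 (ρ : Vec (IΔ₀Exp.Carrier 𝓜) n) → IΔ₀Exp._⊩_ 𝓜 ρ χ

  -- Facts needed inside `T` are verified by reasoning in an arbitrary model; completeness returns a
  -- derivation, whose code is a fixed standard number and so contributes a constant to the bounds.
  provable : ∀ {n} χs (ψ : Δ₀ n) → Valid (impsΔ χs ψ) →
    T ⊢ imps (mapL (λ χ → emb χ (vars n)) χs) (emb ψ (vars n))
  provable {n} χs ψ v = subst (T ⊢_) (emb-imps χs ψ (vars n))
    (Completeness.completeness T (emb (impsΔ χs ψ) (vars n))
      (λ M ρ → ArithmeticOf.emb← ext M ρ (impsΔ χs ψ) (vars n) (v (ArithmeticOf.model ext M) _)))

  record Aux (n : ℕ) : Set₁ where
    constructor aux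
    field
      {guard}  : Fm n
      {result} : Δ₀ n
      derived  : Derives guard result
  open Aux public

  results : ∀ {n} → List (Aux n) → List (Δ₀ n)
  results []       = []
  results (a ∷ as) = result a ∷ results as

  auxBound : ∀ {n} → List (Aux n) → ATerm 1
  auxBound []       = O
  auxBound (a ∷ as) = bd (derived a) ⊕ auxBound as

  Guards : ∀ {n} 𝓜 → List (Aux n) → Vec (IΔ₀Exp.Carrier 𝓜) n → Set
  Guards 𝓜 []       ρ = ⊤
  Guards 𝓜 (a ∷ as) ρ = IΔ₀Exp.⟦_⟧ᶠ 𝓜 (guard a) ρ × Guards 𝓜 as ρ

  module _ (𝓜 : IΔ₀Exp) where
    open IΔ₀Exp 𝓜
    open Laws 𝓜
    open Numerals 𝓜
    open Provability T 𝓜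
    open Instances T 𝓜

    auxiliary : ∀ {n} (as : List (Aux n)) {X β} {xs zs : Vec Carrier n} → Below X xs → Nums xs zs →
      val (auxBound as) (X ∷ []) ≼ β → Guards 𝓜 as xs → All (PrfΔ β zs) (results as)
    auxiliary []       b h l g        = []
    auxiliary (a ∷ as) b h l (g , gs) =
      prf-mono (≼-trans (x≼x∔y _ _) l) (establishes (derived a) 𝓜 _ _ _ b h g) ∷
      auxiliary as b h (≼-trans (x≼y∔x _ _) l) gs

  Witnesses : ∀ {m n} → Fm n → ATerm 1 → List (Aux (m + n)) → IΔ₀Exp → Set
  Witnesses {m} {n} P W as 𝓜 = ∀ X (xs : Vec Carrier n) → Provability.Below T 𝓜 X xs → ⟦ P ⟧ᶠ xs →
    Cl (Σ[ ws ∈ Vec Carrier m ] Provability.Below T 𝓜 (val W (X ∷ [])) ws × Guards 𝓜 as (ws ++ xs))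
    where open IΔ₀Exp 𝓜

  -- The witnesses are found in the model and may be nonstandard, but the step from the auxiliary
  -- formulas to `ψ` is one fixed derivation in `T`. Only its instance at the numerals depends on
  -- the arguments, so the bound is a term in `X`.
  cut : ∀ {m n} {P : Fm n} {ψ : Δ₀ n} (W : ATerm 1) (as : List (Aux (m + n))) →
    (∀ 𝓜 → Witnesses {m} P W as 𝓜) → Valid (impsΔ (results as) (ren (m ↑ʳ_) ψ)) → Derives P ψ
  cut {m} {n} {P} {ψ} W as wit v = record { bd = B ; establishes = est }
    where
    ψ′ = ren (m ↑ʳ_) ψ
    d = provable (results as) ψ′ v
    -- `Y` bounds arguments and witnesses, `C` their numerals and the proofs of the auxiliary
    -- instances, and `I` the proof inferred from these.
    Y C I B : ATerm 1
    Y = var fzero ⊕ W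
    C = numBound ⊕ auxBound as
    I = inferBound (m + n) d (length (mapL (λ χ → emb χ (vars (m + n))) (results as)))
    B = I ∘A (C ∘A Y)
    est : ∀ 𝓜 → Instances.Establishes T 𝓜 P ψ B
    est 𝓜 X xs zs b h p = do
        (ws , wb , gs) ← wit 𝓜 X xs b p
        (vs , vh) ← numerals ws
        let b′ = below-++ {ws = ws} {xs} (λ i → ≼-trans (wb i) (x≼y∔x _ X)) (λ i → ≼-trans (b i) (x≼x∔y X _))
            β = val C (val Y (X ∷ []) ∷ [])
            h′ = nums-++ {ws = ws} {vs} {xs} {zs} vh h
        subst₂ Prf (≡.sym eq) (code-reindex (m ↑ʳ_) {zs} {vs ++ zs} (lookup-++ʳ vs zs) ψ)
          (inferΔ (results as) ψ′ d {β} {vs ++ zs} (nums-numerals {xs = ws ++ xs} {vs ++ zs} h′)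
            (λ i → ≼-trans (nums-below {xs = ws ++ xs} {vs ++ zs} h′ b′ i) (x≼x∔y _ _))
            (auxiliary 𝓜 as {xs = ws ++ xs} {vs ++ zs} b′ h′ (x≼y∔x _ _) gs))
      where
      open IΔ₀Exp 𝓜
      open Laws 𝓜
      open Numerals 𝓜
      open Provability T 𝓜
      open Instances T 𝓜
      eq : val B (X ∷ []) ≡ val I (val C (val Y (X ∷ []) ∷ []) ∷ [])
      eq = ≡.trans (val-∘A I (C ∘A Y) X) (cong (λ c → val I (c ∷ [])) (val-∘A C Y X))

  derives-ren : ∀ {n N} {P : Fm n} {χ : Δ₀ n} (r : Fin n → Fin N) → Derives P χ →
    Derives (P ⟨ tabulate (λ i → var (r i)) ⟩) (ren r χ)
  derives-ren {n} {N} {P} {χ} r D = record { bd = bd D ; establishes = est }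
    where
    est : ∀ 𝓜 → Instances.Establishes T 𝓜 (P ⟨ tabulate (λ i → var (r i)) ⟩) (ren r χ) (bd D)
    est 𝓜 X xs zs b h p = subst (Prf _) (≡.sym (code-reindex r {tabulate (λ i → lookup zs (r i))} (λ i → ≡.sym (look zs i)) χ))
        (establishes D 𝓜 X xs′ (tabulate (λ i → lookup zs (r i)))
          (λ i → subst (_≼ X) (≡.sym (look xs i)) (b (r i)))
          (λ i → subst₂ Num (≡.sym (look xs i)) (≡.sym (look zs i)) (h (r i)))
          (subst (⟦ P ⟧ᶠ) (vals-params xs′ r xs (λ i → ≡.sym (look xs i))) p))
      where
      open IΔ₀Exp 𝓜
      open Laws 𝓜
      open Provability T 𝓜
      open Instances T 𝓜
      look : ∀ (ys : Vec Carrier N) i → lookup (tabulate (λ i → lookup ys (r i))) i ≡ lookup ys (r i)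
      look ys i = lookup∘tabulate (λ i → lookup ys (r i)) i
      xs′ : Vec Carrier n
      xs′ = tabulate (λ i → lookup xs (r i))

  weaken : ∀ {n} {P Q : Fm n} {χ} → (∀ 𝓜 ρ → IΔ₀Exp.⟦_⟧ᶠ 𝓜 P ρ → IΔ₀Exp.⟦_⟧ᶠ 𝓜 Q ρ) → Derives Q χ → Derives P χ
  weaken w D = record { bd = bd D ; establishes = λ 𝓜 X xs zs b h p → establishes D 𝓜 X xs zs b h (w 𝓜 xs p) }

  either : ∀ {n} {P Q : Fm n} {χ} → Derives P χ → Derives Q χ → Derives (P ∨ᶠ Q) χ
  either {P = P} {Q} {χ} D E = record { bd = bd D ⊕ bd E ; establishes = est }
    where
    est : ∀ 𝓜 → Instances.Establishes T 𝓜 (P ∨ᶠ Q) χ (bd D ⊕ bd E)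
    est 𝓜 X xs zs b h p = p >>= λ
        { (inj₁ q) → prf-mono (x≼x∔y _ _) (establishes D 𝓜 X xs zs b h q)
        ; (inj₂ q) → prf-mono (x≼y∔x _ _) (establishes E 𝓜 X xs zs b h q) }
      where
      open IΔ₀Exp 𝓜
      open Laws 𝓜
      open Provability T 𝓜

  -- A step of the iteration has the slots new argument, new value, old argument, old value,
  -- parameters; this embedding passes over the old pair.
  next : ∀ {n} → Fin (2 + n) → Fin (4 + n)
  next fzero           = fzero
  next (fsuc fzero)    = fsuc fzero
  next (fsuc (fsuc i)) = fsuc (fsuc (fsuc (fsuc i)))

  Descends : ∀ {n} → Fm (2 + n) → List (Aux (4 + n)) → IΔ₀Exp → Set
  Descends {n} P as 𝓜 = ∀ i v′ (xs : Vec Carrier n) → ⟦ P ⟧ᶠ (sc i ∷ v′ ∷ xs) →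
      Cl (Σ[ v ∈ Carrier ] v ≼ v′ × ⟦ P ⟧ᶠ (i ∷ v ∷ xs) × Guards 𝓜 as (sc i ∷ v′ ∷ i ∷ v ∷ xs))
    where open IΔ₀Exp 𝓜

  -- Instances of χ (i , v , xs) by induction on i; the value v may depend on i.
  iterate : ∀ {n} {P : Fm (2 + n)} {χ : Δ₀ (2 + n)} (as : List (Aux (4 + n))) →
    Derives (var (# 0) ≐ᶠ O ∧ᶠ P) χ →
    (∀ 𝓜 → Descends P as 𝓜) →
    Valid (impsΔ (ren (2 ↑ʳ_) χ ∷ results as) (ren next χ)) → Derives P χ
  iterate {n} {P} {χ} as D descend v = record { bd = B ; establishes = est }
    where
    χs = ren (2 ↑ʳ_) χ ∷ results as
    d = provable χs (ren next χ) v
    len : ℕ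
    len = length (mapL (λ χ → emb χ (vars (4 + n))) χs)
    -- Each step applies the same derivation and so enlarges the bound by the polynomial `I`, at
    -- most `X` times. The starting value `C` already covers the base case, all numerals and all
    -- auxiliary proofs.
    I C B : ATerm 1
    I = inferBound (4 + n) d len
    C = bd D ⊕ (numBound ⊕ auxBound as)
    B = subA (C ∷ var fzero ∷ []) (iterBound (degree I))
    est : ∀ 𝓜 → Instances.Establishes T 𝓜 P χ B
    est 𝓜 X (x ∷ y ∷ xs) (a ∷ b ∷ zs) below nums p =
        subst (λ β → PrfΔ β (a ∷ b ∷ zs) χ) (≡.sym (val-subA (C ∷ var fzero ∷ []) {X ∷ []} (iterBound (degree I))))
          (prf-mono (iter-mono (degree I) ≼-refl (below fzero))
            (all x (below fzero) y a b (below (# 1)) p (nums fzero) (nums (# 1))))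
      where
      open IΔ₀Exp 𝓜
      open Laws 𝓜
      open Numerals 𝓜
      open Provability T 𝓜
      open Instances T 𝓜
      β M : Carrier
      β = val C (X ∷ [])
      M = numB X
      k : ℕ
      k = degree I
      φ : Formula L
      φ = emb χ (vars (2 + n))
      Statement : Carrier → Set
      Statement i = i ≼ X → ∀ v a b → v ≼ X → ⟦ P ⟧ᶠ (i ∷ v ∷ xs) → Num i a → Num v b →
        Prf (iter k β i) (code φ (a ∷ b ∷ zs))
      xsA zsA : Vec (ATerm (7 + (n + n))) n
      xsA = tabulate (λ i → var (7 ↑ʳ (i ↑ˡ n)))
      zsA = tabulate (λ i → var (7 ↑ʳ (n ↑ʳ i)))
      -- The Δ₀-form of `Statement`: `X` bounds the value, `M` the codes of the two numerals, and
      -- the iterated bound the proof. The numeral bounds follow from `num-≼`.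
      A : Fm (4 + (n + n))
      A = var (# 0) ≤ᶠ var (# 1) ⇒ᶠ ∀ᶠ (var (# 1)) (∀ᶠ (var (# 4)) (∀ᶠ (var (# 5))
        (P ⟨ var (# 3) ∷ var (# 2) ∷ xsA ⟩ ⇒ᶠ numF ⟨ var (# 3) ∷ var (# 1) ∷ [] ⟩ ⇒ᶠ
         numF ⟨ var (# 2) ∷ var (# 0) ∷ [] ⟩ ⇒ᶠ
         prfF ⟨ subA (var (# 5) ∷ var (# 3) ∷ []) (iterBound k)
              ∷ subA (var (# 1) ∷ var (# 0) ∷ zsA) (codeFA 0 φ) ∷ [] ⟩)))
      τ : Vec Carrier (3 + (n + n))
      τ = X ∷ β ∷ M ∷ (xs ++ zs)
      module _ (i v a b : Carrier) where
        ctx : Vec Carrier (7 + (n + n))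
        ctx = b ∷ a ∷ v ∷ i ∷ τ
        xs-eq : vals xsA ctx ≡ xs
        xs-eq = vals-params xs (λ i → 7 ↑ʳ (i ↑ˡ n)) ctx (lookup-++ˡ xs zs)
        zs-eq : vals zsA ctx ≡ zs
        zs-eq = vals-params zs (λ i → 7 ↑ʳ (n ↑ʳ i)) ctx (lookup-++ʳ xs zs)
        iter-eq : val (subA (var (# 5) ∷ var (# 3) ∷ []) (iterBound k)) ctx ≡ iter k β i
        iter-eq = val-subA (var (# 5) ∷ var (# 3) ∷ []) {ctx} (iterBound k)
        code-eq : val (subA (var (# 1) ∷ var (# 0) ∷ zsA) (codeFA 0 φ)) ctx ≡ code φ (a ∷ b ∷ zs)
        code-eq = ≡.trans (val-subA (var (# 1) ∷ var (# 0) ∷ zsA) {ctx} (codeFA 0 φ))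
          (≡.trans (cong (λ zs → val (codeFA 0 φ) (a ∷ b ∷ zs)) zs-eq) (val-codeFA (a ∷ b ∷ zs) 0 φ))
      out : ∀ i → ⟦ A ⟧ᶠ (i ∷ τ) → Statement i
      out i s i≼ v a b v≼ p n m = subst₂ Prf (iter-eq i v a b) (code-eq i v a b)
        (s i≼ v v≼ a (≼-trans (num-≼ n) (numB-mono i≼)) b (≼-trans (num-≼ m) (numB-mono v≼))
          (subst (λ xs → ⟦ P ⟧ᶠ (i ∷ v ∷ xs)) (≡.sym (xs-eq i v a b)) p) n m)
      into : ∀ i → Statement i → ⟦ A ⟧ᶠ (i ∷ τ)
      into i s i≼ v v≼ a _ b _ p n m = subst₂ Prf (≡.sym (iter-eq i v a b)) (≡.sym (code-eq i v a b))
        (s i≼ v a b v≼ (subst (λ xs → ⟦ P ⟧ᶠ (i ∷ v ∷ xs)) (xs-eq i v a b) p) n m)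
      tail-below : Below X xs
      tail-below i = below (fsuc (fsuc i))
      tail-nums : Nums xs zs
      tail-nums i = nums (fsuc (fsuc i))
      cons₂-below : ∀ {m u w} {ys : Vec Carrier m} → u ≼ X → w ≼ X → Below X ys → Below X (u ∷ w ∷ ys)
      cons₂-below p q h fzero           = p
      cons₂-below p q h (fsuc fzero)    = q
      cons₂-below p q h (fsuc (fsuc i)) = h i
      cons₂-nums : ∀ {m u w c d} {ys vs : Vec Carrier m} → Num u c → Num w d → Nums ys vs →
        Nums (u ∷ w ∷ ys) (c ∷ d ∷ vs)
      cons₂-nums p q h fzero           = p
      cons₂-nums p q h (fsuc fzero)    = q
      cons₂-nums p q h (fsuc (fsuc i)) = h i
      base : Statement 0#
      base i≼ v a b v≼ p n m = prf-mono (≼-trans (x≼x∔y _ _) (iter-start k β 0#))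
        (establishes D 𝓜 X (0# ∷ v ∷ xs) (a ∷ b ∷ zs) (cons₂-below i≼ v≼ tail-below)
          (cons₂-nums {ys = xs} {zs} n m tail-nums) (≃-refl , p))
      step : ∀ i → Statement i → Statement (sc i)
      step i ih i≼ v′ a′ b′ v≼ p n′ m′ = do
        (v , v≼v′ , q , gs) ← descend 𝓜 i v′ xs p
        (a , _ , na) ← num-total i
        (b , _ , nb) ← num-total v
        let γ = iter k β i
            zs′ = a′ ∷ b′ ∷ a ∷ b ∷ zs
            i≼X = ≼-trans (x≼scx i) i≼
            v≼X = ≼-trans v≼v′ v≼
            below′ = cons₂-below i≼ v≼ (cons₂-below i≼X v≼X tail-below)
            nums′ = cons₂-nums {ys = i ∷ v ∷ xs} {a ∷ b ∷ zs} n′ m′ (cons₂-nums {ys = xs} {zs} na nb tail-nums)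
            β≼γ = iter-start k β i
            earlier = subst (Prf γ) (≡.sym (code-reindex (2 ↑ʳ_) {a ∷ b ∷ zs} {zs′} (λ _ → ≡.refl) χ))
                        (ih i≼X v a b v≼X q na nb)
        prf-mono (iter-step (Poly-inferBound (4 + n) d len) β i)
          (subst (Prf (val I (γ ∷ []))) (code-reindex next {a′ ∷ b′ ∷ zs} {zs′}
              (λ { fzero → ≡.refl ; (fsuc fzero) → ≡.refl ; (fsuc (fsuc i)) → ≡.refl }) χ)
            (inferΔ χs (ren next χ) d {γ} {zs′}
              (nums-numerals {xs = sc i ∷ v′ ∷ i ∷ v ∷ xs} {zs′} nums′)
              (λ j → ≼-trans (nums-below {xs = sc i ∷ v′ ∷ i ∷ v ∷ xs} {zs′} nums′ below′ j)
                (≼-trans (≼-trans (x≼x∔y _ _) (x≼y∔x _ _)) β≼γ))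
              (earlier ∷ auxiliary 𝓜 as {X} {γ} {sc i ∷ v′ ∷ i ∷ v ∷ xs} {zs′} below′ nums′
                (≼-trans (≼-trans (x≼y∔x _ _) (x≼y∔x _ _)) β≼γ) gs)))
      all : ∀ i → Statement i
      all i = out i (inductᶠ A {τ} (into 0# base) (λ i s → into (sc i) (step i (out i s))) i)

-- Provability of true instances, from equations to bounded quantifiers

module Δ₀-Completeness {L : Language} (T : Theory L) (ext : T ExtendsEA) where
  open Reflection T ext

  pattern x0 = var fzero
  pattern x1 = var (fsuc fzero)
  pattern x2 = var (fsuc (fsuc fzero))
  pattern x3 = var (fsuc (fsuc (fsuc fzero)))
  pattern x4 = var (fsuc (fsuc (fsuc (fsuc fzero))))

  True : ∀ {n} → Δ₀ n → Set₁
  True θ = Derives ⟪ θ ⟫ θ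

  infixl 6 _at_ _on_
  _at_ : ∀ {n N} {P : Fm n} {χ : Δ₀ n} → Derives P χ → (Fin n → Fin N) → Aux N
  D at r = aux (derives-ren r D)

  _on_ : ∀ {n N} {P : Fm n} {χ : Δ₀ n} → Derives P χ → Vec (Fin N) n → Aux N
  D on is = D at lookup is

  -- Equations between numerals

  -- The three basic equations need no recursion on the argument. The equation in the model
  -- identifies the codes of the numerals involved, by `num-zero⁻¹` or `num-unique`, and the
  -- sentence becomes an instance of reflexivity.
  zeroEq : True {1} (x0 ≈ O)
  zeroEq = record { bd = necessityBound 0 d ; establishes = est }
    where
    d : T ⊢ O′ ≐ O′
    d = ≐-refl
    est : ∀ 𝓜 → Instances.Establishes T 𝓜 ⟪ x0 ≈ O ⟫ (x0 ≈ O) (necessityBound 0 d)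
    est 𝓜 X (x ∷ []) (z ∷ []) b h p =
        prf-resp (pr-cong ≃-refl (pr-cong ≃-refl (pr-cong ≃-refl (pr-cong (sym z≃) ≃-refl))))
          (necessity 0 d {X} {[]} (λ ()) (λ ()))
      where
      open IΔ₀Exp 𝓜
      open Laws 𝓜
      open Numerals 𝓜
      open Provability T 𝓜
      z≃ : z ≃ num0
      z≃ = num-zero⁻¹ (num-resp p ≃-refl (h fzero))

  private
    reflBound : Term L → ATerm 1
    reflBound t = necessityBound 1 (≐-refl {T = T} {t = t}) ∘A numBound

  sameEq : True {2} (x0 ≈ x1)
  sameEq = record { bd = reflBound (var 0) ; establishes = est }
    where
    est : ∀ 𝓜 → Instances.Establishes T 𝓜 ⟪ x0 ≈ x1 ⟫ (x0 ≈ x1) (reflBound (var 0))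
    est 𝓜 X (x ∷ y ∷ []) (z ∷ v ∷ []) b h p =
        prf-resp (pr-cong ≃-refl (pr-cong ≃-refl (pr-cong ≃-refl (pr-cong ≃-refl
            (pr-cong ≃-refl (pr-cong z≃v ≃-refl))))))
          (subst (λ β → Prf β (code (var 0 ≐ var 0) (z ∷ [])))
            (≡.sym (val-∘A (necessityBound 1 (≐-refl {T = T} {t = var 0})) numBound X))
            (necessity 1 (≐-refl {t = var 0}) {numB X} {z ∷ []}
              (λ { fzero → return (x , h fzero) })
              (λ { fzero → ≼-trans (num-≼ (h fzero)) (numB-mono (b fzero)) })))
      where
      open IΔ₀Exp 𝓜
      open Laws 𝓜
      open Numerals 𝓜
      open Provability T 𝓜
      open Instances T 𝓜
      z≃v : z ≃ v
      z≃v = num-unique (num-resp p ≃-refl (h fzero)) (h (# 1))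

  sucEq : True {2} (x0 ≈ S x1)
  sucEq = record { bd = reflBound (S′ (var 0)) ; establishes = est }
    where
    est : ∀ 𝓜 → Instances.Establishes T 𝓜 ⟪ x0 ≈ S x1 ⟫ (x0 ≈ S x1) (reflBound (S′ (var 0)))
    est 𝓜 X (x ∷ y ∷ []) (z ∷ v ∷ []) b h p =
        prf-resp (pr-cong ≃-refl (pr-cong ≃-refl (pr-cong ≃-refl (pr-cong (sym z≃) ≃-refl))))
          (subst (λ β → Prf β (code (S′ (var 0) ≐ S′ (var 0)) (v ∷ [])))
            (≡.sym (val-∘A (necessityBound 1 (≐-refl {T = T} {t = S′ (var 0)})) numBound X))
            (necessity 1 (≐-refl {t = S′ (var 0)}) {numB X} {v ∷ []}
              (λ { fzero → return (y , h (# 1)) })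
              (λ { fzero → ≼-trans (num-≼ (h (# 1))) (numB-mono (b (# 1))) })))
      where
      open IΔ₀Exp 𝓜
      open Laws 𝓜
      open Numerals 𝓜
      open Provability T 𝓜
      open Instances T 𝓜
      z≃ : z ≃ numSuc v
      z≃ = num-unique (num-resp p ≃-refl (h fzero)) (num-suc (h (# 1)))

  -- The graphs of the operations; the slots are (y , value , x).

  plusEq : Derives {3} (x1 ≐ᶠ x2 ⊕ x0) (x2 ⊕ x0 ≈ x1)
  plusEq = iterate {1} steps (cut {0} O bases base base-valid) descend valid
    where
    bases : List (Aux 3)
    bases = zeroEq on (# 0 ∷ []) ∷ sameEq on (# 1 ∷ # 2 ∷ []) ∷ []
    steps : List (Aux 5)
    steps = sucEq on (# 0 ∷ # 2 ∷ []) ∷ sucEq on (# 1 ∷ # 3 ∷ []) ∷ []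
    base : ∀ 𝓜 → Witnesses {0} (x0 ≐ᶠ O ∧ᶠ x1 ≐ᶠ x2 ⊕ x0) O bases 𝓜
    base 𝓜 X (y ∷ v ∷ x ∷ []) _ (p , q) =
      return ([] , (λ ()) , p , trans q (trans (∔-cong ≃-refl p) (+-0 x)) , tt)
      where
      open IΔ₀Exp 𝓜
      open Laws 𝓜
    base-valid : Valid (x0 ≈ O ⊃ x1 ≈ x2 ⊃ x2 ⊕ x0 ≈ x1)
    base-valid 𝓜 (y ∷ v ∷ x ∷ []) p q = trans (∔-cong ≃-refl p) (trans (+-0 x) (sym q))
      where
      open IΔ₀Exp 𝓜
      open Laws 𝓜
    descend : ∀ 𝓜 → Descends (x1 ≐ᶠ x2 ⊕ x0) steps 𝓜
    descend 𝓜 i v′ (x ∷ []) p = return (x ∔ i , ≼-respʳ (sym e) (x≼scx _) , ≃-refl , ≃-refl , e , tt)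
      where
      open IΔ₀Exp 𝓜
      open Laws 𝓜
      e : v′ ≃ sc (x ∔ i)
      e = trans p (+-sc x i)
    valid : Valid (x4 ⊕ x2 ≈ x3 ⊃ x0 ≈ S x2 ⊃ x1 ≈ S x3 ⊃ x4 ⊕ x0 ≈ x1)
    valid 𝓜 (i′ ∷ v′ ∷ i ∷ v ∷ x ∷ []) p q r =
      trans (∔-cong ≃-refl q) (trans (+-sc x i) (trans (sc-cong p) (sym r)))
      where
      open IΔ₀Exp 𝓜
      open Laws 𝓜

  timesEq : Derives {3} (x1 ≐ᶠ x2 ⊗ x0) (x2 ⊗ x0 ≈ x1)
  timesEq = iterate {1} steps (cut {0} O bases base base-valid) descend valid
    where
    bases : List (Aux 3)
    bases = zeroEq on (# 0 ∷ []) ∷ zeroEq on (# 1 ∷ []) ∷ []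
    steps : List (Aux 5)
    steps = sucEq on (# 0 ∷ # 2 ∷ []) ∷ plusEq on (# 4 ∷ # 1 ∷ # 3 ∷ []) ∷ []
    base : ∀ 𝓜 → Witnesses {0} (x0 ≐ᶠ O ∧ᶠ x1 ≐ᶠ x2 ⊗ x0) O bases 𝓜
    base 𝓜 X (y ∷ v ∷ x ∷ []) _ (p , q) =
      return ([] , (λ ()) , p , trans q (trans (·-cong ≃-refl p) (*-0 x)) , tt)
      where
      open IΔ₀Exp 𝓜
      open Laws 𝓜
    base-valid : Valid (x0 ≈ O ⊃ x1 ≈ O ⊃ x2 ⊗ x0 ≈ x1)
    base-valid 𝓜 (y ∷ v ∷ x ∷ []) p q = trans (·-cong ≃-refl p) (trans (*-0 x) (sym q))
      where
      open IΔ₀Exp 𝓜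
      open Laws 𝓜
    descend : ∀ 𝓜 → Descends (x1 ≐ᶠ x2 ⊗ x0) steps 𝓜
    descend 𝓜 i v′ (x ∷ []) p = return (x · i , ≼-respʳ (sym e) (x≼x∔y _ x) , ≃-refl , ≃-refl , e , tt)
      where
      open IΔ₀Exp 𝓜
      open Laws 𝓜
      e : v′ ≃ x · i ∔ x
      e = trans p (*-sc x i)
    valid : Valid (x4 ⊗ x2 ≈ x3 ⊃ x0 ≈ S x2 ⊃ x3 ⊕ x4 ≈ x1 ⊃ x4 ⊗ x0 ≈ x1)
    valid 𝓜 (i′ ∷ v′ ∷ i ∷ v ∷ x ∷ []) p q r =
      trans (·-cong ≃-refl q) (trans (*-sc x i) (trans (∔-cong p ≃-refl) r))
      where
      open IΔ₀Exp 𝓜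
      open Laws 𝓜

  oneEq : True {1} (x0 ≈ S O)
  oneEq = cut {1} O as wit valid
    where
    as : List (Aux 2)
    as = zeroEq on (# 0 ∷ []) ∷ sucEq on (# 1 ∷ # 0 ∷ []) ∷ []
    wit : ∀ 𝓜 → Witnesses {1} ⟪ x0 ≈ S O ⟫ O as 𝓜
    wit 𝓜 X (x ∷ []) _ p = return (0# ∷ [] , (λ { fzero → ≼-refl }) , ≃-refl , p , tt)
      where
      open IΔ₀Exp 𝓜
      open Laws 𝓜
    valid : Valid (x0 ≈ O ⊃ x1 ≈ S x0 ⊃ x1 ≈ S O)
    valid 𝓜 (w ∷ x ∷ []) p q = trans q (sc-cong p)
      where
      open IΔ₀Exp 𝓜
      open Laws 𝓜

  expEq : Derives {2} (x1 ≐ᶠ exp x0) (exp x0 ≈ x1)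
  expEq = iterate {0} steps (cut {0} O bases base base-valid) descend valid
    where
    bases : List (Aux 2)
    bases = zeroEq on (# 0 ∷ []) ∷ oneEq on (# 1 ∷ []) ∷ []
    steps : List (Aux 4)
    steps = sucEq on (# 0 ∷ # 2 ∷ []) ∷ plusEq on (# 3 ∷ # 1 ∷ # 3 ∷ []) ∷ []
    base : ∀ 𝓜 → Witnesses {0} (x0 ≐ᶠ O ∧ᶠ x1 ≐ᶠ exp x0) O bases 𝓜
    base 𝓜 X (y ∷ v ∷ []) _ (p , q) =
      return ([] , (λ ()) , p , trans q (trans (ex-cong p) ex-0) , tt)
      where
      open IΔ₀Exp 𝓜
      open Laws 𝓜
    base-valid : Valid (x0 ≈ O ⊃ x1 ≈ S O ⊃ exp x0 ≈ x1)
    base-valid 𝓜 (y ∷ v ∷ []) p q = trans (ex-cong p) (trans ex-0 (sym q))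
      where
      open IΔ₀Exp 𝓜
      open Laws 𝓜
    descend : ∀ 𝓜 → Descends (x1 ≐ᶠ exp x0) steps 𝓜
    descend 𝓜 i v′ [] p = return (ex i , ≼-respʳ (sym e) (x≼x∔y _ _) , ≃-refl , ≃-refl , e , tt)
      where
      open IΔ₀Exp 𝓜
      open Laws 𝓜
      e : v′ ≃ ex i ∔ ex i
      e = trans p (ex-sc i)
    valid : Valid (exp x2 ≈ x3 ⊃ x0 ≈ S x2 ⊃ x3 ⊕ x3 ≈ x1 ⊃ exp x0 ≈ x1)
    valid 𝓜 (i′ ∷ v′ ∷ i ∷ v ∷ []) p q r =
      trans (ex-cong q) (trans (ex-sc i) (trans (∔-cong p p) r))
      where
      open IΔ₀Exp 𝓜
      open Laws 𝓜

  -- Evaluation of terms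

  -- put m j maps (w , xs) to (w₁ , … , wₘ , xs), the first slot to wⱼ.
  put : ∀ m {n} → Fin m → Fin (suc n) → Fin (m + n)
  put m j fzero    = j ↑ˡ _
  put m j (fsuc i) = m ↑ʳ i

  private
    module Values (𝓜 : IΔ₀Exp) where
      open IΔ₀Exp 𝓜
      open Laws 𝓜
      open Provability T 𝓜

      val-tail : ∀ {n N} (r : Fin (suc n) → Fin N) {ρ : Vec Carrier N} {xs : Vec Carrier n} →
        (∀ i → lookup ρ (r (fsuc i)) ≡ lookup xs i) → ∀ t → val (renT r (wkA t)) ρ ≡ val t xs
      val-tail r {ρ} {xs} h t = ≡.trans (val-ren r {ρ} {lookup ρ (r fzero) ∷ xs}
        (λ { fzero → ≡.refl ; (fsuc i) → h i }) (wkA t)) (val-wkA _ t)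

      tail≃ : ∀ {n N} (r : Fin (suc n) → Fin N) {ρ : Vec Carrier N} {xs : Vec Carrier n} →
        (∀ i → lookup ρ (r (fsuc i)) ≡ lookup xs i) → ∀ t → val (renT r (wkA t)) ρ ≃ val t xs
      tail≃ r h t = ≡⇒≃ (val-tail r h t)

      guard-≈ : ∀ {n N} (r : Fin (suc n) → Fin N) {ρ : Vec Carrier N} {xs : Vec Carrier n} {w} →
        lookup ρ (r fzero) ≡ w → (∀ i → lookup ρ (r (fsuc i)) ≡ lookup xs i) → ∀ t → w ≃ val t xs →
        ⟦ ⟪ x0 ≈ wkA t ⟫ ⟨ tabulate (λ i → var (r i)) ⟩ ⟧ᶠ ρ
      guard-≈ r {ρ} {xs} {w} e h t p = subst (λ τ → τ ⊩ x0 ≈ wkA t)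
        (≡.sym (vals-params (w ∷ xs) r ρ (λ { fzero → e ; (fsuc i) → h i })))
        (trans p (≡⇒≃ (≡.sym (val-wkA w t))))

  TermEq : ∀ {n} → ATerm n → Set₁
  TermEq t = True (x0 ≈ wkA t)

  -- The values of the immediate subterms are the witnesses of the cut, bounded by the collapsed
  -- subterms; the graph of the outermost operation then gives the value of the term.
  termEq : ∀ {n} (t : ATerm n) → TermEq t
  termEq (var i) = weaken (λ 𝓜 ρ p → p) (derives-ren (lookup (fzero ∷ fsuc i ∷ [])) sameEq)
  termEq O       = weaken (λ 𝓜 ρ p → p) (derives-ren (lookup (fzero ∷ [])) zeroEq)
  termEq {n} (S t) = cut {1} (collapse t) as wit valid
    where
    as : List (Aux (2 + n))
    as = termEq t at put 2 (# 0) ∷ sucEq on (# 1 ∷ # 0 ∷ []) ∷ []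
    wit : ∀ 𝓜 → Witnesses {1} ⟪ x0 ≈ wkA (S t) ⟫ (collapse t) as 𝓜
    wit 𝓜 X (v ∷ xs) b p = return (val t xs ∷ [] , (λ { fzero → val-collapse t {xs} (b ∘ fsuc) }) ,
        guard-≈ (put 2 (# 0)) ≡.refl (λ _ → ≡.refl) t ≃-refl ,
        trans p (sc-cong (≡⇒≃ (val-wkA v t))) , tt)
      where
      open IΔ₀Exp 𝓜
      open Laws 𝓜
      open Provability T 𝓜
      open Values 𝓜
    valid : Valid (ren (put 2 (# 0)) (x0 ≈ wkA t) ⊃ x1 ≈ S x0 ⊃ ren (1 ↑ʳ_) (x0 ≈ wkA (S t)))
    valid 𝓜 (w ∷ v ∷ xs) p q = trans q (sc-cong (trans p
        (trans (tail≃ (put 2 (# 0)) {w ∷ v ∷ xs} {xs} (λ _ → ≡.refl) t)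
               (sym (tail≃ (1 ↑ʳ_) {w ∷ v ∷ xs} {xs} (λ _ → ≡.refl) t)))))
      where
      open IΔ₀Exp 𝓜
      open Laws 𝓜
      open Values 𝓜
  termEq {n} (exp t) = cut {1} (collapse t) as wit valid
    where
    as : List (Aux (2 + n))
    as = termEq t at put 2 (# 0) ∷ expEq on (# 0 ∷ # 1 ∷ []) ∷ []
    wit : ∀ 𝓜 → Witnesses {1} ⟪ x0 ≈ wkA (exp t) ⟫ (collapse t) as 𝓜
    wit 𝓜 X (v ∷ xs) b p = return (val t xs ∷ [] , (λ { fzero → val-collapse t {xs} (b ∘ fsuc) }) ,
        guard-≈ (put 2 (# 0)) ≡.refl (λ _ → ≡.refl) t ≃-refl ,
        trans p (ex-cong (≡⇒≃ (val-wkA v t))) , tt)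
      where
      open IΔ₀Exp 𝓜
      open Laws 𝓜
      open Provability T 𝓜
      open Values 𝓜
    valid : Valid (ren (put 2 (# 0)) (x0 ≈ wkA t) ⊃ exp x0 ≈ x1 ⊃ ren (1 ↑ʳ_) (x0 ≈ wkA (exp t)))
    valid 𝓜 (w ∷ v ∷ xs) p q = trans (sym q) (ex-cong (trans p
        (trans (tail≃ (put 2 (# 0)) {w ∷ v ∷ xs} {xs} (λ _ → ≡.refl) t)
               (sym (tail≃ (1 ↑ʳ_) {w ∷ v ∷ xs} {xs} (λ _ → ≡.refl) t)))))
      where
      open IΔ₀Exp 𝓜
      open Laws 𝓜
      open Values 𝓜
  termEq {n} (t ⊕ u) = cut {2} (collapse t ⊕ collapse u) as wit valid
    where
    as : List (Aux (3 + n))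
    as = termEq t at put 3 (# 0) ∷ termEq u at put 3 (# 1) ∷ plusEq on (# 1 ∷ # 2 ∷ # 0 ∷ []) ∷ []
    wit : ∀ 𝓜 → Witnesses {2} ⟪ x0 ≈ wkA (t ⊕ u) ⟫ (collapse t ⊕ collapse u) as 𝓜
    wit 𝓜 X (v ∷ xs) b p = return (val t xs ∷ val u xs ∷ [] ,
        (λ { fzero → ≼-trans (val-collapse t {xs} (b ∘ fsuc)) (x≼x∔y _ _)
           ; (fsuc fzero) → ≼-trans (val-collapse u {xs} (b ∘ fsuc)) (x≼y∔x _ _) }) ,
        guard-≈ (put 3 (# 0)) ≡.refl (λ _ → ≡.refl) t ≃-refl , guard-≈ (put 3 (# 1)) ≡.refl (λ _ → ≡.refl) u ≃-refl ,
        trans p (∔-cong (≡⇒≃ (val-wkA v t)) (≡⇒≃ (val-wkA v u))) , tt)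
      where
      open IΔ₀Exp 𝓜
      open Laws 𝓜
      open Provability T 𝓜
      open Values 𝓜
    valid : Valid (ren (put 3 (# 0)) (x0 ≈ wkA t) ⊃ ren (put 3 (# 1)) (x0 ≈ wkA u) ⊃ x0 ⊕ x1 ≈ x2 ⊃
                   ren (2 ↑ʳ_) (x0 ≈ wkA (t ⊕ u)))
    valid 𝓜 (w ∷ w′ ∷ v ∷ xs) p q r = trans (sym r) (∔-cong
        (trans p (trans (tail≃ (put 3 (# 0)) {w ∷ w′ ∷ v ∷ xs} {xs} (λ _ → ≡.refl) t)
                        (sym (tail≃ (2 ↑ʳ_) {w ∷ w′ ∷ v ∷ xs} {xs} (λ _ → ≡.refl) t))))
        (trans q (trans (tail≃ (put 3 (# 1)) {w ∷ w′ ∷ v ∷ xs} {xs} (λ _ → ≡.refl) u)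
                        (sym (tail≃ (2 ↑ʳ_) {w ∷ w′ ∷ v ∷ xs} {xs} (λ _ → ≡.refl) u)))))
      where
      open IΔ₀Exp 𝓜
      open Laws 𝓜
      open Values 𝓜
  termEq {n} (t ⊗ u) = cut {2} (collapse t ⊕ collapse u) as wit valid
    where
    as : List (Aux (3 + n))
    as = termEq t at put 3 (# 0) ∷ termEq u at put 3 (# 1) ∷ timesEq on (# 1 ∷ # 2 ∷ # 0 ∷ []) ∷ []
    wit : ∀ 𝓜 → Witnesses {2} ⟪ x0 ≈ wkA (t ⊗ u) ⟫ (collapse t ⊕ collapse u) as 𝓜
    wit 𝓜 X (v ∷ xs) b p = return (val t xs ∷ val u xs ∷ [] ,
        (λ { fzero → ≼-trans (val-collapse t {xs} (b ∘ fsuc)) (x≼x∔y _ _)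
           ; (fsuc fzero) → ≼-trans (val-collapse u {xs} (b ∘ fsuc)) (x≼y∔x _ _) }) ,
        guard-≈ (put 3 (# 0)) ≡.refl (λ _ → ≡.refl) t ≃-refl , guard-≈ (put 3 (# 1)) ≡.refl (λ _ → ≡.refl) u ≃-refl ,
        trans p (·-cong (≡⇒≃ (val-wkA v t)) (≡⇒≃ (val-wkA v u))) , tt)
      where
      open IΔ₀Exp 𝓜
      open Laws 𝓜
      open Provability T 𝓜
      open Values 𝓜
    valid : Valid (ren (put 3 (# 0)) (x0 ≈ wkA t) ⊃ ren (put 3 (# 1)) (x0 ≈ wkA u) ⊃ x0 ⊗ x1 ≈ x2 ⊃
                   ren (2 ↑ʳ_) (x0 ≈ wkA (t ⊗ u)))
    valid 𝓜 (w ∷ w′ ∷ v ∷ xs) p q r = trans (sym r) (·-cong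
        (trans p (trans (tail≃ (put 3 (# 0)) {w ∷ w′ ∷ v ∷ xs} {xs} (λ _ → ≡.refl) t)
                        (sym (tail≃ (2 ↑ʳ_) {w ∷ w′ ∷ v ∷ xs} {xs} (λ _ → ≡.refl) t))))
        (trans q (trans (tail≃ (put 3 (# 1)) {w ∷ w′ ∷ v ∷ xs} {xs} (λ _ → ≡.refl) u)
                        (sym (tail≃ (2 ↑ʳ_) {w ∷ w′ ∷ v ∷ xs} {xs} (λ _ → ≡.refl) u)))))
      where
      open IΔ₀Exp 𝓜
      open Laws 𝓜
      open Values 𝓜

  -- Atomic formulas

  private
    -- The conclusion is left open because a strict inequality is the reason for three kinds of
    -- facts: `≲`, a negated equation and a negated `≲`. The witnesses are the two values, the
    -- successor of the smaller one and the difference that ⊕ has to make up.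
    less : ∀ {n} (t u : ATerm n) (ψ : Δ₀ n) →
      Valid (S t ≲ u ⊃ ψ) → Derives ⟪ S t ≲ u ⟫ ψ
    less {n} t u ψ sem = cut {4} (collapse t ⊕ collapse u) as wit valid
      where
      as : List (Aux (4 + n))
      as = termEq t at put 4 (# 0) ∷ termEq u at put 4 (# 1) ∷ sucEq on (# 2 ∷ # 0 ∷ [])
         ∷ plusEq on (# 2 ∷ # 1 ∷ # 3 ∷ []) ∷ []
      wit : ∀ 𝓜 → Witnesses {4} ⟪ S t ≲ u ⟫ (collapse t ⊕ collapse u) as 𝓜
      wit 𝓜 X xs b p = ≼⇒ p >>= λ { (e , eq) →
          let u≼ = ≼-trans (val-collapse u {xs} b) (x≼y∔x (val (collapse u) (X ∷ [])) (val (collapse t) (X ∷ [])))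
          in return (val t xs ∷ val u xs ∷ sc (val t xs) ∷ e ∷ [] ,
          (λ { fzero → ≼-trans (val-collapse t {xs} b) (x≼x∔y _ _)
             ; (fsuc fzero) → u≼
             ; (fsuc (fsuc fzero)) → ≼-trans p u≼
             ; (fsuc (fsuc (fsuc fzero))) → ≼-trans (≼-respʳ eq (x≼x∔y e _)) u≼ }) ,
          guard-≈ (put 4 (# 0)) ≡.refl (λ _ → ≡.refl) t ≃-refl ,
          guard-≈ (put 4 (# 1)) ≡.refl (λ _ → ≡.refl) u ≃-refl , ≃-refl , sym eq , tt) }
        where
        open IΔ₀Exp 𝓜
        open Laws 𝓜
        open Provability T 𝓜
        open Values 𝓜
      valid : Valid (ren (put 4 (# 0)) (x0 ≈ wkA t) ⊃ ren (put 4 (# 1)) (x0 ≈ wkA u) ⊃ x2 ≈ S x0 ⊃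
                     x3 ⊕ x2 ≈ x1 ⊃ ren (4 ↑ʳ_) ψ)
      valid 𝓜 ρ@(a ∷ b ∷ s ∷ e ∷ xs) p q r f = ren← (4 ↑ʳ_) {ρ} {xs} (λ _ → ≡.refl) ψ (sem 𝓜 xs
          (⇒≼ e (trans (∔-cong ≃-refl (trans (sc-cong (sym (trans p t≃))) (sym r))) (trans f (trans q u≃)))))
        where
        open IΔ₀Exp 𝓜
        open Laws 𝓜
        open Values 𝓜
        t≃ = tail≃ (put 4 (# 0)) {ρ} {xs} (λ _ → ≡.refl) t
        u≃ = tail≃ (put 4 (# 1)) {ρ} {xs} (λ _ → ≡.refl) u

    equal : ∀ {n} (t u : ATerm n) (ψ : Δ₀ n) →
      Valid (t ≈ u ⊃ ψ) → Derives ⟪ t ≈ u ⟫ ψ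
    equal {n} t u ψ sem = cut {1} (collapse t) as wit valid
      where
      as : List (Aux (1 + n))
      as = termEq t at put 1 (# 0) ∷ termEq u at put 1 (# 0) ∷ []
      wit : ∀ 𝓜 → Witnesses {1} ⟪ t ≈ u ⟫ (collapse t) as 𝓜
      wit 𝓜 X xs b p = return (val t xs ∷ [] , (λ { fzero → val-collapse t {xs} b }) ,
          guard-≈ (put 1 (# 0)) ≡.refl (λ _ → ≡.refl) t ≃-refl ,
          guard-≈ (put 1 (# 0)) ≡.refl (λ _ → ≡.refl) u p , tt)
        where
        open IΔ₀Exp 𝓜
        open Laws 𝓜
        open Provability T 𝓜
        open Values 𝓜
      valid : Valid (ren (put 1 (# 0)) (x0 ≈ wkA t) ⊃ ren (put 1 (# 0)) (x0 ≈ wkA u) ⊃ ren (1 ↑ʳ_) ψ)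
      valid 𝓜 ρ@(a ∷ xs) p q = ren← (1 ↑ʳ_) {ρ} {xs} (λ _ → ≡.refl) ψ (sem 𝓜 xs
          (trans (sym (trans p (tail≃ (put 1 (# 0)) {ρ} {xs} (λ _ → ≡.refl) t)))
                 (trans q (tail≃ (put 1 (# 0)) {ρ} {xs} (λ _ → ≡.refl) u))))
        where
        open IΔ₀Exp 𝓜
        open Laws 𝓜
        open Values 𝓜

  true-≲ : ∀ {n} (t u : ATerm n) → True (t ≲ u)
  true-≲ t u = weaken (λ 𝓜 ρ p → Laws.≼-split 𝓜 p)
    (either (less t u (t ≲ u) (λ 𝓜 xs l → Laws.≼-trans 𝓜 (Laws.x≼scx 𝓜 _) l))
            (equal t u (t ≲ u) (λ 𝓜 xs e → Laws.≼-reflexive 𝓜 e)))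

  -- Quantifiers

  module _ {n} (θ : Δ₀ (suc n)) where

    -- The second slot is the place that `iterate` reserves for a value. A universal statement
    -- computes none, so any number may stand there; `true-all` puts 0.
    upTo : Δ₀ (2 + n)
    upTo = all≤ x0 (ren (put 3 (# 0)) θ)

    private
      module Semantics (𝓜 : IΔ₀Exp) where
        open IΔ₀Exp 𝓜
        open Laws 𝓜

        upTo→ : ∀ {i v xs} → i ∷ v ∷ xs ⊩ upTo → ∀ k → k ≼ i → k ∷ xs ⊩ θ
        upTo→ {i} {v} {xs} p k l = ren→ (put 3 (# 0)) {k ∷ i ∷ v ∷ xs} {k ∷ xs}
          (λ { fzero → ≡.refl ; (fsuc _) → ≡.refl }) θ (p k l)

        upTo← : ∀ {i v xs} → (∀ k → k ≼ i → k ∷ xs ⊩ θ) → i ∷ v ∷ xs ⊩ upTo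
        upTo← {i} {v} {xs} p k l = ren← (put 3 (# 0)) {k ∷ i ∷ v ∷ xs} {k ∷ xs}
          (λ { fzero → ≡.refl ; (fsuc _) → ≡.refl }) θ (p k l)

        guard-put : ∀ {N} (r : Fin (suc n) → Fin N) {ρ k xs} → lookup ρ (r fzero) ≡ k →
          (∀ i → lookup ρ (r (fsuc i)) ≡ lookup xs i) → k ∷ xs ⊩ θ →
          ⟦ ⟪ θ ⟫ ⟨ tabulate (λ i → var (r i)) ⟩ ⟧ᶠ ρ
        guard-put r {ρ} {k} {xs} e h = subst (_⊩ θ)
          (≡.sym (vals-params (k ∷ xs) r ρ (λ { fzero → e ; (fsuc i) → h i })))

    true-upTo : True θ → True upTo
    true-upTo D = iterate {n} steps (cut {0} O bases base base-valid) descend valid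
      where
      bases : List (Aux (2 + n))
      bases = zeroEq on (# 0 ∷ []) ∷ D at put 2 (# 0) ∷ []
      steps : List (Aux (4 + n))
      steps = sucEq on (# 0 ∷ # 2 ∷ []) ∷ D at put 4 (# 0) ∷ []
      base : ∀ 𝓜 → Witnesses {0} (x0 ≐ᶠ O ∧ᶠ ⟪ upTo ⟫) O bases 𝓜
      base 𝓜 X (i ∷ v ∷ xs) _ (e , p) = return ([] , (λ ()) , e ,
          guard-put (put 2 (# 0)) ≡.refl (λ _ → ≡.refl) (upTo→ {i} {v} {xs} p i ≼-refl) , tt)
        where
        open IΔ₀Exp 𝓜
        open Laws 𝓜
        open Semantics 𝓜
      base-valid : Valid (x0 ≈ O ⊃ ren (put 2 (# 0)) θ ⊃ ren (0 ↑ʳ_) upTo)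
      base-valid 𝓜 ρ@(i ∷ v ∷ xs) e p = ren← (0 ↑ʳ_) {ρ} {ρ} (λ _ → ≡.refl) upTo
          (upTo← {i} {v} {xs} (λ k l → ≃-subst θ xs (≼-antisym (≼-respˡ (sym e) (0≼ k)) l)
            (ren→ (put 2 (# 0)) {ρ} {i ∷ xs} (λ { fzero → ≡.refl ; (fsuc _) → ≡.refl }) θ p)))
        where
        open IΔ₀Exp 𝓜
        open Laws 𝓜
        open Semantics 𝓜
      descend : ∀ 𝓜 → Descends ⟪ upTo ⟫ steps 𝓜
      descend 𝓜 i v xs p = return (v , ≼-refl ,
          upTo← {i} {v} {xs} (λ k l → upTo→ {sc i} {v} {xs} p k (≼-trans l (x≼scx i))) , ≃-refl ,
          guard-put (put 4 (# 0)) ≡.refl (λ _ → ≡.refl) (upTo→ {sc i} {v} {xs} p (sc i) ≼-refl) , tt)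
        where
        open IΔ₀Exp 𝓜
        open Laws 𝓜
        open Semantics 𝓜
      valid : Valid (ren (2 ↑ʳ_) upTo ⊃ x0 ≈ S x2 ⊃ ren (put 4 (# 0)) θ ⊃ ren next upTo)
      valid 𝓜 ρ@(i′ ∷ v′ ∷ i ∷ v ∷ xs) p e q = ren← next {ρ} {i′ ∷ v′ ∷ xs}
          (λ { fzero → ≡.refl ; (fsuc fzero) → ≡.refl ; (fsuc (fsuc _)) → ≡.refl }) upTo
          (upTo← {i′} {v′} {xs} (λ k l → stable θ (k ∷ xs) (≼sc-split (≼-respʳ e l) >>= λ
            { (inj₁ l′) → return (upTo→ {i} {v} {xs}
                (ren→ (2 ↑ʳ_) {ρ} {i ∷ v ∷ xs} (λ _ → ≡.refl) upTo p) k l′)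
            ; (inj₂ f) → return (≃-subst θ xs (trans e (sym f))
                (ren→ (put 4 (# 0)) {ρ} {i′ ∷ xs} (λ { fzero → ≡.refl ; (fsuc _) → ≡.refl }) θ q)) })))
        where
        open IΔ₀Exp 𝓜
        open Laws 𝓜
        open Semantics 𝓜

    true-all : ∀ t → True θ → True (all≤ t θ)
    true-all t D = cut {2} (collapse t) as wit valid
      where
      as : List (Aux (2 + n))
      as = termEq t at put 2 (# 0) ∷ aux (true-upTo D) ∷ []
      wit : ∀ 𝓜 → Witnesses {2} ⟪ all≤ t θ ⟫ (collapse t) as 𝓜
      wit 𝓜 X xs b p = return (val t xs ∷ 0# ∷ [] ,
          (λ { fzero → val-collapse t {xs} b ; (fsuc fzero) → 0≼ _ }) ,
          guard-≈ (put 2 (# 0)) ≡.refl (λ _ → ≡.refl) t ≃-refl , upTo← {val t xs} {0#} {xs} p , tt)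
        where
        open IΔ₀Exp 𝓜
        open Laws 𝓜
        open Provability T 𝓜
        open Values 𝓜
        open Semantics 𝓜
      valid : Valid (ren (put 2 (# 0)) (x0 ≈ wkA t) ⊃ upTo ⊃ ren (2 ↑ʳ_) (all≤ t θ))
      valid 𝓜 ρ@(w ∷ d ∷ xs) e p = ren← (2 ↑ʳ_) {ρ} {xs} (λ _ → ≡.refl) (all≤ t θ)
          (λ k l → upTo→ {w} {d} {xs} p k
            (≼-respʳ (sym (trans e (tail≃ (put 2 (# 0)) {ρ} {xs} (λ _ → ≡.refl) t))) l))
        where
        open IΔ₀Exp 𝓜
        open Laws 𝓜
        open Values 𝓜
        open Semantics 𝓜

    false-all : ∀ t → True (neg θ) → True (neg (all≤ t θ))
    false-all t D = cut {1} (collapse t) as wit valid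
      where
      as : List (Aux (1 + n))
      as = aux D ∷ aux (true-≲ x0 (wkA t)) ∷ []
      wit : ∀ 𝓜 → Witnesses {1} ⟪ neg (all≤ t θ) ⟫ (collapse t) as 𝓜
      -- The continuation `c` refutes every counterexample; by stability `θ` then holds for all `k`
      -- up to the bound, contrary to `p`.
      wit 𝓜 X xs b p = cl (λ c → p (λ k l → stable θ (k ∷ xs) (cl (λ q → c (k ∷ [] ,
          (λ { fzero → ≼-trans l (val-collapse t {xs} b) }) , q ,
          ≼-respʳ (≡⇒≃ (≡.sym (val-wkA k t))) l , tt)))))
        where
        open IΔ₀Exp 𝓜
        open Laws 𝓜
        open Provability T 𝓜
      valid : Valid (neg θ ⊃ x0 ≲ wkA t ⊃ ren (1 ↑ʳ_) (neg (all≤ t θ)))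
      valid 𝓜 ρ@(k ∷ xs) q l = ren← (1 ↑ʳ_) {ρ} {xs} (λ _ → ≡.refl) (neg (all≤ t θ))
          (λ p → q (p k (≼-respʳ (≡⇒≃ (val-wkA k t)) l)))
        where
        open IΔ₀Exp 𝓜
        open Laws 𝓜

  -- Provable Δ₀-completeness

  private
    consequence : ∀ {n} {P : Fm n} {χ ψ : Δ₀ n} → Valid (χ ⊃ ψ) → Derives P χ → Derives P ψ
    consequence {ψ = ψ} v D = cut {0} O (aux D ∷ [])
      (λ 𝓜 X xs b p → IΔ₀Exp.return 𝓜 ([] , (λ ()) , p , tt))
      (λ 𝓜 ρ p → IΔ₀Exp.ren← 𝓜 (0 ↑ʳ_) {ρ} {ρ} (λ _ → ≡.refl) ψ (v 𝓜 ρ p))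

  mutual
    -- Truth and falsity are treated together because a true implication is proved from a false
    -- premise or a true conclusion. That distinction is classical and made in the model; adding the
    -- two bounds makes the outcome irrelevant to the size.
    complete⁺ : ∀ {n} (θ : Δ₀ n) → True θ
    complete⁺ (t ≈ u) = equal t u (t ≈ u) (λ 𝓜 xs e → e)
    complete⁺ (t ≲ u) = true-≲ t u
    complete⁺ ff = record { bd = O ; establishes = λ 𝓜 X xs zs b h p → Laws.absurd 𝓜 p }
    complete⁺ (θ ⊃ χ) = weaken cases
        (either (consequence (λ 𝓜 ρ p q → IΔ₀Exp.ex-falso 𝓜 χ ρ (p q)) (complete⁻ θ))
                (consequence (λ 𝓜 ρ p q → p) (complete⁺ χ)))
      where
      cases : ∀ 𝓜 ρ → IΔ₀Exp._⊩_ 𝓜 ρ (θ ⊃ χ) → IΔ₀Exp.⟦_⟧ᶠ 𝓜 (⟪ neg θ ⟫ ∨ᶠ ⟪ χ ⟫) ρ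
      cases 𝓜 ρ f = lem (ρ ⊩ θ) >>= λ
          { (inj₁ p) → return (inj₂ (f p)) ; (inj₂ q) → return (inj₁ q) }
        where open IΔ₀Exp 𝓜
    complete⁺ (all≤ t θ) = true-all θ t (complete⁺ θ)

    complete⁻ : ∀ {n} (θ : Δ₀ n) → True (neg θ)
    complete⁻ (t ≈ u) = weaken apart (either
        (less t u _ (λ 𝓜 xs l e → Laws.≺⇒≄ 𝓜 l e))
        (less u t _ (λ 𝓜 xs l e → Laws.≺⇒≄ 𝓜 l (Laws.sym 𝓜 e))))
      where
      apart : ∀ 𝓜 ρ → IΔ₀Exp._⊩_ 𝓜 ρ (neg (t ≈ u)) → IΔ₀Exp.⟦_⟧ᶠ 𝓜 (⟪ S t ≲ u ⟫ ∨ᶠ ⟪ S u ≲ t ⟫) ρ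
      apart 𝓜 ρ n = ≼-total _ _ >>= λ
          { (inj₂ l) → return (inj₂ l)
          ; (inj₁ l) → ≼-split l >>= λ { (inj₁ l′) → return (inj₁ l′) ; (inj₂ e) → absurd (n e) } }
        where
        open IΔ₀Exp 𝓜
        open Laws 𝓜
    complete⁻ (t ≲ u) = weaken greater (less u t _ (λ 𝓜 xs l p → Laws.≼-irrefl 𝓜 (Laws.≼-trans 𝓜 l p)))
      where
      greater : ∀ 𝓜 ρ → IΔ₀Exp._⊩_ 𝓜 ρ (neg (t ≲ u)) → IΔ₀Exp._⊩_ 𝓜 ρ (S u ≲ t)
      greater 𝓜 ρ n = stable≼ (≼-total _ _ >>= λ { (inj₁ l) → absurd (n l) ; (inj₂ l) → return l })
        where
        open IΔ₀Exp 𝓜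
        open Laws 𝓜
    complete⁻ ff = cut {0} O [] (λ 𝓜 X xs b p → IΔ₀Exp.return 𝓜 ([] , (λ ()) , tt)) (λ 𝓜 ρ p → p)
    complete⁻ (θ ⊃ χ) = cut {0} O as wit
        (λ 𝓜 ρ p q → IΔ₀Exp.ren← 𝓜 (0 ↑ʳ_) {ρ} {ρ} (λ _ → ≡.refl) (neg (θ ⊃ χ)) (λ f → q (f p)))
      where
      as = aux (complete⁺ θ) ∷ aux (complete⁻ χ) ∷ []
      wit : ∀ 𝓜 → Witnesses {0} ⟪ neg (θ ⊃ χ) ⟫ O as 𝓜
      wit 𝓜 X xs b n = return ([] , (λ ()) , stable θ xs (cl (λ ¬p → n (λ p → ex-falso χ xs (¬p p)))) ,
          (λ q → n (λ _ → q)) , tt)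
        where open IΔ₀Exp 𝓜
    complete⁻ (all≤ t θ) = false-all θ t (complete⁻ θ)

-- Graphs in models

module GraphOf {L : Language} {T : Theory L} (ext : T ExtendsEA) (M : Model T) where
  open Model M
  open ArithmeticOf ext M using (model; emb→; emb←; evalTs-lookup)
  open IΔ₀Exp model hiding (Carrier; sc)
  open Laws model using (pr)
  open Recursive model

  private
    -- The outermost quantifier of `∃*` binds the variable with the largest index, so the values
    -- enter from the last to the first.
    extend : ℕ → (ℕ → Carrier) → (ℕ → Carrier) → ℕ → Carrier
    extend zero    f ρ = ρ
    extend (suc m) f ρ = extend m f (f m ∷ₑ ρ)

    extend-above : ∀ (m : ℕ) f ρ i → extend m f ρ (m + i) ≡ ρ i
    extend-above zero    f ρ i = ≡.refl
    extend-above (suc m) f ρ i =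
      ≡.trans (cong (extend m f (f m ∷ₑ ρ)) (≡.sym (ℕₚ.+-suc m i))) (extend-above m f (f m ∷ₑ ρ) (suc i))

    extend-below : ∀ (m : ℕ) f ρ i → i < m → extend m f ρ i ≡ f i
    extend-below (suc m) f ρ i (s≤s le) with ℕₚ.m≤n⇒m<n∨m≡n le
    ... | inj₁ lt     = extend-below m f (f m ∷ₑ ρ) i lt
    ... | inj₂ ≡.refl = ≡.trans (cong (extend m f (f m ∷ₑ ρ)) (≡.sym (ℕₚ.+-identityʳ m)))
                                (extend-above m f (f m ∷ₑ ρ) 0)

    ∃*-intro : ∀ (m : ℕ) f ρ φ → extend m f ρ ⊩ᶠ φ → ρ ⊩ᶠ ∃* m φ
    ∃*-intro zero    f ρ φ p     = p
    ∃*-intro (suc m) f ρ φ p all = all (f m) (∃*-intro m f (f m ∷ₑ ρ) φ p)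

    evalT-shiftBy : ∀ (m : ℕ) {ρ ρ′ : ℕ → Carrier} → (∀ i → ρ′ (m + i) ≡ ρ i) → ∀ t → evalT ρ′ (shiftBy m t) ≡ evalT ρ t
    evalT-shiftBy zero h t = evalT-cong h t
      where
      evalT-cong  : ∀ {ρ ρ′ : ℕ → Carrier} → (∀ i → ρ′ i ≡ ρ i) → ∀ t → evalT ρ′ t ≡ evalT ρ t
      evalTs-cong : ∀ {ρ ρ′ : ℕ → Carrier} → (∀ i → ρ′ i ≡ ρ i) → ∀ {k} (ts : Vec (Term L) k) → evalTs ρ′ ts ≡ evalTs ρ ts
      evalT-cong h (var i)   = h i
      evalT-cong h (fn f ts) = cong (fnI f) (evalTs-cong h ts)
      evalTs-cong h []       = ≡.refl
      evalTs-cong h (t ∷ ts) = cong₂ _∷_ (evalT-cong h t) (evalTs-cong h ts)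
    evalT-shiftBy (suc m) {ρ} {ρ′} h t =
      ≡.trans (evalT-shift ρ′ (shiftBy m t)) (evalT-shiftBy m {ρ} {ρ′ ∘ suc} h t)

    shiftsBy-∷ : ∀ (m : ℕ) {k} t (ts : Vec (Term L) k) → shiftsBy m (t ∷ ts) ≡ shiftBy m t ∷ shiftsBy m ts
    shiftsBy-∷ zero    t ts = ≡.refl
    shiftsBy-∷ (suc m) t ts = cong shifts (shiftsBy-∷ m t ts)

    shiftsBy-[] : ∀ (m : ℕ) → shiftsBy {L} {0} m [] ≡ []
    shiftsBy-[] zero    = ≡.refl
    shiftsBy-[] (suc m) = cong shifts (shiftsBy-[] m)

    evalTs-shiftsBy : ∀ (m : ℕ) {ρ ρ′ : ℕ → Carrier} → (∀ i → ρ′ (m + i) ≡ ρ i) →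
      ∀ {k} (ts : Vec (Term L) k) → evalTs ρ′ (shiftsBy m ts) ≡ evalTs ρ ts
    evalTs-shiftsBy m {ρ′ = ρ′} h [] = cong (evalTs ρ′) (shiftsBy-[] m)
    evalTs-shiftsBy m {ρ′ = ρ′} h (t ∷ ts) = ≡.trans (cong (evalTs ρ′) (shiftsBy-∷ m t ts))
      (cong₂ _∷_ (evalT-shiftBy m h t) (evalTs-shiftsBy m h ts))

    entryΔ : Δ₀ 3
    entryΔ = pairA (var (# 0)) (var (# 1)) ∈̇ var (# 2)

    entry→ : ∀ ρ i v s → ρ ⊩ᶠ entry i v s → pr (evalT ρ i) (evalT ρ v) ∈ evalT ρ s
    entry→ ρ i v s p = ∈̇→ {ρ = evalTs ρ (i ∷ v ∷ s ∷ [])} (pairA (var (# 0)) (var (# 1))) (var (# 2)) (emb→ ρ entryΔ (i ∷ v ∷ s ∷ []) p)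

    entry← : ∀ ρ i v s → pr (evalT ρ i) (evalT ρ v) ∈ evalT ρ s → ρ ⊩ᶠ entry i v s
    entry← ρ i v s p = emb← ρ entryΔ (i ∷ v ∷ s ∷ []) (∈̇← {ρ = evalTs ρ (i ∷ v ∷ s ∷ [])} (pairA (var (# 0)) (var (# 1))) (var (# 2)) p)

    at : ∀ {m} → Vec Carrier m → ℕ → Carrier
    at []       i       = fnI `0 []
    at (w ∷ ws) zero    = w
    at (w ∷ ws) (suc i) = at ws i

    at-lookup : ∀ {m} (ws : Vec Carrier m) i → at ws (toℕ i) ≡ lookup ws i
    at-lookup (w ∷ ws) fzero    = ≡.refl
    at-lookup (w ∷ ws) (fsuc i) = at-lookup ws i

    evalTs-tabulate : ∀ {m} ρ (r : Fin m → ℕ) (ws : Vec Carrier m) → (∀ i → ρ (r i) ≡ lookup ws i) →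
      evalTs ρ (tabulate (λ i → var (r i))) ≡ ws
    evalTs-tabulate ρ r []       h = ≡.refl
    evalTs-tabulate ρ r (w ∷ ws) h = cong₂ _∷_ (h fzero) (evalTs-tabulate ρ (r ∘ fsuc) ws (h ∘ fsuc))

  stable-formula : ∀ φ ρ → Cl (ρ ⊩ᶠ φ) → ρ ⊩ᶠ φ
  stable-formula φ ρ p = sound (DNE {φ = φ}) ρ (run p)

  mutual
    graph-formula : ∀ {n} (f : PR n) ρ xs y → GraphR f (evalTs ρ xs) (evalT ρ y) → ρ ⊩ᶠ Graph f xs y
    graph-formula zero        ρ []       y p = p
    graph-formula succ        ρ (x ∷ []) y p = p
    graph-formula (proj i)    ρ xs       y p = subst (evalT ρ y ≃_) (≡.sym (evalTs-lookup ρ xs i)) p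
    graph-formula (comp {m} f gs) ρ xs y p = stable-formula (∃* m body) ρ (p >>= λ { (ws , q , r) → return
        (∃*-intro m (at ws) ρ body (λ k → k (graphs-formula gs (env ws) (shiftsBy m xs) zs
            (subst₂ (GraphsR gs) (≡.sym (evalTs-shiftsBy m (extend-above m (at ws) ρ) xs)) (≡.sym (zs-eq ws)) q))
          (graph-formula f (env ws) zs (shiftBy m y)
            (subst₂ (GraphR f) (≡.sym (zs-eq ws)) (≡.sym (evalT-shiftBy m (extend-above m (at ws) ρ) y)) r)))) })
      where
      zs : Vec (Term L) m
      zs = tabulate (var ∘ toℕ)
      body : Formula L
      body = Graphs gs (shiftsBy m xs) zs ∧′ Graph f zs (shiftBy m y)
      env : Vec Carrier m → ℕ → Carrier
      env ws = extend m (at ws) ρ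
      zs-eq : ∀ ws → evalTs (env ws) zs ≡ ws
      zs-eq ws = evalTs-tabulate (env ws) toℕ ws
        (λ i → ≡.trans (extend-below m (at ws) ρ (toℕ i) (Finₚ.toℕ<n i)) (at-lookup ws i))
    graph-formula (prec f g) ρ (x ∷ xs) y p all = run p λ { (s , m , start , step) →
        all s (λ k → k
          (entry← (s ∷ₑ ρ) (shift x) (shift y) (var 0)
            (subst₂ (λ x y → pr x y ∈ s) (≡.sym (evalT-shift (s ∷ₑ ρ) x)) (≡.sym (evalT-shift (s ∷ₑ ρ) y)) m))
          (λ k → k
            (λ v e → graph-formula f (v ∷ₑ s ∷ₑ ρ) (shiftsBy 2 xs) (var 0)
              (subst (λ τ → GraphR f τ v) (≡.sym (evalTs-shiftsBy 2 (λ _ → ≡.refl) xs))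
                (start v (entry→ (v ∷ₑ s ∷ₑ ρ) O′ (var 0) (var 1) e))))
            (λ i v e all′ → run (step i v (entry→ (v ∷ₑ i ∷ₑ s ∷ₑ ρ) (S′ (var 1)) (var 0) (var 2) e)) λ { (u , m′ , q) →
              all′ u (λ k → k
                (entry← (u ∷ₑ v ∷ₑ i ∷ₑ s ∷ₑ ρ) (var 2) (var 0) (var 3) m′)
                (graph-formula g (u ∷ₑ v ∷ₑ i ∷ₑ s ∷ₑ ρ) (var 2 ∷ var 0 ∷ shiftsBy 4 xs) (var 1)
                  (subst (λ τ → GraphR g (i ∷ u ∷ τ) v) (≡.sym (evalTs-shiftsBy 4 (λ _ → ≡.refl) xs)) q))) }))) }

    graphs-formula : ∀ {m n} (gs : Vec (PR n) m) ρ xs zs →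
      GraphsR gs (evalTs ρ xs) (evalTs ρ zs) → ρ ⊩ᶠ Graphs gs xs zs
    graphs-formula []       ρ xs []       p = p
    graphs-formula (g ∷ gs) ρ xs (z ∷ zs) (p , q) k = k (graph-formula g ρ xs z p) (graphs-formula gs ρ xs zs q)

-- The graph of the dot function

module Dot {L : Language} (T : Theory L) (𝓜 : IΔ₀Exp) where
  open IΔ₀Exp 𝓜
  open Laws 𝓜
  open Numerals 𝓜
  open Recursive 𝓜
  open Derivability T 𝓜
  open Syntax T 𝓜
  open Provability T 𝓜

  graph-num0 : GraphM (CP.c-fn (litP 0) CP.c-nil) [] num0
  graph-num0 = graph-pair (litP 1) (pairP (litP 0) (litP 0)) [] {lit 1} {pr (lit 0) c-nil} (graph-lit 1 [])
    (graph-pair (litP 0) (litP 0) [] {lit 0} {c-nil} (graph-lit 0 []) (graph-lit 0 []))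

  graph-numSuc : ∀ i u → GraphM (CP.c-fn (litP 1) (CP.c-cons (proj (# 1)) CP.c-nil)) (i ∷ u ∷ []) (numSuc u)
  graph-numSuc i u =
      graph-pair (litP 1) _ xs {lit 1} {pr (lit 1) (c-cons u c-nil)} (graph-lit 1 xs)
        (graph-pair (litP 1) _ xs {lit 1} {c-cons u c-nil} (graph-lit 1 xs)
          (graph-pair (litP 2) _ xs {lit 2} {pr u c-nil} (graph-lit 2 xs)
            (graph-pair (proj (# 1)) (litP 0) xs {u} {c-nil} graph-proj (graph-lit 0 xs))))
    where
    xs : Vec Carrier 2
    xs = i ∷ u ∷ []

  -- `numF` itself serves as the relation for the recursion: the inversion lemmas at zero and
  -- successor are its two conditions, and since codes of numerals increase, `z` bounds all earlier
  -- values.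
  graph-num : ∀ {x z} → Num x z → GraphM num (x ∷ []) z
  graph-num {x} {z} p = graph-prec numF [] x z z
    (λ v n → graph-respʳ (sym (num-zero⁻¹ n)) graph-num0)
    (λ i v _ v≼ n → num-suc⁻¹ n >>= λ { (u , n′ , e) →
      return (u , ≼-trans (z≼numSuc u) (≼-respˡ e v≼) , n′ , graph-respʳ (sym e) (graph-numSuc i u)) })
    ≼-refl p

  toSlot : Maybe ℕ → Fin 1 ⊎ ℕ
  toSlot nothing  = inj₁ fzero
  toSlot (just i) = inj₂ i

  slot-dotVar : ∀ k i → slot 1 k i ≡ toSlot (dotVar k i)
  slot-dotVar zero    zero    = ≡.refl
  slot-dotVar zero    (suc i) = ≡.refl
  slot-dotVar (suc k) zero    = ≡.refl
  slot-dotVar (suc k) (suc i) = ≡.trans (cong (map₂ suc) (slot-dotVar k i)) (lemma (dotVar k i))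
    where
    lemma : ∀ m → map₂ suc (toSlot m) ≡ toSlot (mapMaybe suc m)
    lemma nothing  = ≡.refl
    lemma (just i) = ≡.refl

  module _ {x z} (p : Num x z) where

    private
      xs zs : Vec Carrier 1
      xs = x ∷ []
      zs = z ∷ []

    mutual
      graph-dotT : ∀ k (t : Term L) → GraphM (dotT k t) xs (codeT (ent zs k) t)
      graph-dotT k (var i) rewrite slot-dotVar k i with dotVar k i
      ... | nothing = graph-num p
      ... | just j  = graph-pair (litP 0) (litP j) xs (graph-lit 0 xs) (graph-lit j xs)
      graph-dotT k (fn f ts) = graph-pair (litP 1) _ xs (graph-lit 1 xs)
        (graph-pair (litP (funCode f)) (dotTs k ts) xs (graph-lit (funCode f) xs) (graph-dotTs k ts))

      graph-dotTs : ∀ {m} k (ts : Vec (Term L) m) → GraphM (dotTs k ts) xs (codeTs (ent zs k) ts)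
      graph-dotTs k []       = graph-lit 0 xs
      graph-dotTs k (t ∷ ts) = graph-pair (litP 2) _ xs (graph-lit 2 xs)
        (graph-pair (dotT k t) (dotTs k ts) xs (graph-dotT k t) (graph-dotTs k ts))

    graph-dotAt : ∀ k (φ : Formula L) → GraphM (dotAt k φ) xs (codeF (ent zs) k φ)
    graph-dotAt k (rel r ts) = graph-pair (litP 3) _ xs (graph-lit 3 xs)
      (graph-pair (litP (relCode r)) (dotTs k ts) xs (graph-lit (relCode r) xs) (graph-dotTs k ts))
    graph-dotAt k ⊥′ = graph-pair (litP 4) (litP 0) xs (graph-lit 4 xs) (graph-lit 0 xs)
    graph-dotAt k (φ ⇒ ψ) = graph-pair (litP 5) _ xs (graph-lit 5 xs)
      (graph-pair (dotAt k φ) (dotAt k ψ) xs (graph-dotAt k φ) (graph-dotAt k ψ))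
    graph-dotAt k (∀′ φ) = graph-pair (litP 6) _ xs (graph-lit 6 xs) (graph-dotAt (suc k) φ)

-- Substitution under the embedding of Δ₀-formulas

embTs : ∀ {m n} → Vec (ATerm n) m → Vec (Term L) n → Vec (Term L) m
embTs us ts = map (λ u → embT u ts) us

embT-wkA : ∀ {n} u (t : ATerm n) (ts : Vec (Term L) n) → embT (wkA t) (u ∷ ts) ≡ embT t ts
embT-wkA u (var i) ts = ≡.refl
embT-wkA u O       ts = ≡.refl
embT-wkA u (S t)   ts = cong S′ (embT-wkA u t ts)
embT-wkA u (exp t) ts = cong exp′ (embT-wkA u t ts)
embT-wkA u (t ⊕ v) ts = cong₂ _+′_ (embT-wkA u t ts) (embT-wkA u v ts)
embT-wkA u (t ⊗ v) ts = cong₂ _*′_ (embT-wkA u t ts) (embT-wkA u v ts)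

embT-subA : ∀ {m n} (us : Vec (ATerm n) m) t (ts : Vec (Term L) n) →
  embT (subA us t) ts ≡ embT t (embTs us ts)
embT-subA (u ∷ us) (var fzero)    ts = ≡.refl
embT-subA (u ∷ us) (var (fsuc i)) ts = embT-subA us (var i) ts
embT-subA us O       ts = ≡.refl
embT-subA us (S t)   ts = cong S′ (embT-subA us t ts)
embT-subA us (exp t) ts = cong exp′ (embT-subA us t ts)
embT-subA us (t ⊕ v) ts = cong₂ _+′_ (embT-subA us t ts) (embT-subA us v ts)
embT-subA us (t ⊗ v) ts = cong₂ _*′_ (embT-subA us t ts) (embT-subA us v ts)

embTs-wkA : ∀ {m n} (us : Vec (ATerm n) m) (ts : Vec (Term L) n) →
  embTs (map wkA us) (var 0 ∷ shifts ts) ≡ shifts (embTs us ts)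
embTs-wkA []       ts = ≡.refl
embTs-wkA (u ∷ us) ts =
  cong₂ _∷_ (≡.trans (embT-wkA (var 0) u (shifts ts)) (≡.sym (shift-embT u ts))) (embTs-wkA us ts)

emb-subΔ : ∀ {m n} (us : Vec (ATerm n) m) θ (ts : Vec (Term L) n) →
  emb (subΔ us θ) ts ≡ emb θ (embTs us ts)
emb-subΔ us (t ≈ u)    ts = cong₂ _≐_ (embT-subA us t ts) (embT-subA us u ts)
emb-subΔ us (t ≲ u)    ts = cong₂ _≤′_ (embT-subA us t ts) (embT-subA us u ts)
emb-subΔ us ff         ts = ≡.refl
emb-subΔ us (θ ⊃ χ)    ts = cong₂ _⇒_ (emb-subΔ us θ ts) (emb-subΔ us χ ts)
emb-subΔ us (all≤ t θ) ts = cong ∀′ (cong₂ _⇒_ (cong (λ u → var 0 ≤′ shift u) (embT-subA us t ts))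
  (≡.trans (emb-subΔ (var fzero ∷ map wkA us) θ (var 0 ∷ shifts ts))
           (cong (λ us → emb θ (var 0 ∷ us)) (embTs-wkA us ts))))

embT-litA : ∀ {n} k (ts : Vec (Term L) n) → embT (litA k) ts ≡ numeral k
embT-litA zero    ts = ≡.refl
embT-litA (suc k) ts = cong S′ (embT-litA k ts)

-- Bounded proofs of the consistency instances, and the selector

module Selector {L : Language} (T : Theory L) (ext : T ExtendsEA) where
  open Reflection T ext
  open Δ₀-Completeness T ext

  private
    c : ℕ
    c = ⌜0=1⌝ L

    0=1 : Formula L
    0=1 = numeral 0 ≐ numeral 1

    -- The Gödel number of 0=1 enters as a closed term, which leaves `x` as the only variable. The
    -- instance established by `complete⁺` then has the same code as the sentence in question.
    ψ : Δ₀ 1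
    ψ = subΔ (x0 ∷ litA c ∷ []) (neg (proof T))

    emb-ψ : emb ψ (vars 1) ≡ NotProofOf0=1 T
    emb-ψ = ≡.trans (emb-subΔ (x0 ∷ litA c ∷ []) (neg (proof T)) (vars 1))
      (cong (λ t → ¬′ emb (proof T) (var 0 ∷ t ∷ [])) (embT-litA c (vars 1)))

    explosion : T ⊢ 0=1 ⇒ NotProofOf0=1 T
    explosion = Completeness.completeness T (0=1 ⇒ NotProofOf0=1 T)
      (λ M ρ e _ → IΔ₀Exp.sc≄0 (ArithmeticOf.model ext M) (Laws.sym (ArithmeticOf.model ext M) e))

    -- Besides the numeral of `x`, the number `x` itself counts: in the explosive case it is the
    -- proof of 0=1 to which modus ponens is applied.
    Y : ATerm 1
    Y = x0 ⊕ numBound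

  -- The summands bound the proof of the Δ₀-sentence ¬ Proof (x̄ , 0=1), if it is
  -- true, and otherwise the proof by explosion from the proof x of 0=1.
  sizeBound : ATerm 1
  sizeBound = bd (complete⁺ ψ) ⊕ inferBound 1 explosion 1 ∘A Y

  module _ (𝓜 : IΔ₀Exp) where
    open IΔ₀Exp 𝓜
    open Laws 𝓜
    open Numerals 𝓜
    open Recursive 𝓜
    open Derivability T 𝓜
    open Syntax T 𝓜
    open Provability T 𝓜
    open Instances T 𝓜
    open Dot T 𝓜

    -- The case distinction on whether `x` proves 0=1 is made in the model, under `Cl`. Both cases
    -- fall below one bound, so the search need not know which case applies.
    consistency-instance : ∀ {x a} → Num x a → Prf (val sizeBound (x ∷ [])) (code (NotProofOf0=1 T) (a ∷ []))
    consistency-instance {x} {a} n = lem (Proves x (lit c)) >>= λ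
      { (inj₂ ¬p) → prf-mono (x≼x∔y _ _) (subst (λ φ → Prf (val (bd (complete⁺ ψ)) (x ∷ [])) (code φ (a ∷ []))) emb-ψ
          (establishes (complete⁺ ψ) 𝓜 x (x ∷ []) (a ∷ []) (λ { fzero → ≼-refl }) (λ { fzero → n })
            (subΔ← (x0 ∷ litA c ∷ []) {x ∷ []} (neg (proof T))
              (λ q → ¬p (subst (λ y → x ∷ y ∷ [] ⊩ proof T) (val-litA c) q)))))
      ; (inj₁ p) → prf-mono (x≼y∔x _ _)
          (subst (λ β → Prf β (code (NotProofOf0=1 T) (a ∷ []))) (≡.sym (val-∘A (inferBound 1 explosion 1) Y x))
            (infer 1 (0=1 ∷ []) explosion {val Y (x ∷ [])} {a ∷ []} (λ { fzero → return (x , n) })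
              (λ { fzero → ≼-trans (num-≼ n) (x≼y∔x _ x) })
              (prf-mono (x≼x∔y x _) (prf-resp (lit-cF 0=1) (return (x , ≼-refl , p))) ∷ []))) }

  selector : PR 1
  selector = comp (searchP (proof T)) (termP sizeBound ∷ dot (NotProofOf0=1 T) ∷ [])

  module _ (𝓜 : IΔ₀Exp) where
    open IΔ₀Exp 𝓜
    open Laws 𝓜
    open Recursive 𝓜
    open Provability T 𝓜
    open Dot T 𝓜

    selects : ∀ x → Cl (Σ[ y ∈ Carrier ] Σ[ z ∈ Carrier ] GraphM selector (x ∷ []) y
      × GraphM (dot (NotProofOf0=1 T)) (x ∷ []) z × (y ∷ z ∷ [] ⊩ proof T))
    selects x = do
      (a , _ , n) ← num-total x
      let z = code (NotProofOf0=1 T) (a ∷ [])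
          g : GraphM (dot (NotProofOf0=1 T)) (x ∷ []) z
          g = graph-dotAt n 0 (NotProofOf0=1 T)
      (p , p≼ , proves) ← consistency-instance 𝓜 n
      (y , h , proves′) ← graph-search (proof T) (val sizeBound (x ∷ [])) z p≼ proves
      return (y , z , graph-comp (graph-term sizeBound (x ∷ []) ∷ᵍ g ∷ᵍ []ᵍ) h , g , proves′)

theorem2p3 : (L : Language) (T : Theory L) → T ExtendsEA →
    Σ[ s ∈ PR 1 ] (T ⊢ ∀′ (∃′ (∃′ (Graph s (var 2 ∷ []) (var 1)
    ∧′ Graph (dot (NotProofOf0=1 T)) (var 2 ∷ []) (var 0)
    ∧′ Proof T (var 1) (var 0)))))
theorem2p3 L T ea = selector , Completeness.completeness T _ valid
  where
  open Selector T ea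
  valid : ∀ (M : Model T) ρ → Model._⊩ᶠ_ M ρ (∀′ (∃′ (∃′ (Graph selector (var 2 ∷ []) (var 1)
    ∧′ Graph (dot (NotProofOf0=1 T)) (var 2 ∷ []) (var 0) ∧′ Proof T (var 1) (var 0)))))
  valid M ρ x none = run (selects model x) λ { (y , z , g , h , p) →
      none y (λ none′ → none′ z (λ k → k
        (graph-formula selector (z ∷ₑ y ∷ₑ x ∷ₑ ρ) (var 2 ∷ []) (var 1) (raw g))
        (λ k → k
          (graph-formula (dot (NotProofOf0=1 T)) (z ∷ₑ y ∷ₑ x ∷ₑ ρ) (var 2 ∷ []) (var 0) (raw h))
          (emb← (z ∷ₑ y ∷ₑ x ∷ₑ ρ) (proof T) (var 1 ∷ var 0 ∷ []) p)))) }
    where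
    open ArithmeticOf ea M using (model; emb←)
    open GraphOf ea M
    open IΔ₀Exp model using (run)
    open Recursive model using (raw)
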